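{- Let $G$ be a hypergraph of $n$ vertices and $m$ edges, and let $H$ be a hypergraph of constant size with $k$ edges and minimum degree at least $2$. Let $\varepsilon\in(0,1)$ be a constant, and write $\#H:=\#(H,G)$ for the number of occurrences of $H$ in $G$. Then there is a randomized streaming algorithm, working in the turnstile model, that $(1\pm\varepsilon)$-approximates $\#H$, i.e. whose output $Z$ satisfies $Z\in[(1-\varepsilon)\cdot\#H,\ (1+\varepsilon)\cdot\#H]$ with probability at least $2/3$. The algorithm uses $$O\left(\frac{1}{\varepsilon^2}\cdot\frac{m^k}{(\#H)^2}\cdot\log n\right)$$ bits of space, and its update time per arriving edge is $$O\left(\frac{1}{\varepsilon^2}\cdot\frac{m^k}{(\#H)^2}\right).$$
   Context: A hypergraph $G=(V[G],E[G])$ consists of a finite vertex set $V[G]$ and a set $E[G]$ of non-empty subsets of $V[G]$ (edges may have different sizes). The degree of a vertex is the number of edges containing it, and the minimum degree of $H$ is the minimum over all vertices of $H$. Two hypergraphs $H_1,H_2$ are isomorphic if there is a bijection $\varphi:V[H_1]\to V[H_2]$ such that $D\in E[H_1]$ if and only if $\{\varphi(u):u\in D\}\in E[H_2]$. An occurrence of $H$ in $G$ is a (not necessarily induced) subgraph of $G$ that is isomorphic to $H$; $\#(H,G)$ is the number of occurrences of $H$ in $G$. Turnstile model: the hypergraph $G$ is presented as a data stream of signed edges arriving sequentially in an arbitrary order; each item is a set of vertices of $G$ (an edge) together with a sign "$+$" or "$-$", indicating that this edge is inserted into or deleted from the hypergraph, respectively. $G$ is the hypergraph resulting from the stream, and $m$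 is its number of edges. The number $n$ of vertices is known in advance. The hypergraph $H$ is fixed and of constant size, so constants hidden in $O(\cdot)$ may depend on $H$. The update time is the time spent processing one stream item. The stated bounds are understood for $\#H>0$. -}

module Defs where

open import Data.Bool.Base using (if_then_else_)
import Data.Bool.Properties as Bool
open import Data.Fin.Base using (Fin; toℕ; fromℕ<)
import Data.Fin.Properties as Fin
open import Data.Fin.Subset using (Subset; _∈_; _⊆_; Nonempty; inside; outside; ⊤; ∣_∣)
open import Data.Fin.Subset.Properties using (_∈?_; _⊆?_; anySubset?)
import Data.Integer.Base as ℤ
open import Data.List.Base as List
  using (List; []; _∷_; _++_; length; filter; map; cartesianProduct; allFin; head; drop)
import Data.List.Membership.Propositional as List∈
import Data.List.Membership.DecPropositional as DecList∈
open import Data.List.Relation.Unary.All as All using (All)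
open import Data.List.Relation.Unary.Unique.Propositional using (Unique)
open import Data.Maybe.Base using (fromMaybe)
open import Data.Nat.Base as ℕ using (ℕ; zero; suc; _+_; _*_; _∸_; _^_; _⊓_; _⊔_; _<ᵇ_; _≡ᵇ_)
open import Data.Nat.DivMod using (_/_; _%_; _mod_)
open import Data.Nat.Logarithm using (⌊log₂_⌋)
import Data.Nat.Properties as ℕ
open import Data.Product.Base using (∃-syntax; _×_; _,_)
open import Data.Product.Properties using () renaming (≡-dec to ×-≡-dec)
open import Data.Rational.Base as ℚ using (ℚ; 0ℚ; 1ℚ)
import Data.Rational.Properties as ℚ
open import Data.Sign.Base as Sign using (Sign)
import Data.Sign.Properties as Sign
open import Data.Vec.Base as Vec using (Vec; []; _∷_; lookup; tabulate; replicate; _[_]≔_; foldr₁)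
import Data.Vec.Properties as Vec
import Data.Vec.Functional as Vector
open import Function.Base using (_∘_)
open import Relation.Binary.Definitions using (DecidableEquality)
open import Relation.Binary.PropositionalEquality using (_≡_)
open import Relation.Nullary.Decidable
  using (Dec; yes; no; does; ¬?; map′; _×-dec_; _→-dec_; decidable-stable)
open import Relation.Nullary.Negation using (¬_)
open import Relation.Unary using (Decidable)

------------------------------------------------------------------------
-- Hypergraphs

_≟ₛ_ : ∀ {n} → DecidableEquality (Subset n)
_≟ₛ_ = Vec.≡-dec Bool._≟_

_∈ᴱ_ : ∀ {n} → Subset n → List (Subset n) → Set
e ∈ᴱ es = e List∈.∈ es

_∈ᴱ?_ : ∀ {n} (e : Subset n) (es : List (Subset n)) → Dec (e ∈ᴱ es)
_∈ᴱ?_ = DecList∈._∈?_ _≟ₛ_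

record Hypergraph (n : ℕ) : Set where
  field
    edges    : List (Subset n)
    unique   : Unique edges
    nonempty : All Nonempty edges

  size : ℕ
  size = length edges

  degree : Fin n → ℕ
  degree v = length (filter (v ∈?_) edges)

open Hypergraph public

minDegree : ∀ {t} → Hypergraph (suc t) → ℕ
minDegree H = foldr₁ _⊓_ (tabulate (degree H))

------------------------------------------------------------------------
-- Occurrences

image : ∀ {t n} → Vec (Fin n) t → Subset t → Subset n
image φ D = tabulate λ v → does (Fin.any? λ u → u ∈? D ×-dec lookup φ u Fin.≟ v)

-- φ is an isomorphism from H to the hypergraph with vertex set U and edge
-- set F, both on the ambient vertices Fin n.
IsIso : ∀ {t n} → Hypergraph t → Subset n → List (Subset n) → Vec (Fin n) t → Set
IsIso H U F φ =
    (∀ u v → lookup φ u ≡ lookup φ v → u ≡ v)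
  × image φ ⊤ ≡ U
  × (∀ D → (D ∈ᴱ edges H → image φ D ∈ᴱ F) × (image φ D ∈ᴱ F → D ∈ᴱ edges H))

IsOccurrence : ∀ {t n} → Hypergraph t → Subset n × List (Subset n) → Set
IsOccurrence H (U , F) = All (_⊆ U) F × ∃[ φ ] IsIso H U F φ

allSubsets? : ∀ {n} {P : Subset n → Set} → Decidable P → Dec (∀ D → P D)
allSubsets? P? = map′
  (λ ¬∃¬ D → decidable-stable (P? D) (λ ¬p → ¬∃¬ (D , ¬p)))
  (λ ∀p (D , ¬p) → ¬p (∀p D))
  (¬? (anySubset? (¬? ∘ P?)))

anyVec? : ∀ {n t} {P : Vec (Fin n) t → Set} → Decidable P → Dec (∃[ φ ] P φ)
anyVec? {t = zero}  P? = map′ ([] ,_) (λ { ([] , p) → p }) (P? [])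
anyVec? {t = suc t} P? = map′
  (λ (x , xs , p) → x ∷ xs , p)
  (λ { (x ∷ xs , p) → x , xs , p })
  (Fin.any? λ x → anyVec? λ xs → P? (x ∷ xs))

isIso? : ∀ {t n} (H : Hypergraph t) U F (φ : Vec (Fin n) t) → Dec (IsIso H U F φ)
isIso? H U F φ =
        (Fin.all? λ u → Fin.all? λ v → lookup φ u Fin.≟ lookup φ v →-dec u Fin.≟ v)
  ×-dec image φ ⊤ ≟ₛ U
  ×-dec allSubsets? λ D → (D ∈ᴱ? edges H →-dec image φ D ∈ᴱ? F)
                          ×-dec (image φ D ∈ᴱ? F →-dec D ∈ᴱ? edges H)

isOccurrence? : ∀ {t n} (H : Hypergraph t) → Decidable (IsOccurrence {n = n} H)
isOccurrence? H (U , F) = All.all? (_⊆? U) F ×-dec anyVec? (isIso? H U F)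

allSubsets : ∀ n → List (Subset n)
allSubsets zero    = [] ∷ []
allSubsets (suc n) = map (inside ∷_) (allSubsets n) ++ map (outside ∷_) (allSubsets n)

sublists : ∀ {A : Set} → List A → List (List A)
sublists []       = [] ∷ []
sublists (x ∷ xs) = map (x ∷_) (sublists xs) ++ sublists xs

-- The edges of G are distinct, so the pairs (U , F) enumerate every choice of
-- a set of vertices and a set of edges of G exactly once.
# : ∀ {t n} → Hypergraph t → Hypergraph n → ℕ
# {n = n} H G =
  length (filter (isOccurrence? H) (cartesianProduct (allSubsets n) (sublists (edges G))))

------------------------------------------------------------------------
-- Turnstile streams

Item : ℕ → Set
Item n = Sign × Subset n

Stream : ℕ → Set
Stream n = List (Item n)

occurs : ∀ {n} → Item n → Stream n → ℕ
occurs i σ = length (filter (×-≡-dec Sign._≟_ _≟ₛ_ i) σ)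

-- Only the final multiplicities are constrained, so deletions may precede the
-- matching insertions.  Streams whose every prefix describes a hypergraph are
-- a special case.
_Yields_ : ∀ {n} → Stream n → Hypergraph n → Set
σ Yields G = ∀ e →
    (e ∈ᴱ edges G → occurs (Sign.+ , e) σ ≡ suc (occurs (Sign.- , e) σ))
  × (¬ e ∈ᴱ edges G → occurs (Sign.+ , e) σ ≡ occurs (Sign.- , e) σ)

------------------------------------------------------------------------
-- Finite probability

data Rnd (A : Set) : Set where
  return : A → Rnd A
  draw   : ∀ N → (Fin (suc N) → Rnd A) → Rnd A

infixl 1 _>>=_

_>>=_ : ∀ {A B} → Rnd A → (A → Rnd B) → Rnd B
return a >>= k = k a
draw N f >>= k = draw N λ i → f i >>= k

Always : ∀ {A} → (A → Set) → Rnd A → Set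
Always P (return a) = P a
Always P (draw N f) = ∀ i → Always P (f i)

Pr : ∀ {A} {P : A → Set} → Decidable P → Rnd A → ℚ
Pr P? (return a) = if does (P? a) then 1ℚ else 0ℚ
Pr P? (draw N f) = (ℤ.+ 1 ℚ./ suc N) ℚ.* Vector.foldr ℚ._+_ 0ℚ (λ i → Pr P? (f i))

------------------------------------------------------------------------
-- A word RAM with structured control flow

data Op : Set where
  add sub mul quot rem lt eq : Op

infixr 5 _⨾_

-- Writing M for the memory and I for a read-only input:
--   const x k      M[x] ← k
--   bin o x y z    M[x] ← M[y] o M[z]
--   load x y       M[x] ← M[M[y]]
--   store x y      M[M[x]] ← M[y]
--   input x y      M[x] ← I[M[y]]
--   rand x y       M[x] ← a uniformly random element of {0,…,M[y]-1}
--   if x c d       c when M[x] ≠ 0, and d otherwise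
--   loop x c       c repeated M[x] times, M[x] being read on entry
data Cmd : Set where
  skip  : Cmd
  const : (x k : ℕ) → Cmd
  bin   : (o : Op) (x y z : ℕ) → Cmd
  load  : (x y : ℕ) → Cmd
  store : (x y : ℕ) → Cmd
  input : (x y : ℕ) → Cmd
  rand  : (x y : ℕ) → Cmd
  _⨾_   : Cmd → Cmd → Cmd
  if    : (x : ℕ) → Cmd → Cmd → Cmd
  loop  : (x : ℕ) → Cmd → Cmd

-- A loop needs a counter of its own; nesting is the number of counters that
-- can be live at once.
nesting : Cmd → ℕ
nesting (c ⨾ d)    = nesting c ⊔ nesting d
nesting (if x c d) = nesting c ⊔ nesting d
nesting (loop x c) = suc (nesting c)
nesting _          = 0

module RAM (w S : ℕ) where  -- S cells of w bits each

  Word : Set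
  Word = Fin (2 ^ w)

  Memory : Set
  Memory = Vec Word S

  instance
    2^w≢0 : ℕ.NonZero (2 ^ w)
    2^w≢0 = ℕ.m^n≢0 2 w

  blank : Memory
  blank = replicate S (0 mod (2 ^ w))

  -- Out-of-range reads give 0 and out-of-range writes have no effect; written
  -- values are truncated to w bits.
  read : Memory → ℕ → ℕ
  read M x with x ℕ.<? S
  ... | yes x<S = toℕ (lookup M (fromℕ< x<S))
  ... | no  _   = 0

  write : Memory → ℕ → ℕ → Memory
  write M x v with x ℕ.<? S
  ... | yes x<S = M [ fromℕ< x<S ]≔ (v mod (2 ^ w))
  ... | no  _   = M

  ⟦_⟧ : Op → ℕ → ℕ → ℕ
  ⟦ add  ⟧ a b       = a + b
  ⟦ sub  ⟧ a b       = (2 ^ w + a) ∸ b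
  ⟦ mul  ⟧ a b       = a * b
  ⟦ quot ⟧ a zero    = 0
  ⟦ quot ⟧ a (suc b) = a / suc b
  ⟦ rem  ⟧ a zero    = 0
  ⟦ rem  ⟧ a (suc b) = a % suc b
  ⟦ lt   ⟧ a b       = if a <ᵇ b then 1 else 0
  ⟦ eq   ⟧ a b       = if a ≡ᵇ b then 1 else 0

  uniform : ℕ → Rnd ℕ
  uniform zero    = return 0
  uniform (suc N) = draw N (return ∘ toℕ)

  -- The second component of a result counts steps: one for every command
  -- executed other than ⨾, and one for every loop iteration.
  tick : Rnd (Memory × ℕ) → Rnd (Memory × ℕ)
  tick r = r >>= λ (M , t) → return (M , suc t)

  infixl 1 _then_

  _then_ : Rnd (Memory × ℕ) → (Memory → Rnd (Memory × ℕ)) → Rnd (Memory × ℕ)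
  r then k = r >>= λ (M , t) → k M >>= λ (M′ , t′) → return (M′ , t + t′)

  iterate : ℕ → (Memory → Rnd (Memory × ℕ)) → Memory → Rnd (Memory × ℕ)
  iterate zero    f M = return (M , 0)
  iterate (suc j) f M = tick (f M) then iterate j f

  exec : (I : List ℕ) → Cmd → Memory → Rnd (Memory × ℕ)
  exec I skip          M = return (M , 1)
  exec I (const x k)   M = return (write M x k , 1)
  exec I (bin o x y z) M = return (write M x (⟦ o ⟧ (read M y) (read M z)) , 1)
  exec I (load x y)    M = return (write M x (read M (read M y)) , 1)
  exec I (store x y)   M = return (write M (read M x) (read M y) , 1)
  exec I (input x y)   M = return (write M x (fromMaybe 0 (head (drop (read M y) I))) , 1)
  exec I (rand x y)    M = uniform (read M y) >>= λ v → return (write M x v , 1)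
  exec I (c ⨾ d)       M = exec I c M then exec I d
  exec I (if x c d)    M = tick (if read M x ≡ᵇ 0 then exec I d M else exec I c M)
  exec I (loop x c)    M = tick (iterate (read M x) (exec I c) M)

------------------------------------------------------------------------
-- Streaming algorithms

-- Words have wordFactor · ⌊log₂ n⌋ bits.  The three programs share the memory:
-- initialise runs before the stream, update once per item, and output after
-- the stream.
record Algorithm : Set where
  field
    wordFactor                : ℕ
    initialise update output  : Cmd

module _ (A : Algorithm) (n S : ℕ) where
  open Algorithm A

  wordSize : ℕ
  wordSize = wordFactor * ⌊log₂ n ⌋

  spaceBits : ℕ
  spaceBits = (S + (nesting initialise ⊔ nesting update ⊔ nesting output)) * wordSize

  open RAM wordSize S

  -- The sign, the number of vertices, and the vertices in increasing order.
  encode : Item n → List ℕ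
  encode (s , e) = sign s ∷ ∣ e ∣ ∷ map toℕ (filter (_∈? e) (allFin n))
    where
    sign : Sign → ℕ
    sign Sign.+ = 1
    sign Sign.- = 0

  -- T accumulates the largest number of steps spent on one item.
  process : Stream n → Memory → ℕ → Rnd (Memory × ℕ)
  process []      M T = return (M , T)
  process (i ∷ σ) M T = exec (encode i) update M >>= λ (M′ , t) → process σ M′ (T ⊔ t)

  answer : Memory → ℚ
  answer M with read M 1
  ... | zero  = 0ℚ
  ... | suc d = ℤ.+ read M 0 ℚ./ suc d

  -- The answer together with the worst update time.  Initially the algorithm is
  -- told only the number of vertices and the amount of memory at its disposal.
  run : Stream n → Rnd (ℚ × ℕ)
  run σ =
    exec (n ∷ S ∷ []) initialise blank >>= λ (M₀ , _) →
    process σ M₀ 0                     >>= λ (M₁ , T) →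
    exec [] output M₁                  >>= λ (M₂ , _) →
    return (answer M₂ , T)

------------------------------------------------------------------------
-- Approximation and its cost

fromℕ : ℕ → ℚ
fromℕ a = ℤ.+ a ℚ./ 1

Approximates : ℚ → ℕ → ℚ → Set
Approximates ε h Z = (1ℚ ℚ.- ε) ℚ.* fromℕ h ℚ.≤ Z × Z ℚ.≤ (1ℚ ℚ.+ ε) ℚ.* fromℕ h

approximates? : ∀ ε h → Decidable (Approximates ε h)
approximates? ε h Z =
  (1ℚ ℚ.- ε) ℚ.* fromℕ h ℚ.≤? Z ×-dec Z ℚ.≤? (1ℚ ℚ.+ ε) ℚ.* fromℕ h

-- 1/ε² · mᵏ/(#H)²
cost : ∀ {t n} (ε : ℚ) .{{_ : ℚ.Positive ε}} (H : Hypergraph t) (G : Hypergraph n)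
       .{{_ : ℕ.NonZero (# H G)}} → ℚ
cost ε H G = 1/ε ℚ.* 1/ε ℚ.* (ℤ.+ (size G ^ size H) ℚ./ (# H G ^ 2)) {{ℕ.m^n≢0 (# H G) 2}}
  where
  1/ε : ℚ
  1/ε = (ℚ.1/ ε) {{ℚ.pos⇒nonZero ε}}

{-# OPTIONS --safe #-}
module Submission where

-- Every vertex of G gets a random colour among the vertices of H, and a random
-- sign for every edge of H; the signs of a vertex of colour u are conditioned to
-- have product 1 over the edges at u.  The i-th of the k counters sums, over the
-- edges of G of the size of the i-th edge D of H, the product over u in D of the
-- sums of the i-th signs of their vertices of colour u.
--
-- Over a non-empty proper subset of the edges at u, the product of the signs has
-- mean 0.  Hence the product of the k counters has mean proportional to the
-- number of embeddings of H, and, as all degrees of H are at least 2, its second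
-- moment only sees the 2k-tuples of edges of G in which no vertex lies in
-- exactly one edge.  By AM-GM there are O(m^k) of these, so that by Chebyshev's
-- inequality O(m^k / (ε² #²)) independent copies suffice.  Only as much
-- independence is needed as a random polynomial modulo a power of two provides,
-- and the counters are linear in the stream, which takes care of deletions.
-- They are kept modulo the word size: only the final total has to fit.

module Big where

  open import Algebra.Structures using (IsCommutativeMonoid; IsCommutativeSemiring)
  open import Data.Bool.Base using (if_then_else_; true; false)
  open import Data.Fin.Base using (Fin; zero; suc)
  import Data.Fin.Properties as Fin
  open import Data.Fin.Subset using (Subset; inside; outside)
  open import Defs using (allSubsets)
  open import Data.List.Base as List using (List; []; _∷_; _++_; map; filter; length; allFin; cartesianProduct; cartesianProductWith; lookup)
  open import Data.List.Membership.Propositional using (_∈_)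
  open import Data.List.Relation.Unary.Any using (here; there)
  import Data.List.Properties as List
  open import Data.Nat.Base as ℕ using (ℕ; zero; suc)
  import Data.Nat.Properties as ℕ
  import Data.Integer.Base as ℤ
  open ℤ using (ℤ)
  import Data.Integer.Properties as ℤ
  open import Data.Product.Base using (_×_; _,_)
  open import Data.Sum.Base using (_⊎_; inj₁; inj₂)
  open import Data.Vec.Base as Vec using (Vec; []; _∷_)
  open import Function.Base using (_∘_; id)
  open import Relation.Binary.PropositionalEquality
  open import Relation.Nullary.Decidable using (Dec; yes; no; does)
  open import Relation.Nullary.Negation using (¬_; contradiction)
  open import Relation.Unary using (Decidable)

  private variable
    A B X : Set

  vecs : List A → ∀ N → List (Vec A N)
  vecs xs zero    = [] ∷ []
  vecs xs (suc N) = cartesianProductWith _∷_ xs (vecs xs N)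

  module Fold {C : Set} {_∙_ : C → C → C} {ε : C} (M : IsCommutativeMonoid _≡_ _∙_ ε) where
    open IsCommutativeMonoid M using (assoc; identityˡ; identityʳ; comm)

    fold : List A → (A → C) → C
    fold []       f = ε
    fold (x ∷ xs) f = f x ∙ fold xs f

    fold-cong∈ : ∀ (xs : List A) {f g} → (∀ {x} → x ∈ xs → f x ≡ g x) → fold xs f ≡ fold xs g
    fold-cong∈ []       e = refl
    fold-cong∈ (x ∷ xs) e = cong₂ _∙_ (e (here refl)) (fold-cong∈ xs (e ∘ there))

    fold-cong : ∀ (xs : List A) {f g} → (∀ x → f x ≡ g x) → fold xs f ≡ fold xs g
    fold-cong xs e = fold-cong∈ xs (λ {x} _ → e x)

    fold-ε : ∀ (xs : List A) → fold xs (λ _ → ε) ≡ ε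
    fold-ε []       = refl
    fold-ε (x ∷ xs) = trans (identityˡ _) (fold-ε xs)

    fold-++ : ∀ (xs ys : List A) {f} → fold (xs ++ ys) f ≡ fold xs f ∙ fold ys f
    fold-++ []       ys = sym (identityˡ _)
    fold-++ (x ∷ xs) ys = trans (cong (_ ∙_) (fold-++ xs ys)) (sym (assoc _ _ _))

    fold-map : ∀ (g : A → B) xs {f} → fold (map g xs) f ≡ fold xs (f ∘ g)
    fold-map g []       = refl
    fold-map g (x ∷ xs) = cong (_ ∙_) (fold-map g xs)

    interchange : ∀ a b c d → (a ∙ b) ∙ (c ∙ d) ≡ (a ∙ c) ∙ (b ∙ d)
    interchange a b c d = begin
      (a ∙ b) ∙ (c ∙ d) ≡⟨ assoc a b _ ⟩
      a ∙ (b ∙ (c ∙ d)) ≡⟨ cong (a ∙_) (sym (assoc b c d)) ⟩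
      a ∙ ((b ∙ c) ∙ d) ≡⟨ cong (λ z → a ∙ (z ∙ d)) (comm b c) ⟩
      a ∙ ((c ∙ b) ∙ d) ≡⟨ cong (a ∙_) (assoc c b d) ⟩
      a ∙ (c ∙ (b ∙ d)) ≡⟨ sym (assoc a c _) ⟩
      (a ∙ c) ∙ (b ∙ d) ∎
      where open ≡-Reasoning

    fold-∙ : ∀ (xs : List A) (f g : A → C) → fold xs (λ x → f x ∙ g x) ≡ fold xs f ∙ fold xs g
    fold-∙ []       f g = sym (identityˡ ε)
    fold-∙ (x ∷ xs) f g = trans (cong (_ ∙_) (fold-∙ xs f g)) (interchange _ _ _ _)

    fold-swap : ∀ (xs : List A) (ys : List B) (f : A → B → C) →
      fold xs (λ x → fold ys (f x)) ≡ fold ys (λ y → fold xs (λ x → f x y))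
    fold-swap []       ys f = sym (fold-ε ys)
    fold-swap (x ∷ xs) ys f = trans (cong (_ ∙_) (fold-swap xs ys f)) (sym (fold-∙ ys _ _))

    fold-× : ∀ (g : A → B → X) xs ys {f} →
      fold (cartesianProductWith g xs ys) f ≡ fold xs (λ x → fold ys (λ y → f (g x y)))
    fold-× g []       ys = refl
    fold-× g (x ∷ xs) ys = trans (fold-++ (map (g x) ys) _) (cong₂ _∙_ (fold-map (g x) ys) (fold-× g xs ys))

    fold-pairs : ∀ (xs : List A) (ys : List B) {f : A × B → C} →
      fold (cartesianProduct xs ys) f ≡ fold xs (λ x → fold ys (λ y → f (x , y)))
    fold-pairs = fold-× _,_

    fold-filter : ∀ {P : A → Set} (P? : Decidable P) xs {f} →
      fold (filter P? xs) f ≡ fold xs (λ x → if does (P? x) then f x else ε)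
    fold-filter P? []       = refl
    fold-filter P? (x ∷ xs) with does (P? x)
    ... | true  = cong (_ ∙_) (fold-filter P? xs)
    ... | false = trans (fold-filter P? xs) (sym (identityˡ _))

    fold-allFin : ∀ N {f} → fold (allFin (suc N)) f ≡ f zero ∙ fold (allFin N) (f ∘ suc)
    fold-allFin N {f} = cong (f zero ∙_) (trans (cong (λ l → fold l f) (sym (List.map-tabulate id suc))) (fold-map suc (allFin N)))

    fold-isolate : ∀ N (p : Fin N) (f : Fin N → C) →
      fold (allFin N) f ≡ f p ∙ fold (allFin N) (λ r → if does (r Fin.≟ p) then ε else f r)
    fold-isolate (suc N) zero    f = trans (fold-allFin N) (cong (f zero ∙_) (sym (trans (fold-allFin N) (identityˡ _))))
    fold-isolate (suc N) (suc p) f = begin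
      fold (allFin (suc N)) f                                            ≡⟨ fold-allFin N ⟩
      f zero ∙ fold (allFin N) (f ∘ suc)                                 ≡⟨ cong (f zero ∙_) (fold-isolate N p (f ∘ suc)) ⟩
      f zero ∙ (f (suc p) ∙ rest)                                        ≡⟨ sym (assoc _ _ _) ⟩
      (f zero ∙ f (suc p)) ∙ rest                                        ≡⟨ cong (_∙ rest) (comm _ _) ⟩
      (f (suc p) ∙ f zero) ∙ rest                                        ≡⟨ assoc _ _ _ ⟩
      f (suc p) ∙ (f zero ∙ rest)                                        ≡⟨ cong (f (suc p) ∙_) (sym (fold-allFin N)) ⟩
      f (suc p) ∙ fold (allFin (suc N)) (λ r → if does (r Fin.≟ suc p) then ε else f r) ∎
      where
      open ≡-Reasoning
      rest = fold (allFin N) (λ r → if does (r Fin.≟ p) then ε else f (suc r))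

    fold-lookup : ∀ (xs : List A) {f} → fold (allFin (length xs)) (f ∘ lookup xs) ≡ fold xs f
    fold-lookup []       = refl
    fold-lookup (x ∷ xs) {f} = trans (fold-allFin (length xs)) (cong (f x ∙_) (fold-lookup xs))

    fold-vecs : ∀ (xs : List A) N {f} → fold (vecs xs (suc N)) f ≡ fold xs (λ x → fold (vecs xs N) (λ v → f (x ∷ v)))
    fold-vecs xs N = fold-× _∷_ xs (vecs xs N)

    fold-allSubsets : ∀ n {f : Subset (suc n) → C} →
      fold (allSubsets (suc n)) f ≡ fold (allSubsets n) (f ∘ (inside ∷_)) ∙ fold (allSubsets n) (f ∘ (outside ∷_))
    fold-allSubsets n = trans (fold-++ (map (inside ∷_) (allSubsets n)) _) (cong₂ _∙_ (fold-map _ (allSubsets n)) (fold-map _ (allSubsets n)))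

  module Semi {C : Set} {_+_ _*_ : C → C → C} {0# 1# : C} (R : IsCommutativeSemiring _≡_ _+_ _*_ 0# 1#) where
    open IsCommutativeSemiring R
      using (+-isCommutativeMonoid; *-isCommutativeMonoid; *-assoc; *-comm; *-identityˡ; *-identityʳ; +-identityˡ; +-identityʳ; distribˡ; distribʳ; zeroˡ; zeroʳ)
    module S = Fold +-isCommutativeMonoid
    module P = Fold *-isCommutativeMonoid

    ∑ ∏ : List A → (A → C) → C
    ∑ = S.fold
    ∏ = P.fold

    ∑-*ˡ : ∀ (xs : List A) c (f : A → C) → ∑ xs (λ x → c * f x) ≡ c * ∑ xs f
    ∑-*ˡ []       c f = sym (zeroʳ c)
    ∑-*ˡ (x ∷ xs) c f = trans (cong (_ +_) (∑-*ˡ xs c f)) (sym (distribˡ _ _ _))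

    ∑-*ʳ : ∀ (xs : List A) c (f : A → C) → ∑ xs (λ x → f x * c) ≡ ∑ xs f * c
    ∑-*ʳ xs c f = trans (S.fold-cong xs (λ x → *-comm (f x) c)) (trans (∑-*ˡ xs c f) (*-comm c _))

    ∑-∑* : ∀ (xs : List A) (ys : List B) (f : A → C) (g : B → C) →
      ∑ xs (λ x → ∑ ys (λ y → f x * g y)) ≡ ∑ xs f * ∑ ys g
    ∑-∑* xs ys f g = trans (S.fold-cong xs (λ x → ∑-*ˡ ys (f x) g)) (∑-*ʳ xs (∑ ys g) f)

    ⟦_⟧ : ∀ {P : Set} → Dec P → C
    ⟦ d ⟧ = if does d then 1# else 0#

    ⟦yes⟧ : ∀ {P : Set} (d : Dec P) → P → ⟦ d ⟧ ≡ 1#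
    ⟦yes⟧ (yes _) _ = refl
    ⟦yes⟧ (no ¬p) p = contradiction p ¬p

    ⟦no⟧ : ∀ {P : Set} (d : Dec P) → ¬ P → ⟦ d ⟧ ≡ 0#
    ⟦no⟧ (yes p) ¬p = contradiction p ¬p
    ⟦no⟧ (no _)  _  = refl

    ⟦⟧-cases : ∀ {P : Set} (d : Dec P) → P × ⟦ d ⟧ ≡ 1# ⊎ ¬ P × ⟦ d ⟧ ≡ 0#
    ⟦⟧-cases (yes p) = inj₁ (p , refl)
    ⟦⟧-cases (no ¬p) = inj₂ (¬p , refl)

    ⟦⇔⟧ : ∀ {P Q : Set} (d : Dec P) (e : Dec Q) → (P → Q) → (Q → P) → ⟦ d ⟧ ≡ ⟦ e ⟧
    ⟦⇔⟧ (yes p) e f g = sym (⟦yes⟧ e (f p))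
    ⟦⇔⟧ (no ¬p) e f g = sym (⟦no⟧ e (¬p ∘ g))

    ∏∑ : ∀ (xs : List A) N (g : Fin N → A → C) →
      ∏ (allFin N) (λ p → ∑ xs (g p)) ≡ ∑ (vecs xs N) (λ α → ∏ (allFin N) (λ p → g p (Vec.lookup α p)))
    ∏∑ xs zero    g = sym (+-identityʳ 1#)
    ∏∑ xs (suc N) g = begin
      ∏ (allFin (suc N)) (λ p → ∑ xs (g p))
        ≡⟨ P.fold-allFin N ⟩
      ∑ xs (g zero) * ∏ (allFin N) (λ p → ∑ xs (g (suc p)))
        ≡⟨ cong (∑ xs (g zero) *_) (∏∑ xs N (g ∘ suc)) ⟩
      ∑ xs (g zero) * ∑ (vecs xs N) (λ α → ∏ (allFin N) (λ p → g (suc p) (Vec.lookup α p)))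
        ≡⟨ sym (∑-∑* xs (vecs xs N) _ _) ⟩
      ∑ xs (λ x → ∑ (vecs xs N) (λ α → g zero x * ∏ (allFin N) (λ p → g (suc p) (Vec.lookup α p))))
        ≡⟨ S.fold-cong xs (λ x → S.fold-cong (vecs xs N) (λ α → sym (P.fold-allFin N))) ⟩
      ∑ xs (λ x → ∑ (vecs xs N) (λ α → ∏ (allFin (suc N)) (λ p → g p (Vec.lookup (x ∷ α) p))))
        ≡⟨ sym (S.fold-vecs xs N) ⟩
      ∑ (vecs xs (suc N)) (λ α → ∏ (allFin (suc N)) (λ p → g p (Vec.lookup α p))) ∎
      where open ≡-Reasoning

    ∏-zero∈ : ∀ (xs : List A) {f x} → x ∈ xs → f x ≡ 0# → ∏ xs f ≡ 0#
    ∏-zero∈ (x ∷ xs) {f} (here refl) e = trans (cong (_* ∏ xs f) e) (zeroˡ _)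
    ∏-zero∈ (x ∷ xs) {f} (there m)   e = trans (cong (f x *_) (∏-zero∈ xs m e)) (zeroʳ _)

  module ℕΣ = Semi ℕ.+-*-isCommutativeSemiring
  module ℤΣ = Semi ℤ.+-*-isCommutativeSemiring

module Hash where

  open Big
  open import Data.Bool.Base using (if_then_else_)
  open import Data.Integer.Base as ℤ using (ℤ)
  import Data.Integer.Properties as ℤ
  open import Data.List.Base as List using (List; []; _∷_; map; length; upTo)
  import Data.List.Properties as List
  open import Data.List.Membership.Propositional using (_∈_; _∉_)
  open import Data.List.Membership.Propositional.Properties using (∈-upTo⁻)
  open import Data.List.Relation.Unary.Any using (here; there)
  open import Data.List.Relation.Unary.All as All using (All; []; _∷_)
  open import Data.Nat.Base as ℕ using (ℕ; zero; suc; _+_; _*_; _∸_; _^_; _≤_; _<_; z≤n; s≤s; NonZero)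
  open import Data.Nat.Coprimality using (Coprime; coprime-divisor)
  open import Data.Nat.Divisibility
  open import Data.Nat.DivMod
  open import Data.Nat.GCD
  import Data.Nat.Properties as ℕ
  open import Data.Nat.Tactic.RingSolver using (solve-∀)
  open import Data.Product.Base using (∃-syntax; Σ-syntax; _×_; _,_; proj₁; proj₂)
  open import Data.Sum.Base using (_⊎_; inj₁; inj₂)
  open import Data.Vec.Base as Vec using (Vec; []; _∷_; replicate; zipWith)
  open import Function.Base using (_∘_)
  open import Relation.Binary.PropositionalEquality
  open import Relation.Binary.Definitions using (tri<; tri≈; tri>)
  open import Relation.Nullary.Decidable using (does; dec-true; dec-false)
  open import Relation.Nullary.Negation using (contradiction)
  open ℤΣ

  ∑-const : ∀ {A : Set} (xs : List A) c → ∑ xs (λ _ → c) ≡ ℤ.+ length xs ℤ.* c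
  ∑-const []       c = sym (ℤ.*-zeroˡ c)
  ∑-const (x ∷ xs) c = trans (cong (ℤ._+_ c) (∑-const xs c)) (sym (ℤ.suc-* (ℤ.+ length xs) c))

  ∑-upTo-suc : ∀ m F → ∑ (upTo (suc m)) F ≡ F 0 ℤ.+ ∑ (upTo m) (F ∘ suc)
  ∑-upTo-suc m F = cong (ℤ._+_ (F 0)) (trans (cong (λ l → ∑ l F) (sym (List.map-upTo suc m))) (S.fold-map suc (upTo m)))

  ∑-upTo-last : ∀ m F → ∑ (upTo (suc m)) F ≡ ∑ (upTo m) F ℤ.+ F m
  ∑-upTo-last m F = trans (cong (λ l → ∑ l F) (sym (List.upTo-∷ʳ m)))
    (trans (S.fold-++ (upTo m) (m ∷ [])) (cong (ℤ._+_ (∑ (upTo m) F)) (ℤ.+-identityʳ (F m))))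

  ∑-rotate : ∀ q .{{_ : NonZero q}} c F → ∑ (upTo q) (λ s → F ((s + c) % q)) ≡ ∑ (upTo q) F
  ∑-rotate (suc m) zero    F = S.fold-cong∈ (upTo (suc m)) λ {s} s∈ →
    cong F (trans (cong (_% suc m) (ℕ.+-identityʳ s)) (m<n⇒m%n≡m (∈-upTo⁻ s∈)))
  ∑-rotate (suc m) (suc c) F = trans (S.fold-cong (upTo (suc m)) shift) (trans one (∑-rotate (suc m) c F))
    where
    q = suc m
    F′ : ℕ → ℤ
    F′ t = F ((t + c) % q)
    shift : ∀ s → F ((s + suc c) % q) ≡ F′ (suc s % q)
    shift s = cong F (begin
      (s + suc c) % q                 ≡⟨ cong (_% q) (ℕ.+-suc s c) ⟩
      (suc s + c) % q                 ≡⟨ %-distribˡ-+ (suc s) c q ⟩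
      (suc s % q + c % q) % q         ≡⟨ cong (λ z → (z + c % q) % q) (m%n%n≡m%n (suc s) q) ⟨
      (suc s % q % q + c % q) % q     ≡⟨ %-distribˡ-+ (suc s % q) c q ⟨
      (suc s % q + c) % q             ∎)
      where open ≡-Reasoning
    one : ∑ (upTo q) (λ s → F′ (suc s % q)) ≡ ∑ (upTo q) F′
    one = begin
      ∑ (upTo (suc m)) (λ s → F′ (suc s % q))                   ≡⟨ ∑-upTo-last m _ ⟩
      ∑ (upTo m) (λ s → F′ (suc s % q)) ℤ.+ F′ (suc m % q)      ≡⟨ cong₂ ℤ._+_
          (S.fold-cong∈ (upTo m) (λ s∈ → cong F′ (m<n⇒m%n≡m (s≤s (∈-upTo⁻ s∈))))) (cong F′ (n%n≡0 q)) ⟩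
      ∑ (upTo m) (F′ ∘ suc) ℤ.+ F′ 0                            ≡⟨ ℤ.+-comm (∑ (upTo m) (F′ ∘ suc)) _ ⟩
      F′ 0 ℤ.+ ∑ (upTo m) (F′ ∘ suc)                            ≡⟨ ∑-upTo-suc m F′ ⟨
      ∑ (upTo (suc m)) F′                                       ∎
      where open ≡-Reasoning

  even⊎odd : ∀ g → 2 ∣ g ⊎ Coprime g 2
  even⊎odd g with g % 2 in eq | m%n<n g 2
  ... | 0 | _ = inj₁ (m%n≡0⇒n∣m g 2 eq)
  ... | 1 | _ = inj₂ λ {d} (d∣g , d∣2) → ∣1⇒≡1 (∣m+n∣m⇒∣n {d} {g / 2 * 2} {1}
    (subst (d ∣_) (trans (m≡m%n+[m/n]*n g 2) (trans (cong (_+ g / 2 * 2) eq) (ℕ.+-comm 1 (g / 2 * 2)))) d∣g)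
    (∣n⇒∣m*n (g / 2) d∣2))
  ... | suc (suc _) | s≤s (s≤s ())

  ∣2^⇒small : ∀ W ℓ g → g ∣ 2 ^ W → g < 2 ^ ℓ → g ∣ 2 ^ ℓ
  ∣2^⇒small zero    ℓ g g∣ g< = ∣-trans g∣ (1∣ _)
  ∣2^⇒small (suc W) ℓ g g∣ g< with even⊎odd g
  ... | inj₂ odd = ∣2^⇒small W ℓ g (coprime-divisor odd g∣) g<
  ∣2^⇒small (suc W) zero    g g∣ (s≤s z≤n) | inj₁ _ = contradiction (0∣⇒≡0 g∣) (ℕ.≢-nonZero⁻¹ (2 ^ suc W) {{ℕ.m^n≢0 2 (suc W)}})
  ∣2^⇒small (suc W) (suc ℓ) g g∣ g< | inj₁ (divides h refl) =
    subst₂ _∣_ (ℕ.*-comm 2 h) refl (*-monoʳ-∣ 2 (∣2^⇒small W ℓ h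
      (*-cancelˡ-∣ 2 (subst (_∣ 2 * 2 ^ W) (ℕ.*-comm h 2) g∣))
      (ℕ.*-cancelˡ-< 2 h _ (subst (_< 2 * 2 ^ ℓ) (ℕ.*-comm h 2) g<))))

  evalPoly : ∀ {K} → Vec ℕ K → ℕ → ℕ
  evalPoly []       x = 0
  evalPoly (s ∷ ss) x = s + x * evalPoly ss x

  mulLinear : ∀ {K} → ℕ → Vec ℕ K → Vec ℕ (suc K)
  mulLinear β []       = 0 ∷ []
  mulLinear β (s ∷ ss) with mulLinear β ss
  ... | t ∷ ts = β * s ∷ s + t ∷ ts

  evalPoly-mulLinear : ∀ {K} β (ss : Vec ℕ K) x → evalPoly (mulLinear β ss) x ≡ (x + β) * evalPoly ss x
  evalPoly-mulLinear β []       x = trans (ℕ.*-zeroʳ x) (sym (ℕ.*-zeroʳ (x + β)))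
  evalPoly-mulLinear β (s ∷ ss) x with mulLinear β ss | evalPoly-mulLinear β ss x
  ... | t ∷ ts | eq = begin
    β * s + x * (s + t + x * evalPoly ts x)    ≡⟨ cong (λ z → β * s + x * z) (ℕ.+-assoc s t _) ⟩
    β * s + x * (s + (t + x * evalPoly ts x))  ≡⟨ cong (λ z → β * s + x * (s + z)) eq ⟩
    β * s + x * (s + (x + β) * evalPoly ss x)  ≡⟨ lemma β s x (evalPoly ss x) ⟩
    (x + β) * (s + x * evalPoly ss x)          ∎
    where
    open ≡-Reasoning
    lemma : ∀ β s x p → β * s + x * (s + (x + β) * p) ≡ (x + β) * (s + x * p)
    lemma = solve-∀

  evalPoly-zero : ∀ K x → evalPoly (replicate K 0) x ≡ 0
  evalPoly-zero zero    x = refl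
  evalPoly-zero (suc K) x = trans (cong (x *_) (evalPoly-zero K x)) (ℕ.*-zeroʳ x)

  evalPoly-scale : ∀ {K} i (d : Vec ℕ K) x → evalPoly (Vec.map (i *_) d) x ≡ i * evalPoly d x
  evalPoly-scale i []       x = sym (ℕ.*-zeroʳ i)
  evalPoly-scale i (s ∷ ss) x = trans (cong (λ z → i * s + x * z) (evalPoly-scale i ss x)) (lemma i s x (evalPoly ss x))
    where
    lemma : ∀ i s x p → i * s + x * (i * p) ≡ i * (s + x * p)
    lemma = solve-∀

  -- Dietzfelbinger's limited independence without primes: the top L bits of a
  -- random polynomial modulo 2^(L+e+ℓK) are exactly K-wise independent on
  -- arguments below 2^ℓ.  Adding to the seed a multiple of the polynomial
  -- c·∏(x-b) moves the value at a alone, and c can be chosen so that it moves by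
  -- exactly one unit of the top bits, because every difference a-b divides 2^ℓ
  -- up to an odd factor.
  module Poly (L ℓ K e : ℕ) where

    q′ Q q : ℕ
    q′ = 2 ^ (e + ℓ * K)
    Q  = 2 ^ L
    q  = Q * q′

    instance
      q′≢0 : NonZero q′
      q′≢0 = ℕ.m^n≢0 2 (e + ℓ * K)
      Q≢0 : NonZero Q
      Q≢0 = ℕ.m^n≢0 2 L
      q≢0 : NonZero q
      q≢0 = ℕ.m*n≢0 Q q′

    q≡2^ : q ≡ 2 ^ (L + (e + ℓ * K))
    q≡2^ = sym (ℕ.^-distribˡ-+-* 2 L (e + ℓ * K))

    infix 4 _≈_
    _≈_ : ℕ → ℕ → Set
    a ≈ b = a % q ≡ b % q

    +-cong : ∀ {a a′ b b′} → a ≈ a′ → b ≈ b′ → a + b ≈ a′ + b′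
    +-cong {a} {a′} {b} {b′} p r = trans (%-distribˡ-+ a b q) (trans (cong₂ (λ x y → (x + y) % q) p r) (sym (%-distribˡ-+ a′ b′ q)))

    *-cong : ∀ {a a′ b b′} → a ≈ a′ → b ≈ b′ → a * b ≈ a′ * b′
    *-cong {a} {a′} {b} {b′} p r = trans (%-distribˡ-* a b q) (trans (cong₂ (λ x y → (x * y) % q) p r) (sym (%-distribˡ-* a′ b′ q)))

    q≈0 : ∀ k → k * q ≈ 0
    q≈0 k = trans (m*n%n≡0 k q) (sym (0%n≡0))
      where
      0%n≡0 : 0 % q ≡ 0
      0%n≡0 = m<n⇒m%n≡m (ℕ.>-nonZero⁻¹ q)

    bezout : ∀ m → ∃[ x ] x * m ≈ gcd m q
    bezout m with Bézout.identity (gcd-GCD m q)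
    ... | Bézout.+- x y eq = x , trans (cong (_% q) (sym eq)) (trans (+-cong {gcd m q} refl (q≈0 y)) (cong (_% q) (ℕ.+-identityʳ _)))
    ... | Bézout.-+ x y eq = (q ∸ 1) * x , (begin
      ((q ∸ 1) * x * m) % q                      ≡⟨ +-cong {0} {gcd m q + x * m} {(q ∸ 1) * x * m} (sym (trans (cong (_% q) eq) (q≈0 y))) refl ⟩
      (gcd m q + x * m + (q ∸ 1) * x * m) % q    ≡⟨ cong (_% q) (trans (lemma (gcd m q) x m (q ∸ 1)) (cong (λ z → gcd m q + x * m * z) (ℕ.suc-pred q))) ⟩
      (gcd m q + x * m * q) % q                  ≡⟨ +-cong {gcd m q} refl (q≈0 (x * m)) ⟩
      (gcd m q + 0) % q                          ≡⟨ cong (_% q) (ℕ.+-identityʳ _) ⟩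
      gcd m q % q                                ∎)
      where
      open ≡-Reasoning
      lemma : ∀ g x m p → g + x * m + p * x * m ≡ g + x * m * suc p
      lemma = solve-∀

    2^ℓ∣q′-if : 1 ≤ K → 2 ^ ℓ ≤ q
    2^ℓ∣q′-if (s≤s {n = K′} _) = ℕ.≤-trans (ℕ.^-monoʳ-≤ 2 (ℕ.≤-trans (ℕ.m≤m*n ℓ (suc K′)) (ℕ.≤-trans (ℕ.m≤n+m _ e) (ℕ.m≤n+m _ L)))) (ℕ.≤-reflexive (sym q≡2^))

    invert : ∀ a b → a < 2 ^ ℓ → b < 2 ^ ℓ → a ≢ b → 2 ^ ℓ ≤ q → ∃[ x ] x * (a + (q ∸ b)) ≈ 2 ^ ℓ
    invert a b a< b< a≢b ℓ≤q = proj₁ bz * z , (begin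
      (proj₁ bz * z * m) % q   ≡⟨ cong (_% q) (lemma (proj₁ bz) z m) ⟩
      (z * (proj₁ bz * m)) % q ≡⟨ *-cong {z} refl (proj₂ bz) ⟩
      (z * g) % q              ≡⟨ cong (_% q) (sym (_∣_.equality g∣2^ℓ)) ⟩
      2 ^ ℓ % q                ∎)
      where
      open ≡-Reasoning
      lemma : ∀ x z m → x * z * m ≡ z * (x * m)
      lemma = solve-∀
      m = a + (q ∸ b)
      g = gcd m q
      b≤q = ℕ.≤-trans (ℕ.<⇒≤ b<) ℓ≤q
      g< : g < 2 ^ ℓ
      g< with ℕ.<-cmp a b
      ... | tri≈ _ a≡b _ = contradiction a≡b a≢b
      ... | tri< a<b _ _ = ℕ.≤-<-trans (∣⇒≤ {{ℕ.>-nonZero (ℕ.m<n⇒0<n∸m a<b)}} (∣m+n∣m⇒∣n {g} {m} {b ∸ a} (subst (g ∣_) (sym eq) (gcd[m,n]∣n m q)) (gcd[m,n]∣m m q)))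
                                       (ℕ.≤-<-trans (ℕ.m∸n≤m b a) b<)
        where
        eq : m + (b ∸ a) ≡ q
        eq = trans (cong (_+ (b ∸ a)) (ℕ.+-comm a (q ∸ b))) (trans (ℕ.+-assoc (q ∸ b) a (b ∸ a)) (trans (cong (_+_ (q ∸ b)) (ℕ.m+[n∸m]≡n (ℕ.<⇒≤ a<b))) (ℕ.m∸n+n≡m b≤q)))
      ... | tri> _ _ b<a = ℕ.≤-<-trans (∣⇒≤ {{ℕ.>-nonZero (ℕ.m<n⇒0<n∸m b<a)}} (∣m+n∣m⇒∣n {g} {q} {a ∸ b} (subst (g ∣_) eq (gcd[m,n]∣m m q)) (gcd[m,n]∣n m q)))
                                       (ℕ.≤-<-trans (ℕ.m∸n≤m a b) a<)
        where
        eq : m ≡ q + (a ∸ b)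
        eq = trans (cong (_+ (q ∸ b)) (sym (ℕ.m∸n+n≡m (ℕ.<⇒≤ b<a)))) (trans (ℕ.+-assoc (a ∸ b) b (q ∸ b)) (trans (cong (_+_ (a ∸ b)) (ℕ.m+[n∸m]≡n b≤q)) (ℕ.+-comm (a ∸ b) q)))
      g∣2^ℓ = ∣2^⇒small (L + (e + ℓ * K)) ℓ g (subst (g ∣_) q≡2^ (gcd[m,n]∣n m q)) g<
      z = quotient g∣2^ℓ
      bz = bezout m

    rootPoly : ∀ {K} → ℕ → (bs : List ℕ) → length bs < K → Vec ℕ K
    rootPoly {suc K} c []       _         = c ∷ replicate K 0
    rootPoly {suc K} c (b ∷ bs) (s≤s len) = mulLinear (q ∸ b) (rootPoly c bs len)

    factors : List ℕ → ℕ → ℕ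
    factors []       x = 1
    factors (b ∷ bs) x = (x + (q ∸ b)) * factors bs x

    evalPoly-rootPoly : ∀ {K} c bs (len : length bs < K) x → evalPoly (rootPoly c bs len) x ≡ factors bs x * c
    evalPoly-rootPoly {suc K} c []       len       x = trans (cong (λ z → c + x * z) (evalPoly-zero K x)) (trans (cong (c +_) (ℕ.*-zeroʳ x)) refl)
    evalPoly-rootPoly {suc K} c (b ∷ bs) (s≤s len) x = trans (evalPoly-mulLinear (q ∸ b) (rootPoly c bs len) x)
      (trans (cong ((x + (q ∸ b)) *_) (evalPoly-rootPoly c bs len x)) (sym (ℕ.*-assoc (x + (q ∸ b)) _ c)))

    factors-root : ∀ bs {b} → b ∈ bs → All (_≤ q) bs → factors bs b ≈ 0
    factors-root (b ∷ bs) (here refl) (b≤q ∷ _) = *-cong {b + (q ∸ b)} {0} {factors bs b} (trans (cong (_% q) (trans (ℕ.m+[n∸m]≡n b≤q) (sym (ℕ.*-identityˡ q)))) (q≈0 1)) refl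
    factors-root (b ∷ bs) {b′} (there m) (_ ∷ all) = trans (*-cong {b′ + (q ∸ b)} refl (factors-root bs m all)) (cong (_% q) (ℕ.*-zeroʳ (b′ + (q ∸ b))))

    factors-inv : ∀ a bs → a < 2 ^ ℓ → All (_< 2 ^ ℓ) bs → a ∉ bs → 2 ^ ℓ ≤ q → ∃[ c ] factors bs a * c ≈ 2 ^ (ℓ * length bs)
    factors-inv a []       a< _           a∉ _ = 1 , cong (λ z → 2 ^ z % q) (sym (ℕ.*-zeroʳ ℓ))
    factors-inv a (b ∷ bs) a< (b< ∷ all) a∉ ℓ≤q
      with invert a b a< b< (a∉ ∘ here) ℓ≤q | factors-inv a bs a< all (a∉ ∘ there) ℓ≤q
    ... | x , ex | c , ec = x * c , trans (cong (_% q) (lemma (a + (q ∸ b)) (factors bs a) x c))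
        (trans (*-cong ex ec) (cong (_% q) (trans (sym (ℕ.^-distribˡ-+-* 2 ℓ (ℓ * length bs))) (cong (2 ^_) (sym (ℕ.*-suc ℓ (length bs)))))))
      where
      lemma : ∀ m f x c → m * f * (x * c) ≡ x * m * (f * c)
      lemma = solve-∀

    moving : ∀ a bs → a < 2 ^ ℓ → All (_< 2 ^ ℓ) bs → a ∉ bs → length bs < K →
      Σ[ d ∈ Vec ℕ K ] (evalPoly d a ≈ q′ × ∀ {b} → b ∈ bs → evalPoly d b ≈ 0)
    moving a bs a< all a∉ len = rootPoly c′ bs len
      , trans (cong (_% q) (trans (evalPoly-rootPoly c′ bs len a) (sym (ℕ.*-assoc (factors bs a) _ r))))
          (trans (*-cong {b = r} ec refl) (cong (_% q) (trans (sym (ℕ.^-distribˡ-+-* 2 (ℓ * length bs) rest)) (cong (2 ^_) exp))))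
      , λ {b} b∈ → trans (cong (_% q) (evalPoly-rootPoly c′ bs len b)) (*-cong {b = c′} (factors-root bs b∈ (All.map (λ b< → ℕ.≤-trans (ℕ.<⇒≤ b<) ℓ≤q) all)) refl)
      where
      ℓ≤q = 2^ℓ∣q′-if (ℕ.≤-trans (s≤s z≤n) len)
      fi = factors-inv a bs a< all a∉ ℓ≤q
      ec = proj₂ fi
      rest = e + ℓ * (K ∸ length bs)
      r = 2 ^ rest
      c′ = proj₁ fi * r
      exp : ℓ * length bs + rest ≡ e + ℓ * K
      exp = begin
        ℓ * length bs + (e + ℓ * (K ∸ length bs))  ≡⟨ lemma ℓ (length bs) e (K ∸ length bs) ⟩
        e + ℓ * (length bs + (K ∸ length bs))      ≡⟨ cong (λ z → e + ℓ * z) (ℕ.m+[n∸m]≡n (ℕ.<⇒≤ len)) ⟩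
        e + ℓ * K                                  ∎
        where
        open ≡-Reasoning
        lemma : ∀ ℓ b e k → ℓ * b + (e + ℓ * k) ≡ e + ℓ * (b + k)
        lemma = solve-∀

    hash : Vec ℕ K → ℕ → ℕ
    hash s v = (evalPoly s v % q) / q′

    hash<Q : ∀ s v → hash s v < Q
    hash<Q s v = m<n*o⇒m/o<n (m%n<n (evalPoly s v) q)

    hash-≈ : ∀ {x y} → x ≈ y → (x % q) / q′ ≡ (y % q) / q′
    hash-≈ eq = cong (λ z → z / q′) eq

    hash-move : ∀ x i → ((x + i * q′) % q) / q′ ≡ (i + (x % q) / q′) % Q
    hash-move x i = begin
      ((x + i * q′) % q) / q′             ≡⟨ m%[n*o]/o≡m/o%n (x + i * q′) Q q′ ⟩
      ((x + i * q′) / q′) % Q             ≡⟨ cong (_% Q) (trans (+-distrib-/-∣ʳ x (n∣m*n i)) (cong (λ z → x / q′ + z) (m*n/n≡m i q′))) ⟩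
      (x / q′ + i) % Q                    ≡⟨ cong (_% Q) (ℕ.+-comm (x / q′) i) ⟩
      (i + x / q′) % Q                    ≡⟨ %-distribˡ-+ i (x / q′) Q ⟩
      (i % Q + x / q′ % Q) % Q            ≡⟨ cong (λ z → (i % Q + z) % Q) (m%n%n≡m%n (x / q′) Q) ⟨
      (i % Q + x / q′ % Q % Q) % Q        ≡⟨ %-distribˡ-+ i (x / q′ % Q) Q ⟨
      (i + x / q′ % Q) % Q                ≡⟨ cong (λ z → (i + z) % Q) (m%[n*o]/o≡m/o%n x Q q′) ⟨
      (i + (x % q) / q′) % Q              ∎
      where open ≡-Reasoning

    seeds : ∀ K → List (Vec ℕ K)
    seeds = vecs (upTo q)

    shift : ∀ {K} → Vec ℕ K → Vec ℕ K → Vec ℕ K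
    shift = zipWith (λ d s → (s + d) % q)

    ∑-shift : ∀ {K} (d : Vec ℕ K) F → ∑ (seeds K) (F ∘ shift d) ≡ ∑ (seeds K) F
    ∑-shift []       F = refl
    ∑-shift {suc K} (d ∷ ds) F = begin
      ∑ (seeds (suc K)) (F ∘ shift (d ∷ ds))                                  ≡⟨ S.fold-vecs (upTo q) K ⟩
      ∑ (upTo q) (λ s → ∑ (seeds K) (λ ss → F ((s + d) % q ∷ shift ds ss)))   ≡⟨ S.fold-cong (upTo q) (λ s → ∑-shift ds (λ ss → F ((s + d) % q ∷ ss))) ⟩
      ∑ (upTo q) (λ s → ∑ (seeds K) (λ ss → F ((s + d) % q ∷ ss)))            ≡⟨ ∑-rotate q d (λ s → ∑ (seeds K) (λ ss → F (s ∷ ss))) ⟩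
      ∑ (upTo q) (λ s → ∑ (seeds K) (λ ss → F (s ∷ ss)))                      ≡⟨ S.fold-vecs (upTo q) K ⟨
      ∑ (seeds (suc K)) F                                                     ∎
      where open ≡-Reasoning

    evalPoly-shift : ∀ {K} (d s : Vec ℕ K) x → evalPoly (shift d s) x ≈ evalPoly s x + evalPoly d x
    evalPoly-shift []       []       x = refl
    evalPoly-shift (d ∷ ds) (s ∷ ss) x = trans (+-cong {(s + d) % q} {s + d} (m%n%n≡m%n (s + d) q) (*-cong {x} refl (evalPoly-shift ds ss x)))
      (cong (_% q) (lemma s d x (evalPoly ss x) (evalPoly ds x)))
      where
      lemma : ∀ s d x p r → s + d + x * (p + r) ≡ s + x * p + (d + x * r)
      lemma = solve-∀

    infixl 6 _[_≔_]
    _[_≔_] : (ℕ → ℕ) → ℕ → ℕ → ℕ → ℕ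
    (y [ a ≔ c ]) b = if does (b ℕ.≟ a) then c else y b

    resample : ∀ a bs (Φ : (ℕ → ℕ) → ℤ) → a < 2 ^ ℓ → All (_< 2 ^ ℓ) bs → a ∉ bs → length bs < K →
      (∀ y y′ → y a ≡ y′ a → (∀ {b} → b ∈ bs → y b ≡ y′ b) → Φ y ≡ Φ y′) →
      ℤ.+ Q ℤ.* ∑ (seeds K) (Φ ∘ hash) ≡ ∑ (seeds K) (λ s → ∑ (upTo Q) (λ c → Φ (hash s [ a ≔ c ])))
    resample a bs Φ a< bs< a∉ len local = begin
      ℤ.+ Q ℤ.* T                                                     ≡⟨ cong (λ z → ℤ.+ z ℤ.* T) (List.length-upTo Q) ⟨
      ℤ.+ length (upTo Q) ℤ.* T                                       ≡⟨ ∑-const (upTo Q) T ⟨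
      ∑ (upTo Q) (λ _ → T)                                          ≡⟨ S.fold-cong (upTo Q) (λ i → ∑-shift (Vec.map (i *_) d) (Φ ∘ hash)) ⟨
      ∑ (upTo Q) (λ i → ∑ (seeds K) (λ s → Φ (hash (shift (Vec.map (i *_) d) s))))  ≡⟨ S.fold-swap (upTo Q) (seeds K) _ ⟩
      ∑ (seeds K) (λ s → ∑ (upTo Q) (λ i → Φ (hash (shift (Vec.map (i *_) d) s))))  ≡⟨ S.fold-cong (seeds K) (λ s → trans
          (S.fold-cong (upTo Q) (moved s)) (∑-rotate Q (hash s a) (λ c → Φ (hash s [ a ≔ c ])))) ⟩
      ∑ (seeds K) (λ s → ∑ (upTo Q) (λ c → Φ (hash s [ a ≔ c ])))   ∎
      where
      open ≡-Reasoning
      T = ∑ (seeds K) (Φ ∘ hash)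
      mv = moving a bs a< bs< a∉ len
      d = proj₁ mv
      atOther : ∀ s i {b} → b ∈ bs → hash (shift (Vec.map (i *_) d) s) b ≡ hash s b
      atOther s i {b} b∈ = hash-≈ (trans (evalPoly-shift (Vec.map (i *_) d) s b)
        (trans (+-cong {evalPoly s b} refl (trans (cong (_% q) (evalPoly-scale i d b)) (trans (*-cong {i} refl (proj₂ (proj₂ mv) b∈)) (cong (_% q) (ℕ.*-zeroʳ i)))))
          (cong (_% q) (ℕ.+-identityʳ (evalPoly s b)))))
      atA : ∀ s i → hash (shift (Vec.map (i *_) d) s) a ≡ (i + hash s a) % Q
      atA s i = trans (hash-≈ (trans (evalPoly-shift (Vec.map (i *_) d) s a)
        (+-cong {evalPoly s a} refl (trans (cong (_% q) (evalPoly-scale i d a)) (*-cong {i} refl (proj₁ (proj₂ mv)))))))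
        (hash-move (evalPoly s a) i)
      moved : ∀ s i → Φ (hash (shift (Vec.map (i *_) d) s)) ≡ Φ (hash s [ a ≔ (i + hash s a) % Q ])
      moved s i = local _ _
        (trans (atA s i) (sym (cong (λ z → if z then (i + hash s a) % Q else hash s a) (dec-true (a ℕ.≟ a) refl))))
        (λ {b} b∈ → trans (atOther s i b∈) (sym (cong (λ z → if z then (i + hash s a) % Q else hash s b) (dec-false (b ℕ.≟ a) (λ { refl → a∉ b∈ })))))

module Codes where

  open Big
  open Hash
  open import Defs using (allSubsets; _≟ₛ_)
  open import Data.Bool.Base using (Bool; true; false; not; if_then_else_)
  open import Data.Fin.Base as Fin using (Fin; zero; suc)
  import Data.Fin.Properties as Fin
  open import Data.Fin.Subset using (Subset; inside; outside; ⁅_⁆) renaming (_∈_ to _∈ₛ_)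
  open import Data.Fin.Subset.Properties using (_∈?_; x∈⁅x⁆; x∈⁅y⁆⇒x≡y)
  open import Data.Integer.Base as ℤ using (ℤ; 0ℤ; 1ℤ; -1ℤ; -_) renaming (_+_ to _+ᶻ_; _*_ to _*ᶻ_)
  import Data.Integer.Properties as ℤ
  open import Data.Integer.Tactic.RingSolver using (solve-∀)
  open import Data.List.Base as List using (List; []; _∷_; _++_; map; filter; length; upTo; allFin; cartesianProduct)
  import Data.List.Properties as List
  open import Data.List.Membership.Propositional using (_∈_; _∉_)
  open import Data.List.Membership.Propositional.Properties
  open import Data.List.Relation.Unary.Any using (here; there)
  open import Data.List.Relation.Unary.All as All using (All; []; _∷_)
  open import Data.List.Relation.Unary.Unique.Propositional using (Unique; []; _∷_)
  import Data.List.Relation.Unary.Unique.Propositional.Properties as Unique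
  open import Data.Nat.Base as ℕ using (ℕ; zero; suc; _+_; _*_; _^_; _≤_; _<_; s≤s)
  import Data.Nat.Properties as ℕ
  open import Data.Product.Base using (∃-syntax; _×_; _,_; proj₂)
  open import Data.Sum.Base using (inj₁; inj₂)
  open import Data.Vec.Base as Vec using (Vec; []; _∷_; lookup; updateAt)
  import Data.Vec.Properties as Vec
  open import Function.Base using (_∘_)
  open import Relation.Binary.PropositionalEquality
  open import Relation.Nullary.Decidable using (yes; no; does; dec-true; dec-false)
  open import Relation.Nullary.Negation using (¬_)
  open ℤΣ

  private variable
    A B : Set

  nth : A → List A → ℕ → A
  nth d []       _       = d
  nth d (x ∷ xs) zero    = x
  nth d (x ∷ xs) (suc i) = nth d xs i

  ∑-nth : ∀ d (xs : List A) (g : A → ℤ) → ∑ (upTo (length xs)) (g ∘ nth d xs) ≡ ∑ xs g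
  ∑-nth d []       g = refl
  ∑-nth d (x ∷ xs) g = trans (∑-upTo-suc (length xs) (g ∘ nth d (x ∷ xs))) (cong (_+ᶻ_ (g x)) (∑-nth d xs g))

  length-× : ∀ (xs : List A) (ys : List B) → length (cartesianProduct xs ys) ≡ length xs * length ys
  length-× []       ys = refl
  length-× (x ∷ xs) ys = trans (List.length-++ (map (x ,_) ys)) (cong₂ _+_ (List.length-map (x ,_) ys) (length-× xs ys))

  length-allSubsets : ∀ n → length (allSubsets n) ≡ 2 ^ n
  length-allSubsets zero    = refl
  length-allSubsets (suc n) = trans (List.length-++ (map (inside ∷_) (allSubsets n)))
    (cong₂ _+_ (trans (List.length-map _ (allSubsets n)) (length-allSubsets n))
      (trans (trans (List.length-map _ (allSubsets n)) (length-allSubsets n)) (sym (ℕ.+-identityʳ _))))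

  ∑-allSubsets : ∀ n (g : Subset (suc n) → ℤ) → ∑ (allSubsets (suc n)) g ≡ ∑ (allSubsets n) (g ∘ (inside ∷_)) +ᶻ ∑ (allSubsets n) (g ∘ (outside ∷_))
  ∑-allSubsets n g = S.fold-allSubsets n

  flip : ∀ {k} → Fin k → Subset k → Subset k
  flip i B = updateAt B i not

  ∑-flip : ∀ k i (g : Subset k → ℤ) → ∑ (allSubsets k) (g ∘ flip i) ≡ ∑ (allSubsets k) g
  ∑-flip (suc k) zero    g = trans (∑-allSubsets k _) (trans (ℤ.+-comm (∑ (allSubsets k) _) _) (sym (∑-allSubsets k g)))
  ∑-flip (suc k) (suc i) g = trans (∑-allSubsets k _) (trans (cong₂ _+ᶻ_ (∑-flip k i _) (∑-flip k i _)) (sym (∑-allSubsets k g)))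

  x≡-x⇒x≡0 : ∀ {x : ℤ} → x ≡ - x → x ≡ 0ℤ
  x≡-x⇒x≡0 {ℤ.+ zero}    _ = refl
  x≡-x⇒x≡0 {ℤ.+ suc _}   ()
  x≡-x⇒x≡0 {ℤ.-[1+ _ ]}  ()

  neg-as-* : ∀ x → - x ≡ -1ℤ *ᶻ x
  neg-as-* x = sym (ℤ.-1*i≡-i x)

  ∑-neg : ∀ (xs : List A) (g : A → ℤ) → ∑ xs (λ x → - g x) ≡ - ∑ xs g
  ∑-neg xs g = trans (S.fold-cong xs (λ x → neg-as-* (g x))) (trans (∑-*ˡ xs -1ℤ g) (sym (neg-as-* (∑ xs g))))

  ∑-odd : ∀ k i j (g : Subset k → ℤ) → (∀ B → g (flip i (flip j B)) ≡ - g B) → ∑ (allSubsets k) g ≡ 0ℤ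
  ∑-odd k i j g odd = x≡-x⇒x≡0 (begin
    ∑ (allSubsets k) g                          ≡⟨ ∑-flip k i g ⟨
    ∑ (allSubsets k) (g ∘ flip i)               ≡⟨ ∑-flip k j (g ∘ flip i) ⟨
    ∑ (allSubsets k) (g ∘ flip i ∘ flip j)      ≡⟨ S.fold-cong (allSubsets k) odd ⟩
    ∑ (allSubsets k) (λ B → - g B)              ≡⟨ ∑-neg (allSubsets k) g ⟩
    - ∑ (allSubsets k) g                        ∎)
    where open ≡-Reasoning

  ∏-neg : ∀ N (p : Fin N) (f g : Fin N → ℤ) → g p ≡ - f p → (∀ r → r ≢ p → g r ≡ f r) → ∏ (allFin N) g ≡ - ∏ (allFin N) f
  ∏-neg N p f g gp gr = begin
    ∏ (allFin N) g                                                        ≡⟨ P.fold-isolate N p g ⟩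
    g p *ᶻ ∏ (allFin N) (λ r → if does (r Fin.≟ p) then 1ℤ else g r)      ≡⟨ cong₂ _*ᶻ_ gp (P.fold-cong (allFin N) other) ⟩
    - f p *ᶻ ∏ (allFin N) (λ r → if does (r Fin.≟ p) then 1ℤ else f r)    ≡⟨ ℤ.neg-distribˡ-* (f p) _ ⟨
    - (f p *ᶻ ∏ (allFin N) (λ r → if does (r Fin.≟ p) then 1ℤ else f r))  ≡⟨ cong -_ (P.fold-isolate N p f) ⟨
    - ∏ (allFin N) f                                                      ∎
    where
    open ≡-Reasoning
    other : ∀ r → (if does (r Fin.≟ p) then 1ℤ else g r) ≡ (if does (r Fin.≟ p) then 1ℤ else f r)
    other r with r Fin.≟ p
    ... | yes _  = refl
    ... | no r≢p = gr r r≢p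

  ∏-absorb : ∀ (us : List A) x (a b : A → ℤ) → (∀ {u} → u ∈ us → x *ᶻ a u ≡ 0ℤ) → x *ᶻ ∏ us (λ u → a u +ᶻ b u) ≡ x *ᶻ ∏ us b
  ∏-absorb []       x a b e = refl
  ∏-absorb (u ∷ us) x a b e = begin
    x *ᶻ ((a u +ᶻ b u) *ᶻ X)              ≡⟨ l₁ x (a u) (b u) X ⟩
    (x *ᶻ a u) *ᶻ X +ᶻ b u *ᶻ (x *ᶻ X)    ≡⟨ cong₂ (λ y z → y *ᶻ X +ᶻ b u *ᶻ z) (e (here refl)) (∏-absorb us x a b (e ∘ there)) ⟩
    0ℤ *ᶻ X +ᶻ b u *ᶻ (x *ᶻ ∏ us b)       ≡⟨ l₂ x (b u) X (∏ us b) ⟩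
    x *ᶻ (b u *ᶻ ∏ us b)                  ∎
    where
    open ≡-Reasoning
    X = ∏ us (λ u → a u +ᶻ b u)
    l₁ : ∀ x a b X → x *ᶻ ((a +ᶻ b) *ᶻ X) ≡ (x *ᶻ a) *ᶻ X +ᶻ b *ᶻ (x *ᶻ X)
    l₁ = solve-∀
    l₂ : ∀ x b X Y → 0ℤ *ᶻ X +ᶻ b *ᶻ (x *ᶻ Y) ≡ x *ᶻ (b *ᶻ Y)
    l₂ = solve-∀

  ∑-insert : ∀ (ws₁ : List A) {w ws₂} (g : A → ℤ) → ∑ (ws₁ ++ w ∷ ws₂) g ≡ g w +ᶻ ∑ (ws₁ ++ ws₂) g
  ∑-insert []        g = refl
  ∑-insert (v ∷ ws₁) {w} {ws₂} g = trans (cong (_+ᶻ_ (g v)) (∑-insert ws₁ g)) (l (g v) (g w) _)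
    where
    l : ∀ a b c → a +ᶻ (b +ᶻ c) ≡ b +ᶻ (a +ᶻ c)
    l = solve-∀

  ∏∑-pigeonhole : ∀ (us : List A) (ws : List B) (g : A → B → ℤ) → Unique us →
    (∀ w {u u′} → u ≢ u′ → g u w *ᶻ g u′ w ≡ 0ℤ) → length ws < length us → ∏ us (λ u → ∑ ws (g u)) ≡ 0ℤ
  ∏∑-pigeonhole (u ∷ us) ws g (u∉ ∷ uniq) excl (s≤s len) = begin
    ∑ ws (g u) *ᶻ X                ≡⟨ ∑-*ʳ ws X (g u) ⟨
    ∑ ws (λ w → g u w *ᶻ X)        ≡⟨ S.fold-cong∈ ws zeroTerm ⟩
    ∑ ws (λ _ → 0ℤ)                ≡⟨ S.fold-ε ws ⟩
    0ℤ                             ∎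
    where
    open ≡-Reasoning
    X = ∏ us (λ u′ → ∑ ws (g u′))
    zeroTerm : ∀ {w} → w ∈ ws → g u w *ᶻ X ≡ 0ℤ
    zeroTerm {w} w∈ with ws₁ , ws₂ , refl ← ∈-∃++ w∈ = begin
      g u w *ᶻ X                                                   ≡⟨ cong (_*ᶻ_ (g u w)) (P.fold-cong us (λ u′ → ∑-insert ws₁ (g u′))) ⟩
      g u w *ᶻ ∏ us (λ u′ → g u′ w +ᶻ ∑ (ws₁ ++ ws₂) (g u′))       ≡⟨ ∏-absorb us (g u w) (λ u′ → g u′ w) _ (λ u′∈ → excl w (All.lookup u∉ u′∈)) ⟩
      g u w *ᶻ ∏ us (λ u′ → ∑ (ws₁ ++ ws₂) (g u′))                 ≡⟨ cong (_*ᶻ_ (g u w)) (∏∑-pigeonhole us (ws₁ ++ ws₂) g uniq excl shorter) ⟩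
      g u w *ᶻ 0ℤ                                                  ≡⟨ ℤ.*-zeroʳ (g u w) ⟩
      0ℤ                                                           ∎
      where
      shorter : length (ws₁ ++ ws₂) < length us
      shorter = ℕ.≤-trans (ℕ.≤-reflexive (trans (cong suc (List.length-++ ws₁)) (trans (sym (ℕ.+-suc (length ws₁) (length ws₂))) (sym (List.length-++ ws₁))))) len

  ⁅⁆-injective : ∀ {n} {u v : Fin n} → ⁅ u ⁆ ≡ ⁅ v ⁆ → u ≡ v
  ⁅⁆-injective {u = u} eq = x∈⁅y⁆⇒x≡y _ (subst (u ∈ₛ_) eq (x∈⁅x⁆ u))

  members : ∀ {n} → Subset n → List (Fin n)
  members U = filter (_∈? U) (allFin _)

  members-unique : ∀ {n} (U : Subset n) → Unique (members U)
  members-unique {n} U = Unique.filter⁺ (_∈? U) (Unique.allFin⁺ n)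

  ∈-members⁻ : ∀ {n} {U : Subset n} {w} → w ∈ members U → w ∈ₛ U
  ∈-members⁻ {U = U} w∈ = proj₂ (∈-filter⁻ (_∈? U) {xs = allFin _} w∈)

  ∈-members⁺ : ∀ {n} {U : Subset n} {w} → w ∈ₛ U → w ∈ members U
  ∈-members⁺ {U = U} {w} w∈ = ∈-filter⁺ (_∈? U) (∈-allFin w) w∈

  -- The table of a hypergraph with edges D: a code (A , B) carries a colour, u if
  -- A = ⁅ u ⁆, and one sign for every edge.
  module Table {h k : ℕ} (D : Fin k → Subset h) where

    Code : Set
    Code = Subset h × Subset k

    codes : List Code
    codes = cartesianProduct (allSubsets h) (allSubsets k)

    length-codes : length codes ≡ 2 ^ (h + k)
    length-codes = trans (length-× (allSubsets h) (allSubsets k)) (trans (cong₂ _*_ (length-allSubsets h) (length-allSubsets k)) (sym (ℕ.^-distribˡ-+-* 2 h k)))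

    code : ℕ → Code
    code = nth (Vec.replicate h outside , Vec.replicate k outside) codes

    ∑-code : ∀ (g : Code → ℤ) → ∑ (upTo (2 ^ (h + k))) (g ∘ code) ≡ ∑ codes g
    ∑-code g = trans (cong (λ z → ∑ (upTo z) (g ∘ code)) (sym length-codes)) (∑-nth _ codes g)

    sgn : Bool → ℤ
    sgn true  = -1ℤ
    sgn false = 1ℤ

    sgn-not : ∀ b → sgn (not b) ≡ - sgn b
    sgn-not true  = refl
    sgn-not false = refl

    parity : Fin h → Subset k → ℤ
    parity u B = ∏ (allFin k) (λ j → if does (u ∈? D j) then sgn (lookup B j) else 1ℤ)

    -- Restricting the signs at u to those of product 1 makes the product of the
    -- factors of u over a set of edges at u have mean 0 unless the set is empty
    -- or contains every edge at u.
    factor : Fin h → Fin k → Code → ℤ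
    factor u i (A , B) = ⟦ A ≟ₛ ⁅ u ⁆ ⟧ *ᶻ (⟦ parity u B ℤ.≟ 1ℤ ⟧ *ᶻ sgn (lookup B i))

    factor-colour : ∀ u i {A} B → A ≢ ⁅ u ⁆ → factor u i (A , B) ≡ 0ℤ
    factor-colour u i {A} B A≢ = cong (_*ᶻ (⟦ parity u B ℤ.≟ 1ℤ ⟧ *ᶻ sgn (lookup B i))) (⟦no⟧ (A ≟ₛ ⁅ u ⁆) A≢)

    factor-exclusive : ∀ {u u′} i i′ c → u ≢ u′ → factor u i c *ᶻ factor u′ i′ c ≡ 0ℤ
    factor-exclusive {u} {u′} i i′ (A , B) u≢u′ with A ≟ₛ ⁅ u ⁆
    ... | no _     = refl
    ... | yes refl = trans (cong (_*ᶻ_ (1ℤ *ᶻ (⟦ parity u B ℤ.≟ 1ℤ ⟧ *ᶻ sgn (lookup B i)))) (factor-colour u′ i′ B (u≢u′ ∘ ⁅⁆-injective))) (ℤ.*-zeroʳ (1ℤ *ᶻ (⟦ parity u B ℤ.≟ 1ℤ ⟧ *ᶻ sgn (lookup B i))))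

    parity-flip : ∀ {u i} B → u ∈ₛ D i → parity u (flip i B) ≡ - parity u B
    parity-flip {u} {i} B u∈ = ∏-neg k i _ _ at other
      where
      at : (if does (u ∈? D i) then sgn (lookup (flip i B) i) else 1ℤ) ≡ - (if does (u ∈? D i) then sgn (lookup B i) else 1ℤ)
      at rewrite dec-true (u ∈? D i) u∈ = trans (cong sgn (Vec.lookup∘updateAt i B)) (sgn-not (lookup B i))
      other : ∀ j → j ≢ i → (if does (u ∈? D j) then sgn (lookup (flip i B) j) else 1ℤ) ≡ (if does (u ∈? D j) then sgn (lookup B j) else 1ℤ)
      other j j≢i = cong (λ b → if does (u ∈? D j) then sgn b else 1ℤ) (Vec.lookup∘updateAt′ j i j≢i B)

    parity-flip₂ : ∀ {u i j} B → u ∈ₛ D i → u ∈ₛ D j → parity u (flip i (flip j B)) ≡ parity u B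
    parity-flip₂ {u} {i} {j} B u∈i u∈j = trans (parity-flip (flip j B) u∈i) (trans (cong -_ (parity-flip B u∈j)) (ℤ.neg-involutive (parity u B)))

    factor-flip : ∀ {u i j} A B → i ≢ j → u ∈ₛ D i → u ∈ₛ D j → factor u i (A , flip i (flip j B)) ≡ - factor u i (A , B)
    factor-flip {u} {i} {j} A B i≢j u∈i u∈j rewrite parity-flip₂ B u∈i u∈j | Vec.lookup∘updateAt i {f = not} (flip j B) | Vec.lookup∘updateAt′ i j {f = not} i≢j B | sgn-not (lookup B i) =
      l ⟦ A ≟ₛ ⁅ u ⁆ ⟧ ⟦ parity u B ℤ.≟ 1ℤ ⟧ (sgn (lookup B i))
      where
      l : ∀ a b c → a *ᶻ (b *ᶻ (- c)) ≡ - (a *ᶻ (b *ᶻ c))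
      l = solve-∀

    factor-flip-other : ∀ {u i j l} A B → l ≢ i → l ≢ j → u ∈ₛ D i → u ∈ₛ D j → factor u l (A , flip i (flip j B)) ≡ factor u l (A , B)
    factor-flip-other {u} {i} {j} {l} A B l≢i l≢j u∈i u∈j rewrite parity-flip₂ B u∈i u∈j | Vec.lookup∘updateAt′ l i {f = not} l≢i (flip j B) | Vec.lookup∘updateAt′ l j {f = not} l≢j B = refl

    ∑-codes : ∀ (g : Code → ℤ) → ∑ codes g ≡ ∑ (allSubsets h) (λ A → ∑ (allSubsets k) (λ B → g (A , B)))
    ∑-codes g = S.fold-pairs (allSubsets h) (allSubsets k)

    factor-mean : ∀ {u i j} → i ≢ j → u ∈ₛ D i → u ∈ₛ D j → ∑ codes (factor u i) ≡ 0ℤ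
    factor-mean {u} {i} {j} i≢j u∈i u∈j = trans (∑-codes (factor u i)) (trans
      (S.fold-cong (allSubsets h) (λ A → ∑-odd k i j (λ B → factor u i (A , B)) (λ B → factor-flip A B i≢j u∈i u∈j)))
      (S.fold-ε (allSubsets h)))

    star : Fin h → Code → ℤ
    star u c = ∏ (allFin k) (λ i → if does (u ∈? D i) then factor u i c else 1ℤ)

    κ : ℤ
    κ = ∏ (allFin h) (λ u → ∑ codes (star u))

    -- The contribution of an edge with vertices ws to the i-th counter.
    weight : ∀ {n} → Fin k → List (Fin n) → (Fin n → Code) → ℤ
    weight i ws y = ∏ (members (D i)) (λ u → ∑ ws (λ w → factor u i (y w)))

    ∑∏-linear : ∀ i (us : List (Fin h)) (R : Fin h → ℤ) → Unique us → (∀ {u} → u ∈ us → ∑ codes (factor u i) ≡ 0ℤ) →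
      ∑ codes (λ c → ∏ us (λ u → factor u i c +ᶻ R u)) ≡ ∑ codes (λ _ → ∏ us R)
    ∑∏-linear i []       R _ _ = refl
    ∑∏-linear i (u ∷ us) R (u∉ ∷ uniq) mean = begin
      ∑ codes (λ c → (factor u i c +ᶻ R u) *ᶻ X c)                          ≡⟨ S.fold-cong codes (λ c → ℤ.*-distribʳ-+ (X c) (factor u i c) (R u)) ⟩
      ∑ codes (λ c → factor u i c *ᶻ X c +ᶻ R u *ᶻ X c)                     ≡⟨ S.fold-∙ codes _ _ ⟩
      ∑ codes (λ c → factor u i c *ᶻ X c) +ᶻ ∑ codes (λ c → R u *ᶻ X c)     ≡⟨ cong₂ _+ᶻ_
          (S.fold-cong codes (λ c → ∏-absorb us (factor u i c) (λ u′ → factor u′ i c) R (λ u′∈ → factor-exclusive i i c (All.lookup u∉ u′∈))))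
          (∑-*ˡ codes (R u) X) ⟩
      ∑ codes (λ c → factor u i c *ᶻ ∏ us R) +ᶻ R u *ᶻ ∑ codes X            ≡⟨ cong₂ (λ a b → a +ᶻ R u *ᶻ b) (∑-*ʳ codes (∏ us R) (factor u i)) (∑∏-linear i us R uniq (mean ∘ there)) ⟩
      ∑ codes (factor u i) *ᶻ ∏ us R +ᶻ R u *ᶻ ∑ codes (λ _ → ∏ us R)       ≡⟨ cong₂ (λ a b → a *ᶻ ∏ us R +ᶻ b) (mean (here refl)) (sym (∑-*ˡ codes (R u) (λ _ → ∏ us R))) ⟩
      0ℤ +ᶻ ∑ codes (λ _ → R u *ᶻ ∏ us R)                                   ≡⟨ ℤ.+-identityˡ _ ⟩
      ∑ codes (λ _ → R u *ᶻ ∏ us R)                                         ∎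
      where
      open ≡-Reasoning
      X : Code → ℤ
      X c = ∏ us (λ u → factor u i c +ᶻ R u)

    infixl 6 _[_≔_]
    _[_≔_] : ∀ {n} → (Fin n → Code) → Fin n → Code → Fin n → Code
    (y [ a ≔ c ]) b = if does (b Fin.≟ a) then c else y b

    ≔-same : ∀ {n} (y : Fin n → Code) a c → (y [ a ≔ c ]) a ≡ c
    ≔-same y a c = cong (λ z → if z then c else y a) (dec-true (a Fin.≟ a) refl)

    ≔-other : ∀ {n} (y : Fin n → Code) {a b} c → b ≢ a → (y [ a ≔ c ]) b ≡ y b
    ≔-other y {a} {b} c b≢a = cong (λ z → if z then c else y b) (dec-false (b Fin.≟ a) b≢a)

    weight-local : ∀ {n} i (ws : List (Fin n)) {y y′} → (∀ {w} → w ∈ ws → y w ≡ y′ w) → weight i ws y ≡ weight i ws y′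
    weight-local i ws e = P.fold-cong (members (D i)) (λ u → S.fold-cong∈ ws (λ w∈ → cong (factor u i) (e w∈)))

    EveryDegree≥2 : Set
    EveryDegree≥2 = ∀ {u i} → u ∈ₛ D i → ∃[ j ] i ≢ j × u ∈ₛ D j

    module _ (2≤deg : EveryDegree≥2) where

      weight-mean : ∀ {n} i (ws : List (Fin n)) y {a} → Unique ws → a ∈ ws → length ws ≤ length (members (D i)) →
        ∑ codes (λ c → weight i ws (y [ a ≔ c ])) ≡ 0ℤ
      weight-mean i ws y {a} uniq a∈ len with ws₁ , ws₂ , refl ← ∈-∃++ a∈ = begin
        ∑ codes (λ c → weight i (ws₁ ++ a ∷ ws₂) (y [ a ≔ c ]))
          ≡⟨ S.fold-cong codes (λ c → P.fold-cong us (λ u → trans (∑-insert ws₁ _) (cong₂ _+ᶻ_ (cong (factor u i) (≔-same y a c))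
               (S.fold-cong∈ (ws₁ ++ ws₂) (λ {w} w∈ → cong (factor u i) (≔-other y c (λ { refl → a∉ w∈ }))))))) ⟩
        ∑ codes (λ c → ∏ us (λ u → factor u i c +ᶻ R u))
          ≡⟨ ∑∏-linear i us R (members-unique (D i)) (λ u∈ → let j , i≢j , u∈j = 2≤deg (∈-members⁻ u∈) in factor-mean i≢j (∈-members⁻ u∈) u∈j) ⟩
        ∑ codes (λ _ → ∏ us R)
          ≡⟨ S.fold-cong codes (λ _ → ∏∑-pigeonhole us (ws₁ ++ ws₂) (λ u w → factor u i (y w)) (members-unique (D i)) (λ w → factor-exclusive i i (y w)) shorter) ⟩
        ∑ codes (λ _ → 0ℤ)
          ≡⟨ S.fold-ε codes ⟩
        0ℤ ∎
        where
        open ≡-Reasoning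
        us = members (D i)
        R : Fin h → ℤ
        R u = ∑ (ws₁ ++ ws₂) (λ w → factor u i (y w))
        shorter : length (ws₁ ++ ws₂) < length us
        shorter = ℕ.≤-trans (ℕ.≤-reflexive (trans (cong suc (List.length-++ ws₁)) (trans (sym (ℕ.+-suc (length ws₁) (length ws₂))) (sym (List.length-++ ws₁))))) len
        a∉ : a ∉ ws₁ ++ ws₂
        a∉ m with ∈-++⁻ ws₁ m
        ... | inj₁ m₁ = notLeft ws₁ uniq m₁
          where
          notLeft : ∀ ws₁ → Unique (ws₁ ++ a ∷ ws₂) → a ∉ ws₁
          notLeft (x ∷ xs) (x∉ ∷ _)    (here refl) = All.lookup x∉ (∈-++⁺ʳ xs (here refl)) refl
          notLeft (x ∷ xs) (_ ∷ uniq′) (there m)   = notLeft xs uniq′ m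
        ... | inj₂ m₂ = notRight ws₁ uniq
          where
          notRight : ∀ ws₁ → ¬ Unique (ws₁ ++ a ∷ ws₂)
          notRight []       (a∉ws₂ ∷ _) = All.lookup a∉ws₂ m₂ refl
          notRight (x ∷ xs) (_ ∷ uniq′) = notRight xs uniq′

module Enum where

  open Big
  open import Defs using (allSubsets; _≟ₛ_)
  open import Data.Bool.Base using (true; false; if_then_else_)
  open import Data.Fin.Base as Fin using (Fin; zero; suc)
  import Data.Fin.Properties as Fin
  open import Data.Fin.Subset using (inside; outside)
  open import Data.Integer.Base as ℤ using (ℤ; 0ℤ) renaming (_+_ to _+ᶻ_; _*_ to _*ᶻ_)
  import Data.Integer.Properties as ℤ
  open import Data.List.Base using (List; []; _∷_; allFin)
  open import Data.Nat.Base using (zero; suc)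
  open import Data.Product.Base using (∃-syntax; _×_; _,_)
  open import Data.Sum.Base using (_⊎_; inj₁; inj₂)
  open import Data.Vec.Base as Vec using (Vec; []; _∷_)
  import Data.Vec.Properties as Vec
  open import Function.Base using (_∘_)
  open import Relation.Binary.Definitions using (DecidableEquality)
  open import Relation.Binary.PropositionalEquality
  open import Relation.Nullary.Decidable using (Dec; yes; no; does)
  open ℤΣ
  open Codes using (∑-allSubsets)

  private variable
    A B : Set

  Enumerates : List A → DecidableEquality A → Set
  Enumerates {A} xs _≟_ = ∀ x₀ (g : A → ℤ) → ∑ xs (λ x → ⟦ x ≟ x₀ ⟧ *ᶻ g x) ≡ g x₀

  enumerates-allFin : ∀ n → Enumerates (allFin n) Fin._≟_
  enumerates-allFin n x₀ g = trans (S.fold-isolate n x₀ _) (trans (cong₂ _+ᶻ_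
    (trans (cong (_*ᶻ g x₀) (⟦yes⟧ (x₀ Fin.≟ x₀) refl)) (ℤ.*-identityˡ (g x₀)))
    (trans (S.fold-cong (allFin n) other) (S.fold-ε (allFin n)))) (ℤ.+-identityʳ (g x₀)))
    where
    other : ∀ r → (if does (r Fin.≟ x₀) then 0ℤ else (⟦ r Fin.≟ x₀ ⟧ *ᶻ g r)) ≡ 0ℤ
    other r with r Fin.≟ x₀
    ... | yes _ = refl
    ... | no  _ = refl

  ⟦×⟧ : ∀ {P Q R : Set} (d : Dec R) (e : Dec P) (f : Dec Q) → (R → P × Q) → (P → Q → R) → ⟦ d ⟧ ≡ ⟦ e ⟧ *ᶻ ⟦ f ⟧
  ⟦×⟧ d (no ¬p) f to from = ⟦no⟧ d (λ r → let p , _ = to r in ¬p p)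
  ⟦×⟧ d (yes p) (no ¬q) to from = ⟦no⟧ d (λ r → let _ , q = to r in ¬q q)
  ⟦×⟧ d (yes p) (yes q) to from = ⟦yes⟧ d (from p q)

  enumerates-vecs : ∀ {xs : List A} {_≟_ : DecidableEquality A} → Enumerates xs _≟_ → ∀ N → Enumerates (vecs xs N) (Vec.≡-dec _≟_)
  enumerates-vecs en zero    []       g = trans (ℤ.+-identityʳ _) (ℤ.*-identityˡ (g []))
  enumerates-vecs {xs = xs} {_≟_} en (suc N) (x₀ ∷ v₀) g = begin
    ∑ (vecs xs (suc N)) (λ w → ⟦ Vec.≡-dec _≟_ w (x₀ ∷ v₀) ⟧ *ᶻ g w)
      ≡⟨ S.fold-vecs xs N ⟩
    ∑ xs (λ x → ∑ (vecs xs N) (λ v → ⟦ Vec.≡-dec _≟_ (x ∷ v) (x₀ ∷ v₀) ⟧ *ᶻ g (x ∷ v)))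
      ≡⟨ S.fold-cong xs (λ x → trans (S.fold-cong (vecs xs N) (λ v → trans
           (cong (_*ᶻ g (x ∷ v)) (⟦×⟧ (Vec.≡-dec _≟_ (x ∷ v) (x₀ ∷ v₀)) (x ≟ x₀) (Vec.≡-dec _≟_ v v₀) (λ { refl → refl , refl }) (λ { refl refl → refl })))
           (ℤ.*-assoc ⟦ x ≟ x₀ ⟧ ⟦ Vec.≡-dec _≟_ v v₀ ⟧ (g (x ∷ v))))) (∑-*ˡ (vecs xs N) ⟦ x ≟ x₀ ⟧ _)) ⟩
    ∑ xs (λ x → ⟦ x ≟ x₀ ⟧ *ᶻ ∑ (vecs xs N) (λ v → ⟦ Vec.≡-dec _≟_ v v₀ ⟧ *ᶻ g (x ∷ v)))
      ≡⟨ en x₀ _ ⟩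
    ∑ (vecs xs N) (λ v → ⟦ Vec.≡-dec _≟_ v v₀ ⟧ *ᶻ g (x₀ ∷ v))
      ≡⟨ enumerates-vecs {_≟_ = _≟_} en N v₀ (g ∘ (x₀ ∷_)) ⟩
    g (x₀ ∷ v₀) ∎
    where open ≡-Reasoning

  enumerates-allSubsets : ∀ n → Enumerates (allSubsets n) _≟ₛ_
  enumerates-allSubsets zero    []       g = trans (ℤ.+-identityʳ _) (ℤ.*-identityˡ (g []))
  enumerates-allSubsets (suc n) (b ∷ v) g = trans (∑-allSubsets n _) (split b)
    where
    match : ∀ b → ∑ (allSubsets n) (λ w → ⟦ (b ∷ w) ≟ₛ (b ∷ v) ⟧ *ᶻ g (b ∷ w)) ≡ g (b ∷ v)
    match b = trans (S.fold-cong (allSubsets n) (λ w → cong (_*ᶻ g (b ∷ w)) (⟦⇔⟧ ((b ∷ w) ≟ₛ (b ∷ v)) (w ≟ₛ v) (λ { refl → refl }) (λ { refl → refl }))))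
      (enumerates-allSubsets n v (g ∘ (b ∷_)))
    mismatch : ∀ c b → c ≢ b → ∑ (allSubsets n) (λ w → ⟦ (c ∷ w) ≟ₛ (b ∷ v) ⟧ *ᶻ g (c ∷ w)) ≡ 0ℤ
    mismatch c b c≢b = trans (S.fold-cong (allSubsets n) (λ w → cong (_*ᶻ g (c ∷ w)) (⟦no⟧ ((c ∷ w) ≟ₛ (b ∷ v)) (λ { refl → c≢b refl })))) (S.fold-ε (allSubsets n))
    split : ∀ b → ∑ (allSubsets n) (λ w → ⟦ (inside ∷ w) ≟ₛ (b ∷ v) ⟧ *ᶻ g (inside ∷ w)) +ᶻ ∑ (allSubsets n) (λ w → ⟦ (outside ∷ w) ≟ₛ (b ∷ v) ⟧ *ᶻ g (outside ∷ w)) ≡ g (b ∷ v)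
    split true  = trans (cong₂ _+ᶻ_ (match true) (mismatch false true λ ())) (ℤ.+-identityʳ _)
    split false = trans (cong₂ _+ᶻ_ (mismatch true false λ ()) (match false)) (ℤ.+-identityˡ _)

  reindex : ∀ (xs : List A) (ys : List B) (_≟ᴬ_ : DecidableEquality A) (_≟ᴮ_ : DecidableEquality B) →
    Enumerates xs _≟ᴬ_ → Enumerates ys _≟ᴮ_ → (T : A → B) → (∀ {x x′} → T x ≡ T x′ → x ≡ x′) →
    ∀ g → (∀ y → g y ≡ 0ℤ ⊎ ∃[ x ] T x ≡ y) → ∑ ys g ≡ ∑ xs (g ∘ T)
  reindex xs ys _≟ᴬ_ _≟ᴮ_ enˣ enʸ T inj g supp = begin
    ∑ ys g                                            ≡⟨ S.fold-cong ys spread ⟩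
    ∑ ys (λ y → ∑ xs (λ x → ⟦ y ≟ᴮ T x ⟧ *ᶻ g y))     ≡⟨ S.fold-swap ys xs _ ⟩
    ∑ xs (λ x → ∑ ys (λ y → ⟦ y ≟ᴮ T x ⟧ *ᶻ g y))     ≡⟨ S.fold-cong xs (λ x → enʸ (T x) g) ⟩
    ∑ xs (g ∘ T)                                      ∎
    where
    open ≡-Reasoning
    spread : ∀ y → g y ≡ ∑ xs (λ x → ⟦ y ≟ᴮ T x ⟧ *ᶻ g y)
    spread y with supp y
    ... | inj₁ g≡0 = sym (trans (S.fold-cong xs (λ x → trans (cong (⟦ y ≟ᴮ T x ⟧ *ᶻ_) g≡0) (ℤ.*-zeroʳ ⟦ y ≟ᴮ T x ⟧))) (trans (S.fold-ε xs) (sym g≡0)))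
    ... | inj₂ (x₀ , refl) = sym (trans (S.fold-cong xs (λ x → cong (_*ᶻ g (T x₀)) (⟦⇔⟧ (T x₀ ≟ᴮ T x) (x ≟ᴬ x₀) (sym ∘ inj) (cong T ∘ sym)))) (enˣ x₀ (λ _ → g (T x₀))))

module Moments where

  open Big
  open Hash
  open Codes
  open Enum
  open import Defs using (allSubsets; _≟ₛ_)
  open import Data.Bool.Base using (true; false; if_then_else_)
  open import Data.Fin.Base as Fin using (Fin; zero; suc; toℕ)
  import Data.Fin.Properties as Fin
  open import Data.Fin.Subset using (Subset; ⁅_⁆) renaming (_∈_ to _∈ₛ_; _∉_ to _∉ₛ_)
  open import Data.Fin.Subset.Properties using (_∈?_)
  open import Data.Integer.Base as ℤ using (ℤ; 0ℤ; 1ℤ; -_) renaming (_*_ to _*ᶻ_)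
  import Data.Integer.Properties as ℤ
  open import Data.Integer.Tactic.RingSolver using (solve-∀)
  open import Data.List.Base as List using (List; []; _∷_; map; filter; length; upTo; allFin; cartesianProduct; concatMap)
  import Data.List.Properties as List
  open import Data.List.Membership.Propositional using (_∈_; _∉_)
  open import Data.List.Membership.Propositional.Properties
  open import Data.List.Relation.Unary.Any as Any using (index)
  open import Data.List.Relation.Unary.Any.Properties using (lookup-index)
  open import Data.List.Relation.Unary.All as All using (All; []; _∷_)
  import Data.List.Relation.Unary.All.Properties as All
  open import Data.List.Relation.Unary.Unique.Propositional using (Unique; []; _∷_)
  import Data.List.Relation.Unary.Unique.Propositional.Properties as Unique
  open import Data.Nat.Base as ℕ using (ℕ; zero; suc; _+_; _*_; _^_; _≤_; _<_)
  import Data.Nat.Properties as ℕ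
  open import Data.Product.Base using (∃-syntax; Σ-syntax; _×_; _,_; proj₁; proj₂)
  open import Data.Sum.Base using (_⊎_; inj₁; inj₂)
  open import Data.Vec.Base as Vec using (Vec; []; _∷_; lookup; tabulate)
  import Data.Vec.Properties as Vec
  import Data.Vec.Membership.Propositional.Properties as VecMem
  open VecMem using (∈-toList⁺)
  open import Function.Base using (_∘_; id)
  open import Relation.Binary.PropositionalEquality
  open import Relation.Nullary.Decidable using (Dec; yes; no; does; dec-true; dec-false; ¬?; _→-dec_)
  open import Relation.Nullary.Negation using (¬_; contradiction)
  open ℤΣ

  private variable
    A : Set

  ∏-pair-zero : ∀ N (p r : Fin N) (f : Fin N → ℤ) → p ≢ r → f p *ᶻ f r ≡ 0ℤ → ∏ (allFin N) f ≡ 0ℤ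
  ∏-pair-zero N p r f p≢r e = begin
    ∏ (allFin N) f                                                 ≡⟨ P.fold-isolate N p f ⟩
    f p *ᶻ ∏ (allFin N) f′                                         ≡⟨ cong (f p *ᶻ_) (P.fold-isolate N r f′) ⟩
    f p *ᶻ (f′ r *ᶻ X)                                             ≡⟨ cong (λ z → f p *ᶻ ((if z then 1ℤ else f r) *ᶻ X)) (dec-false (r Fin.≟ p) (p≢r ∘ sym)) ⟩
    f p *ᶻ (f r *ᶻ X)                                              ≡⟨ ℤ.*-assoc (f p) (f r) X ⟨
    f p *ᶻ f r *ᶻ X                                                ≡⟨ cong (_*ᶻ X) e ⟩
    0ℤ *ᶻ X                                                        ≡⟨ ℤ.*-zeroˡ X ⟩
    0ℤ                                                             ∎
    where
    open ≡-Reasoning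
    f′ : Fin N → ℤ
    f′ s = if does (s Fin.≟ p) then 1ℤ else f s
    X = ∏ (allFin N) (λ s → if does (s Fin.≟ r) then 1ℤ else f′ s)

  lookup-unique : ∀ {xs : List A} → Unique xs → ∀ {i j} → List.lookup xs i ≡ List.lookup xs j → i ≡ j
  lookup-unique (x∉ ∷ u) {zero}  {zero}  e = refl
  lookup-unique {xs = _ ∷ xs} (x∉ ∷ u) {zero}  {suc j} e = contradiction e (All.lookup x∉ (∈-lookup {xs = xs} j))
  lookup-unique {xs = _ ∷ xs} (x∉ ∷ u) {suc i} {zero}  e = contradiction (sym e) (All.lookup x∉ (∈-lookup {xs = xs} i))
  lookup-unique (x∉ ∷ u) {suc i} {suc j} e = cong suc (lookup-unique u e)

  Injective : ∀ {h n} → Vec (Fin n) h → Set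
  Injective φ = ∀ u v → lookup φ u ≡ lookup φ v → u ≡ v

  injective? : ∀ {h n} (φ : Vec (Fin n) h) → Dec (Injective φ)
  injective? φ = Fin.all? λ u → Fin.all? λ v → lookup φ u Fin.≟ lookup φ v →-dec u Fin.≟ v

  module Hashed {h k : ℕ} (D : Fin k → Subset h) {n : ℕ} (ℓ K e : ℕ) (n≤2^ℓ : n ≤ 2 ^ ℓ) where
    open Table D
    open Poly (h + k) ℓ K e hiding (_[_≔_]; resample) public
    private module Pl = Poly (h + k) ℓ K e

    colours : Vec ℕ K → Fin n → Code
    colours s v = code (hash s (toℕ v))

    E : ((Fin n → Code) → ℤ) → ℤ
    E Φ = ∑ (seeds K) (Φ ∘ colours)

    Local : List (Fin n) → ((Fin n → Code) → ℤ) → Set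
    Local L Φ = ∀ {y y′} → (∀ {b} → b ∈ L → y b ≡ y′ b) → Φ y ≡ Φ y′

    resample : ∀ a L Φ → Local L Φ → length L < K → ℤ.+ Q *ᶻ E Φ ≡ ∑ (seeds K) (λ s → ∑ codes (λ c → Φ (colours s [ a ≔ c ])))
    resample a L Φ local len = trans
      (Pl.resample (toℕ a) bs (λ y → Φ (code ∘ y ∘ toℕ)) (small a) bs< a∉bs bs-length
        (λ y y′ ya yb → local (agree y y′ ya yb)))
      (S.fold-cong (seeds K) (λ s → trans
        (S.fold-cong (upTo Q) (λ c → local (λ {b} _ → pointwise s c b)))
        (∑-code (λ c → Φ (colours s [ a ≔ c ])))))
      where
      rest = filter (λ b → ¬? (b Fin.≟ a)) L
      bs = map toℕ rest
      small : ∀ v → toℕ v < 2 ^ ℓ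
      small v = ℕ.<-≤-trans (Fin.toℕ<n v) n≤2^ℓ
      bs< : All (_< 2 ^ ℓ) bs
      bs< = All.map⁺ (All.universal small rest)
      a∉bs : toℕ a ∉ bs
      a∉bs m with b , b∈ , eq ← ∈-map⁻ toℕ m = proj₂ (∈-filter⁻ (λ b → ¬? (b Fin.≟ a)) {xs = L} b∈) (sym (Fin.toℕ-injective eq))
      bs-length : length bs < K
      bs-length = ℕ.≤-<-trans (ℕ.≤-trans (ℕ.≤-reflexive (List.length-map toℕ rest)) (List.length-filter _ L)) len
      agree : ∀ y y′ → y (toℕ a) ≡ y′ (toℕ a) → (∀ {b} → b ∈ bs → y b ≡ y′ b) → ∀ {b} → b ∈ L → code (y (toℕ b)) ≡ code (y′ (toℕ b))
      agree y y′ ya yb {b} b∈ with b Fin.≟ a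
      ... | yes refl = cong code ya
      ... | no b≢a   = cong code (yb (∈-map⁺ toℕ (∈-filter⁺ (λ b → ¬? (b Fin.≟ a)) b∈ b≢a)))
      pointwise : ∀ s c b → code ((hash s Pl.[ toℕ a ≔ c ]) (toℕ b)) ≡ (colours s [ a ≔ code c ]) b
      pointwise s c b with b Fin.≟ a
      ... | yes refl rewrite dec-true (toℕ b ℕ.≟ toℕ b) refl = refl
      ... | no b≢a rewrite dec-false (toℕ b ℕ.≟ toℕ a) (b≢a ∘ Fin.toℕ-injective) = refl

    resample-zero : ∀ a L Φ → Local L Φ → length L < K → (∀ y → ∑ codes (λ c → Φ (y [ a ≔ c ])) ≡ 0ℤ) → E Φ ≡ 0ℤ
    resample-zero a L Φ local len z = ℤ.*-cancelˡ-≡ (ℤ.+ Q) (E Φ) 0ℤ {{Q≢0}}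
      (trans (resample a L Φ local len) (trans (S.fold-cong (seeds K) (λ s → z (colours s))) (trans (S.fold-ε (seeds K)) (sym (ℤ.*-zeroʳ (ℤ.+ Q))))))

    E-cong : ∀ {Φ Ψ} → (∀ y → Φ y ≡ Ψ y) → E Φ ≡ E Ψ
    E-cong eq = S.fold-cong (seeds K) (λ s → eq (colours s))

    E-∑ : ∀ {A : Set} (xs : List A) (Φ : A → (Fin n → Code) → ℤ) → E (λ y → ∑ xs (λ x → Φ x y)) ≡ ∑ xs (λ x → E (Φ x))
    E-∑ xs Φ = S.fold-swap (seeds K) xs (λ s x → Φ x (colours s))

    E-* : ∀ c Φ → E (λ y → c *ᶻ Φ y) ≡ c *ᶻ E Φ
    E-* c Φ = ∑-*ˡ (seeds K) c (Φ ∘ colours)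

    -- An edge with a vertex of its own contributes nothing on average.
    weights-mean : EveryDegree≥2 → ∀ r (e : Fin r → Fin k) (U : Fin r → Subset n) p a →
      a ∈ₛ U p → (∀ p′ → p′ ≢ p → a ∉ₛ U p′) → length (members (U p)) ≤ length (members (D (e p))) →
      length (concatMap (members ∘ U) (allFin r)) < K →
      E (λ y → ∏ (allFin r) (λ p → weight (e p) (members (U p)) y)) ≡ 0ℤ
    weights-mean 2≤deg r e U p a a∈ a∉ len short = resample-zero a L Φ local short zeroSum
      where
      L = concatMap (members ∘ U) (allFin r)
      Φ : (Fin n → Code) → ℤ
      Φ y = ∏ (allFin r) (λ p → weight (e p) (members (U p)) y)
      local : Local L Φ
      local eq = P.fold-cong (allFin r) (λ p → weight-local (e p) (members (U p)) (λ w∈ → eq (∈-concatMap⁺ (members ∘ U) (Any.map (λ { refl → w∈ }) (∈-allFin p)))))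
      rest : (Fin n → Code) → ℤ
      rest y = ∏ (allFin r) (λ s → if does (s Fin.≟ p) then 1ℤ else weight (e s) (members (U s)) y)
      rest-const : ∀ y c → rest (y [ a ≔ c ]) ≡ rest y
      rest-const y c = P.fold-cong (allFin r) at
        where
        at : ∀ s → (if does (s Fin.≟ p) then 1ℤ else weight (e s) (members (U s)) (y [ a ≔ c ])) ≡ (if does (s Fin.≟ p) then 1ℤ else weight (e s) (members (U s)) y)
        at s with s Fin.≟ p
        ... | yes _  = refl
        ... | no s≢p = weight-local (e s) (members (U s)) (λ w∈ → ≔-other y c (λ { refl → a∉ s s≢p (∈-members⁻ w∈) }))
      zeroSum : ∀ y → ∑ codes (λ c → Φ (y [ a ≔ c ])) ≡ 0ℤ
      zeroSum y = begin
        ∑ codes (λ c → Φ (y [ a ≔ c ]))                                                 ≡⟨ S.fold-cong codes (λ c → trans (P.fold-isolate r p _) (cong (W c *ᶻ_) (rest-const y c))) ⟩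
        ∑ codes (λ c → W c *ᶻ rest y)                                                   ≡⟨ ∑-*ʳ codes (rest y) W ⟩
        ∑ codes W *ᶻ rest y                                                             ≡⟨ cong (_*ᶻ rest y) (weight-mean 2≤deg (e p) (members (U p)) y (members-unique (U p)) (∈-members⁺ a∈) len) ⟩
        0ℤ *ᶻ rest y                                                                    ≡⟨ ℤ.*-zeroˡ (rest y) ⟩
        0ℤ                                                                              ∎
        where
        open ≡-Reasoning
        W : Code → ℤ
        W c = weight (e p) (members (U p)) (y [ a ≔ c ])

    Slot : Set
    Slot = Fin h × Fin k

    slots : List Slot
    slots = filter (λ (u , i) → u ∈? D i) (cartesianProduct (allFin h) (allFin k))

    slots-unique : Unique slots
    slots-unique = Unique.filter⁺ (λ (u , i) → u ∈? D i) (Unique.cartesianProduct⁺ (Unique.allFin⁺ h) (Unique.allFin⁺ k))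

    N = length slots

    vertexOf : Fin N → Fin h
    vertexOf p = proj₁ (List.lookup slots p)

    edgeOf : Fin N → Fin k
    edgeOf p = proj₂ (List.lookup slots p)

    slot-incident : ∀ p → vertexOf p ∈ₛ D (edgeOf p)
    slot-incident p = proj₂ (∈-filter⁻ (λ (u , i) → u ∈? D i) {xs = cartesianProduct (allFin h) (allFin k)} (∈-lookup {xs = slots} p))

    slot-injective : ∀ {p r} → vertexOf p ≡ vertexOf r → edgeOf p ≡ edgeOf r → p ≡ r
    slot-injective eu ei = lookup-unique slots-unique (cong₂ _,_ eu ei)

    slotAt : ∀ {u i} → u ∈ₛ D i → Σ[ p ∈ Fin N ] (vertexOf p ≡ u × edgeOf p ≡ i)
    slotAt {u} {i} u∈ with m ← ∈-filter⁺ (λ (u , i) → u ∈? D i) (∈-cartesianProduct⁺ (∈-allFin u) (∈-allFin i)) u∈ =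
      index m , cong proj₁ (sym (lookup-index m)) , cong proj₂ (sym (lookup-index m))

    ∏-grid : ∀ (g : Fin h → Fin k → ℤ) → ∏ (allFin N) (λ p → g (vertexOf p) (edgeOf p)) ≡ ∏ (allFin h) (λ u → ∏ (allFin k) (λ i → if does (u ∈? D i) then g u i else 1ℤ))
    ∏-grid g = trans (P.fold-lookup slots) (trans (P.fold-filter (λ (u , i) → u ∈? D i) (cartesianProduct (allFin h) (allFin k))) (P.fold-pairs (allFin h) (allFin k)))

    ∏-slots : ∀ (g : Fin h → Fin k → ℤ) → ∏ (allFin N) (λ p → g (vertexOf p) (edgeOf p)) ≡ ∏ (allFin k) (λ i → ∏ (members (D i)) (λ u → g u i))
    ∏-slots g = trans (∏-grid g) (trans (P.fold-swap (allFin h) (allFin k) _)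
      (P.fold-cong (allFin k) (λ i → sym (P.fold-filter (_∈? D i) (allFin h)))))

    term : Vec (Fin n) N → (Fin n → Code) → ℤ
    term α y = ∏ (allFin N) (λ p → factor (vertexOf p) (edgeOf p) (y (lookup α p)))

    term-inconsistent : N < K → ∀ α {p r} → vertexOf p ≡ vertexOf r → lookup α p ≢ lookup α r → E (term α) ≡ 0ℤ
    term-inconsistent N<K α {p} {r} u≡ α≢ = resample-zero a (Vec.toList α) (term α) local (subst (_< K) (sym (Vec.length-toList α)) N<K) zeroSum
      where
      a = lookup α p
      u = vertexOf p
      i = edgeOf p
      j = edgeOf r
      u∈i = slot-incident p
      u∈j : u ∈ₛ D j
      u∈j = subst (_∈ₛ D j) (sym u≡) (slot-incident r)
      i≢j : i ≢ j
      i≢j i≡j = α≢ (cong (lookup α) (slot-injective u≡ i≡j))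
      local : Local (Vec.toList α) (term α)
      local eq = P.fold-cong (allFin N) (λ p → cong (factor (vertexOf p) (edgeOf p)) (eq (∈-toList⁺ (VecMem.∈-lookup p α))))
      f : (Fin n → Code) → Subset h → Subset k → Fin N → ℤ
      f y A B s = factor (vertexOf s) (edgeOf s) ((y [ a ≔ (A , B) ]) (lookup α s))
      odd : ∀ y A B → term α (y [ a ≔ (A , flip i (flip j B)) ]) ≡ - term α (y [ a ≔ (A , B) ])
      odd y A B with A ≟ₛ ⁅ u ⁆
      ... | no A≢ = trans (vanish (flip i (flip j B))) (sym (cong -_ (vanish B)))
        where
        vanish : ∀ B → term α (y [ a ≔ (A , B) ]) ≡ 0ℤ
        vanish B = ∏-zero∈ (allFin N) (∈-allFin p) (trans (cong (factor u i) (≔-same y a (A , B))) (factor-colour u i B A≢))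
      ... | yes refl = ∏-neg N p (f y A B) (f y A (flip i (flip j B)))
        (trans (cong (factor u i) (≔-same y a _)) (trans (factor-flip A B i≢j u∈i u∈j) (cong (-_ ∘ factor u i) (sym (≔-same y a _)))))
        other
        where
        other : ∀ s → s ≢ p → f y A (flip i (flip j B)) s ≡ f y A B s
        other s s≢p with lookup α s Fin.≟ a
        ... | no _ = refl
        ... | yes αs≡a with vertexOf s Fin.≟ u
        ...   | no u′≢u = trans (factor-colour (vertexOf s) (edgeOf s) (flip i (flip j B)) (u′≢u ∘ sym ∘ ⁅⁆-injective)) (sym (factor-colour (vertexOf s) (edgeOf s) B (u′≢u ∘ sym ∘ ⁅⁆-injective)))
        ...   | yes u′≡u = subst (λ v → factor v (edgeOf s) (A , flip i (flip j B)) ≡ factor v (edgeOf s) (A , B)) (sym u′≡u)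
          (factor-flip-other A B (λ l≡i → s≢p (slot-injective u′≡u l≡i))
            (λ l≡j → α≢ (trans (sym αs≡a) (cong (lookup α) (slot-injective (trans u′≡u u≡) l≡j)))) u∈i u∈j)
      zeroSum : ∀ y → ∑ codes (λ c → term α (y [ a ≔ c ])) ≡ 0ℤ
      zeroSum y = trans (∑-codes _) (trans (S.fold-cong (allSubsets h) (λ A → ∑-odd k i j _ (odd y A))) (S.fold-ε (allSubsets h)))

    spread : Vec (Fin n) h → Vec (Fin n) N
    spread φ = tabulate (λ p → lookup φ (vertexOf p))

    term-spread : ∀ φ y → term (spread φ) y ≡ ∏ (allFin h) (λ u → star u (y (lookup φ u)))
    term-spread φ y = trans (P.fold-cong (allFin N) (λ p → cong (λ v → factor (vertexOf p) (edgeOf p) (y v)) (Vec.lookup∘tabulate _ p)))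
      (∏-grid (λ u i → factor u i (y (lookup φ u))))

    E-stars : ∀ (φ : Fin h → Fin n) us → Unique us → (∀ {u v} → φ u ≡ φ v → u ≡ v) → length us < K →
      ℤ.+ (Q ^ length us) *ᶻ E (λ y → ∏ us (λ u → star u (y (φ u)))) ≡ E (λ _ → 1ℤ) *ᶻ ∏ us (λ u → ∑ codes (star u))
    E-stars φ []       _           inj _   = trans (ℤ.*-identityˡ _) (sym (ℤ.*-identityʳ _))
    E-stars φ (u ∷ us) (u∉ ∷ uniq) inj len = begin
      ℤ.+ (Q * Q ^ length us) *ᶻ E Φ                                     ≡⟨ cong (_*ᶻ E Φ) (ℤ.pos-* Q (Q ^ length us)) ⟩
      ℤ.+ Q *ᶻ ℤ.+ (Q ^ length us) *ᶻ E Φ                                ≡⟨ l₁ (ℤ.+ Q) (ℤ.+ (Q ^ length us)) (E Φ) ⟩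
      ℤ.+ (Q ^ length us) *ᶻ (ℤ.+ Q *ᶻ E Φ)                              ≡⟨ cong (ℤ.+ (Q ^ length us) *ᶻ_) (resample (φ u) (map φ (u ∷ us)) Φ local (subst (_< K) (sym (List.length-map φ (u ∷ us))) len)) ⟩
      ℤ.+ (Q ^ length us) *ᶻ ∑ (seeds K) (λ s → ∑ codes (λ c → Φ (colours s [ φ u ≔ c ])))   ≡⟨ cong (ℤ.+ (Q ^ length us) *ᶻ_) (S.fold-cong (seeds K) split) ⟩
      ℤ.+ (Q ^ length us) *ᶻ ∑ (seeds K) (λ s → ∑ codes (star u) *ᶻ R (colours s))           ≡⟨ cong (ℤ.+ (Q ^ length us) *ᶻ_) (∑-*ˡ (seeds K) (∑ codes (star u)) (R ∘ colours)) ⟩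
      ℤ.+ (Q ^ length us) *ᶻ (∑ codes (star u) *ᶻ E R)                   ≡⟨ l₂ (ℤ.+ (Q ^ length us)) (∑ codes (star u)) (E R) ⟩
      ∑ codes (star u) *ᶻ (ℤ.+ (Q ^ length us) *ᶻ E R)                   ≡⟨ cong (∑ codes (star u) *ᶻ_) (E-stars φ us uniq inj (ℕ.<-trans (ℕ.n<1+n _) len)) ⟩
      ∑ codes (star u) *ᶻ (E (λ _ → 1ℤ) *ᶻ ∏ us (λ u → ∑ codes (star u))) ≡⟨ l₂ (∑ codes (star u)) (E (λ _ → 1ℤ)) (∏ us (λ u → ∑ codes (star u))) ⟩
      E (λ _ → 1ℤ) *ᶻ ∏ (u ∷ us) (λ u → ∑ codes (star u))                ∎
      where
      open ≡-Reasoning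
      l₁ : ∀ a b c → a *ᶻ b *ᶻ c ≡ b *ᶻ (a *ᶻ c)
      l₁ = solve-∀
      l₂ : ∀ a b c → a *ᶻ (b *ᶻ c) ≡ b *ᶻ (a *ᶻ c)
      l₂ = solve-∀
      Φ R : (Fin n → Code) → ℤ
      Φ y = ∏ (u ∷ us) (λ u → star u (y (φ u)))
      R y = ∏ us (λ u → star u (y (φ u)))
      local : Local (map φ (u ∷ us)) Φ
      local eq = P.fold-cong∈ (u ∷ us) (λ {v} v∈ → cong (star v) (eq (∈-map⁺ φ v∈)))
      split : ∀ s → ∑ codes (λ c → Φ (colours s [ φ u ≔ c ])) ≡ ∑ codes (star u) *ᶻ R (colours s)
      split s = trans (S.fold-cong codes (λ c → cong₂ _*ᶻ_ (cong (star u) (≔-same (colours s) (φ u) c))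
          (P.fold-cong∈ us (λ {v} v∈ → cong (star v) (≔-other (colours s) c (λ φv≡φu → All.lookup u∉ v∈ (sym (inj φv≡φu))))))))
        (∑-*ʳ codes (R (colours s)) (star u))

    module _ (1≤deg : ∀ u → ∃[ i ] u ∈ₛ D i) (N<K : N < K) (h<K : h < K) where

      term-noninjective : ∀ φ {u v} → lookup φ u ≡ lookup φ v → u ≢ v → ∀ y → term (spread φ) y ≡ 0ℤ
      term-noninjective φ {u} {v} φ≡ u≢v y =
        ∏-pair-zero N p r _ (λ p≡r → u≢v (trans (sym pu) (trans (cong vertexOf p≡r) rv)))
          (subst (λ z → factor (vertexOf p) (edgeOf p) (y (lookup (spread φ) p)) *ᶻ factor (vertexOf r) (edgeOf r) (y z) ≡ 0ℤ) same
            (factor-exclusive (edgeOf p) (edgeOf r) (y (lookup (spread φ) p)) (λ e → u≢v (trans (sym pu) (trans e rv)))))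
        where
        sp = slotAt (proj₂ (1≤deg u))
        sr = slotAt (proj₂ (1≤deg v))
        p = proj₁ sp
        r = proj₁ sr
        pu = proj₁ (proj₂ sp)
        rv = proj₁ (proj₂ sr)
        same : lookup (spread φ) p ≡ lookup (spread φ) r
        same = trans (Vec.lookup∘tabulate _ p) (trans (cong (lookup φ) pu) (trans φ≡ (trans (cong (lookup φ) (sym rv)) (sym (Vec.lookup∘tabulate _ r)))))

      E-term-spread : ∀ φ → ℤ.+ (Q ^ h) *ᶻ E (term (spread φ)) ≡ E (λ _ → 1ℤ) *ᶻ κ *ᶻ ⟦ injective? φ ⟧
      E-term-spread φ = go (injective? φ)
        where
        zeroTerm : ¬ Injective φ → ∀ y → term (spread φ) y ≡ 0ℤ
        zeroTerm ¬inj y with Fin.¬∀⟶∃¬ h _ (λ u → Fin.all? λ v → lookup φ u Fin.≟ lookup φ v →-dec u Fin.≟ v) ¬inj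
        ... | u , ¬u with Fin.¬∀⟶∃¬ h _ (λ v → lookup φ u Fin.≟ lookup φ v →-dec u Fin.≟ v) ¬u
        ...   | v , ¬v with lookup φ u Fin.≟ lookup φ v
        ...     | yes φ≡ = term-noninjective φ φ≡ (λ u≡v → ¬v (λ _ → u≡v)) y
        ...     | no φ≢  = contradiction (λ e → contradiction e φ≢) ¬v
        go : (d : Dec (Injective φ)) → ℤ.+ (Q ^ h) *ᶻ E (term (spread φ)) ≡ E (λ _ → 1ℤ) *ᶻ κ *ᶻ ⟦ d ⟧
        go (yes inj) = trans (cong (ℤ.+ (Q ^ h) *ᶻ_) (E-cong (term-spread φ)))
            (trans (subst (λ z → ℤ.+ (Q ^ z) *ᶻ E (λ y → ∏ (allFin h) (λ u → star u (y (lookup φ u)))) ≡ E (λ _ → 1ℤ) *ᶻ κ) (List.length-tabulate {n = h} id)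
              (E-stars (lookup φ) (allFin h) (Unique.allFin⁺ h) (inj _ _) (subst (_< K) (sym (List.length-tabulate {n = h} id)) h<K)))
              (sym (ℤ.*-identityʳ _)))
        go (no ¬inj) = trans (cong (ℤ.+ (Q ^ h) *ᶻ_) (trans (E-cong (zeroTerm ¬inj)) (S.fold-ε (seeds K)))) (trans (ℤ.*-zeroʳ (ℤ.+ (Q ^ h))) (sym (ℤ.*-zeroʳ (E (λ _ → 1ℤ) *ᶻ κ))))

      spread-injective : ∀ {φ ψ} → spread φ ≡ spread ψ → φ ≡ ψ
      spread-injective {φ} {ψ} eq = trans (sym (Vec.tabulate∘lookup φ)) (trans (Vec.tabulate-cong at) (Vec.tabulate∘lookup ψ))
        where
        at : ∀ u → lookup φ u ≡ lookup ψ u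
        at u with p , refl , _ ← slotAt (proj₂ (1≤deg u)) = trans (sym (Vec.lookup∘tabulate _ p)) (trans (cong (λ α → lookup α p) eq) (Vec.lookup∘tabulate _ p))

      -- Only the consistent assignments of vertices to slots survive on average.
      E-∑-terms : ∀ (g : Vec (Fin n) N → ℤ) →
        ∑ (vecs (allFin n) N) (λ α → g α *ᶻ E (term α)) ≡ ∑ (vecs (allFin n) h) (λ φ → g (spread φ) *ᶻ E (term (spread φ)))
      E-∑-terms g = reindex (vecs (allFin n) h) (vecs (allFin n) N) (Vec.≡-dec Fin._≟_) (Vec.≡-dec Fin._≟_) (enumerates-vecs {_≟_ = Fin._≟_} (enumerates-allFin n) h) (enumerates-vecs {_≟_ = Fin._≟_} (enumerates-allFin n) N) spread spread-injective _ support
        where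
        support : ∀ α → g α *ᶻ E (term α) ≡ 0ℤ ⊎ ∃[ φ ] spread φ ≡ α
        support α with Fin.all? (λ p → Fin.all? λ r → vertexOf p Fin.≟ vertexOf r →-dec lookup α p Fin.≟ lookup α r)
        ... | yes consistent = inj₂ (φ , trans (Vec.tabulate-cong at) (Vec.tabulate∘lookup α))
          where
          home : Fin h → Fin N
          home u = proj₁ (slotAt (proj₂ (1≤deg u)))
          φ = tabulate (λ u → lookup α (home u))
          at : ∀ p → lookup φ (vertexOf p) ≡ lookup α p
          at p = trans (Vec.lookup∘tabulate _ (vertexOf p)) (consistent (home (vertexOf p)) p (proj₁ (proj₂ (slotAt (proj₂ (1≤deg (vertexOf p)))))))
        ... | no ¬c with Fin.¬∀⟶∃¬ N _ (λ p → Fin.all? λ r → vertexOf p Fin.≟ vertexOf r →-dec lookup α p Fin.≟ lookup α r) ¬c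
        ...   | p , ¬p with Fin.¬∀⟶∃¬ N _ (λ r → vertexOf p Fin.≟ vertexOf r →-dec lookup α p Fin.≟ lookup α r) ¬p
        ...     | r , ¬r with vertexOf p Fin.≟ vertexOf r
        ...       | no u≢ = contradiction (λ e → contradiction e u≢) ¬r
        ...       | yes u≡ = inj₁ (trans (cong (g α *ᶻ_) (term-inconsistent N<K α u≡ (λ e → ¬r (λ _ → e)))) (ℤ.*-zeroʳ (g α)))

      module FirstMoment (F : Fin k → Subset n → ℤ) where

        counter : Fin k → (Fin n → Code) → ℤ
        counter i y = ∑ (allSubsets n) (λ U → F i U *ᶻ weight i (members U) y)

        embedded : Vec (Fin n) h → ℤ
        embedded φ = ∏ (allFin k) (λ i → ∑ (allSubsets n) (λ U → F i U *ᶻ ∏ (members (D i)) (λ u → ⟦ lookup φ u ∈? U ⟧)))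

        lies : Vec (Subset n) k → Vec (Fin n) N → ℤ
        lies Us α = ∏ (allFin N) (λ p → ⟦ lookup α p ∈? lookup Us (edgeOf p) ⟧)

        ∏-weights : ∀ Us y → ∏ (allFin k) (λ i → weight i (members (lookup Us i)) y) ≡ ∑ (vecs (allFin n) N) (λ α → lies Us α *ᶻ term α y)
        ∏-weights Us y = begin
          ∏ (allFin k) (λ i → weight i (members (lookup Us i)) y)
            ≡⟨ ∏-slots (λ u i → ∑ (members (lookup Us i)) (λ w → factor u i (y w))) ⟨
          ∏ (allFin N) (λ p → ∑ (members (lookup Us (edgeOf p))) (λ w → factor (vertexOf p) (edgeOf p) (y w)))
            ≡⟨ P.fold-cong (allFin N) (λ p → trans (S.fold-filter (_∈? lookup Us (edgeOf p)) (allFin n)) (S.fold-cong (allFin n) (λ w → if-as-* (lookup Us (edgeOf p)) w _))) ⟩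
          ∏ (allFin N) (λ p → ∑ (allFin n) (λ w → ⟦ w ∈? lookup Us (edgeOf p) ⟧ *ᶻ factor (vertexOf p) (edgeOf p) (y w)))
            ≡⟨ ∏∑ (allFin n) N _ ⟩
          ∑ (vecs (allFin n) N) (λ α → ∏ (allFin N) (λ p → ⟦ lookup α p ∈? lookup Us (edgeOf p) ⟧ *ᶻ factor (vertexOf p) (edgeOf p) (y (lookup α p))))
            ≡⟨ S.fold-cong (vecs (allFin n) N) (λ α → P.fold-∙ (allFin N) _ _) ⟩
          ∑ (vecs (allFin n) N) (λ α → lies Us α *ᶻ term α y) ∎
          where
          open ≡-Reasoning
          if-as-* : ∀ U w x → (if does (w ∈? U) then x else 0ℤ) ≡ ⟦ w ∈? U ⟧ *ᶻ x
          if-as-* U w x with does (w ∈? U)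
          ... | true  = sym (ℤ.*-identityˡ x)
          ... | false = sym (ℤ.*-zeroˡ x)

        lies-spread : ∀ Us φ → lies Us (spread φ) ≡ ∏ (allFin k) (λ i → ∏ (members (D i)) (λ u → ⟦ lookup φ u ∈? lookup Us i ⟧))
        lies-spread Us φ = trans (P.fold-cong (allFin N) (λ p → cong (λ v → ⟦ v ∈? lookup Us (edgeOf p) ⟧) (Vec.lookup∘tabulate _ p)))
          (∏-slots (λ u i → ⟦ lookup φ u ∈? lookup Us i ⟧))

        first-moment : ℤ.+ (Q ^ h) *ᶻ E (λ y → ∏ (allFin k) (λ i → counter i y)) ≡
          E (λ _ → 1ℤ) *ᶻ κ *ᶻ ∑ (vecs (allFin n) h) (λ φ → ⟦ injective? φ ⟧ *ᶻ embedded φ)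
        first-moment = begin
          ℤ.+ (Q ^ h) *ᶻ E (λ y → ∏ (allFin k) (λ i → counter i y))
            ≡⟨ cong (ℤ.+ (Q ^ h) *ᶻ_) (E-cong expand) ⟩
          ℤ.+ (Q ^ h) *ᶻ E (λ y → ∑ Vs (λ Us → ∑ αs (λ α → (Fs Us *ᶻ lies Us α) *ᶻ term α y)))
            ≡⟨ cong (ℤ.+ (Q ^ h) *ᶻ_) (trans (E-∑ Vs (λ Us y → ∑ αs (λ α → (Fs Us *ᶻ lies Us α) *ᶻ term α y))) (S.fold-cong Vs (λ Us → trans (E-∑ αs (λ α y → (Fs Us *ᶻ lies Us α) *ᶻ term α y)) (S.fold-cong αs (λ α → E-* (Fs Us *ᶻ lies Us α) (term α)))))) ⟩
          ℤ.+ (Q ^ h) *ᶻ ∑ Vs (λ Us → ∑ αs (λ α → (Fs Us *ᶻ lies Us α) *ᶻ E (term α)))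
            ≡⟨ cong (ℤ.+ (Q ^ h) *ᶻ_) (S.fold-cong Vs (λ Us → E-∑-terms (λ α → Fs Us *ᶻ lies Us α))) ⟩
          ℤ.+ (Q ^ h) *ᶻ ∑ Vs (λ Us → ∑ φs (λ φ → (Fs Us *ᶻ lies Us (spread φ)) *ᶻ E (term (spread φ))))
            ≡⟨ cong (ℤ.+ (Q ^ h) *ᶻ_) (trans (S.fold-swap Vs φs _) (S.fold-cong φs (λ φ → ∑-*ʳ Vs (E (term (spread φ))) _))) ⟩
          ℤ.+ (Q ^ h) *ᶻ ∑ φs (λ φ → ∑ Vs (λ Us → Fs Us *ᶻ lies Us (spread φ)) *ᶻ E (term (spread φ)))
            ≡⟨ ∑-*ˡ φs (ℤ.+ (Q ^ h)) _ ⟨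
          ∑ φs (λ φ → ℤ.+ (Q ^ h) *ᶻ (∑ Vs (λ Us → Fs Us *ᶻ lies Us (spread φ)) *ᶻ E (term (spread φ))))
            ≡⟨ S.fold-cong φs each ⟩
          ∑ φs (λ φ → E (λ _ → 1ℤ) *ᶻ κ *ᶻ (⟦ injective? φ ⟧ *ᶻ embedded φ))
            ≡⟨ ∑-*ˡ φs (E (λ _ → 1ℤ) *ᶻ κ) _ ⟩
          E (λ _ → 1ℤ) *ᶻ κ *ᶻ ∑ φs (λ φ → ⟦ injective? φ ⟧ *ᶻ embedded φ) ∎
          where
          open ≡-Reasoning
          Vs = vecs (allSubsets n) k
          αs = vecs (allFin n) N
          φs = vecs (allFin n) h
          Fs : Vec (Subset n) k → ℤ
          Fs Us = ∏ (allFin k) (λ i → F i (lookup Us i))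
          expand : ∀ y → ∏ (allFin k) (λ i → counter i y) ≡ ∑ Vs (λ Us → ∑ αs (λ α → (Fs Us *ᶻ lies Us α) *ᶻ term α y))
          expand y = trans (∏∑ (allSubsets n) k _) (S.fold-cong Vs (λ Us → trans (P.fold-∙ (allFin k) _ _)
            (trans (cong (Fs Us *ᶻ_) (∏-weights Us y)) (trans (sym (∑-*ˡ αs (Fs Us) _)) (S.fold-cong αs (λ α → sym (ℤ.*-assoc (Fs Us) (lies Us α) (term α y))))))))
          emb : ∀ φ → ∑ Vs (λ Us → Fs Us *ᶻ lies Us (spread φ)) ≡ embedded φ
          emb φ = trans (S.fold-cong Vs (λ Us → trans (cong (Fs Us *ᶻ_) (lies-spread Us φ)) (sym (P.fold-∙ (allFin k) _ _)))) (sym (∏∑ (allSubsets n) k _))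
          l₁ : ∀ a b c → a *ᶻ (b *ᶻ c) ≡ b *ᶻ (a *ᶻ c)
          l₁ = solve-∀
          l₂ : ∀ a b c → a *ᶻ (b *ᶻ c) ≡ b *ᶻ (c *ᶻ a)
          l₂ = solve-∀
          each : ∀ φ → ℤ.+ (Q ^ h) *ᶻ (∑ Vs (λ Us → Fs Us *ᶻ lies Us (spread φ)) *ᶻ E (term (spread φ))) ≡ E (λ _ → 1ℤ) *ᶻ κ *ᶻ (⟦ injective? φ ⟧ *ᶻ embedded φ)
          each φ = trans (cong (λ z → ℤ.+ (Q ^ h) *ᶻ (z *ᶻ E (term (spread φ)))) (emb φ))
            (trans (l₁ (ℤ.+ (Q ^ h)) (embedded φ) (E (term (spread φ)))) (trans (cong (embedded φ *ᶻ_) (E-term-spread φ)) (l₂ (embedded φ) (E (λ _ → 1ℤ) *ᶻ κ) ⟦ injective? φ ⟧)))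

module Count where

  open Big
  open import Defs using (allSubsets)
  open import Data.Bool.Base using (Bool; true; false; if_then_else_)
  open import Data.Fin.Base using (Fin; zero; suc)
  open import Data.Fin.Subset using (Subset; inside; outside; ∣_∣; ⊥)
  open import Data.List.Base as List using (List; []; _∷_; length; allFin)
  open import Data.List.Membership.Propositional using (_∈_)
  open import Data.List.Membership.Propositional.Properties using (∈-++⁺ˡ; ∈-++⁺ʳ; ∈-map⁺)
  open import Data.List.Relation.Unary.Any using (here; there)
  open import Data.Nat.Base using (ℕ; zero; suc; _+_; _*_; _^_; _≤_; z≤n; s≤s)
  open import Data.Nat.Properties
  open import Data.Nat.Tactic.RingSolver using (solve-∀)
  open import Data.Product.Base using (∃-syntax; Σ-syntax; _×_; _,_)
  open import Data.Sum.Base using (_⊎_; inj₁; inj₂)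
  open import Data.Vec.Base as Vec using (Vec; []; _∷_; lookup; zipWith)
  import Data.Vec.Properties as Vec
  open import Function.Base using (_∘_)
  open import Relation.Binary.PropositionalEquality
  open import Relation.Nullary.Decidable using (yes; no; ¬?)
  open import Relation.Nullary.Negation using (contradiction)
  open ℕΣ

  private variable
    A : Set

  ∑-mono∈ : ∀ (xs : List A) {f g : A → ℕ} → (∀ {x} → x ∈ xs → f x ≤ g x) → ∑ xs f ≤ ∑ xs g
  ∑-mono∈ []       e = z≤n
  ∑-mono∈ (x ∷ xs) e = +-mono-≤ (e (here refl)) (∑-mono∈ xs (e ∘ there))

  ∑-mono : ∀ (xs : List A) {f g : A → ℕ} → (∀ x → f x ≤ g x) → ∑ xs f ≤ ∑ xs g
  ∑-mono xs e = ∑-mono∈ xs (λ {x} _ → e x)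

  ∏-mono : ∀ (xs : List A) {f g : A → ℕ} → (∀ x → f x ≤ g x) → ∏ xs f ≤ ∏ xs g
  ∏-mono []       e = ≤-refl
  ∏-mono (x ∷ xs) e = *-mono-≤ (e x) (∏-mono xs e)

  ∈⇒≤∑ : ∀ {xs : List A} {x} (f : A → ℕ) → x ∈ xs → f x ≤ ∑ xs f
  ∈⇒≤∑ f (here refl) = m≤m+n _ _
  ∈⇒≤∑ f (there x∈)  = ≤-trans (∈⇒≤∑ f x∈) (m≤n+m _ _)

  ∑-constⁿ : ∀ (xs : List A) c → ∑ xs (λ _ → c) ≡ length xs * c
  ∑-constⁿ []       c = refl
  ∑-constⁿ (x ∷ xs) c = cong (c +_) (∑-constⁿ xs c)

  ∏-constⁿ : ∀ (xs : List A) c → ∏ xs (λ _ → c) ≡ c ^ length xs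
  ∏-constⁿ []       c = refl
  ∏-constⁿ (x ∷ xs) c = cong (c *_) (∏-constⁿ xs c)

  ∈-allSubsets : ∀ {n} (U : Subset n) → U ∈ allSubsets n
  ∈-allSubsets []          = here refl
  ∈-allSubsets (true ∷ U)  = ∈-++⁺ˡ (∈-map⁺ (inside ∷_) (∈-allSubsets U))
  ∈-allSubsets (false ∷ U) = ∈-++⁺ʳ (List.map (inside ∷_) (allSubsets _)) (∈-map⁺ (outside ∷_) (∈-allSubsets U))

  4ab≤[a+b]² : ∀ a b → 4 * (a * b) ≤ (a + b) * (a + b)
  4ab≤[a+b]² a b with ≤-total a b
  ... | inj₁ a≤b with d , refl ← m≤n⇒∃[o]m+o≡n a≤b = subst (4 * (a * (a + d)) ≤_) (l a d) (m≤m+n _ (d * d))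
    where
    l : ∀ a d → 4 * (a * (a + d)) + d * d ≡ (a + (a + d)) * (a + (a + d))
    l = solve-∀
  ... | inj₂ b≤a with d , refl ← m≤n⇒∃[o]m+o≡n b≤a = subst (4 * ((b + d) * b) ≤_) (l b d) (m≤m+n _ (d * d))
    where
    l : ∀ b d → 4 * ((b + d) * b) + d * d ≡ (b + d + b) * (b + d + b)
    l = solve-∀

  z²≤ab⇒2z≤a+b : ∀ z a b → z * z ≤ a * b → 2 * z ≤ a + b
  z²≤ab⇒2z≤a+b z a b le = ≮⇒≥ λ lt → <-irrefl refl (begin-strict
    (a + b) * (a + b)      <⟨ *-mono-< lt lt ⟩
    2 * z * (2 * z)        ≡⟨ l z ⟩
    4 * (z * z)            ≤⟨ *-monoʳ-≤ 4 le ⟩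
    4 * (a * b)            ≤⟨ 4ab≤[a+b]² a b ⟩
    (a + b) * (a + b)      ∎)
    where
    open ≤-Reasoning
    l : ∀ z → 2 * z * (2 * z) ≡ 4 * (z * z)
    l = solve-∀

  [∑]²≤len*∑² : ∀ (xs : List A) (f : A → ℕ) → ∑ xs f * ∑ xs f ≤ length xs * ∑ xs (λ x → f x * f x)
  [∑]²≤len*∑² []       f = z≤n
  [∑]²≤len*∑² (x ∷ xs) f = begin
    (a + s) * (a + s)                                     ≡⟨ l₁ a s ⟩
    a * a + (2 * (a * s) + s * s)                         ≤⟨ +-monoʳ-≤ (a * a) (+-mono-≤ cross ih) ⟩
    a * a + (len * (a * a) + q + len * q)                 ≡⟨ l₂ a len q ⟩
    suc len * (a * a + q)                                 ∎
    where
    open ≤-Reasoning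
    a = f x
    s = ∑ xs f
    len = length xs
    q = ∑ xs (λ x → f x * f x)
    ih = [∑]²≤len*∑² xs f
    l₁ : ∀ a s → (a + s) * (a + s) ≡ a * a + (2 * (a * s) + s * s)
    l₁ = solve-∀
    l₂ : ∀ a n q → a * a + (n * (a * a) + q + n * q) ≡ suc n * (a * a + q)
    l₂ = solve-∀
    l₃ : ∀ a s → a * s * (a * s) ≡ a * a * (s * s)
    l₃ = solve-∀
    l₄ : ∀ a n q → a * a * (n * q) ≡ n * (a * a) * q
    l₄ = solve-∀
    cross : 2 * (a * s) ≤ len * (a * a) + q
    cross = z²≤ab⇒2z≤a+b (a * s) (len * (a * a)) q (begin
      a * s * (a * s)      ≡⟨ l₃ a s ⟩
      a * a * (s * s)      ≤⟨ *-monoʳ-≤ (a * a) ih ⟩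
      a * a * (len * q)    ≡⟨ l₄ a len q ⟩
      len * (a * a) * q    ∎)

  -- 1 if no point lies in exactly one of the sets, and 0 otherwise.
  noLone : ∀ {n r} → Vec (Subset n) r → ℕ
  noLone {zero}  Us = 1
  noLone {suc n} Us = ⟦ ¬? (∣ Vec.map Vec.head Us ∣ ≟ 1) ⟧ * noLone (Vec.map Vec.tail Us)

  lone : ∀ {n r} (Us : Vec (Subset n) r) → noLone Us ≡ 1 ⊎ noLone Us ≡ 0 × ∃[ a ] ∣ Vec.map (λ U → lookup U a) Us ∣ ≡ 1
  lone {zero}  Us = inj₁ refl
  lone {suc n} Us with ∣ Vec.map Vec.head Us ∣ ≟ 1
  ... | yes eq = inj₂ (cong (_* noLone (Vec.map Vec.tail Us)) (⟦no⟧ (¬? (∣ Vec.map Vec.head Us ∣ ≟ 1)) (λ ne → ne eq)) , zero , trans (cong ∣_∣ (Vec.map-cong (λ { (b ∷ U) → refl }) Us)) eq)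
  ... | no ne with e ← ⟦yes⟧ (¬? (∣ Vec.map Vec.head Us ∣ ≟ 1)) ne | lone (Vec.map Vec.tail Us)
  ...   | inj₁ eq           = inj₁ (cong₂ _*_ e eq)
  ...   | inj₂ (eq , a , c) = inj₂ (cong₂ _*_ e eq , suc a , trans (cong ∣_∣ (trans (Vec.map-cong (λ { (b ∷ U) → refl }) Us) (Vec.map-∘ (λ U → lookup U a) Vec.tail Us))) c)

  ∣A∣≡0⇒outside : ∀ {r} (A : Subset r) → ∣ A ∣ ≡ 0 → ∀ p → lookup A p ≡ outside
  ∣A∣≡0⇒outside (false ∷ A) eq zero    = refl
  ∣A∣≡0⇒outside (false ∷ A) eq (suc p) = ∣A∣≡0⇒outside A eq p

  singleton : ∀ {r} (A : Subset r) → ∣ A ∣ ≡ 1 → ∃[ p ] lookup A p ≡ inside × (∀ p′ → p′ ≢ p → lookup A p′ ≡ outside)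
  singleton (true ∷ A)  eq = zero , refl , λ { zero p≢ → contradiction refl p≢ ; (suc p) _ → ∣A∣≡0⇒outside A (suc-injective eq) p }
  singleton (false ∷ A) eq with singleton A eq
  ... | p , in′ , out = suc p , in′ , λ { zero _ → refl ; (suc p′) p≢ → out p′ (p≢ ∘ cong suc) }

  ∑-tuples : ∀ n r (F : Vec (Subset (suc n)) r → ℕ) →
    ∑ (vecs (allSubsets (suc n)) r) F ≡ ∑ (allSubsets r) (λ A → ∑ (vecs (allSubsets n) r) (λ Us → F (zipWith _∷_ A Us)))
  ∑-tuples n zero    F = sym (+-identityʳ _)
  ∑-tuples n (suc r) F = begin
    ∑ (vecs (allSubsets (suc n)) (suc r)) F
      ≡⟨ S.fold-vecs (allSubsets (suc n)) r ⟩
    ∑ (allSubsets (suc n)) (λ U → ∑ (vecs (allSubsets (suc n)) r) (λ Us → F (U ∷ Us)))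
      ≡⟨ S.fold-cong (allSubsets (suc n)) (λ U → ∑-tuples n r (λ Us → F (U ∷ Us))) ⟩
    ∑ (allSubsets (suc n)) (λ U → ∑ (allSubsets r) (λ A → ∑ Vs (λ Us → F (U ∷ zipWith _∷_ A Us))))
      ≡⟨ S.fold-allSubsets n ⟩
    part inside + part outside
      ≡⟨ cong₂ _+_ (swap inside) (swap outside) ⟩
    ∑ (allSubsets r) (λ A → ∑ (vecs (allSubsets n) (suc r)) (λ Us → F (zipWith _∷_ (inside ∷ A) Us))) +
    ∑ (allSubsets r) (λ A → ∑ (vecs (allSubsets n) (suc r)) (λ Us → F (zipWith _∷_ (outside ∷ A) Us)))
      ≡⟨ S.fold-allSubsets r ⟨
    ∑ (allSubsets (suc r)) (λ A → ∑ (vecs (allSubsets n) (suc r)) (λ Us → F (zipWith _∷_ A Us))) ∎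
    where
    open ≡-Reasoning
    Vs = vecs (allSubsets n) r
    part : Bool → ℕ
    part b = ∑ (allSubsets n) (λ U → ∑ (allSubsets r) (λ A → ∑ Vs (λ Us → F ((b ∷ U) ∷ zipWith _∷_ A Us))))
    swap : ∀ b → part b ≡ ∑ (allSubsets r) (λ A → ∑ (vecs (allSubsets n) (suc r)) (λ Us → F (zipWith _∷_ (b ∷ A) Us)))
    swap b = trans (S.fold-swap (allSubsets n) (allSubsets r) _) (S.fold-cong (allSubsets r) (λ A → sym (S.fold-vecs (allSubsets n) r)))

  ∏-binary : ∀ r (a : Bool → Fin r → ℕ) → ∏ (allFin r) (λ p → a inside p + a outside p) ≡ ∑ (allSubsets r) (λ A → ∏ (allFin r) (λ p → a (lookup A p) p))
  ∏-binary zero    a = refl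
  ∏-binary (suc r) a = begin
    ∏ (allFin (suc r)) (λ p → a inside p + a outside p)
      ≡⟨ P.fold-allFin r {λ p → a inside p + a outside p} ⟩
    (a inside zero + a outside zero) * ∏ (allFin r) (λ p → a inside (suc p) + a outside (suc p))
      ≡⟨ cong ((a inside zero + a outside zero) *_) (∏-binary r (λ b → a b ∘ suc)) ⟩
    (a inside zero + a outside zero) * ∑ (allSubsets r) X
      ≡⟨ *-distribʳ-+ (∑ (allSubsets r) X) (a inside zero) (a outside zero) ⟩
    a inside zero * ∑ (allSubsets r) X + a outside zero * ∑ (allSubsets r) X
      ≡⟨ cong₂ _+_ (push inside) (push outside) ⟩
    ∑ (allSubsets r) (λ A → ∏ (allFin (suc r)) (λ p → a (lookup (inside ∷ A) p) p)) + ∑ (allSubsets r) (λ A → ∏ (allFin (suc r)) (λ p → a (lookup (outside ∷ A) p) p))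
      ≡⟨ S.fold-allSubsets r ⟨
    ∑ (allSubsets (suc r)) (λ A → ∏ (allFin (suc r)) (λ p → a (lookup A p) p)) ∎
    where
    open ≡-Reasoning
    X : Subset r → ℕ
    X A = ∏ (allFin r) (λ p → a (lookup A p) (suc p))
    push : ∀ b → a b zero * ∑ (allSubsets r) X ≡ ∑ (allSubsets r) (λ A → ∏ (allFin (suc r)) (λ p → a (lookup (b ∷ A) p) p))
    push b = trans (sym (∑-*ˡ (allSubsets r) (a b zero) X)) (S.fold-cong (allSubsets r) (λ A → sym (P.fold-allFin r {λ p → a (lookup (b ∷ A) p) p})))

  halves : ∀ {r} (A : Subset r) → 2 ≤ ∣ A ∣ → Σ[ A₁ ∈ Subset r ] Σ[ A₂ ∈ Subset r ] (1 ≤ ∣ A₁ ∣ × 1 ≤ ∣ A₂ ∣ ×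
    (∀ p → lookup A₁ p ≡ outside × lookup A₂ p ≡ lookup A p ⊎ lookup A₁ p ≡ lookup A p × lookup A₂ p ≡ outside))
  halves (true ∷ A)  (s≤s 1≤) = inside ∷ ⊥ , outside ∷ A , s≤s z≤n , 1≤ , λ { zero → inj₂ (refl , refl) ; (suc p) → inj₁ (Vec.lookup-replicate p outside , refl) }
  halves (false ∷ A) 2≤ with halves A 2≤
  ... | A₁ , A₂ , n₁ , n₂ , s = outside ∷ A₁ , outside ∷ A₂ , n₁ , n₂ , λ { zero → inj₁ (refl , refl) ; (suc p) → s p }

  ∑-size-zero : ∀ r (x : Subset r → ℕ) → ∑ (allSubsets r) (λ A → ⟦ ∣ A ∣ ≟ 0 ⟧ * x A) ≡ x ⊥
  ∑-size-zero zero    x = trans (+-identityʳ _) (+-identityʳ _)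
  ∑-size-zero (suc r) x = trans (S.fold-allSubsets r) (trans (cong (_+ ∑ (allSubsets r) (λ A → ⟦ ∣ A ∣ ≟ 0 ⟧ * x (outside ∷ A))) (S.fold-ε (allSubsets r))) (∑-size-zero r (x ∘ (outside ∷_))))

  -- The two-point inequality behind the count: the sets of size one are left out,
  -- and every other set splits into two non-empty parts, so AM-GM bounds every
  -- cross term by monomials P A with A non-empty.
  module TwoPoint {r : ℕ} (a : Bool → Fin r → ℕ) (x : Subset r → ℕ)
    (x²≤ : ∀ A → x A * x A ≤ ∏ (allFin r) (λ p → a (lookup A p) p)) where

    Λ : ℕ
    Λ = 3 * 2 ^ r

    monomial : Subset r → ℕ
    monomial A = ∏ (allFin r) (λ p → a (lookup A p) p)

    T : ℕ
    T = ∑ (allSubsets r) (λ A → ⟦ 1 ≤? ∣ A ∣ ⟧ * monomial A)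

    monomial≤T : ∀ A → 1 ≤ ∣ A ∣ → monomial A ≤ T
    monomial≤T A 1≤ = ≤-trans (≤-reflexive (sym (trans (cong (_* monomial A) (⟦yes⟧ (1 ≤? ∣ A ∣) 1≤)) (*-identityˡ _))))
      (∈⇒≤∑ (λ A → ⟦ 1 ≤? ∣ A ∣ ⟧ * monomial A) (∈-allSubsets A))

    S₂ : ℕ
    S₂ = ∑ (allSubsets r) (λ A → ⟦ 2 ≤? ∣ A ∣ ⟧ * x A)

    cross : ∀ A → 2 ≤ ∣ A ∣ → 2 * (x ⊥ * x A) ≤ 2 * T
    cross A 2≤ with A₁ , A₂ , n₁ , n₂ , s ← halves A 2≤ = ≤-trans
      (z²≤ab⇒2z≤a+b (x ⊥ * x A) (monomial A₁) (monomial A₂) (begin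
        x ⊥ * x A * (x ⊥ * x A)        ≡⟨ l (x ⊥) (x A) ⟩
        x ⊥ * x ⊥ * (x A * x A)        ≤⟨ *-mono-≤ (x²≤ ⊥) (x²≤ A) ⟩
        monomial ⊥ * monomial A        ≡⟨ P.fold-∙ (allFin r) _ _ ⟨
        ∏ (allFin r) (λ p → a (lookup ⊥ p) p * a (lookup A p) p)     ≡⟨ P.fold-cong (allFin r) at ⟩
        ∏ (allFin r) (λ p → a (lookup A₁ p) p * a (lookup A₂ p) p)   ≡⟨ P.fold-∙ (allFin r) _ _ ⟩
        monomial A₁ * monomial A₂      ∎))
      (≤-trans (+-mono-≤ (monomial≤T A₁ n₁) (monomial≤T A₂ n₂)) (≤-reflexive (cong (T +_) (sym (+-identityʳ T)))))
      where
      open ≤-Reasoning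
      l : ∀ a b → a * b * (a * b) ≡ a * a * (b * b)
      l = solve-∀
      at : ∀ p → a (lookup ⊥ p) p * a (lookup A p) p ≡ a (lookup A₁ p) p * a (lookup A₂ p) p
      at p with s p
      ... | inj₁ (e₁ , e₂) rewrite e₁ | e₂ | Vec.lookup-replicate p outside = refl
      ... | inj₂ (e₁ , e₂) rewrite e₁ | e₂ | Vec.lookup-replicate p outside = *-comm (a outside p) _

    len : length (allSubsets r) ≡ 2 ^ r
    len = go r
      where
      open import Data.List.Properties using (length-++; length-map)
      go : ∀ n → length (allSubsets n) ≡ 2 ^ n
      go zero    = refl
      go (suc n) = trans (length-++ (List.map (inside ∷_) (allSubsets n)))
        (cong₂ _+_ (trans (length-map _ (allSubsets n)) (go n)) (trans (trans (length-map _ (allSubsets n)) (go n)) (sym (+-identityʳ _))))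

    2x⊥S₂≤ : 2 * (x ⊥ * S₂) ≤ 2 ^ r * (2 * T)
    2x⊥S₂≤ = begin
      2 * (x ⊥ * S₂)                                                        ≡⟨ cong (2 *_) (∑-*ˡ (allSubsets r) (x ⊥) _) ⟨
      2 * ∑ (allSubsets r) (λ A → x ⊥ * (⟦ 2 ≤? ∣ A ∣ ⟧ * x A))             ≡⟨ ∑-*ˡ (allSubsets r) 2 _ ⟨
      ∑ (allSubsets r) (λ A → 2 * (x ⊥ * (⟦ 2 ≤? ∣ A ∣ ⟧ * x A)))           ≤⟨ ∑-mono (allSubsets r) each ⟩
      ∑ (allSubsets r) (λ A → 2 * T)                                        ≡⟨ ∑-constⁿ (allSubsets r) (2 * T) ⟩
      length (allSubsets r) * (2 * T)                                       ≡⟨ cong (_* (2 * T)) len ⟩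
      2 ^ r * (2 * T)                                                       ∎
      where
      open ≤-Reasoning
      each : ∀ A → 2 * (x ⊥ * (⟦ 2 ≤? ∣ A ∣ ⟧ * x A)) ≤ 2 * T
      each A with ⟦⟧-cases (2 ≤? ∣ A ∣)
      ... | inj₁ (2≤ , e) = subst (λ z → 2 * (x ⊥ * z) ≤ 2 * T) (sym (trans (cong (_* x A) e) (*-identityˡ (x A)))) (cross A 2≤)
      ... | inj₂ (_ , e)  = subst (λ z → 2 * z ≤ 2 * T) (sym (trans (cong (λ z → x ⊥ * (z * x A)) e) (*-zeroʳ (x ⊥)))) z≤n

    S₂²≤ : S₂ * S₂ ≤ 2 ^ r * T
    S₂²≤ = ≤-trans ([∑]²≤len*∑² (allSubsets r) _) (≤-trans (≤-reflexive (cong (_* ∑ (allSubsets r) sq) len)) (*-monoʳ-≤ (2 ^ r) (∑-mono (allSubsets r) each)))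
      where
      sq : Subset r → ℕ
      sq A = ⟦ 2 ≤? ∣ A ∣ ⟧ * x A * (⟦ 2 ≤? ∣ A ∣ ⟧ * x A)
      each : ∀ A → sq A ≤ ⟦ 1 ≤? ∣ A ∣ ⟧ * monomial A
      each A with ⟦⟧-cases (2 ≤? ∣ A ∣)
      ... | inj₂ (_ , e)  = ≤-trans (≤-reflexive (cong (λ z → z * x A * (z * x A)) e)) z≤n
      ... | inj₁ (2≤ , e) = begin
        sq A                                   ≡⟨ cong (λ z → z * x A * (z * x A)) e ⟩
        1 * x A * (1 * x A)                    ≡⟨ cong₂ _*_ (*-identityˡ (x A)) (*-identityˡ (x A)) ⟩
        x A * x A                              ≤⟨ x²≤ A ⟩
        monomial A                             ≡⟨ *-identityˡ (monomial A) ⟨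
        1 * monomial A                         ≡⟨ cong (_* monomial A) (⟦yes⟧ (1 ≤? ∣ A ∣) (≤-trans (n≤1+n 1) 2≤)) ⟨
        ⟦ 1 ≤? ∣ A ∣ ⟧ * monomial A            ∎
        where open ≤-Reasoning

    split : ∑ (allSubsets r) (λ A → ⟦ ¬? (∣ A ∣ ≟ 1) ⟧ * x A) ≡ x ⊥ + S₂
    split = trans (S.fold-cong (allSubsets r) each) (trans (S.fold-∙ (allSubsets r) _ _) (cong (_+ S₂) (∑-size-zero r x)))
      where
      each : ∀ A → ⟦ ¬? (∣ A ∣ ≟ 1) ⟧ * x A ≡ ⟦ ∣ A ∣ ≟ 0 ⟧ * x A + ⟦ 2 ≤? ∣ A ∣ ⟧ * x A
      each A with ∣ A ∣
      ... | 0           = sym (+-identityʳ _)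
      ... | 1           = refl
      ... | suc (suc _) = refl

    two-point : ∑ (allSubsets r) (λ A → ⟦ ¬? (∣ A ∣ ≟ 1) ⟧ * x A) * ∑ (allSubsets r) (λ A → ⟦ ¬? (∣ A ∣ ≟ 1) ⟧ * x A) ≤
      ∏ (allFin r) (λ p → Λ * a inside p + a outside p)
    two-point = begin
      ∑ (allSubsets r) (λ A → ⟦ ¬? (∣ A ∣ ≟ 1) ⟧ * x A) * ∑ (allSubsets r) (λ A → ⟦ ¬? (∣ A ∣ ≟ 1) ⟧ * x A)    ≡⟨ cong₂ _*_ split split ⟩
      (x ⊥ + S₂) * (x ⊥ + S₂)                                        ≡⟨ l₁ (x ⊥) S₂ ⟩
      x ⊥ * x ⊥ + (2 * (x ⊥ * S₂) + S₂ * S₂)                         ≤⟨ +-mono-≤ (x²≤ ⊥) (+-mono-≤ 2x⊥S₂≤ S₂²≤) ⟩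
      monomial ⊥ + (2 ^ r * (2 * T) + 2 ^ r * T)                     ≡⟨ cong (monomial ⊥ +_) (l₂ (2 ^ r) T) ⟩
      monomial ⊥ + Λ * T                                             ≡⟨ cong₂ _+_ (sym (∑-size-zero r monomial)) (sym (∑-*ˡ (allSubsets r) Λ _)) ⟩
      ∑ (allSubsets r) (λ A → ⟦ ∣ A ∣ ≟ 0 ⟧ * monomial A) + ∑ (allSubsets r) (λ A → Λ * (⟦ 1 ≤? ∣ A ∣ ⟧ * monomial A))   ≡⟨ S.fold-∙ (allSubsets r) _ _ ⟨
      ∑ (allSubsets r) (λ A → ⟦ ∣ A ∣ ≟ 0 ⟧ * monomial A + Λ * (⟦ 1 ≤? ∣ A ∣ ⟧ * monomial A))  ≤⟨ ∑-mono (allSubsets r) each ⟩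
      ∑ (allSubsets r) (λ A → Λ ^ ∣ A ∣ * monomial A)                ≡⟨ S.fold-cong (allSubsets r) (λ A → scaled r A a) ⟩
      ∑ (allSubsets r) (λ A → ∏ (allFin r) (λ p → b (lookup A p) p)) ≡⟨ ∏-binary r b ⟨
      ∏ (allFin r) (λ p → Λ * a inside p + a outside p)              ∎
      where
      open ≤-Reasoning
      l₁ : ∀ x s → (x + s) * (x + s) ≡ x * x + (2 * (x * s) + s * s)
      l₁ = solve-∀
      l₂ : ∀ p t → p * (2 * t) + p * t ≡ 3 * p * t
      l₂ = solve-∀
      b : Bool → Fin r → ℕ
      b c p = if c then Λ * a inside p else a outside p
      Λ≥1 : 1 ≤ Λ
      Λ≥1 = *-mono-≤ {1} {3} {1} {2 ^ r} (s≤s z≤n) (m^n>0 2 r)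
      each : ∀ A → ⟦ ∣ A ∣ ≟ 0 ⟧ * monomial A + Λ * (⟦ 1 ≤? ∣ A ∣ ⟧ * monomial A) ≤ Λ ^ ∣ A ∣ * monomial A
      each A with ∣ A ∣
      ... | zero  = ≤-reflexive (trans (cong (1 * monomial A +_) (*-zeroʳ Λ)) (+-identityʳ (1 * monomial A)))
      ... | suc c = ≤-trans (≤-reflexive (cong (Λ *_) (*-identityˡ (monomial A)))) (*-monoˡ-≤ (monomial A) (≤-trans (≤-reflexive (sym (*-identityʳ Λ))) (*-monoʳ-≤ Λ (≤-trans (≤-reflexive (sym (^-zeroˡ c))) (^-monoˡ-≤ c Λ≥1)))))
      scaled : ∀ r (A : Subset r) (a : Bool → Fin r → ℕ) → Λ ^ ∣ A ∣ * ∏ (allFin r) (λ p → a (lookup A p) p) ≡ ∏ (allFin r) (λ p → (if lookup A p then Λ * a inside p else a outside p))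
      scaled zero    []          a = refl
      scaled (suc r) (true ∷ A)  a = trans (cong (Λ * Λ ^ ∣ A ∣ *_) (P.fold-allFin r {λ p → a (lookup (true ∷ A) p) p})) (trans (l Λ (Λ ^ ∣ A ∣) (a inside zero) (∏ (allFin r) (λ p → a (lookup A p) (suc p)))) (trans (cong (Λ * a inside zero *_) (scaled r A (λ b → a b ∘ suc))) (sym (P.fold-allFin r {λ p → if lookup (true ∷ A) p then Λ * a inside p else a outside p}))))
        where
        l : ∀ x y z w → x * y * (z * w) ≡ x * z * (y * w)
        l = solve-∀
      scaled (suc r) (false ∷ A) a = trans (cong (Λ ^ ∣ A ∣ *_) (P.fold-allFin r {λ p → a (lookup (false ∷ A) p) p})) (trans (l (Λ ^ ∣ A ∣) (a outside zero) (∏ (allFin r) (λ p → a (lookup A p) (suc p)))) (trans (cong (a outside zero *_) (scaled r A (λ b → a b ∘ suc))) (sym (P.fold-allFin r {λ p → if lookup (false ∷ A) p then Λ * a inside p else a outside p}))))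
        where
        l : ∀ y z w → y * (z * w) ≡ z * (y * w)
        l = solve-∀

  norm : ∀ {n} → ℕ → (Subset n → ℕ) → ℕ
  norm Λ f = ∑ (allSubsets _) (λ U → Λ ^ ∣ U ∣ * (f U * f U))

  weightedTuples : ∀ {n r} → (Fin r → Subset n → ℕ) → ℕ
  weightedTuples {n} {r} f = ∑ (vecs (allSubsets n) r) (λ Us → noLone Us * ∏ (allFin r) (λ p → f p (lookup Us p)))

  map-head-zip : ∀ {n r} (A : Subset r) (Us : Vec (Subset n) r) → Vec.map Vec.head (zipWith _∷_ A Us) ≡ A
  map-head-zip []      []       = refl
  map-head-zip (b ∷ A) (U ∷ Us) = cong (b ∷_) (map-head-zip A Us)

  map-tail-zip : ∀ {n r} (A : Subset r) (Us : Vec (Subset n) r) → Vec.map Vec.tail (zipWith _∷_ A Us) ≡ Us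
  map-tail-zip []      []       = refl
  map-tail-zip (b ∷ A) (U ∷ Us) = cong (U ∷_) (map-tail-zip A Us)

  weightedTuples² : ∀ n {r} (f : Fin r → Subset n → ℕ) → weightedTuples f * weightedTuples f ≤ ∏ (allFin r) (λ p → norm (3 * 2 ^ r) (f p))
  weightedTuples² zero {r} f = ≤-reflexive (begin
    weightedTuples f * weightedTuples f                                       ≡⟨ cong₂ _*_ flat flat ⟩
    ∏ (allFin r) (λ p → f p [] + 0) * ∏ (allFin r) (λ p → f p [] + 0)         ≡⟨ P.fold-∙ (allFin r) _ _ ⟨
    ∏ (allFin r) (λ p → (f p [] + 0) * (f p [] + 0))                          ≡⟨ P.fold-cong (allFin r) (λ p → l (f p [])) ⟩
    ∏ (allFin r) (λ p → norm (3 * 2 ^ r) (f p))                               ∎)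
    where
    open ≡-Reasoning
    l : ∀ x → (x + 0) * (x + 0) ≡ 1 * (x * x) + 0
    l = solve-∀
    flat : weightedTuples f ≡ ∏ (allFin r) (λ p → f p [] + 0)
    flat = trans (S.fold-cong (vecs (allSubsets 0) r) (λ Us → *-identityˡ _)) (sym (∏∑ (allSubsets 0) r f))
  weightedTuples² (suc n) {r} f = begin
    weightedTuples f * weightedTuples f                                                  ≡⟨ cong₂ _*_ split split ⟩
    ∑ (allSubsets r) (λ A → ⟦ ¬? (∣ A ∣ ≟ 1) ⟧ * x A) * ∑ (allSubsets r) (λ A → ⟦ ¬? (∣ A ∣ ≟ 1) ⟧ * x A)   ≤⟨ TwoPoint.two-point a x (λ A → weightedTuples² n (λ p U → f p (lookup A p ∷ U))) ⟩
    ∏ (allFin r) (λ p → Λ * a inside p + a outside p)                                    ≡⟨ P.fold-cong (allFin r) normSplit ⟩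
    ∏ (allFin r) (λ p → norm Λ (f p))                                                    ∎
    where
    open ≤-Reasoning
    Λ = 3 * 2 ^ r
    x : Subset r → ℕ
    x A = weightedTuples (λ p U → f p (lookup A p ∷ U))
    a : Bool → Fin r → ℕ
    a b p = norm Λ (λ U → f p (b ∷ U))
    split : weightedTuples f ≡ ∑ (allSubsets r) (λ A → ⟦ ¬? (∣ A ∣ ≟ 1) ⟧ * x A)
    split = trans (∑-tuples n r _) (S.fold-cong (allSubsets r) (λ A → trans (S.fold-cong (vecs (allSubsets n) r) (λ Us →
        trans (cong₂ _*_ (cong₂ (λ B Vs → ⟦ ¬? (∣ B ∣ ≟ 1) ⟧ * noLone Vs) (map-head-zip A Us) (map-tail-zip A Us))
                         (P.fold-cong (allFin r) (λ p → cong (f p) (Vec.lookup-zipWith _∷_ p A Us))))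
              (*-assoc ⟦ ¬? (∣ A ∣ ≟ 1) ⟧ (noLone Us) _)))
      (∑-*ˡ (vecs (allSubsets n) r) ⟦ ¬? (∣ A ∣ ≟ 1) ⟧ _)))
    normSplit : ∀ p → Λ * a inside p + a outside p ≡ norm Λ (f p)
    normSplit p = trans (cong (_+ a outside p) (trans (sym (∑-*ˡ (allSubsets n) Λ _)) (S.fold-cong (allSubsets n) (λ U → sym (*-assoc Λ (Λ ^ ∣ U ∣) _))))) (sym (S.fold-allSubsets n))

  square-cancel-≤ : ∀ {a b} → a * a ≤ b * b → a ≤ b
  square-cancel-≤ {a} {b} le = ≮⇒≥ λ lt → <⇒≱ (*-mono-< lt lt) le

  weightedTuples-bound : ∀ {n k r} → r ≡ k + k → ∀ h μ (f : Fin r → Subset n → ℕ) → (∀ p U → f p U ≡ 0 ⊎ f p U ≡ 1 × ∣ U ∣ ≤ h) → (∀ p → ∑ (allSubsets n) (f p) ≤ μ) →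
    weightedTuples f ≤ ((3 * 2 ^ (k + k)) ^ h * μ) ^ k
  weightedTuples-bound {n} {k} refl h μ f f01 sum≤ = square-cancel-≤ (begin
    weightedTuples f * weightedTuples f                ≤⟨ weightedTuples² n f ⟩
    ∏ (allFin (k + k)) (λ p → norm Λ (f p))            ≤⟨ ∏-mono (allFin (k + k)) normBound ⟩
    ∏ (allFin (k + k)) (λ p → Λ ^ h * μ)               ≡⟨ ∏-constⁿ (allFin (k + k)) (Λ ^ h * μ) ⟩
    (Λ ^ h * μ) ^ length (allFin (k + k))              ≡⟨ cong ((Λ ^ h * μ) ^_) (length-tabulate {n = k + k} id) ⟩
    (Λ ^ h * μ) ^ (k + k)                              ≡⟨ ^-distribˡ-+-* (Λ ^ h * μ) k k ⟩
    (Λ ^ h * μ) ^ k * (Λ ^ h * μ) ^ k                  ∎)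
    where
    open import Data.List.Properties using (length-tabulate)
    open import Function.Base using (id)
    open ≤-Reasoning
    Λ = 3 * 2 ^ (k + k)
    Λ≥1 : 1 ≤ Λ
    Λ≥1 = *-mono-≤ {1} {3} {1} {2 ^ (k + k)} (s≤s z≤n) (m^n>0 2 (k + k))
    ^-monoʳ : ∀ {a b} → a ≤ b → Λ ^ a ≤ Λ ^ b
    ^-monoʳ {a} a≤b with c , refl ← m≤n⇒∃[o]m+o≡n a≤b = ≤-trans (≤-reflexive (sym (*-identityʳ (Λ ^ a)))) (≤-trans (*-monoʳ-≤ (Λ ^ a) (≤-trans (≤-reflexive (sym (^-zeroˡ c))) (^-monoˡ-≤ c Λ≥1))) (≤-reflexive (sym (^-distribˡ-+-* Λ a c))))
    normBound : ∀ p → norm Λ (f p) ≤ Λ ^ h * μ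
    normBound p = ≤-trans (∑-mono (allSubsets n) each) (≤-trans (≤-reflexive (∑-*ˡ (allSubsets n) (Λ ^ h) (f p))) (*-monoʳ-≤ (Λ ^ h) (sum≤ p)))
      where
      each : ∀ U → Λ ^ ∣ U ∣ * (f p U * f p U) ≤ Λ ^ h * f p U
      each U with f01 p U
      ... | inj₁ e rewrite e = ≤-reflexive (trans (*-zeroʳ (Λ ^ ∣ U ∣)) (sym (*-zeroʳ (Λ ^ h))))
      ... | inj₂ (e , U≤h) rewrite e = *-monoˡ-≤ 1 (^-monoʳ U≤h)

module Second where

  open Big
  open Hash
  open Codes
  open Moments
  open Count
  open import Defs using (allSubsets; _≟ₛ_)
  open import Data.Bool.Base using (true; false; if_then_else_)
  open import Data.Fin.Base as Fin using (Fin; zero; suc)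
  import Data.Fin.Properties as Fin
  open import Data.Fin.Subset using (Subset; inside; outside; ⁅_⁆; ⊥; ∣_∣) renaming (_∈_ to _∈ₛ_)
  open import Data.Fin.Subset.Properties using (_∈?_; ∣p∣≤n)
  open import Data.Integer.Base as ℤ using (ℤ; 0ℤ; 1ℤ) renaming (_+_ to _+ᶻ_; _*_ to _*ᶻ_)
  import Data.Integer.Properties as ℤ
  open import Data.List.Base as List using (List; []; _∷_; _++_; map; filter; length; allFin; concatMap)
  import Data.List.Properties as List
  open import Data.List.Membership.Propositional.Properties
  open import Data.Nat.Base as ℕ using (ℕ; zero; suc; _+_; _*_; _^_; _≤_; _<_; z≤n)
  import Data.Nat.Properties as ℕ
  open import Data.Product.Base using (∃-syntax; _×_; _,_; proj₁; proj₂)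
  open import Data.Sum.Base using (_⊎_; inj₁; inj₂)
  open import Data.Vec.Base as Vec using (Vec; []; _∷_; lookup)
  import Data.Vec.Properties as Vec
  open import Function.Base using (_∘_; id)
  open import Relation.Binary.PropositionalEquality
  open import Relation.Nullary.Decidable using (Dec; yes; no; does; dec-true)
  open import Relation.Nullary.Negation using (contradiction)
  open ℤΣ

  private variable
    A : Set

  ∣∑∣≤ : ∀ (xs : List A) (f : A → ℤ) → ℤ.∣ ∑ xs f ∣ ≤ ℕΣ.∑ xs (λ x → ℤ.∣ f x ∣)
  ∣∑∣≤ []       f = z≤n
  ∣∑∣≤ (x ∷ xs) f = ℕ.≤-trans (ℤ.∣i+j∣≤∣i∣+∣j∣ (f x) (∑ xs f)) (ℕ.+-monoʳ-≤ ℤ.∣ f x ∣ (∣∑∣≤ xs f))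

  ∣∏∣ : ∀ (xs : List A) (f : A → ℤ) → ℤ.∣ ∏ xs f ∣ ≡ ℕΣ.∏ xs (λ x → ℤ.∣ f x ∣)
  ∣∏∣ []       f = refl
  ∣∏∣ (x ∷ xs) f = trans (ℤ.abs-* (f x) (∏ xs f)) (cong (ℤ.∣ f x ∣ *_) (∣∏∣ xs f))

  pos-∑ : ∀ (xs : List A) (f : A → ℕ) → ℤ.+ ℕΣ.∑ xs f ≡ ∑ xs (λ x → ℤ.+ f x)
  pos-∑ []       f = refl
  pos-∑ (x ∷ xs) f = trans (ℤ.pos-+ (f x) (ℕΣ.∑ xs f)) (cong (_+ᶻ_ (ℤ.+ f x)) (pos-∑ xs f))

  pos-∏ : ∀ (xs : List A) (f : A → ℕ) → ℤ.+ ℕΣ.∏ xs f ≡ ∏ xs (λ x → ℤ.+ f x)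
  pos-∏ []       f = refl
  pos-∏ (x ∷ xs) f = trans (ℤ.pos-* (f x) (ℕΣ.∏ xs f)) (cong (ℤ.+ f x *ᶻ_) (pos-∏ xs f))

  length-members : ∀ {n} (U : Subset n) → length (members U) ≡ ∣ U ∣
  length-members {zero}  []      = refl
  length-members {suc n} (b ∷ U) = trans (cong (λ l → length (filter (_∈? (b ∷ U)) (zero ∷ l))) (sym (List.map-tabulate id suc))) (head b)
    where
    tail : ∀ b → length (filter (_∈? (b ∷ U)) (map suc (allFin n))) ≡ ∣ U ∣
    tail b = trans (go (allFin n)) (length-members U)
      where
      go : ∀ xs → length (filter (_∈? (b ∷ U)) (map suc xs)) ≡ length (filter (_∈? U) xs)
      go []       = refl
      go (x ∷ xs) with does (x ∈? U)
      ... | true  = cong suc (go xs)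
      ... | false = go xs
    head : ∀ b → length (filter (_∈? (b ∷ U)) (zero ∷ map suc (allFin n))) ≡ ∣ b ∷ U ∣
    head true  = cong suc (tail true)
    head false = tail false

  module _ {h k : ℕ} (D : Fin k → Subset h) where
    open Table D

    ∣factor∣≤1 : ∀ u i c → ℤ.∣ factor u i c ∣ ≤ 1
    ∣factor∣≤1 u i (A , B) = ℕ.≤-trans (ℕ.≤-reflexive (trans (ℤ.abs-* ⟦ A ≟ₛ ⁅ u ⁆ ⟧ _) (cong (ℤ.∣ ⟦ A ≟ₛ ⁅ u ⁆ ⟧ ∣ *_) (ℤ.abs-* ⟦ parity u B ℤ.≟ 1ℤ ⟧ _))))
      (ℕ.*-mono-≤ (ind (A ≟ₛ ⁅ u ⁆)) (ℕ.*-mono-≤ (ind (parity u B ℤ.≟ 1ℤ)) (sgn≤ (lookup B i))))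
      where
      ind : ∀ {P : Set} (d : Dec P) → ℤ.∣ ⟦ d ⟧ ∣ ≤ 1
      ind (yes _) = ℕ.≤-refl
      ind (no _)  = z≤n
      sgn≤ : ∀ b → ℤ.∣ sgn b ∣ ≤ 1
      sgn≤ true  = ℕ.≤-refl
      sgn≤ false = ℕ.≤-refl

    ∣weight∣≤ : ∀ {n} i (ws : List (Fin n)) y → length ws ≤ h → ℤ.∣ weight i ws y ∣ ≤ suc h ^ h
    ∣weight∣≤ i ws y len = begin
      ℤ.∣ weight i ws y ∣                                                     ≡⟨ ∣∏∣ (members (D i)) _ ⟩
      ℕΣ.∏ (members (D i)) (λ u → ℤ.∣ ∑ ws (λ w → factor u i (y w)) ∣)        ≤⟨ ∏-mono (members (D i)) sum≤ ⟩
      ℕΣ.∏ (members (D i)) (λ _ → suc h)                                      ≡⟨ ∏-constⁿ (members (D i)) (suc h) ⟩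
      suc h ^ length (members (D i))                                          ≤⟨ ℕ.^-monoʳ-≤ (suc h) (ℕ.≤-trans (ℕ.≤-reflexive (length-members (D i))) (∣p∣≤n (D i))) ⟩
      suc h ^ h                                                               ∎
      where
      open ℕ.≤-Reasoning
      sum≤ : ∀ u → ℤ.∣ ∑ ws (λ w → factor u i (y w)) ∣ ≤ suc h
      sum≤ u = begin
        ℤ.∣ ∑ ws (λ w → factor u i (y w)) ∣               ≤⟨ ∣∑∣≤ ws _ ⟩
        ℕΣ.∑ ws (λ w → ℤ.∣ factor u i (y w) ∣)            ≤⟨ ∑-mono ws (λ w → ∣factor∣≤1 u i (y w)) ⟩
        ℕΣ.∑ ws (λ _ → 1)                                 ≡⟨ ∑-constⁿ ws 1 ⟩
        length ws * 1                                     ≡⟨ ℕ.*-identityʳ (length ws) ⟩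
        length ws                                         ≤⟨ len ⟩
        h                                                 ≤⟨ ℕ.n≤1+n h ⟩
        suc h                                             ∎

    -- The mean of the factors of u over a whole star counts the codes of colour u
    -- whose signs at u have product 1.
    module _ (1≤deg : ∀ u → ∃[ i ] u ∈ₛ D i) where

      starCount : Fin h → ℕ
      starCount u = ℕΣ.∑ codes (λ (A , B) → ℕΣ.⟦ A ≟ₛ ⁅ u ⁆ ⟧ * ℕΣ.⟦ parity u B ℤ.≟ 1ℤ ⟧)

      star-indicator : ∀ u c → star u c ≡ ℤ.+ (ℕΣ.⟦ proj₁ c ≟ₛ ⁅ u ⁆ ⟧ * ℕΣ.⟦ parity u (proj₂ c) ℤ.≟ 1ℤ ⟧)
      star-indicator u (A , B) with i , u∈ ← 1≤deg u = go (A ≟ₛ ⁅ u ⁆) (parity u B ℤ.≟ 1ℤ) refl refl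
        where
        vanish : factor u i (A , B) ≡ 0ℤ → star u (A , B) ≡ 0ℤ
        vanish e = ∏-zero∈ (allFin k) (∈-allFin i) (trans (cong (λ z → if z then factor u i (A , B) else 1ℤ) (dec-true (u ∈? D i) u∈)) e)
        go : (d : Dec (A ≡ ⁅ u ⁆)) (e : Dec (parity u B ≡ 1ℤ)) → ⟦ A ≟ₛ ⁅ u ⁆ ⟧ ≡ ⟦ d ⟧ → ⟦ parity u B ℤ.≟ 1ℤ ⟧ ≡ ⟦ e ⟧ →
          star u (A , B) ≡ ℤ.+ (ℕΣ.⟦ d ⟧ * ℕΣ.⟦ e ⟧)
        go (no A≢) e        p q = vanish (factor-colour u i B A≢)
        go (yes _) (no _)   p q = vanish (trans (cong₂ (λ x y → x *ᶻ (y *ᶻ sgn (lookup B i))) p q) (trans (ℤ.*-identityˡ _) (ℤ.*-zeroˡ (sgn (lookup B i)))))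
        go (yes _) (yes pr) p q = trans (P.fold-cong (allFin k) at) pr
          where
          at : ∀ j → (if does (u ∈? D j) then factor u j (A , B) else 1ℤ) ≡ (if does (u ∈? D j) then sgn (lookup B j) else 1ℤ)
          at j = cong (λ z → if does (u ∈? D j) then z else 1ℤ) (trans (cong₂ (λ x y → x *ᶻ (y *ᶻ sgn (lookup B j))) p q) (trans (ℤ.*-identityˡ _) (ℤ.*-identityˡ (sgn (lookup B j)))))

      ∑-star : ∀ u → ∑ codes (star u) ≡ ℤ.+ starCount u
      ∑-star u = trans (S.fold-cong codes (star-indicator u)) (sym (pos-∑ codes _))

      1≤starCount : ∀ u → 1 ≤ starCount u
      1≤starCount u = ℕ.≤-trans (ℕ.≤-reflexive (sym (cong₂ _*_ (ℕΣ.⟦yes⟧ (⁅ u ⁆ ≟ₛ ⁅ u ⁆) refl) (ℕΣ.⟦yes⟧ (parity u ⊥ ℤ.≟ 1ℤ) par))))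
        (∈⇒≤∑ (λ (A , B) → ℕΣ.⟦ A ≟ₛ ⁅ u ⁆ ⟧ * ℕΣ.⟦ parity u B ℤ.≟ 1ℤ ⟧) (∈-cartesianProduct⁺ (∈-allSubsets ⁅ u ⁆) (∈-allSubsets ⊥)))
        where
        par : parity u ⊥ ≡ 1ℤ
        par = trans (P.fold-cong (allFin k) at) (P.fold-ε (allFin k))
          where
          at : ∀ j → (if does (u ∈? D j) then sgn (lookup ⊥ j) else 1ℤ) ≡ 1ℤ
          at j rewrite Vec.lookup-replicate j outside with does (u ∈? D j)
          ... | true  = refl
          ... | false = refl

      κⁿ : ℕ
      κⁿ = ℕΣ.∏ (allFin h) starCount

      κ≡κⁿ : κ ≡ ℤ.+ κⁿ
      κ≡κⁿ = trans (P.fold-cong (allFin h) ∑-star) (sym (pos-∏ (allFin h) starCount))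

      1≤κⁿ : 1 ≤ κⁿ
      1≤κⁿ = ℕ.≤-trans (ℕ.≤-reflexive (sym (ℕΣ.P.fold-ε (allFin h)))) (∏-mono (allFin h) 1≤starCount)

  module SecondMoment {h k : ℕ} (D : Fin k → Subset h) {n : ℕ} (ℓ K e : ℕ) (n≤2^ℓ : n ≤ 2 ^ ℓ) (f : Fin k → Subset n → ℕ) where
    open Table D
    open Hashed D ℓ K e n≤2^ℓ

    counter : Fin k → (Fin n → Code) → ℤ
    counter i y = ∑ (allSubsets n) (λ U → ℤ.+ f i U *ᶻ weight i (members U) y)

    Z : (Fin n → Code) → ℤ
    Z y = ∏ (allFin k) (λ i → counter i y)

    doubled : List (Fin k)
    doubled = allFin k ++ allFin k

    r = length doubled

    r≡k+k : r ≡ k + k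
    r≡k+k = trans (List.length-++ (allFin k)) (cong₂ _+_ (List.length-tabulate {n = k} id) (List.length-tabulate {n = k} id))

    edge : Fin r → Fin k
    edge = List.lookup doubled

    Z² : ∀ y → Z y *ᶻ Z y ≡ ∑ (vecs (allSubsets n) r) (λ Us → ∏ (allFin r) (λ p → ℤ.+ f (edge p) (lookup Us p)) *ᶻ ∏ (allFin r) (λ p → weight (edge p) (members (lookup Us p)) y))
    Z² y = begin
      Z y *ᶻ Z y                                            ≡⟨ P.fold-++ (allFin k) (allFin k) ⟨
      ∏ doubled (λ i → counter i y)                         ≡⟨ P.fold-lookup doubled ⟨
      ∏ (allFin r) (λ p → counter (edge p) y)               ≡⟨ ∏∑ (allSubsets n) r _ ⟩
      ∑ (vecs (allSubsets n) r) (λ Us → ∏ (allFin r) (λ p → ℤ.+ f (edge p) (lookup Us p) *ᶻ weight (edge p) (members (lookup Us p)) y))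
                                                            ≡⟨ S.fold-cong (vecs (allSubsets n) r) (λ Us → P.fold-∙ (allFin r) _ _) ⟩
      ∑ (vecs (allSubsets n) r) (λ Us → ∏ (allFin r) (λ p → ℤ.+ f (edge p) (lookup Us p)) *ᶻ ∏ (allFin r) (λ p → weight (edge p) (members (lookup Us p)) y)) ∎
      where open ≡-Reasoning

    module _ (2≤deg : EveryDegree≥2) (f01 : ∀ i U → f i U ≡ 0 ⊎ f i U ≡ 1 × ∣ U ∣ ≡ ∣ D i ∣) (short : (k + k) * h < K) where

      T B : ℕ
      T = length (seeds K)
      B = (suc h ^ h) ^ r

      small : ∀ i (U : Subset n) → ∣ U ∣ ≡ ∣ D i ∣ → length (members U) ≤ h
      small i U eq = ℕ.≤-trans (ℕ.≤-reflexive (trans (length-members U) eq)) (∣p∣≤n (D i))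

      E-weights≤ : ∀ (Us : Vec (Subset n) r) → (∀ p → ∣ lookup Us p ∣ ≡ ∣ D (edge p) ∣) →
        ℤ.∣ E (λ y → ∏ (allFin r) (λ p → weight (edge p) (members (lookup Us p)) y)) ∣ ≤ T * B
      E-weights≤ Us sizes = ℕ.≤-trans (∣∑∣≤ (seeds K) _) (ℕ.≤-trans (∑-mono (seeds K) each) (ℕ.≤-reflexive (∑-constⁿ (seeds K) B)))
        where
        each : ∀ s → ℤ.∣ ∏ (allFin r) (λ p → weight (edge p) (members (lookup Us p)) (colours s)) ∣ ≤ B
        each s = ℕ.≤-trans (ℕ.≤-reflexive (∣∏∣ (allFin r) _)) (ℕ.≤-trans
          (∏-mono (allFin r) (λ p → ∣weight∣≤ D (edge p) (members (lookup Us p)) (colours s) (small (edge p) (lookup Us p) (sizes p))))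
          (ℕ.≤-reflexive (trans (∏-constⁿ (allFin r) (suc h ^ h)) (cong ((suc h ^ h) ^_) (List.length-tabulate {n = r} id)))))

      E-weights-lone : ∀ (Us : Vec (Subset n) r) → (∀ p → ∣ lookup Us p ∣ ≡ ∣ D (edge p) ∣) → ∀ a → ∣ Vec.map (λ U → lookup U a) Us ∣ ≡ 1 →
        E (λ y → ∏ (allFin r) (λ p → weight (edge p) (members (lookup Us p)) y)) ≡ 0ℤ
      E-weights-lone Us sizes a one with p , in′ , out ← singleton (Vec.map (λ U → lookup U a) Us) one =
        weights-mean 2≤deg r edge (lookup Us) p a
          (Vec.lookup⇒[]= a (lookup Us p) (trans (sym (Vec.lookup-map p (λ U → lookup U a) Us)) in′))
          (λ p′ p′≢p a∈ → inside≢outside (trans (sym (Vec.[]=⇒lookup a∈)) (trans (sym (Vec.lookup-map p′ (λ U → lookup U a) Us)) (out p′ p′≢p))))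
          (ℕ.≤-reflexive (trans (length-members (lookup Us p)) (trans (sizes p) (sym (length-members (D (edge p)))))))
          (ℕ.≤-<-trans (ℕ.≤-trans (len (allFin r)) (ℕ.≤-reflexive (cong (_* h) (trans (List.length-tabulate {n = r} id) r≡k+k)))) short)
        where
        inside≢outside : inside ≢ outside
        inside≢outside ()
        len : ∀ ps → length (concatMap (members ∘ lookup Us) ps) ≤ length ps * h
        len []       = z≤n
        len (p ∷ ps) = ℕ.≤-trans (ℕ.≤-reflexive (List.length-++ (members (lookup Us p)))) (ℕ.+-mono-≤ (small (edge p) (lookup Us p) (sizes p)) (len ps))

      second-moment : ∀ μ → (∀ i → ℕΣ.∑ (allSubsets n) (f i) ≤ μ) →
        ℤ.∣ E (λ y → Z y *ᶻ Z y) ∣ ≤ T * (B * ((3 * 2 ^ (k + k)) ^ h * μ) ^ k)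
      second-moment μ sum≤ = begin
        ℤ.∣ E (λ y → Z y *ᶻ Z y) ∣
          ≡⟨ cong ℤ.∣_∣ (trans (E-cong Z²) (trans (E-∑ Vs (λ Us y → ∏ (allFin r) (λ p → ℤ.+ f (edge p) (lookup Us p)) *ᶻ W Us y)) (S.fold-cong Vs (λ Us → E-* (∏ (allFin r) (λ p → ℤ.+ f (edge p) (lookup Us p))) (W Us))))) ⟩
        ℤ.∣ ∑ Vs (λ Us → ∏ (allFin r) (λ p → ℤ.+ f (edge p) (lookup Us p)) *ᶻ E (W Us)) ∣
          ≤⟨ ∣∑∣≤ Vs _ ⟩
        ℕΣ.∑ Vs (λ Us → ℤ.∣ ∏ (allFin r) (λ p → ℤ.+ f (edge p) (lookup Us p)) *ᶻ E (W Us) ∣)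
          ≤⟨ ∑-mono Vs each ⟩
        ℕΣ.∑ Vs (λ Us → (T * B) * (noLone Us * Fs Us))
          ≡⟨ ℕΣ.∑-*ˡ Vs (T * B) _ ⟩
        (T * B) * weightedTuples (f ∘ edge)
          ≤⟨ ℕ.*-monoʳ-≤ (T * B) (weightedTuples-bound {k = k} r≡k+k h μ (f ∘ edge) f01′ (sum≤ ∘ edge)) ⟩
        (T * B) * ((3 * 2 ^ (k + k)) ^ h * μ) ^ k
          ≡⟨ ℕ.*-assoc T B _ ⟩
        T * (B * ((3 * 2 ^ (k + k)) ^ h * μ) ^ k) ∎
        where
        open ℕ.≤-Reasoning
        Vs = vecs (allSubsets n) r
        W : Vec (Subset n) r → (Fin n → Code) → ℤ
        W Us y = ∏ (allFin r) (λ p → weight (edge p) (members (lookup Us p)) y)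
        Fs : Vec (Subset n) r → ℕ
        Fs Us = ℕΣ.∏ (allFin r) (λ p → f (edge p) (lookup Us p))
        f01′ : ∀ p U → f (edge p) U ≡ 0 ⊎ f (edge p) U ≡ 1 × ∣ U ∣ ≤ h
        f01′ p U with f01 (edge p) U
        ... | inj₁ e       = inj₁ e
        ... | inj₂ (e , s) = inj₂ (e , ℕ.≤-trans (ℕ.≤-reflexive s) (∣p∣≤n (D (edge p))))
        factored : ∀ Us → ℤ.∣ ∏ (allFin r) (λ p → ℤ.+ f (edge p) (lookup Us p)) *ᶻ E (W Us) ∣ ≡ Fs Us * ℤ.∣ E (W Us) ∣
        factored Us = trans (ℤ.abs-* (∏ (allFin r) (λ p → ℤ.+ f (edge p) (lookup Us p))) (E (W Us))) (cong (_* ℤ.∣ E (W Us) ∣) (cong ℤ.∣_∣ (sym (pos-∏ (allFin r) (λ p → f (edge p) (lookup Us p))))))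
        each : ∀ Us → ℤ.∣ ∏ (allFin r) (λ p → ℤ.+ f (edge p) (lookup Us p)) *ᶻ E (W Us) ∣ ≤ (T * B) * (noLone Us * Fs Us)
        each Us with Fin.any? (λ p → f (edge p) (lookup Us p) ℕ.≟ 0)
        ... | yes (p , f≡0) = ℕ.≤-trans (ℕ.≤-reflexive (trans (factored Us) (cong (_* ℤ.∣ E (W Us) ∣) (ℕΣ.∏-zero∈ (allFin r) (∈-allFin p) f≡0)))) z≤n
        ... | no none with lone Us
        ...   | inj₁ ok = ℕ.≤-trans (ℕ.≤-reflexive (factored Us)) (ℕ.≤-trans (ℕ.*-monoʳ-≤ (Fs Us) (E-weights≤ Us sizes))
                (ℕ.≤-reflexive (trans (ℕ.*-comm (Fs Us) (T * B)) (cong (T * B *_) (trans (sym (ℕ.*-identityˡ (Fs Us))) (cong (_* Fs Us) (sym ok)))))))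
          where
          sizes : ∀ p → ∣ lookup Us p ∣ ≡ ∣ D (edge p) ∣
          sizes p with f01 (edge p) (lookup Us p)
          ... | inj₁ e       = contradiction (p , e) none
          ... | inj₂ (_ , s) = s
        ...   | inj₂ (_ , a , one) = ℕ.≤-trans (ℕ.≤-reflexive (trans (factored Us) (trans (cong (λ z → Fs Us * ℤ.∣ z ∣) (E-weights-lone Us sizes a one)) (ℕ.*-zeroʳ (Fs Us))))) z≤n
          where
          sizes : ∀ p → ∣ lookup Us p ∣ ≡ ∣ D (edge p) ∣
          sizes p with f01 (edge p) (lookup Us p)
          ... | inj₁ e       = contradiction (p , e) none
          ... | inj₂ (_ , s) = s

module Graph where

  open Big
  open Enum
  open Codes
  open Moments using (Injective; injective?)
  open Count
  open Second using (pos-∑)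
  open import Defs using (Hypergraph; edges; unique; size; #; IsIso; isIso?; IsOccurrence; isOccurrence?; image; allSubsets; sublists; _≟ₛ_; _∈ᴱ_; _∈ᴱ?_)
  open import Data.Bool.Base using (true; false)
  open import Data.Fin.Base as Fin using (Fin; zero; suc)
  import Data.Fin.Properties as Fin
  open import Data.Fin.Subset using (Subset; _∈_; _∉_; _⊆_; ⊤; ∣_∣)
  open import Data.Fin.Subset.Properties using (_∈?_; _⊆?_; ∈⊤; ⊆-antisym; p⊆q⇒∣p∣≤∣q∣; drop-∷-⊆)
  open import Data.Integer.Base as ℤ using (ℤ; 0ℤ; 1ℤ) renaming (_+_ to _+ᶻ_; _*_ to _*ᶻ_)
  import Data.Integer.Properties as ℤ
  open import Data.List.Base as List using (List; []; _∷_; map; filter; length; allFin; cartesianProduct)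
  import Data.List.Properties as List
  import Data.List.Membership.Propositional as L
  open import Data.List.Membership.Propositional.Properties using (∈-map⁺; ∈-map⁻; ∈-filter⁺; ∈-filter⁻; ∈-++⁻; ∈-allFin; ∈-lookup)
  open import Data.List.Relation.Unary.Any using (here; there; index)
  open import Data.List.Relation.Unary.Any.Properties using (lookup-index)
  open import Data.List.Relation.Unary.All as All using (All; []; _∷_)
  open import Data.List.Relation.Unary.Unique.Propositional using (Unique; []; _∷_)
  open import Data.Nat.Base as ℕ using (ℕ; zero; suc; _+_; _*_; _^_; _≤_; z≤n)
  import Data.Nat.Properties as ℕ
  open import Data.Product.Base using (∃-syntax; _×_; _,_; proj₁; proj₂)
  open import Data.Sum.Base using (_⊎_; inj₁; inj₂)
  open import Data.Vec.Base as Vec using (Vec; []; _∷_; lookup; tabulate; here; there)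
  import Data.Vec.Properties as Vec
  open import Function.Base using (_∘_)
  open import Relation.Binary.PropositionalEquality
  open import Relation.Nullary.Decidable using (Dec; yes; no; does; _×-dec_; dec-true)
  open import Relation.Nullary.Negation using (¬_; contradiction)
  open import Relation.Unary using (Decidable)
  open ℤΣ

  private variable
    A : Set

  ∈-image⁺ : ∀ {t n} (φ : Vec (Fin n) t) {D u} → u ∈ D → lookup φ u ∈ image φ D
  ∈-image⁺ φ {D} {u} u∈ = Vec.lookup⇒[]= _ (image φ D) (trans (Vec.lookup∘tabulate _ (lookup φ u))
    (dec-true (Fin.any? λ u′ → u′ ∈? D ×-dec lookup φ u′ Fin.≟ lookup φ u) (u , u∈ , refl)))

  ∈-image⁻ : ∀ {t n} (φ : Vec (Fin n) t) {D v} → v ∈ image φ D → ∃[ u ] u ∈ D × lookup φ u ≡ v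
  ∈-image⁻ φ {D} {v} v∈ with Fin.any? (λ u → u ∈? D ×-dec lookup φ u Fin.≟ v) | trans (sym (Vec.lookup∘tabulate _ v)) (Vec.[]=⇒lookup v∈)
  ... | yes p | _ = p

  image-injective : ∀ {t n} (φ : Vec (Fin n) t) → Injective φ → ∀ {D D′} → image φ D ≡ image φ D′ → D ≡ D′
  image-injective φ inj {D} {D′} eq = ⊆-antisym (half eq) (half (sym eq))
    where
    half : ∀ {D D′} → image φ D ≡ image φ D′ → D ⊆ D′
    half {D} {D′} eq {u} u∈ with u′ , u′∈ , e ← ∈-image⁻ φ (subst (lookup φ u ∈_) eq (∈-image⁺ φ u∈)) = subst (_∈ D′) (inj u′ u e) u′∈

  ∈-image-inj : ∀ {t n} (φ : Vec (Fin n) t) → Injective φ → ∀ {D u} → lookup φ u ∈ image φ D → u ∈ D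
  ∈-image-inj φ inj {D} {u} m with u′ , u′∈ , e ← ∈-image⁻ φ m = subst (_∈ D) (inj u′ u e) u′∈

  ⊆∧∣≡∣⇒≡ : ∀ {n} {p q : Subset n} → p ⊆ q → ∣ p ∣ ≡ ∣ q ∣ → p ≡ q
  ⊆∧∣≡∣⇒≡ {p = []}        {[]}        p⊆q eq = refl
  ⊆∧∣≡∣⇒≡ {p = true ∷ p}  {true ∷ q}  p⊆q eq = cong (true ∷_) (⊆∧∣≡∣⇒≡ (drop-∷-⊆ p⊆q) (ℕ.suc-injective eq))
  ⊆∧∣≡∣⇒≡ {p = false ∷ p} {false ∷ q} p⊆q eq = cong (false ∷_) (⊆∧∣≡∣⇒≡ (drop-∷-⊆ p⊆q) eq)
  ⊆∧∣≡∣⇒≡ {p = true ∷ p}  {false ∷ q} p⊆q eq with () ← p⊆q here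
  ⊆∧∣≡∣⇒≡ {p = false ∷ p} {true ∷ q}  p⊆q eq = contradiction (p⊆q⇒∣p∣≤∣q∣ (drop-∷-⊆ p⊆q)) (ℕ.<⇒≱ (ℕ.≤-reflexive (sym eq)))

  ∣∣-as-∑ : ∀ {n} (U : Subset n) → ℤ.+ ∣ U ∣ ≡ ∑ (allFin n) (λ v → ⟦ v ∈? U ⟧)
  ∣∣-as-∑ {zero}  []          = refl
  ∣∣-as-∑ {suc n} (true ∷ U)  = trans (cong (_+ᶻ_ 1ℤ) (∣∣-as-∑ U)) (sym (S.fold-allFin n {λ v → ⟦ v ∈? (true ∷ U) ⟧}))
  ∣∣-as-∑ {suc n} (false ∷ U) = trans (∣∣-as-∑ U) (sym (trans (S.fold-allFin n {λ v → ⟦ v ∈? (false ∷ U) ⟧}) (ℤ.+-identityˡ _)))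

  ∣image∣ : ∀ {t n} (φ : Vec (Fin n) t) → Injective φ → ∀ D → ∣ image φ D ∣ ≡ ∣ D ∣
  ∣image∣ {t} {n} φ inj D = ℤ.+-injective (begin
    ℤ.+ ∣ image φ D ∣                                 ≡⟨ ∣∣-as-∑ (image φ D) ⟩
    ∑ (allFin n) (λ v → ⟦ v ∈? image φ D ⟧)           ≡⟨ reindex (allFin t) (allFin n) Fin._≟_ Fin._≟_ (enumerates-allFin t) (enumerates-allFin n) (lookup φ) (inj _ _) _ support ⟩
    ∑ (allFin t) (λ u → ⟦ lookup φ u ∈? image φ D ⟧)  ≡⟨ S.fold-cong (allFin t) (λ u → ⟦⇔⟧ (lookup φ u ∈? image φ D) (u ∈? D) (∈-image-inj φ inj) (∈-image⁺ φ)) ⟩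
    ∑ (allFin t) (λ u → ⟦ u ∈? D ⟧)                   ≡⟨ ∣∣-as-∑ D ⟨
    ℤ.+ ∣ D ∣                                         ∎)
    where
    open ≡-Reasoning
    support : ∀ v → ⟦ v ∈? image φ D ⟧ ≡ 0ℤ ⊎ ∃[ u ] lookup φ u ≡ v
    support v with v ∈? image φ D
    ... | yes v∈ = inj₂ (let u , _ , e = ∈-image⁻ φ v∈ in u , e)
    ... | no v∉  = inj₁ refl

  ∏-⟦⟧ : ∀ {P : A → Set} (P? : Decidable P) (xs : List A) → ((∀ {x} → x L.∈ xs → P x) × ∏ xs (λ x → ⟦ P? x ⟧) ≡ 1ℤ) ⊎ (∃[ x ] x L.∈ xs × ¬ P x) × ∏ xs (λ x → ⟦ P? x ⟧) ≡ 0ℤ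
  ∏-⟦⟧ P? []       = inj₁ ((λ ()) , refl)
  ∏-⟦⟧ P? (x ∷ xs) with P? x | ∏-⟦⟧ P? xs
  ... | no ¬p | _               = inj₂ ((x , here refl , ¬p) , ℤ.*-zeroˡ (∏ xs (λ x → ⟦ P? x ⟧)))
  ... | yes p | inj₁ (all , e)  = inj₁ ((λ { (here refl) → p ; (there m) → all m }) , trans (ℤ.*-identityˡ _) e)
  ... | yes p | inj₂ ((y , y∈ , ¬py) , e) = inj₂ ((y , there y∈ , ¬py) , trans (ℤ.*-identityˡ _) e)

  length-filter-∑ : ∀ {P : A → Set} (P? : Decidable P) xs → ℤ.+ length (filter P? xs) ≡ ∑ xs (λ x → ⟦ P? x ⟧)
  length-filter-∑ P? []       = refl
  length-filter-∑ P? (x ∷ xs) with does (P? x)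
  ... | true  = cong (_+ᶻ_ 1ℤ) (length-filter-∑ P? xs)
  ... | false = trans (length-filter-∑ P? xs) (sym (ℤ.+-identityˡ _))

  ∈-sublists : ∀ {xs : List A} {F e} → F L.∈ sublists xs → e L.∈ F → e L.∈ xs
  ∈-sublists {xs = []}     (here refl) ()
  ∈-sublists {xs = x ∷ xs} F∈ e∈ with ∈-++⁻ (map (x ∷_) (sublists xs)) F∈
  ... | inj₂ F∈′ = there (∈-sublists F∈′ e∈)
  ... | inj₁ F∈′ with F′ , F′∈ , refl ← ∈-map⁻ (x ∷_) F∈′ with e∈
  ...   | here refl = here refl
  ...   | there e∈′ = there (∈-sublists F′∈ e∈′)

  module _ {P : A → Set} (P? : Decidable P) where

    sublist≡filter : ∀ {xs F} → Unique xs → F L.∈ sublists xs → (∀ {e} → e L.∈ xs → e L.∈ F → P e) → (∀ {e} → e L.∈ xs → P e → e L.∈ F) → F ≡ filter P? xs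
    sublist≡filter {[]} u (here refl) to from = refl
    sublist≡filter {x ∷ xs} (x∉ ∷ u) F∈ to from with ∈-++⁻ (map (x ∷_) (sublists xs)) F∈
    ... | inj₁ F∈′ with F′ , F′∈ , refl ← ∈-map⁻ (x ∷_) F∈′ =
      trans (cong (x ∷_) (sublist≡filter u F′∈ (λ e∈ e∈F → to (there e∈) (there e∈F)) from′)) (sym (List.filter-accept P? (to (here refl) (here refl))))
      where
      from′ : ∀ {e} → e L.∈ xs → P e → e L.∈ F′
      from′ e∈ p with from (there e∈) p
      ... | here refl = contradiction refl (All.lookup x∉ e∈)
      ... | there m   = m
    ... | inj₂ F∈′ = trans (sublist≡filter u F∈′ (λ e∈ → to (there e∈)) (λ e∈ → from (there e∈)))
      (sym (List.filter-reject P? (λ px → contradiction refl (All.lookup x∉ (∈-sublists F∈′ (from (here refl) px))))))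

  module _ (_≟_ : ∀ (x y : List A) → Dec (x ≡ y)) {P : A → Set} (P? : Decidable P) where

    ∑-sublists : ∀ {xs : List A} → Unique xs → ∑ (sublists xs) (λ F → ⟦ F ≟ filter P? xs ⟧) ≡ 1ℤ
    ∑-sublists {[]} u = trans (ℤ.+-identityʳ _) (⟦yes⟧ ([] ≟ []) refl)
    ∑-sublists {x ∷ xs} (x∉ ∷ u) = trans (S.fold-++ (map (x ∷_) (sublists xs)) (sublists xs)) (trans (cong (_+ᶻ ∑ (sublists xs) (λ F → ⟦ F ≟ filter P? (x ∷ xs) ⟧)) (S.fold-map (x ∷_) (sublists xs))) (go (P? x)))
      where
      x∉filter : ∀ {F} → x L.∈ F → ¬ F ≡ filter P? xs
      x∉filter x∈ refl = contradiction refl (All.lookup x∉ (proj₁ (∈-filter⁻ P? {xs = xs} x∈)))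
      go : Dec (P x) → ∑ (sublists xs) (λ F → ⟦ (x ∷ F) ≟ filter P? (x ∷ xs) ⟧) +ᶻ ∑ (sublists xs) (λ F → ⟦ F ≟ filter P? (x ∷ xs) ⟧) ≡ 1ℤ
      go (yes px) rewrite List.filter-accept P? {xs = xs} px = trans (cong₂ _+ᶻ_
        (trans (S.fold-cong (sublists xs) (λ F → ⟦⇔⟧ ((x ∷ F) ≟ (x ∷ filter P? xs)) (F ≟ filter P? xs) List.∷-injectiveʳ (cong (x ∷_)))) (∑-sublists u))
        (trans (S.fold-cong∈ (sublists xs) (λ {F} F∈ → ⟦no⟧ (F ≟ (x ∷ filter P? xs)) (λ { refl → contradiction refl (All.lookup x∉ (∈-sublists F∈ (here refl))) }))) (S.fold-ε (sublists xs))))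
        (ℤ.+-identityʳ 1ℤ)
      go (no ¬px) rewrite List.filter-reject P? {xs = xs} ¬px = trans (cong₂ _+ᶻ_
        (trans (S.fold-cong (sublists xs) (λ F → ⟦no⟧ ((x ∷ F) ≟ filter P? xs) (x∉filter (here refl)))) (S.fold-ε (sublists xs)))
        (∑-sublists u)) (ℤ.+-identityˡ 1ℤ)

  ∈-edge : ∀ {t} (H : Hypergraph t) {D} → D ∈ᴱ edges H → ∃[ i ] List.lookup (edges H) i ≡ D
  ∈-edge H m = index m , sym (lookup-index m)

  edgeOf : ∀ {t} (H : Hypergraph t) → Fin (size H) → Subset t
  edgeOf H = List.lookup (edges H)

  automorphisms : ∀ {t} → Hypergraph t → ℕ
  automorphisms {t} H = length (filter (isIso? H ⊤ (edges H)) (vecs (allFin t) t))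

  module _ {t n : ℕ} (H : Hypergraph t) (G : Hypergraph n) where

    present : Fin (size H) → Subset n → ℕ
    present i U = ℕΣ.⟦ U ∈ᴱ? edges G ⟧ * ℕΣ.⟦ ∣ U ∣ ℕ.≟ ∣ edgeOf H i ∣ ⟧

    present-01 : ∀ i U → present i U ≡ 0 ⊎ present i U ≡ 1 × ∣ U ∣ ≡ ∣ edgeOf H i ∣
    present-01 i U with ℕΣ.⟦⟧-cases (U ∈ᴱ? edges G) | ℕΣ.⟦⟧-cases (∣ U ∣ ℕ.≟ ∣ edgeOf H i ∣)
    ... | inj₂ (_ , e) | _            = inj₁ (cong (_* ℕΣ.⟦ ∣ U ∣ ℕ.≟ ∣ edgeOf H i ∣ ⟧) e)
    ... | inj₁ _       | inj₂ (_ , e) = inj₁ (trans (cong (ℕΣ.⟦ U ∈ᴱ? edges G ⟧ *_) e) (ℕ.*-zeroʳ ℕΣ.⟦ U ∈ᴱ? edges G ⟧))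
    ... | inj₁ (_ , e) | inj₁ (s , e′) = inj₂ (cong₂ _*_ e e′ , s)

    pos-⟦⟧ : ∀ {P : Set} (d : Dec P) → ℤ.+ ℕΣ.⟦ d ⟧ ≡ ⟦ d ⟧
    pos-⟦⟧ (yes _) = refl
    pos-⟦⟧ (no _)  = refl

    pos-present : ∀ i U → ℤ.+ present i U ≡ ⟦ U ∈ᴱ? edges G ⟧ *ᶻ ⟦ ∣ U ∣ ℕ.≟ ∣ edgeOf H i ∣ ⟧
    pos-present i U = trans (ℤ.pos-* ℕΣ.⟦ U ∈ᴱ? edges G ⟧ _) (cong₂ _*ᶻ_ (pos-⟦⟧ (U ∈ᴱ? edges G)) (pos-⟦⟧ (∣ U ∣ ℕ.≟ ∣ edgeOf H i ∣)))

    ∑-present≤size : ∀ i → ℕΣ.∑ (allSubsets n) (present i) ≤ size G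
    ∑-present≤size i = ℕ.≤-trans (∑-mono (allSubsets n) le) (ℕ.≤-reflexive (ℤ.+-injective (begin
      ℤ.+ ℕΣ.∑ (allSubsets n) (λ U → ℕΣ.∑ (edges G) (λ e → ℕΣ.⟦ U ≟ₛ e ⟧))    ≡⟨ cong ℤ.+_ (ℕΣ.S.fold-swap (allSubsets n) (edges G) _) ⟩
      ℤ.+ ℕΣ.∑ (edges G) (λ e → ℕΣ.∑ (allSubsets n) (λ U → ℕΣ.⟦ U ≟ₛ e ⟧))    ≡⟨ cong ℤ.+_ (ℕΣ.S.fold-cong (edges G) one) ⟩
      ℤ.+ ℕΣ.∑ (edges G) (λ e → 1)                                            ≡⟨ cong ℤ.+_ (trans (∑-constⁿ (edges G) 1) (ℕ.*-identityʳ (size G))) ⟩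
      ℤ.+ size G                                                              ∎)))
      where
      open ≡-Reasoning
      one : ∀ e → ℕΣ.∑ (allSubsets n) (λ U → ℕΣ.⟦ U ≟ₛ e ⟧) ≡ 1
      one e = ℤ.+-injective (trans (pos-∑ (allSubsets n) _) (trans (S.fold-cong (allSubsets n) (λ U → trans (pos-⟦⟧ (U ≟ₛ e)) (sym (ℤ.*-identityʳ ⟦ U ≟ₛ e ⟧)))) (enumerates-allSubsets n e (λ _ → 1ℤ))))
      le : ∀ U → present i U ≤ ℕΣ.∑ (edges G) (λ e → ℕΣ.⟦ U ≟ₛ e ⟧)
      le U with ℕΣ.⟦⟧-cases (U ∈ᴱ? edges G)
      ... | inj₂ (_ , e) = ℕ.≤-trans (ℕ.≤-reflexive (cong (_* ℕΣ.⟦ ∣ U ∣ ℕ.≟ ∣ edgeOf H i ∣ ⟧) e)) z≤n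
      ... | inj₁ (U∈ , _) = ℕ.≤-trans (≤1 (present-01 i U)) (ℕ.≤-trans (ℕ.≤-reflexive (sym (ℕΣ.⟦yes⟧ (U ≟ₛ U) refl))) (∈⇒≤∑ (λ e → ℕΣ.⟦ U ≟ₛ e ⟧) U∈))
        where
        ≤1 : ∀ {x} {Q : Set} → x ≡ 0 ⊎ x ≡ 1 × Q → x ≤ 1
        ≤1 (inj₁ refl)       = z≤n
        ≤1 (inj₂ (refl , _)) = ℕ.≤-refl

    ∑-present≤[1+n]^t : ∀ i → ℕΣ.∑ (allSubsets n) (present i) ≤ suc n ^ t
    ∑-present≤[1+n]^t i = ℕ.≤-trans (∑-mono (allSubsets n) le) (ℕ.≤-trans (bySize n ∣ edgeOf H i ∣) (ℕ.^-monoʳ-≤ (suc n) (∣p∣≤n (edgeOf H i))))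
      where
      open import Data.Fin.Subset.Properties using (∣p∣≤n)
      le : ∀ U → present i U ≤ ℕΣ.⟦ ∣ U ∣ ℕ.≟ ∣ edgeOf H i ∣ ⟧
      le U with ℕΣ.⟦⟧-cases (U ∈ᴱ? edges G)
      ... | inj₁ (_ , e) = ℕ.≤-reflexive (trans (cong (_* ℕΣ.⟦ ∣ U ∣ ℕ.≟ ∣ edgeOf H i ∣ ⟧) e) (ℕ.*-identityˡ _))
      ... | inj₂ (_ , e) = ℕ.≤-trans (ℕ.≤-reflexive (cong (_* ℕΣ.⟦ ∣ U ∣ ℕ.≟ ∣ edgeOf H i ∣ ⟧) e)) z≤n
      bySize : ∀ n d → ℕΣ.∑ (allSubsets n) (λ U → ℕΣ.⟦ ∣ U ∣ ℕ.≟ d ⟧) ≤ suc n ^ d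
      bySize zero    zero    = ℕ.≤-refl
      bySize zero    (suc d) = z≤n
      bySize (suc n) zero    = ℕ.≤-trans (ℕ.≤-reflexive (trans (ℕΣ.S.fold-allSubsets n {λ U → ℕΣ.⟦ ∣ U ∣ ℕ.≟ 0 ⟧}) (cong (_+ ℕΣ.∑ (allSubsets n) (λ U → ℕΣ.⟦ ∣ U ∣ ℕ.≟ 0 ⟧)) (ℕΣ.S.fold-ε (allSubsets n))))) (bySize n zero)
      bySize (suc n) (suc d) = ℕ.≤-trans (ℕ.≤-reflexive (ℕΣ.S.fold-allSubsets n {λ U → ℕΣ.⟦ ∣ U ∣ ℕ.≟ suc d ⟧})) (ℕ.≤-trans (ℕ.+-mono-≤ (bySize n d) (bySize n (suc d)))
        (ℕ.≤-trans (ℕ.*-monoʳ-≤ (suc (suc n)) {suc n ^ d} (ℕ.^-monoˡ-≤ d (ℕ.n≤1+n (suc n)))) ℕ.≤-refl))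

    module _ (φ : Vec (Fin n) t) (inj : Injective φ) where

      present-image : ∀ i U → ℤ.+ present i U *ᶻ ∏ (members (edgeOf H i)) (λ u → ⟦ lookup φ u ∈? U ⟧) ≡ ⟦ U ≟ₛ image φ (edgeOf H i) ⟧ *ᶻ ⟦ image φ (edgeOf H i) ∈ᴱ? edges G ⟧
      present-image i U with ∏-⟦⟧ (λ u → lookup φ u ∈? U) (members (edgeOf H i)) | ℕΣ.⟦⟧-cases (∣ U ∣ ℕ.≟ ∣ edgeOf H i ∣)
      ... | inj₂ ((u , u∈ , φu∉) , e) | _ = trans (cong (ℤ.+ present i U *ᶻ_) e) (trans (ℤ.*-zeroʳ (ℤ.+ present i U)) (sym (trans
          (cong (_*ᶻ ⟦ image φ (edgeOf H i) ∈ᴱ? edges G ⟧) (⟦no⟧ (U ≟ₛ image φ (edgeOf H i)) (λ { refl → φu∉ (∈-image⁺ φ (∈-members⁻ u∈)) }))) (ℤ.*-zeroˡ ⟦ image φ (edgeOf H i) ∈ᴱ? edges G ⟧))))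
      ... | inj₁ (all , e) | inj₂ (≢ , e′) = trans (cong (λ z → ℤ.+ z *ᶻ X) (trans (cong (ℕΣ.⟦ U ∈ᴱ? edges G ⟧ *_) e′) (ℕ.*-zeroʳ ℕΣ.⟦ U ∈ᴱ? edges G ⟧)))
          (trans (ℤ.*-zeroˡ X) (sym (trans (cong (_*ᶻ ⟦ image φ (edgeOf H i) ∈ᴱ? edges G ⟧) (⟦no⟧ (U ≟ₛ image φ (edgeOf H i)) (λ { refl → ≢ (∣image∣ φ inj (edgeOf H i)) }))) (ℤ.*-zeroˡ ⟦ image φ (edgeOf H i) ∈ᴱ? edges G ⟧))))
        where X = ∏ (members (edgeOf H i)) (λ u → ⟦ lookup φ u ∈? U ⟧)
      ... | inj₁ (all , e) | inj₁ (s , e′) with refl ← ⊆∧∣≡∣⇒≡ {p = image φ (edgeOf H i)} {U} (λ v∈ → let u , u∈ , eq = ∈-image⁻ φ v∈ in subst (_∈ U) eq (all (∈-members⁺ u∈))) (trans (∣image∣ φ inj (edgeOf H i)) (sym s)) =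
        trans (cong₂ _*ᶻ_ (trans (pos-present i U) (cong (⟦ U ∈ᴱ? edges G ⟧ *ᶻ_) (⟦yes⟧ (∣ U ∣ ℕ.≟ ∣ edgeOf H i ∣) s))) e)
          (trans (ℤ.*-identityʳ _) (trans (ℤ.*-identityʳ _) (sym (trans (cong (_*ᶻ ⟦ U ∈ᴱ? edges G ⟧) (⟦yes⟧ (U ≟ₛ U) refl)) (ℤ.*-identityˡ _)))))

      ∑-present-image : ∀ i → ∑ (allSubsets n) (λ U → ℤ.+ present i U *ᶻ ∏ (members (edgeOf H i)) (λ u → ⟦ lookup φ u ∈? U ⟧)) ≡ ⟦ image φ (edgeOf H i) ∈ᴱ? edges G ⟧
      ∑-present-image i = trans (S.fold-cong (allSubsets n) (present-image i)) (enumerates-allSubsets n (image φ (edgeOf H i)) (λ _ → ⟦ image φ (edgeOf H i) ∈ᴱ? edges G ⟧))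

    embedded : Vec (Fin n) t → ℤ
    embedded φ = ∏ (allFin (size H)) (λ i → ∑ (allSubsets n) (λ U → ℤ.+ present i U *ᶻ ∏ (members (edgeOf H i)) (λ u → ⟦ lookup φ u ∈? U ⟧)))

    Placement : Vec (Fin n) t → Subset n × List (Subset n) → Set
    Placement φ (U , F) = All (_⊆ U) F × IsIso H U F φ

    placement? : ∀ φ UF → Dec (Placement φ UF)
    placement? φ (U , F) = All.all? (_⊆? U) F ×-dec isIso? H U F φ

    candidates : List (Subset n × List (Subset n))
    candidates = cartesianProduct (allSubsets n) (sublists (edges G))

    private
      images : Vec (Fin n) t → List (Subset n)
      images φ = map (image φ) (edges H)

      _≟ᴸ_ : (F F′ : List (Subset n)) → Dec (F ≡ F′)
      _≟ᴸ_ = List.≡-dec _≟ₛ_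

      selected : Vec (Fin n) t → List (Subset n)
      selected φ = filter (_∈ᴱ? images φ) (edges G)

      Embeds : Vec (Fin n) t → Set
      Embeds φ = Injective φ × (∀ i → image φ (edgeOf H i) ∈ᴱ edges G)

      placement⇒embeds : ∀ φ {U F} → F L.∈ sublists (edges G) → Placement φ (U , F) → Embeds φ
      placement⇒embeds φ F∈ (_ , inj , _ , iff) = inj , λ i → ∈-sublists F∈ (proj₁ (iff (edgeOf H i)) (∈-lookup i))

      placement⇒selected : ∀ φ {U F} → F L.∈ sublists (edges G) → Placement φ (U , F) → F ≡ selected φ
      placement⇒selected φ {U} {F} F∈ (F⊆U , inj , imU , iff) = sublist≡filter (_∈ᴱ? images φ) (unique G) F∈ (λ _ → to) (λ _ → from)
        where
        to : ∀ {e} → e L.∈ F → e ∈ᴱ images φ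
        to {e} e∈ = subst (_∈ᴱ images φ) im≡ (∈-map⁺ (image φ) (proj₂ (iff D) (subst (L._∈ F) (sym im≡) e∈)))
          where
          D : Subset t
          D = tabulate (λ u → does (lookup φ u ∈? e))
          ∈D⁺ : ∀ {u} → lookup φ u ∈ e → u ∈ D
          ∈D⁺ {u} m = Vec.lookup⇒[]= u D (trans (Vec.lookup∘tabulate _ u) (dec-true (lookup φ u ∈? e) m))
          ∈D⁻ : ∀ {u} → u ∈ D → lookup φ u ∈ e
          ∈D⁻ {u} m with lookup φ u ∈? e | trans (sym (Vec.lookup∘tabulate _ u)) (Vec.[]=⇒lookup m)
          ... | yes p | _ = p
          im≡ : image φ D ≡ e
          im≡ = ⊆-antisym (λ v∈ → let u , u∈ , eq = ∈-image⁻ φ v∈ in subst (_∈ e) eq (∈D⁻ u∈))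
            (λ {v} v∈ → let u , _ , eq = ∈-image⁻ φ (subst (v ∈_) (sym imU) (All.lookup F⊆U e∈ v∈)) in subst (_∈ image φ D) eq (∈-image⁺ φ (∈D⁺ (subst (_∈ e) (sym eq) v∈))))
        from : ∀ {e} → e ∈ᴱ images φ → e L.∈ F
        from e∈ with D , D∈ , refl ← ∈-map⁻ (image φ) e∈ = proj₁ (iff D) D∈

      embeds⇒placement : ∀ φ → Embeds φ → Placement φ (image φ ⊤ , selected φ)
      embeds⇒placement φ (inj , emb) = All.tabulate (λ {e} e∈ {v} v∈ → inU e∈ v∈) , inj , refl , λ D →
          (λ D∈ → ∈-filter⁺ (_∈ᴱ? images φ) (let i , eq = ∈-edge H D∈ in subst (λ D → image φ D ∈ᴱ edges G) eq (emb i)) (∈-map⁺ (image φ) D∈))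
        , (λ m → let D′ , D′∈ , eq = ∈-map⁻ (image φ) (proj₂ (∈-filter⁻ (_∈ᴱ? images φ) {xs = edges G} m)) in subst (_∈ᴱ edges H) (image-injective φ inj (sym eq)) D′∈)
        where
        inU : ∀ {e v} → e L.∈ selected φ → v ∈ e → v ∈ image φ ⊤
        inU e∈ v∈ with D , _ , refl ← ∈-map⁻ (image φ) (proj₂ (∈-filter⁻ (_∈ᴱ? images φ) {xs = edges G} e∈)) with u , _ , refl ← ∈-image⁻ φ v∈ = ∈-image⁺ φ ∈⊤

    -- An embedding determines its occurrence.
    ∑-placements : ∀ φ → ∑ candidates (λ UF → ⟦ placement? φ UF ⟧) ≡ ⟦ injective? φ ⟧ *ᶻ embedded φ
    ∑-placements φ = go (injective? φ)
      where
      open ≡-Reasoning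
      go : (d : Dec (Injective φ)) → ∑ candidates (λ UF → ⟦ placement? φ UF ⟧) ≡ ⟦ d ⟧ *ᶻ embedded φ
      go (no ¬inj) = trans (trans (S.fold-cong candidates (λ (U , F) → ⟦no⟧ (placement? φ (U , F)) (λ p → ¬inj (proj₁ (proj₂ p))))) (S.fold-ε candidates)) (sym (ℤ.*-zeroˡ (embedded φ)))
      go (yes inj) with ∏-⟦⟧ (λ i → image φ (edgeOf H i) ∈ᴱ? edges G) (allFin (size H))
      ...   | inj₂ ((i , _ , ∉) , e) = trans (trans (S.fold-pairs (allSubsets n) (sublists (edges G))) (trans
              (S.fold-cong (allSubsets n) (λ U → trans (S.fold-cong∈ (sublists (edges G)) (λ {F} F∈ → ⟦no⟧ (placement? φ (U , F)) (λ p → ∉ (proj₂ (placement⇒embeds φ F∈ p) i)))) (S.fold-ε (sublists (edges G)))))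
              (S.fold-ε (allSubsets n)))) (sym (trans (ℤ.*-identityˡ _) (trans (P.fold-cong (allFin (size H)) (∑-present-image φ inj)) e)))
      ...   | inj₁ (all , e) = begin
        ∑ candidates (λ UF → ⟦ placement? φ UF ⟧)
          ≡⟨ S.fold-pairs (allSubsets n) (sublists (edges G)) ⟩
        ∑ (allSubsets n) (λ U → ∑ (sublists (edges G)) (λ F → ⟦ placement? φ (U , F) ⟧))
          ≡⟨ S.fold-cong (allSubsets n) (λ U → trans (S.fold-cong∈ (sublists (edges G)) (λ {F} F∈ → ⟦×⟧ (placement? φ (U , F)) (U ≟ₛ image φ ⊤) (F ≟ᴸ selected φ)
               (λ p → sym (proj₁ (proj₂ (proj₂ p))) , placement⇒selected φ F∈ p) (λ { refl refl → embeds⇒placement φ emb }))) (∑-*ˡ (sublists (edges G)) ⟦ U ≟ₛ image φ ⊤ ⟧ _)) ⟩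
        ∑ (allSubsets n) (λ U → ⟦ U ≟ₛ image φ ⊤ ⟧ *ᶻ ∑ (sublists (edges G)) (λ F → ⟦ F ≟ᴸ selected φ ⟧))
          ≡⟨ enumerates-allSubsets n (image φ ⊤) _ ⟩
        ∑ (sublists (edges G)) (λ F → ⟦ F ≟ᴸ selected φ ⟧)
          ≡⟨ ∑-sublists _≟ᴸ_ (_∈ᴱ? images φ) (unique G) ⟩
        1ℤ
          ≡⟨ trans (ℤ.*-identityˡ _) (trans (P.fold-cong (allFin (size H)) (∑-present-image φ inj)) e) ⟨
        1ℤ *ᶻ embedded φ ∎
        where
        emb : Embeds φ
        emb = inj , λ i → all (∈-allFin i)

    private
      compose : Vec (Fin n) t → Vec (Fin t) t → Vec (Fin n) t
      compose φ α = Vec.map (lookup φ) α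

      lookup-compose : ∀ φ α u → lookup (compose φ α) u ≡ lookup φ (lookup α u)
      lookup-compose φ α u = Vec.lookup-map u (lookup φ) α

      image-compose : ∀ φ α D → image (compose φ α) D ≡ image φ (image α D)
      image-compose φ α D = ⊆-antisym
        (λ v∈ → let u , u∈ , e = ∈-image⁻ (compose φ α) v∈ in subst (_∈ image φ (image α D)) (trans (sym (lookup-compose φ α u)) e) (∈-image⁺ φ (∈-image⁺ α u∈)))
        (λ v∈ → let w , w∈ , e = ∈-image⁻ φ v∈ ; u , u∈ , e′ = ∈-image⁻ α w∈ in
          subst (_∈ image (compose φ α) D) (trans (lookup-compose φ α u) (trans (cong (lookup φ) e′) e)) (∈-image⁺ (compose φ α) u∈))

    -- The isomorphisms onto a given occurrence form a torsor under the automorphisms.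
    ∑-fibre : ∀ U F → ∑ (vecs (allFin n) t) (λ φ → ⟦ placement? φ (U , F) ⟧) ≡ ⟦ isOccurrence? H (U , F) ⟧ *ᶻ ℤ.+ automorphisms H
    ∑-fibre U F = go (isOccurrence? H (U , F))
     where
     go : (d : Dec (IsOccurrence H (U , F))) → ∑ (vecs (allFin n) t) (λ φ → ⟦ placement? φ (U , F) ⟧) ≡ ⟦ d ⟧ *ᶻ ℤ.+ automorphisms H
     go (no ¬occ) = trans (trans (S.fold-cong (vecs (allFin n) t) (λ φ → ⟦no⟧ (placement? φ (U , F)) (λ (F⊆ , iso) → ¬occ (F⊆ , φ , iso)))) (S.fold-ε (vecs (allFin n) t))) (sym (ℤ.*-zeroˡ (ℤ.+ automorphisms H)))
     go (yes (F⊆ , φ₀ , inj₀ , im₀ , iff₀)) = begin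
      ∑ (vecs (allFin n) t) (λ φ → ⟦ placement? φ (U , F) ⟧)
        ≡⟨ reindex (vecs (allFin t) t) (vecs (allFin n) t) (Vec.≡-dec Fin._≟_) (Vec.≡-dec Fin._≟_) (enumerates-vecs {_≟_ = Fin._≟_} (enumerates-allFin t) t) (enumerates-vecs {_≟_ = Fin._≟_} (enumerates-allFin n) t) (compose φ₀) compose-injective _ support ⟩
      ∑ (vecs (allFin t) t) (λ α → ⟦ placement? (compose φ₀ α) (U , F) ⟧)
        ≡⟨ S.fold-cong (vecs (allFin t) t) (λ α → ⟦⇔⟧ (placement? (compose φ₀ α) (U , F)) (isIso? H ⊤ (edges H) α) (to α) (from α)) ⟩
      ∑ (vecs (allFin t) t) (λ α → ⟦ isIso? H ⊤ (edges H) α ⟧)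
        ≡⟨ length-filter-∑ (isIso? H ⊤ (edges H)) (vecs (allFin t) t) ⟨
      ℤ.+ automorphisms H
        ≡⟨ ℤ.*-identityˡ _ ⟨
      1ℤ *ᶻ ℤ.+ automorphisms H ∎
      where
      open ≡-Reasoning
      compose-injective : ∀ {α β} → compose φ₀ α ≡ compose φ₀ β → α ≡ β
      compose-injective {α} {β} eq = trans (sym (Vec.tabulate∘lookup α)) (trans (Vec.tabulate-cong (λ u → inj₀ _ _ (trans (sym (lookup-compose φ₀ α u)) (trans (cong (λ φ → lookup φ u) eq) (lookup-compose φ₀ β u))))) (Vec.tabulate∘lookup β))
      support : ∀ φ → ⟦ placement? φ (U , F) ⟧ ≡ 0ℤ ⊎ ∃[ α ] compose φ₀ α ≡ φ
      support φ with ⟦⟧-cases (placement? φ (U , F))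
      ... | inj₂ (_ , e) = inj₁ e
      ... | inj₁ ((_ , inj , im , _) , _) = inj₂ (tabulate (proj₁ ∘ preimage) , trans (sym (Vec.tabulate∘lookup (compose φ₀ α))) (trans (Vec.tabulate-cong at) (Vec.tabulate∘lookup φ)))
        where
        preimage : ∀ u → ∃[ w ] w ∈ ⊤ × lookup φ₀ w ≡ lookup φ u
        preimage u = ∈-image⁻ φ₀ (subst (lookup φ u ∈_) (trans im (sym im₀)) (∈-image⁺ φ ∈⊤))
        α = tabulate (proj₁ ∘ preimage)
        at : ∀ u → lookup (compose φ₀ α) u ≡ lookup φ u
        at u = trans (lookup-compose φ₀ α u) (trans (cong (lookup φ₀) (Vec.lookup∘tabulate (proj₁ ∘ preimage) u)) (proj₂ (proj₂ (preimage u))))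
      to : ∀ α → Placement (compose φ₀ α) (U , F) → IsIso H ⊤ (edges H) α
      to α (_ , inj , im , iff) = (λ u v e → inj u v (trans (lookup-compose φ₀ α u) (trans (cong (lookup φ₀) e) (sym (lookup-compose φ₀ α v)))))
        , image-injective φ₀ inj₀ (trans (sym (image-compose φ₀ α ⊤)) (trans im (sym im₀)))
        , λ D → (λ D∈ → proj₂ (iff₀ (image α D)) (subst (L._∈ F) (image-compose φ₀ α D) (proj₁ (iff D) D∈)))
              , (λ m → proj₂ (iff D) (subst (L._∈ F) (sym (image-compose φ₀ α D)) (proj₁ (iff₀ (image α D)) m)))
      from : ∀ α → IsIso H ⊤ (edges H) α → Placement (compose φ₀ α) (U , F)
      from α (inj , im , iff) = F⊆ , (λ u v e → inj u v (inj₀ _ _ (trans (sym (lookup-compose φ₀ α u)) (trans e (lookup-compose φ₀ α v)))))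
        , trans (image-compose φ₀ α ⊤) (trans (cong (image φ₀) im) im₀)
        , λ D → (λ D∈ → subst (L._∈ F) (sym (image-compose φ₀ α D)) (proj₁ (iff₀ (image α D)) (proj₁ (iff D) D∈)))
              , (λ m → proj₂ (iff D) (proj₂ (iff₀ (image α D)) (subst (L._∈ F) (image-compose φ₀ α D) m)))

    ∑-embeddings : ∑ (vecs (allFin n) t) (λ φ → ⟦ injective? φ ⟧ *ᶻ embedded φ) ≡ ℤ.+ (automorphisms H * # H G)
    ∑-embeddings = begin
      ∑ φs (λ φ → ⟦ injective? φ ⟧ *ᶻ embedded φ)                                 ≡⟨ S.fold-cong φs ∑-placements ⟨
      ∑ φs (λ φ → ∑ candidates (λ UF → ⟦ placement? φ UF ⟧))                      ≡⟨ S.fold-swap φs candidates _ ⟩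
      ∑ candidates (λ UF → ∑ φs (λ φ → ⟦ placement? φ UF ⟧))                      ≡⟨ S.fold-cong candidates (λ (U , F) → ∑-fibre U F) ⟩
      ∑ candidates (λ UF → ⟦ isOccurrence? H UF ⟧ *ᶻ ℤ.+ automorphisms H)           ≡⟨ ∑-*ʳ candidates (ℤ.+ automorphisms H) _ ⟩
      ∑ candidates (λ UF → ⟦ isOccurrence? H UF ⟧) *ᶻ ℤ.+ automorphisms H           ≡⟨ cong (_*ᶻ ℤ.+ automorphisms H) (length-filter-∑ (isOccurrence? H) candidates) ⟨
      ℤ.+ # H G *ᶻ ℤ.+ automorphisms H                                              ≡⟨ ℤ.*-comm (ℤ.+ # H G) (ℤ.+ automorphisms H) ⟩
      ℤ.+ automorphisms H *ᶻ ℤ.+ # H G                                              ≡⟨ ℤ.pos-* (automorphisms H) (# H G) ⟨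
      ℤ.+ (automorphisms H * # H G)                                                 ∎
      where
      open ≡-Reasoning
      φs = vecs (allFin n) t

module Ratio where

  open import Defs using (fromℕ; Rnd; return; draw; _>>=_; Always; Pr)
  open Big
  open import Data.Bool.Base using (if_then_else_)
  open import Data.Fin.Base using (Fin; zero; suc; toℕ)
  open import Data.Integer.Base as ℤ using (ℤ; +_)
  import Data.Integer.Properties as ℤ
  open import Data.List.Base as List using (List; []; _∷_; upTo)
  import Data.List.Properties as List
  open import Data.Nat.Base as ℕ using (ℕ; zero; suc; s≤s; z≤n)
  import Data.Nat.Properties as ℕ
  open import Data.Product.Base using (∃-syntax; _×_; _,_)
  open import Data.Rational.Base as ℚ using (ℚ; fromℚᵘ; 0ℚ; 1ℚ) renaming (_+_ to _+ℚ_; _*_ to _*ℚ_; _≤_ to _≤ℚ_)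
  import Data.Rational.Properties as ℚ
  open import Data.Rational.Unnormalised.Base as ℚᵘ using (ℚᵘ; mkℚᵘ; *≡*; *≤*)
  import Data.Rational.Unnormalised.Properties as ℚᵘ
  open import Data.Vec.Base using (Vec; []; _∷_; _++_)
  import Data.Vec.Functional as Vector
  open import Function.Base using (_∘_)
  open import Relation.Binary.PropositionalEquality
  open import Relation.Nullary.Decidable using (Dec; yes; no; does)
  open import Relation.Nullary.Negation using (contradiction)
  open import Relation.Unary using (Decidable)

  fromℚᵘ-* : ∀ p q → fromℚᵘ (p ℚᵘ.* q) ≡ fromℚᵘ p *ℚ fromℚᵘ q
  fromℚᵘ-* p q = ℚ.toℚᵘ-injective (ℚᵘ.≃-trans (ℚ.toℚᵘ-fromℚᵘ (p ℚᵘ.* q))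
    (ℚᵘ.≃-sym (ℚᵘ.≃-trans (ℚ.toℚᵘ-homo-* (fromℚᵘ p) (fromℚᵘ q)) (ℚᵘ.*-cong (ℚ.toℚᵘ-fromℚᵘ p) (ℚ.toℚᵘ-fromℚᵘ q)))))

  fromℚᵘ-+ : ∀ p q → fromℚᵘ (p ℚᵘ.+ q) ≡ fromℚᵘ p +ℚ fromℚᵘ q
  fromℚᵘ-+ p q = ℚ.toℚᵘ-injective (ℚᵘ.≃-trans (ℚ.toℚᵘ-fromℚᵘ (p ℚᵘ.+ q))
    (ℚᵘ.≃-sym (ℚᵘ.≃-trans (ℚ.toℚᵘ-homo-+ (fromℚᵘ p) (fromℚᵘ q)) (ℚᵘ.+-cong (ℚ.toℚᵘ-fromℚᵘ p) (ℚ.toℚᵘ-fromℚᵘ q)))))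

  fromℚᵘ-mono : ∀ {p q} → p ℚᵘ.≤ q → fromℚᵘ p ≤ℚ fromℚᵘ q
  fromℚᵘ-mono {p} {q} p≤q = ℚ.toℚᵘ-cancel-≤ (ℚᵘ.≤-respʳ-≃ (ℚᵘ.≃-sym (ℚ.toℚᵘ-fromℚᵘ q)) (ℚᵘ.≤-respˡ-≃ (ℚᵘ.≃-sym (ℚ.toℚᵘ-fromℚᵘ p)) p≤q))

  fromℚᵘ-cancel : ∀ {p q} → fromℚᵘ p ≤ℚ fromℚᵘ q → p ℚᵘ.≤ q
  fromℚᵘ-cancel {p} {q} p≤q = ℚᵘ.≤-respʳ-≃ (ℚ.toℚᵘ-fromℚᵘ q) (ℚᵘ.≤-respˡ-≃ (ℚ.toℚᵘ-fromℚᵘ p) (ℚ.toℚᵘ-mono-≤ p≤q))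

  integer : ℕ → ℚᵘ
  integer a = mkℚᵘ (+ a) 0

  fromℕ-+ : ∀ a b → fromℕ (a ℕ.+ b) ≡ fromℕ a +ℚ fromℕ b
  fromℕ-+ a b = trans (ℚ.fromℚᵘ-cong {integer (a ℕ.+ b)} {integer a ℚᵘ.+ integer b} (*≡* (cong (ℤ._* + 1) (trans (ℤ.pos-+ a b) (sym (cong₂ ℤ._+_ (ℤ.*-identityʳ (+ a)) (ℤ.*-identityʳ (+ b))))))))
    (fromℚᵘ-+ (integer a) (integer b))

  fromℕ-* : ∀ a b → fromℕ (a ℕ.* b) ≡ fromℕ a *ℚ fromℕ b
  fromℕ-* a b = trans (ℚ.fromℚᵘ-cong {integer (a ℕ.* b)} {integer a ℚᵘ.* integer b} (*≡* (cong (ℤ._* + 1) (ℤ.pos-* a b))))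
    (fromℚᵘ-* (integer a) (integer b))

  fromℕ-mono : ∀ {a b} → a ℕ.≤ b → fromℕ a ≤ℚ fromℕ b
  fromℕ-mono {a} {b} a≤b = fromℚᵘ-mono {integer a} {integer b} (*≤* (ℤ.*-monoʳ-≤-nonNeg (+ 1) (ℤ.+≤+ a≤b)))

  fromℕ-pos : ∀ a .{{_ : ℕ.NonZero a}} → ℚ.Positive (fromℕ a)
  fromℕ-pos (suc a) = ℚ.positive (ℚ.<-≤-trans (ℚ.toℚᵘ-cancel-< {0ℚ} {1ℚ} (ℚᵘ.*<* (ℤ.+<+ (s≤s z≤n)))) (fromℕ-mono {1} {suc a} (s≤s z≤n)))

  1/-* : ∀ N x → (+ 1 ℚ./ suc N) *ℚ (fromℕ (suc N) *ℚ x) ≡ x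
  1/-* N x = trans (sym (ℚ.*-assoc (+ 1 ℚ./ suc N) (fromℕ (suc N)) x)) (trans (cong (_*ℚ x) (trans (sym (fromℚᵘ-* (mkℚᵘ (+ 1) N) (integer (suc N))))
    (ℚ.fromℚᵘ-cong {mkℚᵘ (+ 1) N ℚᵘ.* integer (suc N)} {ℚᵘ.1ℚᵘ} (*≡* (trans (ℤ.*-identityʳ _) (trans (ℤ.*-identityˡ (+ suc N)) (sym (trans (ℤ.*-identityˡ _) (cong +_ (ℕ.*-identityʳ (suc N)))))))))))
    (ℚ.*-identityˡ x))

  -- An execution that draws N uniform values below q, recorded in a vector that P
  -- relates to the result.
  data Samples {A : Set} (q : ℕ) : (N : ℕ) → (Vec ℕ N → A → Set) → Rnd A → Set₁ where
    done : ∀ {P a} → P [] a → Samples q 0 P (return a)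
    step : ∀ {N P M f} → suc M ≡ q → (∀ i → Samples q N (λ v → P (toℕ i ∷ v)) (f i)) → Samples q (suc N) P (draw M f)

  private variable
    A B : Set

  weaken : ∀ {q N} {P R : Vec ℕ N → A → Set} {r} → (∀ {v a} → P v a → R v a) → Samples q N P r → Samples q N R r
  weaken f (done p)   = done (f p)
  weaken f (step e s) = step e (λ i → weaken f (s i))

  bind : ∀ {q N M} {P : Vec ℕ N → A → Set} {R : Vec ℕ (N ℕ.+ M) → B → Set} {r k} → Samples q N P r →
    (∀ {v a} → P v a → Samples q M (λ w → R (v ++ w)) (k a)) → Samples q (N ℕ.+ M) R (r >>= k)
  bind (done p)   f = f p
  bind (step e s) f = step e (λ i → bind (s i) f)

  bind-return : ∀ {q N} {P : Vec ℕ N → A → Set} {R : Vec ℕ N → B → Set} {r k} → Samples q N P r →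
    (∀ {v a} → P v a → ∃[ b ] k a ≡ return b × R v b) → Samples q N R (r >>= k)
  bind-return {R = R} (done {a = a} p) f with b , e , p′ ← f p = subst (Samples _ 0 R) (sym e) (done p′)
  bind-return (step e s) f = step e (λ i → bind-return (s i) f)

  always : ∀ {q N} {P : Vec ℕ N → A → Set} {R : A → Set} {r} → Samples q N P r → (∀ {v a} → P v a → R a) → Always R r
  always (done p)   f = f p
  always (step e s) f = λ i → always (s i) f

  ∑≤foldr : ∀ M (c : ℕ → ℕ) (g : Fin M → ℚ) x → (∀ i → fromℕ (c (toℕ i)) ≤ℚ g i *ℚ x) →
    fromℕ (ℕΣ.∑ (upTo M) c) ≤ℚ Vector.foldr _+ℚ_ 0ℚ g *ℚ x
  ∑≤foldr zero    c g x le = ℚ.≤-reflexive (sym (ℚ.*-zeroˡ x))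
  ∑≤foldr (suc M) c g x le = begin
    fromℕ (c 0 ℕ.+ ℕΣ.∑ (List.applyUpTo suc M) c)              ≡⟨ cong (λ z → fromℕ (c 0 ℕ.+ z)) (trans (cong (λ l → ℕΣ.∑ l c) (sym (List.map-upTo suc M))) (ℕΣ.S.fold-map suc (upTo M))) ⟩
    fromℕ (c 0 ℕ.+ ℕΣ.∑ (upTo M) (c ∘ suc))                    ≡⟨ fromℕ-+ (c 0) _ ⟩
    fromℕ (c 0) +ℚ fromℕ (ℕΣ.∑ (upTo M) (c ∘ suc))             ≤⟨ ℚ.+-mono-≤ (le zero) (∑≤foldr M (c ∘ suc) (g ∘ suc) x (le ∘ suc)) ⟩
    g zero *ℚ x +ℚ Vector.foldr _+ℚ_ 0ℚ (g ∘ suc) *ℚ x         ≡⟨ ℚ.*-distribʳ-+ x (g zero) _ ⟨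
    Vector.foldr _+ℚ_ 0ℚ g *ℚ x                                ∎
    where open ℚ.≤-Reasoning

  good≤Pr : ∀ {q N} {P : A → Set} (P? : Decidable P) {Good : Vec ℕ N → Set} (good? : Decidable Good) {r} →
    Samples q N (λ v a → Good v → P a) r → fromℕ (ℕΣ.∑ (vecs (upTo q) N) (λ v → ℕΣ.⟦ good? v ⟧)) ≤ℚ Pr P? r *ℚ fromℕ (q ℕ.^ N)
  good≤Pr P? good? (done {a = a} f) with good? []
  ... | no _ = ℚ.≤-trans (bound (P? a)) (ℚ.≤-reflexive (sym (ℚ.*-identityʳ _)))
    where
    bound : ∀ {Q : Set} (d : Dec Q) → fromℕ 0 ≤ℚ (if does d then 1ℚ else 0ℚ)
    bound (yes _) = fromℕ-mono {0} {1} z≤n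
    bound (no _)  = ℚ.≤-refl
  ... | yes g = ℚ.≤-trans (bound (P? a)) (ℚ.≤-reflexive (sym (ℚ.*-identityʳ _)))
    where
    bound : (d : Dec _) → fromℕ 1 ≤ℚ (if does d then 1ℚ else 0ℚ)
    bound (yes _) = ℚ.≤-refl
    bound (no ¬p) = contradiction (f g) ¬p
  good≤Pr {N = suc N} P? good? (step {M = M} {f = f} refl s) = begin
    fromℕ (ℕΣ.∑ (vecs (upTo (suc M)) (suc N)) (λ v → ℕΣ.⟦ good? v ⟧))                                   ≡⟨ cong fromℕ (ℕΣ.S.fold-vecs (upTo (suc M)) N) ⟩
    fromℕ (ℕΣ.∑ (upTo (suc M)) (λ i → ℕΣ.∑ (vecs (upTo (suc M)) N) (λ v → ℕΣ.⟦ good? (i ∷ v) ⟧)))       ≤⟨ ∑≤foldr (suc M) (λ i → ℕΣ.∑ (vecs (upTo (suc M)) N) (λ v → ℕΣ.⟦ good? (i ∷ v) ⟧)) (λ i → Pr P? (f i)) x (λ i → good≤Pr P? (λ v → good? (toℕ i ∷ v)) (s i)) ⟩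
    Σ *ℚ x                                                                                              ≡⟨ 1/-* M (Σ *ℚ x) ⟨
    (+ 1 ℚ./ suc M) *ℚ (fromℕ (suc M) *ℚ (Σ *ℚ x))                                                      ≡⟨ cong ((+ 1 ℚ./ suc M) *ℚ_) (trans (sym (ℚ.*-assoc (fromℕ (suc M)) Σ x)) (trans (cong (_*ℚ x) (ℚ.*-comm (fromℕ (suc M)) Σ)) (trans (ℚ.*-assoc Σ (fromℕ (suc M)) x) (cong (Σ *ℚ_) (sym (fromℕ-* (suc M) (suc M ℕ.^ N))))))) ⟩
    (+ 1 ℚ./ suc M) *ℚ (Σ *ℚ fromℕ (suc M ℕ.^ suc N))                                                   ≡⟨ ℚ.*-assoc (+ 1 ℚ./ suc M) Σ _ ⟨
    (+ 1 ℚ./ suc M) *ℚ Σ *ℚ fromℕ (suc M ℕ.^ suc N)                                                     ∎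
    where
    open ℚ.≤-Reasoning
    x = fromℕ (suc M ℕ.^ N)
    Σ = Vector.foldr _+ℚ_ 0ℚ (λ i → Pr P? (f i))

  two-thirds : ∀ g T p .{{_ : ℕ.NonZero T}} → 2 ℕ.* T ℕ.≤ 3 ℕ.* g → fromℕ g ≤ℚ p *ℚ fromℕ T → + 2 ℚ./ 3 ≤ℚ p
  two-thirds g T p 2T≤3g g≤pT = ℚ.*-cancelʳ-≤-pos (fromℕ T) {{fromℕ-pos T}} (ℚ.≤-trans (ℚ.≤-trans (ℚ.≤-reflexive (sym (fromℚᵘ-* (mkℚᵘ (+ 2) 2) (integer T))))
    (fromℚᵘ-mono {mkℚᵘ (+ 2) 2 ℚᵘ.* integer T} {integer g} (*≤* (begin
      + 2 ℤ.* + T ℤ.* + 1      ≡⟨ trans (ℤ.*-identityʳ _) (sym (ℤ.pos-* 2 T)) ⟩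
      + (2 ℕ.* T)              ≤⟨ ℤ.+≤+ 2T≤3g ⟩
      + (3 ℕ.* g)              ≡⟨ trans (ℤ.pos-* 3 g) (ℤ.*-comm (+ 3) (+ g)) ⟩
      + g ℤ.* + 3              ∎)))) g≤pT)
    where open ℤ.≤-Reasoning

module Cheby where

  open Big
  open Hash using (∑-const)
  open Second using (pos-∑)
  open Count using (∑-mono; ∑-constⁿ)
  open import Data.Integer.Base as ℤ using (ℤ; 0ℤ; 1ℤ; -_) renaming (_+_ to _+ᶻ_; _*_ to _*ᶻ_; _≤_ to _≤ᶻ_)
  import Data.Integer.Properties as ℤ
  import Data.Integer.Tactic.RingSolver as ℤSolver
  open import Data.List.Base using (List; []; _∷_; length)
  open import Data.Nat.Base as ℕ using (ℕ; zero; suc; _+_; _*_; _^_; _≤_; z≤n; NonZero)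
  import Data.Nat.Properties as ℕ
  open import Data.Nat.Tactic.RingSolver using (solve-∀)
  open import Data.Vec.Base using (Vec; []; _∷_)
  open import Relation.Binary.PropositionalEquality
  open import Relation.Nullary.Decidable using (yes; no; ¬?)
  open import Relation.Nullary.Negation using (¬_)
  open import Relation.Unary using (Decidable)
  open ℤΣ

  private variable
    A : Set

  ∣i∣² : ∀ i → ℤ.+ (ℤ.∣ i ∣ * ℤ.∣ i ∣) ≡ i *ᶻ i
  ∣i∣² (ℤ.+ n)      = ℤ.pos-* n n
  ∣i∣² (ℤ.-[1+ n ]) = refl

  total : ∀ {s} → (A → ℤ) → Vec A s → ℤ
  total Y []       = 0ℤ
  total Y (x ∷ xs) = Y x +ᶻ total Y xs

  length-vecs : ∀ (xs : List A) N → length (vecs xs N) ≡ length xs ^ N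
  length-vecs xs N = ℕ.*-cancelʳ-≡ (length (vecs xs N)) (length xs ^ N) 1 (trans (sym (∑-constⁿ (vecs xs N) 1)) (trans (go N) (sym (ℕ.*-identityʳ _))))
    where
    go : ∀ N → ℕΣ.∑ (vecs xs N) (λ _ → 1) ≡ length xs ^ N
    go zero    = refl
    go (suc N) = trans (ℕΣ.S.fold-vecs xs N) (trans (ℕΣ.S.fold-cong xs (λ _ → go N)) (∑-constⁿ xs (length xs ^ N)))

  module _ (xs : List A) (Y : A → ℤ) (mean : ∑ xs Y ≡ 0ℤ) where

    private
      T = ℤ.+ length xs
      V = ∑ xs (λ x → Y x *ᶻ Y x)

    ∑-total : ∀ s → ∑ (vecs xs s) (total Y) ≡ 0ℤ
    ∑-total zero    = refl
    ∑-total (suc s) = begin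
      ∑ (vecs xs (suc s)) (total Y)                                       ≡⟨ S.fold-vecs xs s ⟩
      ∑ xs (λ x → ∑ (vecs xs s) (λ v → Y x +ᶻ total Y v))                 ≡⟨ S.fold-cong xs (λ x → trans (S.fold-∙ (vecs xs s) _ _) (cong₂ _+ᶻ_ (∑-const (vecs xs s) (Y x)) (∑-total s))) ⟩
      ∑ xs (λ x → ℤ.+ length (vecs xs s) *ᶻ Y x +ᶻ 0ℤ)                    ≡⟨ S.fold-cong xs (λ x → ℤ.+-identityʳ (ℤ.+ length (vecs xs s) *ᶻ Y x)) ⟩
      ∑ xs (λ x → ℤ.+ length (vecs xs s) *ᶻ Y x)                          ≡⟨ ∑-*ˡ xs (ℤ.+ length (vecs xs s)) Y ⟩
      ℤ.+ length (vecs xs s) *ᶻ ∑ xs Y                                    ≡⟨ trans (cong (ℤ.+ length (vecs xs s) *ᶻ_) mean) (ℤ.*-zeroʳ (ℤ.+ length (vecs xs s))) ⟩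
      0ℤ                                                                  ∎
      where open ≡-Reasoning

    ∑-total² : ∀ s → T *ᶻ ∑ (vecs xs s) (λ v → total Y v *ᶻ total Y v) ≡ ℤ.+ s *ᶻ (ℤ.+ length (vecs xs s) *ᶻ V)
    ∑-total² zero    = trans (ℤ.*-zeroʳ T) (sym (ℤ.*-zeroˡ (1ℤ *ᶻ V)))
    ∑-total² (suc s) = begin
      T *ᶻ ∑ (vecs xs (suc s)) (λ v → total Y v *ᶻ total Y v)
        ≡⟨ cong (T *ᶻ_) (S.fold-vecs xs s) ⟩
      T *ᶻ ∑ xs (λ x → ∑ (vecs xs s) (λ v → (Y x +ᶻ total Y v) *ᶻ (Y x +ᶻ total Y v)))
        ≡⟨ cong (T *ᶻ_) (S.fold-cong xs inner) ⟩
      T *ᶻ ∑ xs (λ x → L *ᶻ (Y x *ᶻ Y x) +ᶻ W)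
        ≡⟨ cong (T *ᶻ_) (trans (S.fold-∙ xs _ _) (cong₂ _+ᶻ_ (∑-*ˡ xs L _) (∑-const xs W))) ⟩
      T *ᶻ (L *ᶻ V +ᶻ T *ᶻ W)
        ≡⟨ cong (λ z → T *ᶻ (L *ᶻ V +ᶻ z)) (∑-total² s) ⟩
      T *ᶻ (L *ᶻ V +ᶻ ℤ.+ s *ᶻ (L *ᶻ V))
        ≡⟨ l T L V (ℤ.+ s) ⟩
      (1ℤ +ᶻ ℤ.+ s) *ᶻ (T *ᶻ L *ᶻ V)
        ≡⟨ cong₂ (λ a b → a *ᶻ (b *ᶻ V)) (sym (ℤ.pos-+ 1 s)) lengths ⟩
      ℤ.+ suc s *ᶻ (ℤ.+ length (vecs xs (suc s)) *ᶻ V) ∎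
      where
      open ≡-Reasoning
      L = ℤ.+ length (vecs xs s)
      W = ∑ (vecs xs s) (λ v → total Y v *ᶻ total Y v)
      l : ∀ T L V s → T *ᶻ (L *ᶻ V +ᶻ s *ᶻ (L *ᶻ V)) ≡ (1ℤ +ᶻ s) *ᶻ (T *ᶻ L *ᶻ V)
      l = ℤSolver.solve-∀
      lengths : T *ᶻ L ≡ ℤ.+ length (vecs xs (suc s))
      lengths = trans (sym (ℤ.pos-* (length xs) (length (vecs xs s)))) (cong ℤ.+_ (trans (cong (length xs *_) (length-vecs xs s)) (sym (length-vecs xs (suc s)))))
      square : ∀ a b → (a +ᶻ b) *ᶻ (a +ᶻ b) ≡ a *ᶻ a +ᶻ ((a +ᶻ a) *ᶻ b +ᶻ b *ᶻ b)
      square = ℤSolver.solve-∀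
      inner : ∀ x → ∑ (vecs xs s) (λ v → (Y x +ᶻ total Y v) *ᶻ (Y x +ᶻ total Y v)) ≡ L *ᶻ (Y x *ᶻ Y x) +ᶻ W
      inner x = begin
        ∑ (vecs xs s) (λ v → (Y x +ᶻ total Y v) *ᶻ (Y x +ᶻ total Y v))
          ≡⟨ S.fold-cong (vecs xs s) (λ v → square (Y x) (total Y v)) ⟩
        ∑ (vecs xs s) (λ v → Y x *ᶻ Y x +ᶻ ((Y x +ᶻ Y x) *ᶻ total Y v +ᶻ total Y v *ᶻ total Y v))
          ≡⟨ trans (S.fold-∙ (vecs xs s) _ _) (cong₂ _+ᶻ_ (∑-const (vecs xs s) (Y x *ᶻ Y x)) (S.fold-∙ (vecs xs s) _ _)) ⟩
        L *ᶻ (Y x *ᶻ Y x) +ᶻ (∑ (vecs xs s) (λ v → (Y x +ᶻ Y x) *ᶻ total Y v) +ᶻ W)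
          ≡⟨ cong (λ z → L *ᶻ (Y x *ᶻ Y x) +ᶻ (z +ᶻ W)) (trans (∑-*ˡ (vecs xs s) (Y x +ᶻ Y x) (total Y)) (trans (cong ((Y x +ᶻ Y x) *ᶻ_) (∑-total s)) (ℤ.*-zeroʳ (Y x +ᶻ Y x)))) ⟩
        L *ᶻ (Y x *ᶻ Y x) +ᶻ (0ℤ +ᶻ W)
          ≡⟨ cong (L *ᶻ (Y x *ᶻ Y x) +ᶻ_) (ℤ.+-identityˡ W) ⟩
        L *ᶻ (Y x *ᶻ Y x) +ᶻ W ∎

    -- Δ / m is the square of the tolerated deviation of the total of s samples.
    chebyshev : ∀ s W m Δ .{{_ : NonZero Δ}} .{{_ : NonZero (length xs)}} → V ≤ᶻ ℤ.+ (length xs * W) → 3 * s * W * m ≤ Δ →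
      ∀ {Good : Vec A s → Set} (good? : Decidable Good) → (∀ v → ¬ Good v → Δ ≤ m * (ℤ.∣ total Y v ∣ * ℤ.∣ total Y v ∣)) →
      2 * length xs ^ s ≤ 3 * ℕΣ.∑ (vecs xs s) (λ v → ℕΣ.⟦ good? v ⟧)
    chebyshev s W m Δ V≤ enough good? deviates = ℕ.+-cancelʳ-≤ (length xs ^ s) _ _ (begin
      2 * N + N                                  ≡⟨ l₁ N ⟩
      3 * N                                      ≡⟨ cong (3 *_) partition ⟨
      3 * (#good + #bad)                         ≡⟨ ℕ.*-distribˡ-+ 3 #good #bad ⟩
      3 * #good + 3 * #bad                       ≤⟨ ℕ.+-monoʳ-≤ (3 * #good) (ℕ.*-cancelʳ-≤ (3 * #bad) N Δ (ℕ.*-cancelˡ-≤ (length xs) rare)) ⟩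
      3 * #good + N                              ∎)
      where
      open ℕ.≤-Reasoning
      N = length xs ^ s
      #good = ℕΣ.∑ (vecs xs s) (λ v → ℕΣ.⟦ good? v ⟧)
      #bad = ℕΣ.∑ (vecs xs s) (λ v → ℕΣ.⟦ ¬? (good? v) ⟧)
      sq : Vec A s → ℕ
      sq v = ℤ.∣ total Y v ∣ * ℤ.∣ total Y v ∣
      l₁ : ∀ n → 2 * n + n ≡ 3 * n
      l₁ = solve-∀
      l₂ : ∀ t b d → t * (3 * b * d) ≡ 3 * (t * (b * d))
      l₂ = solve-∀
      l₃ : ∀ t m q → 3 * (t * (m * q)) ≡ 3 * m * (t * q)
      l₃ = solve-∀
      l₄ : ∀ m s n t w → 3 * m * (s * (n * (t * w))) ≡ t * (n * (3 * s * w * m))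
      l₄ = solve-∀
      partition : #good + #bad ≡ N
      partition = trans (sym (ℕΣ.S.fold-∙ (vecs xs s) _ _)) (trans (ℕΣ.S.fold-cong (vecs xs s) one) (trans (∑-constⁿ (vecs xs s) 1) (trans (ℕ.*-identityʳ _) (length-vecs xs s))))
        where
        one : ∀ v → ℕΣ.⟦ good? v ⟧ + ℕΣ.⟦ ¬? (good? v) ⟧ ≡ 1
        one v with good? v
        ... | yes _ = refl
        ... | no _  = refl
      variance : length xs * ℕΣ.∑ (vecs xs s) sq ≤ s * (N * (length xs * W))
      variance = ℤ.drop‿+≤+ (subst₂ _≤ᶻ_
        (trans (sym (∑-total² s)) (trans (cong (T *ᶻ_) (trans (S.fold-cong (vecs xs s) (λ v → sym (∣i∣² (total Y v)))) (sym (pos-∑ (vecs xs s) sq)))) (sym (ℤ.pos-* (length xs) _))))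
        (trans (cong (λ z → ℤ.+ s *ᶻ (ℤ.+ z *ᶻ ℤ.+ (length xs * W))) (length-vecs xs s)) (trans (cong (ℤ.+ s *ᶻ_) (sym (ℤ.pos-* N (length xs * W)))) (sym (ℤ.pos-* s _))))
        (ℤ.*-monoˡ-≤-nonNeg (ℤ.+ s) (ℤ.*-monoˡ-≤-nonNeg (ℤ.+ length (vecs xs s)) V≤)))
      each : ∀ v → ℕΣ.⟦ ¬? (good? v) ⟧ * Δ ≤ m * sq v
      each v with good? v
      ... | yes _ = z≤n
      ... | no ¬g = ℕ.≤-trans (ℕ.≤-reflexive (ℕ.*-identityˡ Δ)) (deviates v ¬g)
      rare : length xs * (3 * #bad * Δ) ≤ length xs * (N * Δ)
      rare = begin
        length xs * (3 * #bad * Δ)                                       ≡⟨ l₂ (length xs) #bad Δ ⟩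
        3 * (length xs * (#bad * Δ))                                     ≡⟨ cong (λ z → 3 * (length xs * z)) (ℕΣ.∑-*ʳ (vecs xs s) Δ _) ⟨
        3 * (length xs * ℕΣ.∑ (vecs xs s) (λ v → ℕΣ.⟦ ¬? (good? v) ⟧ * Δ)) ≤⟨ ℕ.*-monoʳ-≤ 3 (ℕ.*-monoʳ-≤ (length xs) (∑-mono (vecs xs s) each)) ⟩
        3 * (length xs * ℕΣ.∑ (vecs xs s) (λ v → m * sq v))              ≡⟨ cong (λ z → 3 * (length xs * z)) (ℕΣ.∑-*ˡ (vecs xs s) m sq) ⟩
        3 * (length xs * (m * ℕΣ.∑ (vecs xs s) sq))                      ≡⟨ l₃ (length xs) m (ℕΣ.∑ (vecs xs s) sq) ⟩
        3 * m * (length xs * ℕΣ.∑ (vecs xs s) sq)                        ≤⟨ ℕ.*-monoʳ-≤ (3 * m) variance ⟩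
        3 * m * (s * (N * (length xs * W)))                              ≡⟨ l₄ m s N (length xs) W ⟩
        length xs * (N * (3 * s * W * m))                                ≤⟨ ℕ.*-monoʳ-≤ (length xs) (ℕ.*-monoʳ-≤ N enough) ⟩
        length xs * (N * Δ)                                              ∎

  -- Centring at the mean c / q subtracts its square from the second moment.
  module _ (xs : List A) (X : A → ℤ) (q c : ℤ) (mean : q *ᶻ ∑ xs X ≡ ℤ.+ length xs *ᶻ c) where

    centred : A → ℤ
    centred x = q *ᶻ X x +ᶻ - c

    ∑-centred : ∑ xs centred ≡ 0ℤ
    ∑-centred = trans (S.fold-∙ xs _ _) (trans (cong₂ _+ᶻ_ (trans (∑-*ˡ xs q X) mean) (trans (∑-const xs (- c)) (sym (ℤ.neg-distribʳ-* (ℤ.+ length xs) c)))) (ℤ.+-inverseʳ (ℤ.+ length xs *ᶻ c)))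

    ∑-centred² : ∑ xs (λ x → centred x *ᶻ centred x) +ᶻ ℤ.+ length xs *ᶻ (c *ᶻ c) ≡ q *ᶻ q *ᶻ ∑ xs (λ x → X x *ᶻ X x)
    ∑-centred² = begin
      ∑ xs (λ x → centred x *ᶻ centred x) +ᶻ T *ᶻ (c *ᶻ c)
        ≡⟨ cong (_+ᶻ T *ᶻ (c *ᶻ c)) (S.fold-cong xs (λ x → l₁ q (X x) c)) ⟩
      ∑ xs (λ x → q *ᶻ q *ᶻ (X x *ᶻ X x) +ᶻ ((- (c +ᶻ c)) *ᶻ (q *ᶻ X x) +ᶻ c *ᶻ c)) +ᶻ T *ᶻ (c *ᶻ c)
        ≡⟨ cong (_+ᶻ T *ᶻ (c *ᶻ c)) (trans (S.fold-∙ xs _ _) (cong₂ _+ᶻ_ (∑-*ˡ xs (q *ᶻ q) _) (trans (S.fold-∙ xs _ _) (cong₂ _+ᶻ_ (trans (∑-*ˡ xs (- (c +ᶻ c)) _) (cong (- (c +ᶻ c) *ᶻ_) (trans (∑-*ˡ xs q X) mean))) (∑-const xs (c *ᶻ c)))))) ⟩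
      q *ᶻ q *ᶻ M +ᶻ (- (c +ᶻ c) *ᶻ (T *ᶻ c) +ᶻ T *ᶻ (c *ᶻ c)) +ᶻ T *ᶻ (c *ᶻ c)
        ≡⟨ l₂ (q *ᶻ q *ᶻ M) T c ⟩
      q *ᶻ q *ᶻ M ∎
      where
      open ≡-Reasoning
      T = ℤ.+ length xs
      M = ∑ xs (λ x → X x *ᶻ X x)
      l₁ : ∀ q x c → (q *ᶻ x +ᶻ - c) *ᶻ (q *ᶻ x +ᶻ - c) ≡ q *ᶻ q *ᶻ (x *ᶻ x) +ᶻ ((- (c +ᶻ c)) *ᶻ (q *ᶻ x) +ᶻ c *ᶻ c)
      l₁ = ℤSolver.solve-∀
      l₂ : ∀ a t c → a +ᶻ (- (c +ᶻ c) *ᶻ (t *ᶻ c) +ᶻ t *ᶻ (c *ᶻ c)) +ᶻ t *ᶻ (c *ᶻ c) ≡ a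
      l₂ = ℤSolver.solve-∀

module Machine where

  open import Defs
  open import Data.Bool.Base using (if_then_else_)
  open import Data.Fin.Base as Fin using (Fin; zero; suc; toℕ; fromℕ<; _↑ˡ_; _↑ʳ_; splitAt)
  import Data.Fin.Properties as Fin
  open import Data.List.Base using (List; []; _∷_; _++_; length; concatMap; head; drop)
  open import Data.List.Membership.Propositional using (_∈_)
  open import Data.List.Relation.Unary.Any using (here; there)
  open import Data.List.Relation.Unary.All as All using (All)
  open import Data.List.Relation.Unary.Unique.Propositional using (Unique; []; _∷_)
  open import Data.Maybe.Base using (fromMaybe)
  open import Data.Nat.Base as ℕ using (ℕ; zero; suc; _+_; _*_; _^_; _⊔_; _≤_; _<_; s≤s)
  open import Data.Nat.DivMod
  import Data.Nat.Properties as ℕ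
  open import Data.Product.Base using (∃-syntax; _×_; _,_; proj₁; proj₂)
  open import Data.Sum.Base using (_⊎_; inj₁; inj₂)
  open import Data.Vec.Base as Vec using (Vec; lookup; _[_]≔_)
  import Data.Vec.Properties as Vec
  open import Function.Base using (_∘_)
  open import Relation.Binary.PropositionalEquality
  open import Relation.Nullary.Decidable using (yes; no; does; dec-true; dec-false)
  open import Relation.Nullary.Negation using (¬_; contradiction)

  data Reg (h B : ℕ) : Set where
    gl    : Fin 11 → Reg h B
    vt hs : Fin h → Reg h B
    bl    : Fin B → Reg h B

  data Expr (h B : ℕ) : Set where
    lit  : ℕ → Expr h B
    var  : Reg h B → Expr h B
    exop : Op → Expr h B → Expr h B → Expr h B

  data Stmt (h B : ℕ) : Set where
    set : Reg h B → Expr h B → Stmt h B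
    get : Reg h B → Reg h B → Stmt h B
    put : Reg h B → Reg h B → Stmt h B
    inp : Reg h B → ℕ → Stmt h B

  data Ins : Set where
    constᵢ : (x k : ℕ) → Ins
    binᵢ   : (o : Op) (x y z : ℕ) → Ins
    loadᵢ storeᵢ inputᵢ : (x y : ℕ) → Ins

  ⌈_⌉ : Ins → Cmd
  ⌈ constᵢ x k ⌉   = const x k
  ⌈ binᵢ o x y z ⌉ = bin o x y z
  ⌈ loadᵢ x y ⌉    = load x y
  ⌈ storeᵢ x y ⌉   = store x y
  ⌈ inputᵢ x y ⌉   = input x y

  block : List Ins → Cmd
  block []       = skip
  block (i ∷ is) = ⌈ i ⌉ ⨾ block is

  nesting-block : ∀ is → nesting (block is) ≡ 0
  nesting-block []                  = refl
  nesting-block (constᵢ _ _ ∷ is)   = nesting-block is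
  nesting-block (binᵢ _ _ _ _ ∷ is) = nesting-block is
  nesting-block (loadᵢ _ _ ∷ is)    = nesting-block is
  nesting-block (storeᵢ _ _ ∷ is)   = nesting-block is
  nesting-block (inputᵢ _ _ ∷ is)   = nesting-block is

  module Registers (h B : ℕ) where

    V : ℕ
    V = 11 + (h + (h + B))

    number : Reg h B → Fin V
    number (gl i) = i ↑ˡ (h + (h + B))
    number (vt j) = 11 ↑ʳ (j ↑ˡ (h + B))
    number (hs j) = 11 ↑ʳ (h ↑ʳ (j ↑ˡ B))
    number (bl b) = 11 ↑ʳ (h ↑ʳ (h ↑ʳ b))

    denumber₂ : Fin h ⊎ Fin B → Reg h B
    denumber₂ (inj₁ j) = hs j
    denumber₂ (inj₂ b) = bl b

    denumber₁ : Fin h ⊎ Fin (h + B) → Reg h B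
    denumber₁ (inj₁ j) = vt j
    denumber₁ (inj₂ x) = denumber₂ (splitAt h x)

    denumber : Fin 11 ⊎ Fin (h + (h + B)) → Reg h B
    denumber (inj₁ i) = gl i
    denumber (inj₂ x) = denumber₁ (splitAt h x)

    denumber-number : ∀ r → denumber (splitAt 11 (number r)) ≡ r
    denumber-number (gl i) = cong denumber (Fin.splitAt-↑ˡ 11 i (h + (h + B)))
    denumber-number (vt j) = trans (cong denumber (Fin.splitAt-↑ʳ 11 (h + (h + B)) (j ↑ˡ (h + B)))) (cong denumber₁ (Fin.splitAt-↑ˡ h j (h + B)))
    denumber-number (hs j) = trans (cong denumber (Fin.splitAt-↑ʳ 11 (h + (h + B)) (h ↑ʳ (j ↑ˡ B)))) (trans (cong denumber₁ (Fin.splitAt-↑ʳ h (h + B) (j ↑ˡ B))) (cong denumber₂ (Fin.splitAt-↑ˡ h j B)))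
    denumber-number (bl b) = trans (cong denumber (Fin.splitAt-↑ʳ 11 (h + (h + B)) (h ↑ʳ (h ↑ʳ b)))) (trans (cong denumber₁ (Fin.splitAt-↑ʳ h (h + B) (h ↑ʳ b))) (cong denumber₂ (Fin.splitAt-↑ʳ h B b)))

    idx : Reg h B → ℕ
    idx r = toℕ (number r)

    idx<V : ∀ r → idx r < V
    idx<V r = Fin.toℕ<n (number r)

    idx-injective : ∀ {r r′} → idx r ≡ idx r′ → r ≡ r′
    idx-injective {r} {r′} e = trans (sym (denumber-number r)) (trans (cong (denumber ∘ splitAt 11) (Fin.toℕ-injective e)) (denumber-number r′))

    height : Expr h B → ℕ
    height (lit k)      = 0
    height (var r)      = 1
    height (exop o a b) = suc (height a) ⊔ (2 + height b)

    -- The value goes to x; cells from d on serve as scratch.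
    compile : Expr h B → (x d : ℕ) → List Ins
    compile (lit k)      x d = constᵢ x k ∷ []
    compile (var r)      x d = constᵢ d 0 ∷ binᵢ add x (idx r) d ∷ []
    compile (exop o a b) x d = compile a d (suc d) ++ compile b (suc d) (2 + d) ++ binᵢ o x d (suc d) ∷ []

    translate : Stmt h B → List Ins
    translate (set x e) = compile e (idx x) V
    translate (get x p) = loadᵢ (idx x) (idx p) ∷ []
    translate (put p x) = storeᵢ (idx p) (idx x) ∷ []
    translate (inp x k) = constᵢ V k ∷ inputᵢ (idx x) V ∷ []

    assemble : List (Stmt h B) → List Ins
    assemble = concatMap translate

    opaque
      program : List (Stmt h B) → Cmd
      program ss = block (assemble ss)

      duration : List (Stmt h B) → ℕ
      duration ss = length (assemble ss)

      nesting-program : ∀ ss → nesting (program ss) ≡ 0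
      nesting-program ss = nesting-block (assemble ss)

    heights : List (Stmt h B) → ℕ
    heights []              = 0
    heights (set x e ∷ ss)  = height e ⊔ heights ss
    heights (get x p ∷ ss)  = heights ss
    heights (put p x ∷ ss)  = heights ss
    heights (inp x k ∷ ss)  = 1 ⊔ heights ss

    height≤heights : ∀ {x e ss} → set x e ∈ ss → height e ≤ heights ss
    height≤heights {ss = set x e ∷ ss}  (here refl) = ℕ.m≤m⊔n (height e) (heights ss)
    height≤heights {ss = set x e ∷ ss}  (there m)   = ℕ.≤-trans (height≤heights m) (ℕ.m≤n⊔m (height e) (heights ss))
    height≤heights {ss = get x p ∷ ss}  (there m)   = height≤heights m
    height≤heights {ss = put p x ∷ ss}  (there m)   = height≤heights m
    height≤heights {ss = inp x k ∷ ss}  (there m)   = ℕ.≤-trans (height≤heights m) (ℕ.m≤n⊔m 1 (heights ss))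

    record State : Set where
      constructor state
      field
        glob : Fin 11 → ℕ
        vert hash : Fin h → ℕ
        blok : Fin B → ℕ
        mem  : ℕ → ℕ
    open State public

    reg : State → Reg h B → ℕ
    reg σ (gl i) = glob σ i
    reg σ (vt j) = vert σ j
    reg σ (hs j) = hash σ j
    reg σ (bl b) = blok σ b

    infixl 6 _[_≔_]
    _[_≔_] : ∀ {m} → (Fin m → ℕ) → Fin m → ℕ → Fin m → ℕ
    (ρ [ x ≔ v ]) y = if does (y Fin.≟ x) then v else ρ y

    assign : Reg h B → ℕ → State → State
    assign (gl i) v σ = record σ { glob = glob σ [ i ≔ v ] }
    assign (vt j) v σ = record σ { vert = vert σ [ j ≔ v ] }
    assign (hs j) v σ = record σ { hash = hash σ [ j ≔ v ] }
    assign (bl b) v σ = record σ { blok = blok σ [ b ≔ v ] }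

    ≔-same : ∀ {m} (ρ : Fin m → ℕ) x v → (ρ [ x ≔ v ]) x ≡ v
    ≔-same ρ x v = cong (λ z → if z then v else ρ x) (dec-true (x Fin.≟ x) refl)

    ≔-other : ∀ {m} (ρ : Fin m → ℕ) {x y} v → y ≢ x → (ρ [ x ≔ v ]) y ≡ ρ y
    ≔-other ρ {x} {y} v y≢x = cong (λ z → if z then v else ρ y) (dec-false (y Fin.≟ x) y≢x)

    assign-same : ∀ x v σ → reg (assign x v σ) x ≡ v
    assign-same (gl i) v σ = ≔-same (glob σ) i v
    assign-same (vt j) v σ = ≔-same (vert σ) j v
    assign-same (hs j) v σ = ≔-same (hash σ) j v
    assign-same (bl b) v σ = ≔-same (blok σ) b v

    assign-other : ∀ x v σ r → r ≢ x → reg (assign x v σ) r ≡ reg σ r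
    assign-other (gl i) v σ (gl j) ne = ≔-other (glob σ) v (λ { refl → ne refl })
    assign-other (gl i) v σ (vt j) ne = refl
    assign-other (gl i) v σ (hs j) ne = refl
    assign-other (gl i) v σ (bl j) ne = refl
    assign-other (vt i) v σ (gl j) ne = refl
    assign-other (vt i) v σ (vt j) ne = ≔-other (vert σ) v (λ { refl → ne refl })
    assign-other (vt i) v σ (hs j) ne = refl
    assign-other (vt i) v σ (bl j) ne = refl
    assign-other (hs i) v σ (gl j) ne = refl
    assign-other (hs i) v σ (vt j) ne = refl
    assign-other (hs i) v σ (hs j) ne = ≔-other (hash σ) v (λ { refl → ne refl })
    assign-other (hs i) v σ (bl j) ne = refl
    assign-other (bl i) v σ (gl j) ne = refl
    assign-other (bl i) v σ (vt j) ne = refl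
    assign-other (bl i) v σ (hs j) ne = refl
    assign-other (bl i) v σ (bl j) ne = ≔-other (blok σ) v (λ { refl → ne refl })

    assign-mem : ∀ x v σ → mem (assign x v σ) ≡ mem σ
    assign-mem (gl i) v σ = refl
    assign-mem (vt j) v σ = refl
    assign-mem (hs j) v σ = refl
    assign-mem (bl b) v σ = refl

    poke : ℕ → ℕ → State → State
    poke a v σ = record σ { mem = λ y → if does (y ℕ.≟ a) then v else mem σ y }

  module Simulation (h B w S : ℕ) where
    open RAM w S
    open Registers h B

    private
      N = 2 ^ w

    read-write-same : ∀ M {x} v → x < S → read (write M x v) x ≡ v % N
    read-write-same M {x} v x<S with x ℕ.<? S
    ... | no x≮S  = contradiction x<S x≮S
    ... | yes x<S with x ℕ.<? S
    ...   | no x≮S  = contradiction x<S x≮S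
    ...   | yes x<S′ = trans (cong toℕ (trans (cong (lookup (M [ fromℕ< x<S ]≔ (v mod N))) (Fin.fromℕ<-cong x x refl x<S′ x<S)) (Vec.lookup∘updateAt (fromℕ< x<S) M))) (Fin.toℕ-fromℕ< (m%n<n v N))

    read-write-other : ∀ M {x y} v → y ≢ x → read (write M x v) y ≡ read M y
    read-write-other M {x} {y} v y≢x with x ℕ.<? S
    ... | no _ = refl
    ... | yes x<S with y ℕ.<? S
    ...   | no _    = refl
    ...   | yes y<S = cong toℕ (Vec.lookup∘updateAt′ (fromℕ< y<S) (fromℕ< x<S) (λ e → y≢x (trans (sym (Fin.toℕ-fromℕ< y<S)) (trans (cong toℕ e) (Fin.toℕ-fromℕ< x<S)))) M)

    read< : ∀ M x → read M x < N
    read< M x with x ℕ.<? S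
    ... | yes x<S = Fin.toℕ<n (lookup M (fromℕ< x<S))
    ... | no _    = ℕ.m^n>0 2 w

    read% : ∀ M x → read M x % N ≡ read M x
    read% M x = m<n⇒m%n≡m (read< M x)

    effect : List ℕ → Ins → Memory → Memory
    effect I (constᵢ x k)   M = write M x k
    effect I (binᵢ o x y z) M = write M x (⟦ o ⟧ (read M y) (read M z))
    effect I (loadᵢ x y)    M = write M x (read M (read M y))
    effect I (storeᵢ x y)   M = write M (read M x) (read M y)
    effect I (inputᵢ x y)   M = write M x (fromMaybe 0 (head (drop (read M y) I)))

    effects : List ℕ → List Ins → Memory → Memory
    effects I []       M = M
    effects I (i ∷ is) M = effects I is (effect I i M)

    effects-++ : ∀ I is js M → effects I (is ++ js) M ≡ effects I js (effects I is M)
    effects-++ I []       js M = refl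
    effects-++ I (i ∷ is) js M = effects-++ I is js (effect I i M)

    exec-ins : ∀ I i M → exec I ⌈ i ⌉ M ≡ return (effect I i M , 1)
    exec-ins I (constᵢ x k)   M = refl
    exec-ins I (binᵢ o x y z) M = refl
    exec-ins I (loadᵢ x y)    M = refl
    exec-ins I (storeᵢ x y)   M = refl
    exec-ins I (inputᵢ x y)   M = refl

    exec-block : ∀ I is M → exec I (block is) M ≡ return (effects I is M , suc (length is))
    exec-block I []       M = refl
    exec-block I (i ∷ is) M rewrite exec-ins I i M | exec-block I is (effect I i M) = refl

    exec-seq : ∀ I c d {M M₁ M₂ t₁ t₂} → exec I c M ≡ return (M₁ , t₁) → exec I d M₁ ≡ return (M₂ , t₂) → exec I (c ⨾ d) M ≡ return (M₂ , t₁ + t₂)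
    exec-seq I c d e₁ e₂ rewrite e₁ | e₂ = refl

    exec-seq-loop : ∀ I c x d {M M₁ t m} → exec I c M ≡ return (M₁ , t) → read M₁ x ≡ m →
      exec I (c ⨾ loop x d) M ≡ (tick (iterate m (exec I d) M₁) >>= λ (M′ , t′) → return (M′ , t + t′))
    exec-seq-loop I c x d e₁ refl rewrite e₁ = refl

    exec-rand-seq : ∀ I x y d {M m} → read M y ≡ suc m →
      exec I (rand x y ⨾ d) M ≡ draw m (λ i → exec I d (write M x (toℕ i)) >>= λ (M′ , t′) → return (M′ , 1 + t′))
    exec-rand-seq I x y d e rewrite e = refl

    eval : State → Expr h B → ℕ
    eval σ (lit k)      = k % N
    eval σ (var r)      = reg σ r
    eval σ (exop o a b) = ⟦ o ⟧ (eval σ a) (eval σ b) % N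

    compile-correct : ∀ I e x d M σ → (∀ r → read M (idx r) ≡ reg σ r) → V ≤ d → d + height e ≤ S → x < S →
      read (effects I (compile e x d) M) x ≡ eval σ e ×
      (∀ y → y ≢ x → y < d ⊎ d + height e ≤ y → read (effects I (compile e x d) M) y ≡ read M y)
    compile-correct I (lit k) x d M σ sim V≤d d≤S x<S = read-write-same M k x<S , λ y y≢x _ → read-write-other M k y≢x
    compile-correct I (var r) x d M σ sim V≤d d≤S x<S = at , other
      where
      M₁ = write M d 0
      d<S : d < S
      d<S = ℕ.≤-trans (ℕ.≤-reflexive (ℕ.+-comm 1 d)) d≤S
      r≢d : idx r ≢ d
      r≢d e = ℕ.<-irrefl e (ℕ.<-≤-trans (idx<V r) V≤d)
      at : read (write M₁ x (read M₁ (idx r) + read M₁ d)) x ≡ reg σ r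
      at = trans (read-write-same M₁ _ x<S) (trans (cong (_% N) (trans (cong₂ _+_ (read-write-other M 0 r≢d) (trans (read-write-same M 0 d<S) (m<n⇒m%n≡m (ℕ.m^n>0 2 w)))) (ℕ.+-identityʳ _))) (trans (read% M (idx r)) (sim r)))
      other : ∀ y → y ≢ x → y < d ⊎ d + 1 ≤ y → read (write M₁ x (read M₁ (idx r) + read M₁ d)) y ≡ read M y
      other y y≢x far = trans (read-write-other M₁ _ y≢x) (read-write-other M 0 (y≢d far))
        where
        y≢d : y < d ⊎ d + 1 ≤ y → y ≢ d
        y≢d (inj₁ y<d) refl = ℕ.<-irrefl refl y<d
        y≢d (inj₂ d<y) refl = ℕ.<-irrefl refl (ℕ.≤-trans (ℕ.≤-reflexive (ℕ.+-comm 1 y)) d<y)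
    compile-correct I (exop o a b) x d M σ sim V≤d d≤S x<S
      rewrite effects-++ I (compile a d (suc d)) (compile b (suc d) (2 + d) ++ binᵢ o x d (suc d) ∷ []) M
            | effects-++ I (compile b (suc d) (2 + d)) (binᵢ o x d (suc d) ∷ []) (effects I (compile a d (suc d)) M) = at , other
      where
      M₁ = effects I (compile a d (suc d)) M
      M₂ = effects I (compile b (suc d) (2 + d)) M₁
      ha = suc (height a)
      hb = 2 + height b
      a≤ : suc d + height a ≤ d + (ha ⊔ hb)
      a≤ = ℕ.≤-trans (ℕ.≤-reflexive (sym (ℕ.+-suc d (height a)))) (ℕ.+-monoʳ-≤ d (ℕ.m≤m⊔n ha hb))
      b≤ : 2 + d + height b ≤ d + (ha ⊔ hb)
      b≤ = ℕ.≤-trans (ℕ.≤-reflexive (trans (cong suc (sym (ℕ.+-suc d (height b)))) (sym (ℕ.+-suc d (suc (height b)))))) (ℕ.+-monoʳ-≤ d (ℕ.m≤n⊔m ha hb))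
      d<S : d < S
      d<S = ℕ.≤-trans (s≤s (ℕ.m≤m+n d (height a))) (ℕ.≤-trans a≤ d≤S)
      d+1<S : suc d < S
      d+1<S = ℕ.≤-trans (s≤s (s≤s (ℕ.m≤m+n d (height b)))) (ℕ.≤-trans b≤ d≤S)
      ca = compile-correct I a d (suc d) M σ sim (ℕ.m≤n⇒m≤1+n V≤d) (ℕ.≤-trans a≤ d≤S) d<S
      sim₁ : ∀ r → read M₁ (idx r) ≡ reg σ r
      sim₁ r = trans (proj₂ ca (idx r) (λ e → ℕ.<-irrefl e r<d) (inj₁ (ℕ.m≤n⇒m≤1+n r<d))) (sim r)
        where r<d = ℕ.<-≤-trans (idx<V r) V≤d
      cb = compile-correct I b (suc d) (2 + d) M₁ σ sim₁ (ℕ.m≤n⇒m≤1+n (ℕ.m≤n⇒m≤1+n V≤d)) (ℕ.≤-trans b≤ d≤S) d+1<S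
      at : read (write M₂ x (⟦ o ⟧ (read M₂ d) (read M₂ (suc d)))) x ≡ ⟦ o ⟧ (eval σ a) (eval σ b) % N
      at = trans (read-write-same M₂ _ x<S) (cong (_% N) (cong₂ ⟦ o ⟧
        (trans (proj₂ cb d (λ e → ℕ.<-irrefl e (ℕ.n<1+n d)) (inj₁ (ℕ.m≤n⇒m≤1+n (ℕ.n<1+n d)))) (proj₁ ca)) (proj₁ cb)))
      other : ∀ y → y ≢ x → y < d ⊎ d + (ha ⊔ hb) ≤ y → read (write M₂ x (⟦ o ⟧ (read M₂ d) (read M₂ (suc d)))) y ≡ read M y
      other y y≢x (inj₁ y<d) = trans (read-write-other M₂ _ y≢x) (trans
        (proj₂ cb y (λ e → ℕ.<-irrefl e (ℕ.m≤n⇒m≤1+n y<d)) (inj₁ (ℕ.m≤n⇒m≤1+n (ℕ.m≤n⇒m≤1+n y<d))))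
        (proj₂ ca y (λ e → ℕ.<-irrefl e y<d) (inj₁ (ℕ.m≤n⇒m≤1+n y<d))))
      other y y≢x (inj₂ le) = trans (read-write-other M₂ _ y≢x) (trans
        (proj₂ cb y (λ e → ℕ.<-irrefl (sym e) (ℕ.≤-trans (s≤s (s≤s (ℕ.m≤m+n d (height b)))) (ℕ.≤-trans b≤ le))) (inj₂ (ℕ.≤-trans b≤ le)))
        (proj₂ ca y (λ e → ℕ.<-irrefl (sym e) (ℕ.≤-trans (s≤s (ℕ.m≤m+n d (height a))) (ℕ.≤-trans a≤ le))) (inj₂ (ℕ.≤-trans a≤ le))))

    -- M agrees with the abstract state outside the scratch cells between V and R.
    module Running (R : ℕ) (R≤S : R ≤ S) (V<R : V < R) where

      infix 4 _∼_
      _∼_ : Memory → State → Set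
      M ∼ σ = (∀ r → read M (idx r) ≡ reg σ r) × (∀ a → R ≤ a → read M a ≡ mem σ a)

      step : List ℕ → Stmt h B → State → State
      step I (set x e) σ = assign x (eval σ e) σ
      step I (get x p) σ = assign x (mem σ (reg σ p)) σ
      step I (put p x) σ = poke (reg σ p) (reg σ x) σ
      step I (inp x k) σ = assign x (fromMaybe 0 (head (drop k I)) % N) σ

      Safe : Stmt h B → State → Set
      Safe (set x e) σ = V + height e ≤ R
      Safe (get x p) σ = R ≤ reg σ p
      Safe (put p x) σ = R ≤ reg σ p × reg σ p < S
      Safe (inp x k) σ = k < N

      V≤R : V ≤ R
      V≤R = ℕ.<⇒≤ V<R

      reg<S : ∀ r → idx r < S
      reg<S r = ℕ.<-≤-trans (idx<V r) (ℕ.≤-trans V≤R R≤S)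

      idx≢ : ∀ r {a} → R ≤ a → idx r ≢ a
      idx≢ r R≤a e = ℕ.<-irrefl e (ℕ.<-≤-trans (idx<V r) (ℕ.≤-trans V≤R R≤a))

      assigned : ∀ {M M′ σ} x v → M ∼ σ → read M′ (idx x) ≡ v → (∀ y → y ≢ idx x → y < V ⊎ R ≤ y → read M′ y ≡ read M y) → M′ ∼ assign x v σ
      assigned {M} {M′} {σ} x v (regs , mems) at other = regs′ , λ a R≤a → trans (other a (λ e → idx≢ x R≤a (sym e)) (inj₂ R≤a)) (trans (mems a R≤a) (cong (λ m → m a) (sym (assign-mem x v σ))))
        where
        regs′ : ∀ r → read M′ (idx r) ≡ reg (assign x v σ) r
        regs′ r with idx r ℕ.≟ idx x
        ... | yes e with refl ← idx-injective {r} {x} e = trans at (sym (assign-same x v σ))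
        ... | no ne = trans (other (idx r) ne (inj₁ (idx<V r))) (trans (regs r) (sym (assign-other x v σ r (ne ∘ cong idx))))

      step-correct : ∀ I s {M σ} → M ∼ σ → Safe s σ → effects I (translate s) M ∼ step I s σ
      step-correct I (set x e) {M} {σ} sim fits with compile-correct I e (idx x) V M σ (proj₁ sim) ℕ.≤-refl (ℕ.≤-trans fits R≤S) (reg<S x)
      ... | at , other = assigned x (eval σ e) sim at (λ y ne far → other y ne (beyond far))
        where
        beyond : ∀ {y} → y < V ⊎ R ≤ y → y < V ⊎ V + height e ≤ y
        beyond (inj₁ y<V) = inj₁ y<V
        beyond (inj₂ R≤y) = inj₂ (ℕ.≤-trans fits R≤y)
      step-correct I (get x p) {M} {σ} sim R≤ = assigned x _ sim
        (trans (read-write-same M _ (reg<S x)) (trans (read% M _) (trans (cong (read M) (proj₁ sim p)) (proj₂ sim _ R≤))))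
        (λ y ne _ → read-write-other M _ ne)
      step-correct I (put p x) {M} {σ} (regs , mems) (R≤ , <S) rewrite regs p | regs x = regs′ , mems′
        where
        a = reg σ p
        regs′ : ∀ r → read (write M a (reg σ x)) (idx r) ≡ reg (poke a (reg σ x) σ) r
        regs′ r = trans (read-write-other M _ (idx≢ r R≤)) (trans (regs r) (unpoked r))
          where
          unpoked : ∀ r → reg σ r ≡ reg (poke a (reg σ x) σ) r
          unpoked (gl _) = refl
          unpoked (vt _) = refl
          unpoked (hs _) = refl
          unpoked (bl _) = refl
        mems′ : ∀ y → R ≤ y → read (write M a (reg σ x)) y ≡ (if does (y ℕ.≟ a) then reg σ x else mem σ y)
        mems′ y R≤y with y ℕ.≟ a
        ... | yes refl = trans (read-write-same M _ <S) (trans (cong (_% N) (sym (regs x))) (trans (read% M (idx x)) (trans (regs x) (sym (cong (λ z → if z then reg σ x else mem σ y) (dec-true (y ℕ.≟ y) refl))))))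
        ... | no ne    = trans (read-write-other M _ ne) (trans (mems y R≤y) (sym (cong (λ z → if z then reg σ x else mem σ y) (dec-false (y ℕ.≟ a) ne))))
      step-correct I (inp x k) {M} {σ} sim k<N = assigned x _ sim
        (trans (read-write-same M₁ _ (reg<S x)) (cong (λ z → fromMaybe 0 (head (drop z I)) % N) (trans (read-write-same M k V<S) (m<n⇒m%n≡m k<N))))
        (λ y ne far → trans (read-write-other M₁ _ ne) (read-write-other M k (y≢V far)))
        where
        M₁ = write M V k
        V<S : V < S
        V<S = ℕ.<-≤-trans V<R R≤S
        y≢V : ∀ {y} → y < V ⊎ R ≤ y → y ≢ V
        y≢V (inj₁ y<V) refl = ℕ.<-irrefl refl y<V
        y≢V (inj₂ R≤y) refl = ℕ.<-irrefl refl (ℕ.<-≤-trans V<R R≤y)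

      wp : List ℕ → List (Stmt h B) → (State → Set) → State → Set
      wp I []       Q σ = Q σ
      wp I (s ∷ ss) Q σ = Safe s σ × wp I ss Q (step I s σ)

      wp-mono : ∀ I ss {P Q : State → Set} {σ} → (∀ {τ} → P τ → Q τ) → wp I ss P σ → wp I ss Q σ
      wp-mono I []       f p        = f p
      wp-mono I (s ∷ ss) f (ok , p) = ok , wp-mono I ss f p

      wp-++ : ∀ I ss ts {Q σ} → wp I ss (wp I ts Q) σ → wp I (ss ++ ts) Q σ
      wp-++ I []       ts p        = p
      wp-++ I (s ∷ ss) ts (ok , p) = ok , wp-++ I ss ts p

      -- Every x turns U x into P x, and leaves the claims of the other members alone.
      wp-family : ∀ {A : Set} I (body : A → List (Stmt h B)) (xs : List A) (J : State → Set) (U P : A → State → Set) → Unique xs →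
        (∀ x {σ} → J σ → U x σ → wp I (body x) (λ τ → J τ × P x τ × (∀ y → y ≢ x → (U y σ → U y τ) × (P y σ → P y τ))) σ) →
        ∀ {σ} → J σ → (∀ x → x ∈ xs → U x σ) → wp I (concatMap body xs) (λ τ → J τ × (∀ x → x ∈ xs → P x τ)) σ
      wp-family {A} I body xs J U P uniq each {σ} j us = wp-mono I (concatMap body xs) (λ (j′ , all , _) → j′ , all) (go xs uniq j us)
        where
        go : ∀ xs → Unique xs → ∀ {σ} → J σ → (∀ x → x ∈ xs → U x σ) →
          wp I (concatMap body xs) (λ τ → J τ × (∀ x → x ∈ xs → P x τ) × (∀ y → ¬ y ∈ xs → P y σ → P y τ)) σ
        go []       _           j us = j , (λ _ ()) , λ y _ p → p
        go (x ∷ xs) (x∉ ∷ uniq) j us = wp-++ I (body x) (concatMap body xs) (wp-mono I (body x) (λ (j₁ , px , keep) →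
          wp-mono I (concatMap body xs) (λ (j₂ , all , keep₂) → j₂
            , (λ { _ (here refl) → keep₂ x (λ m → All.lookup x∉ m refl) px ; y (there m) → all y m })
            , (λ y y∉ p → keep₂ y (y∉ ∘ there) (proj₂ (keep y (λ { refl → y∉ (here refl) })) p)))
            (go xs uniq j₁ (λ y m → proj₁ (keep y (λ { refl → All.lookup x∉ m refl })) (us y (there m))))) (each x j (us x (here refl))))

      wp-correct : ∀ I ss {Q : State → Set} {M σ} → M ∼ σ → wp I ss Q σ → ∃[ τ ] effects I (assemble ss) M ∼ τ × Q τ
      wp-correct I []       sim q = _ , sim , q
      wp-correct I (s ∷ ss) {M = M} sim (ok , p) rewrite effects-++ I (translate s) (assemble ss) M = wp-correct I ss (step-correct I s sim ok) p

      Holds : (State → Set) → Memory → Set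
      Holds Q M = ∃[ σ ] M ∼ σ × Q σ

      opaque
        unfolding program duration

        exec-stmts : ∀ I ss {P Q : State → Set} {M} → (∀ {σ} → P σ → wp I ss Q σ) → Holds P M →
          ∃[ M′ ] exec I (program ss) M ≡ return (M′ , suc (duration ss)) × Holds Q M′
        exec-stmts I ss f (σ , sim , p) = effects I (assemble ss) _ , exec-block I (assemble ss) _ , wp-correct I ss sim (f p)

      iterate-stmts : ∀ I ss (P : ℕ → State → Set) n → (∀ {j σ} → j < n → P j σ → wp I ss (P (suc j)) σ) → ∀ k j {M} → j + k ≡ n → Holds (P j) M →
        ∃[ M′ ] iterate k (exec I (program ss)) M ≡ return (M′ , k * (2 + duration ss)) × Holds (P n) M′
      iterate-stmts I ss P n each zero    j {M} e p = M , refl , subst (λ z → Holds (P z) M) (trans (sym (ℕ.+-identityʳ j)) e) p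
      iterate-stmts I ss P n each (suc k) j {M} e p
        with exec-stmts I ss (each (ℕ.≤-trans (ℕ.m≤m+n (suc j) k) (ℕ.≤-reflexive (trans (sym (ℕ.+-suc j k)) e)))) p
      ... | M₁ , eq₁ , p₁ with iterate-stmts I ss P n each k (suc j) (trans (sym (ℕ.+-suc j k)) e) p₁
      ...   | M₂ , eq₂ , p₂ = M₂ , lemma , p₂
        where
        lemma : iterate (suc k) (exec I (program ss)) M ≡ return (M₂ , suc k * (2 + duration ss))
        lemma rewrite eq₁ | eq₂ = refl

      exec-loop : ∀ I x ss (P : ℕ → State → Set) n {M} → (∀ {j σ} → j < n → P j σ → wp I ss (P (suc j)) σ) → (∀ {σ} → P 0 σ → reg σ x ≡ n) → Holds (P 0) M →
        ∃[ M′ ] exec I (loop (idx x) (program ss)) M ≡ return (M′ , suc (n * (2 + duration ss))) × Holds (P n) M′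
      exec-loop I x ss P n {M} each count h₀@(σ , sim , p) with iterate-stmts I ss P n each n 0 refl h₀
      ... | M′ , e , q = M′ , lemma , q
        where
        lemma : exec I (loop (idx x) (program ss)) M ≡ return (M′ , suc (n * (2 + duration ss)))
        lemma rewrite trans (proj₁ sim x) (count p) | e = refl

module Modular where

  open Big
  open Hash using (evalPoly; ∑-upTo-suc)
  open Machine
  open import Defs using (add; sub; mul; quot; rem; eq; module RAM)
  open import Data.Bool.Base using (true; false; if_then_else_)
  open import Data.Fin.Base using (zero; suc)
  open import Data.Integer.Base as ℤ using (ℤ; 0ℤ; 1ℤ; -_) renaming (_+_ to _+ᶻ_; _*_ to _*ᶻ_)
  import Data.Integer.Properties as ℤ
  import Data.Integer.Tactic.RingSolver as ℤSolver
  open import Data.List.Base as List using (List; []; _∷_; upTo)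
  open import Data.List.Membership.Propositional using (_∈_)
  open import Data.List.Relation.Unary.Any using (here; there)
  open import Data.Nat.Base as ℕ using (ℕ; zero; suc; _+_; _*_; _∸_; _^_; _≤_; _<_; s≤s; NonZero)
  open import Data.Nat.DivMod
  import Data.Nat.Properties as ℕ
  open import Data.Vec.Base as Vec using (Vec; []; _∷_)
  open import Function.Base using (_∘_)
  open import Relation.Binary.PropositionalEquality
  open import Relation.Nullary.Decidable using (does)
  open import Relation.Nullary.Negation using (contradiction)
  open ℤΣ

  private variable
    A : Set

  ∑-upTo-δ : ∀ Q y (g : ℕ → ℤ) → y < Q → ∑ (upTo Q) (λ c → ⟦ y ℕ.≟ c ⟧ *ᶻ g c) ≡ g y
  ∑-upTo-δ (suc Q) zero    g _         = trans (∑-upTo-suc Q (λ c → ⟦ zero ℕ.≟ c ⟧ *ᶻ g c)) (trans (cong₂ _+ᶻ_ (ℤ.*-identityˡ (g 0)) (trans (S.fold-cong (upTo Q) (λ c → ℤ.*-zeroˡ (g (suc c)))) (S.fold-ε (upTo Q)))) (ℤ.+-identityʳ (g 0)))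
  ∑-upTo-δ (suc Q) (suc y) g (s≤s y<Q) = trans (∑-upTo-suc Q (λ c → ⟦ suc y ℕ.≟ c ⟧ *ᶻ g c)) (trans (cong₂ _+ᶻ_ (ℤ.*-zeroˡ (g 0)) (∑-upTo-δ Q y (g ∘ suc) y<Q)) (ℤ.+-identityˡ (g (suc y))))

  module Congruence (N : ℕ) .{{_ : NonZero N}} where

    infix 4 _≋_
    record _≋_ (a : ℕ) (z : ℤ) : Set where
      constructor multiple
      field
        factor   : ℤ
        equation : ℤ.+ a ≡ z +ᶻ factor *ᶻ ℤ.+ N

    ≋-pos : ∀ a → a ≋ ℤ.+ a
    ≋-pos a = multiple 0ℤ (sym (trans (cong (_+ᶻ_ (ℤ.+ a)) (ℤ.*-zeroˡ (ℤ.+ N))) (ℤ.+-identityʳ (ℤ.+ a))))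

    ≋-% : ∀ {a z} → a ≋ z → a % N ≋ z
    ≋-% {a} {z} (multiple m e) = multiple (m +ᶻ - (ℤ.+ (a / N))) (begin
      ℤ.+ (a % N)                                              ≡⟨ l₁ (ℤ.+ (a % N)) (ℤ.+ (a / N) *ᶻ ℤ.+ N) ⟩
      (ℤ.+ (a % N) +ᶻ ℤ.+ (a / N) *ᶻ ℤ.+ N) +ᶻ - (ℤ.+ (a / N) *ᶻ ℤ.+ N)   ≡⟨ cong (_+ᶻ - (ℤ.+ (a / N) *ᶻ ℤ.+ N)) (trans (cong (_+ᶻ_ (ℤ.+ (a % N))) (sym (ℤ.pos-* (a / N) N))) (sym (ℤ.pos-+ (a % N) (a / N * N)))) ⟩
      ℤ.+ (a % N + a / N * N) +ᶻ - (ℤ.+ (a / N) *ᶻ ℤ.+ N)      ≡⟨ cong (λ x → ℤ.+ x +ᶻ - (ℤ.+ (a / N) *ᶻ ℤ.+ N)) (m≡m%n+[m/n]*n a N) ⟨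
      ℤ.+ a +ᶻ - (ℤ.+ (a / N) *ᶻ ℤ.+ N)                        ≡⟨ cong (_+ᶻ - (ℤ.+ (a / N) *ᶻ ℤ.+ N)) e ⟩
      z +ᶻ m *ᶻ ℤ.+ N +ᶻ - (ℤ.+ (a / N) *ᶻ ℤ.+ N)              ≡⟨ l₂ z m (ℤ.+ N) (ℤ.+ (a / N)) ⟩
      z +ᶻ (m +ᶻ - (ℤ.+ (a / N))) *ᶻ ℤ.+ N                     ∎)
      where
      open ≡-Reasoning
      l₁ : ∀ a b → a ≡ (a +ᶻ b) +ᶻ - b
      l₁ = ℤSolver.solve-∀
      l₂ : ∀ z m n d → z +ᶻ m *ᶻ n +ᶻ - (d *ᶻ n) ≡ z +ᶻ (m +ᶻ - d) *ᶻ n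
      l₂ = ℤSolver.solve-∀

    ≋-+ : ∀ {a b y z} → a ≋ y → b ≋ z → a + b ≋ y +ᶻ z
    ≋-+ {a} {b} {y} {z} (multiple m e) (multiple m′ e′) = multiple (m +ᶻ m′) (trans (ℤ.pos-+ a b) (trans (cong₂ _+ᶻ_ e e′) (l y z m m′ (ℤ.+ N))))
      where
      l : ∀ y z m m′ n → (y +ᶻ m *ᶻ n) +ᶻ (z +ᶻ m′ *ᶻ n) ≡ y +ᶻ z +ᶻ (m +ᶻ m′) *ᶻ n
      l = ℤSolver.solve-∀

    ≋-* : ∀ {a b y z} → a ≋ y → b ≋ z → a * b ≋ y *ᶻ z
    ≋-* {a} {b} {y} {z} (multiple m e) (multiple m′ e′) = multiple (y *ᶻ m′ +ᶻ m *ᶻ z +ᶻ m *ᶻ ℤ.+ N *ᶻ m′) (trans (ℤ.pos-* a b) (trans (cong₂ _*ᶻ_ e e′) (l y z m m′ (ℤ.+ N))))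
      where
      l : ∀ y z m m′ n → (y +ᶻ m *ᶻ n) *ᶻ (z +ᶻ m′ *ᶻ n) ≡ y *ᶻ z +ᶻ (y *ᶻ m′ +ᶻ m *ᶻ z +ᶻ m *ᶻ n *ᶻ m′) *ᶻ n
      l = ℤSolver.solve-∀

    ≋-sub : ∀ {a b y z} → b ≤ N → a ≋ y → b ≋ z → (N + a) ∸ b ≋ y +ᶻ - z
    ≋-sub {a} {b} {y} {z} b≤N (multiple m e) (multiple m′ e′) = multiple (1ℤ +ᶻ m +ᶻ - m′) (begin
      ℤ.+ ((N + a) ∸ b)                                     ≡⟨ l₁ (ℤ.+ ((N + a) ∸ b)) (ℤ.+ b) ⟩
      ℤ.+ ((N + a) ∸ b) +ᶻ ℤ.+ b +ᶻ - (ℤ.+ b)               ≡⟨ cong (_+ᶻ - (ℤ.+ b)) (trans (sym (ℤ.pos-+ ((N + a) ∸ b) b)) (cong ℤ.+_ (ℕ.m∸n+n≡m (ℕ.≤-trans b≤N (ℕ.m≤m+n N a))))) ⟩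
      ℤ.+ (N + a) +ᶻ - (ℤ.+ b)                              ≡⟨ cong₂ (λ p r → p +ᶻ - r) (trans (ℤ.pos-+ N a) (cong (_+ᶻ_ (ℤ.+ N)) e)) e′ ⟩
      (ℤ.+ N +ᶻ (y +ᶻ m *ᶻ ℤ.+ N)) +ᶻ - (z +ᶻ m′ *ᶻ ℤ.+ N)  ≡⟨ l₂ y z m m′ (ℤ.+ N) ⟩
      y +ᶻ - z +ᶻ (1ℤ +ᶻ m +ᶻ - m′) *ᶻ ℤ.+ N                ∎)
      where
      open ≡-Reasoning
      l₁ : ∀ a b → a ≡ a +ᶻ b +ᶻ - b
      l₁ = ℤSolver.solve-∀
      l₂ : ∀ y z m m′ n → (n +ᶻ (y +ᶻ m *ᶻ n)) +ᶻ - (z +ᶻ m′ *ᶻ n) ≡ y +ᶻ - z +ᶻ (1ℤ +ᶻ m +ᶻ - m′) *ᶻ n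
      l₂ = ℤSolver.solve-∀

    ≋-exact : ∀ {a c} → a < N → c < N → a ≋ ℤ.+ c → a ≡ c
    ≋-exact {a} {c} a<N c<N (multiple (ℤ.+ zero) e) = ℤ.+-injective (trans e (trans (cong (_+ᶻ_ (ℤ.+ c)) (ℤ.*-zeroˡ (ℤ.+ N))) (ℤ.+-identityʳ (ℤ.+ c))))
    ≋-exact {a} {c} a<N c<N (multiple (ℤ.+ suc m) e) = contradiction a<N (ℕ.≤⇒≯ (ℕ.≤-trans (ℕ.≤-trans (ℕ.m≤m+n N (m * N)) (ℕ.m≤n+m _ c)) (ℕ.≤-reflexive (sym (ℤ.+-injective (trans e (trans (cong (_+ᶻ_ (ℤ.+ c)) (sym (ℤ.pos-* (suc m) N))) (sym (ℤ.pos-+ c (suc m * N))))))))))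
    ≋-exact {a} {c} a<N c<N (multiple (ℤ.-[1+ m ]) e) = contradiction c<N (ℕ.≤⇒≯ (ℕ.≤-trans (ℕ.≤-trans (ℕ.m≤m+n N (m * N)) (ℕ.m≤n+m _ a)) (ℕ.≤-reflexive (ℤ.+-injective (trans (ℤ.pos-+ a (suc m * N)) (trans (cong₂ _+ᶻ_ e (ℤ.pos-* (suc m) N)) (l (ℤ.+ c) (ℤ.+ suc m) (ℤ.+ N))))))))
      where
      l : ∀ c m n → c +ᶻ (- m) *ᶻ n +ᶻ m *ᶻ n ≡ c
      l = ℤSolver.solve-∀

  module Builders (h B : ℕ) where

    sumE prodE : List A → (A → Expr h B) → Expr h B
    sumE xs f = List.foldr (λ x e → exop add (f x) e) (lit 0) xs
    prodE xs f = List.foldr (λ x e → exop mul (f x) e) (lit 1) xs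

    intE : ℤ → Expr h B
    intE (ℤ.+ n)      = lit n
    intE (ℤ.-[1+ n ]) = exop sub (lit 0) (lit (suc n))

    hornerE : ∀ {m} → Vec (Expr h B) m → Expr h B → Expr h B
    hornerE []       x = lit 0
    hornerE (e ∷ es) x = exop add e (exop mul x (hornerE es x))

  module Expressions (h B w S : ℕ) where
    open Builders h B
    open RAM w S using (2^w≢0) renaming (⟦_⟧ to ⟦_⟧ᵒ)
    open Registers h B
    open Simulation h B w S using (eval)
    private
      N = 2 ^ w
    open Congruence N public

    %N< : ∀ x → x % N < N
    %N< x = m%n<n x N

    1<N : 2 ≤ N → 1 % N ≡ 1
    1<N 2≤N = m<n⇒m%n≡m 2≤N

    lit-exact : ∀ σ {k} → k < N → eval σ (lit k) ≡ k
    lit-exact σ = m<n⇒m%n≡m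

    lit-≋ : ∀ σ k → eval σ (lit k) ≋ ℤ.+ k
    lit-≋ σ k = ≋-% (≋-pos k)

    add-exact : ∀ σ a b {x y} → eval σ a ≡ x → eval σ b ≡ y → x + y < N → eval σ (exop add a b) ≡ x + y
    add-exact σ a b refl refl = m<n⇒m%n≡m

    mul-exact : ∀ σ a b {x y} → eval σ a ≡ x → eval σ b ≡ y → x * y < N → eval σ (exop mul a b) ≡ x * y
    mul-exact σ a b refl refl = m<n⇒m%n≡m

    sub-exact : ∀ σ a b {x y} → eval σ a ≡ x → eval σ b ≡ y → y ≤ x → x < N → eval σ (exop sub a b) ≡ x ∸ y
    sub-exact σ a b {x} {y} refl refl y≤x x<N = trans (cong (_% N) (ℕ.+-∸-assoc N y≤x)) (trans (cong (_% N) (ℕ.+-comm N (x ∸ y))) (trans ([m+n]%n≡m%n (x ∸ y) N) (m<n⇒m%n≡m (ℕ.≤-<-trans (ℕ.m∸n≤m x y) x<N))))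

    quot-exact : ∀ σ a b {x y} .{{_ : NonZero y}} → eval σ a ≡ x → eval σ b ≡ y → x < N → eval σ (exop quot a b) ≡ x / y
    quot-exact σ a b {x} {y} e e′ x<N = trans (cong (_% N) (go y e′)) (m<n⇒m%n≡m (ℕ.≤-<-trans (m/n≤m x y) x<N))
      where
      go : ∀ y .{{_ : NonZero y}} → eval σ b ≡ y → ⟦ quot ⟧ᵒ (eval σ a) (eval σ b) ≡ x / y
      go (suc y) e′ rewrite e | e′ = refl

    rem-exact : ∀ σ a b {x y} .{{_ : NonZero y}} → eval σ a ≡ x → eval σ b ≡ y → x < N → eval σ (exop rem a b) ≡ x % y
    rem-exact σ a b {x} {y} e e′ x<N = trans (cong (_% N) (go y e′)) (m<n⇒m%n≡m (ℕ.≤-<-trans (m%n≤m x y) x<N))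
      where
      go : ∀ y .{{_ : NonZero y}} → eval σ b ≡ y → ⟦ rem ⟧ᵒ (eval σ a) (eval σ b) ≡ x % y
      go (suc y) e′ rewrite e | e′ = refl

    eq-≋ : ∀ σ a b {x y} → eval σ a ≡ x → eval σ b ≡ y → eval σ (exop eq a b) ≋ ℤΣ.⟦ x ℕ.≟ y ⟧
    eq-≋ σ a b {x} {y} refl refl = ≋-% (go (does (x ℕ.≟ y)))
      where
      go : ∀ c → (if c then 1 else 0) ≋ (if c then 1ℤ else 0ℤ)
      go true  = ≋-pos 1
      go false = ≋-pos 0

    add-≋ : ∀ σ a b {y z} → eval σ a ≋ y → eval σ b ≋ z → eval σ (exop add a b) ≋ y +ᶻ z
    add-≋ σ a b p r = ≋-% (≋-+ {eval σ a} {eval σ b} p r)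

    mul-≋ : ∀ σ a b {y z} → eval σ a ≋ y → eval σ b ≋ z → eval σ (exop mul a b) ≋ y *ᶻ z
    mul-≋ σ a b p r = ≋-% (≋-* {eval σ a} {eval σ b} p r)

    sub-≋ : ∀ σ a b {y z} → eval σ b ≤ N → eval σ a ≋ y → eval σ b ≋ z → eval σ (exop sub a b) ≋ y +ᶻ - z
    sub-≋ σ a b b≤ p r = ≋-% (≋-sub {eval σ a} {eval σ b} b≤ p r)

    sum-≋ : ∀ σ (xs : List A) f z → (∀ {x} → x ∈ xs → eval σ (f x) ≋ z x) → eval σ (sumE xs f) ≋ ∑ xs z
    sum-≋ σ []       f z e = lit-≋ σ 0
    sum-≋ σ (x ∷ xs) f z e = add-≋ σ (f x) (sumE xs f) (e (here refl)) (sum-≋ σ xs f z (e ∘ there))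

    prod-≋ : ∀ σ (xs : List A) f z → (∀ x → eval σ (f x) ≋ z x) → eval σ (prodE xs f) ≋ ∏ xs z
    prod-≋ σ []       f z e = lit-≋ σ 1
    prod-≋ σ (x ∷ xs) f z e = mul-≋ σ (f x) (prodE xs f) (e x) (prod-≋ σ xs f z e)

    int-≋ : ∀ σ z → eval σ (intE z) ≋ z
    int-≋ σ (ℤ.+ n)      = lit-≋ σ n
    int-≋ σ (ℤ.-[1+ n ]) = sub-≋ σ (lit 0) (lit (suc n)) (ℕ.<⇒≤ (%N< (suc n))) (lit-≋ σ 0) (lit-≋ σ (suc n))

    horner-exact : ∀ σ {m} (es : Vec (Expr h B) m) x → eval σ (hornerE es x) ≡ evalPoly (Vec.map (eval σ) es) (eval σ x) % N
    horner-exact σ []       x = refl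
    horner-exact σ (e ∷ es) x = begin
      (a + y * eval σ (hornerE es x) % N) % N       ≡⟨ cong (λ z → (a + y * z % N) % N) (horner-exact σ es x) ⟩
      (a + y * (p % N) % N) % N                     ≡⟨ cong (λ z → (a + z) % N) (trans (%-distribˡ-* y (p % N) N) (trans (cong (λ z → (y % N * z) % N) (m%n%n≡m%n p N)) (sym (%-distribˡ-* y p N)))) ⟩
      (a + y * p % N) % N                           ≡⟨ trans (%-distribˡ-+ a (y * p % N) N) (trans (cong (λ z → (a % N + z) % N) (m%n%n≡m%n (y * p) N)) (sym (%-distribˡ-+ a (y * p) N))) ⟩
      (a + y * p) % N                               ∎
      where
      open ≡-Reasoning
      a = eval σ e
      y = eval σ x
      p = evalPoly (Vec.map (eval σ) es) y

module Program where

  open Big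
  open Hash
  open Codes
  open Machine
  open Modular
  open import Defs
  open import Data.Bool.Base using (if_then_else_)
  open import Data.Fin.Base as Fin using (Fin; zero; suc; toℕ; inject≤)
  import Data.Fin.Properties as Fin
  open import Data.Fin.Patterns
  open import Data.Fin.Subset using (Subset; ∣_∣)
  open import Data.Fin.Subset.Properties using (∣p∣≤n)
  open import Data.Integer.Base as ℤ using (ℤ; 1ℤ; -_) renaming (_+_ to _+ᶻ_; _*_ to _*ᶻ_)
  import Data.Integer.Properties as ℤ
  open import Data.List.Base as List using (List; []; _∷_; _++_; map; length; upTo; allFin; concatMap; head; drop)
  import Data.List.Properties as List
  open import Data.List.Membership.Propositional using (_∈_)
  open import Data.List.Membership.Propositional.Properties
  open import Data.List.Relation.Unary.Any as Any using (here; there)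
  import Data.List.Relation.Unary.Unique.Propositional.Properties as Unique
  open import Data.Maybe.Base using (fromMaybe)
  open import Data.Nat.Base as ℕ using (ℕ; zero; suc; _+_; _*_; _^_; _⊔_; _≤_; _<_; z≤n; s≤s; NonZero)
  open import Data.Nat.DivMod
  open import Data.Nat.Divisibility using (n∣m*n)
  import Data.Nat.Properties as ℕ
  open import Data.Nat.Tactic.RingSolver using (solve-∀)
  open import Data.Product.Base using (∃-syntax; _×_; _,_; proj₁; proj₂)
  open import Data.Unit.Base using (⊤; tt)
  open import Data.Vec.Base as Vec using (Vec; []; _∷_; lookup; tabulate)
  import Data.Vec.Properties as Vec
  open import Function.Base using (_∘_; id)
  open import Relation.Binary.PropositionalEquality
  open import Relation.Nullary.Decidable using (Dec; yes; no; does; dec-true; dec-false)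

  pattern num  = gl 0F
  pattern den  = gl 1F
  pattern ptr  = gl 2F
  pattern cnt  = gl 3F
  pattern half = gl 4F
  pattern unit = gl 5F
  pattern sgn  = gl 6F
  pattern card = gl 7F
  pattern tmp  = gl 8F
  pattern acc  = gl 9F
  pattern pct  = gl (suc 9F)

  -- Memory: registers and scratch below R, then the K seed words of every copy,
  -- then the k counters of every copy.
  module Sketch {h k : ℕ} (D : Fin k → Subset h) (K c₁ c₂ : ℕ) where
    open Table D using (code; factor; weight; Code)
    open Registers h K
    open Builders h K

    private
      Q₀ = 2 ^ (h + k)

    initPre : ℕ → List (Stmt h K)
    initPre R =
      inp cnt 1 ∷
      set cnt (exop quot (exop sub (var cnt) (lit R)) (lit (K + k))) ∷
      set half (exop add (exop quot (exop sub (lit 0) (lit 1)) (lit 2)) (lit 1)) ∷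
      set unit (exop add (exop quot (exop sub (lit 0) (lit 1)) (lit (2 * Q₀))) (lit 1)) ∷
      set ptr (lit R) ∷
      set acc (exop mul (var cnt) (lit K)) ∷ []

    keep : List (Stmt h K)
    keep = put ptr tmp ∷ set ptr (exop add (var ptr) (lit 1)) ∷ []

    positions : Fin k → List (Fin h)
    positions i = map (λ x → inject≤ x (∣p∣≤n (D i))) (allFin ∣ D i ∣)

    tableE : Fin h → Fin k → Fin h → Expr h K
    tableE u i p = sumE (upTo Q₀) (λ c → exop mul (exop eq (var (hs p)) (lit c)) (intE (factor u i (code c))))

    weightE : Fin k → Expr h K
    weightE i = prodE (members (D i)) (λ u → sumE (positions i) (tableE u i))

    incrementE : Fin k → Expr h K
    incrementE i = exop mul (var sgn) (exop mul (exop eq (var card) (lit ∣ D i ∣)) (weightE i))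

    hashE : Fin h → Expr h K
    hashE j = exop quot (exop rem (hornerE (tabulate (var ∘ bl)) (var (vt j))) (var half)) (var unit)

    updatePre : ℕ → List (Stmt h K)
    updatePre R =
      set ptr (lit R) ∷
      set pct (exop add (lit R) (exop mul (var cnt) (lit K))) ∷
      inp sgn 0 ∷
      set sgn (exop sub (exop add (var sgn) (var sgn)) (lit 1)) ∷
      inp card 1 ∷
      concatMap (λ j → inp (vt j) (2 + toℕ j) ∷ []) (allFin h)

    loadSeed : Fin K → List (Stmt h K)
    loadSeed b = set tmp (exop add (var ptr) (lit (toℕ b))) ∷ get (bl b) tmp ∷ []

    hashVertex : Fin h → List (Stmt h K)
    hashVertex j = set (hs j) (hashE j) ∷ []

    bump : Fin k → List (Stmt h K)
    bump i =
      set tmp (exop add (var pct) (lit (toℕ i))) ∷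
      get acc tmp ∷
      set acc (exop add (var acc) (incrementE i)) ∷
      put tmp acc ∷ []

    advance : List (Stmt h K)
    advance = set ptr (exop add (var ptr) (lit K)) ∷ set pct (exop add (var pct) (lit k)) ∷ []

    updateBody : List (Stmt h K)
    updateBody = concatMap loadSeed (allFin K) ++ concatMap hashVertex (allFin h) ++ concatMap bump (allFin k) ++ advance

    outputPre : ℕ → List (Stmt h K)
    outputPre R = set pct (exop add (lit R) (exop mul (var cnt) (lit K))) ∷ set acc (lit 0) ∷ []

    multiply : Fin k → List (Stmt h K)
    multiply i =
      set tmp (exop add (var pct) (lit (toℕ i))) ∷
      get card tmp ∷
      set sgn (exop mul (var sgn) (var card)) ∷ []

    accumulate : List (Stmt h K)
    accumulate = set acc (exop add (var acc) (var sgn)) ∷ set pct (exop add (var pct) (lit k)) ∷ []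

    outputBody : List (Stmt h K)
    outputBody = set sgn (lit 1) ∷ concatMap multiply (allFin k) ++ accumulate

    outputPost : List (Stmt h K)
    outputPost =
      set num (exop quot (exop add (exop mul (lit c₁) (var acc)) (exop mul (var cnt) (lit c₂)))
                         (exop add (exop mul (var cnt) (lit c₂)) (exop mul (var cnt) (lit c₂)))) ∷
      set den (lit 1) ∷ []

    scratch : ℕ
    scratch = heights (initPre 0) ⊔ (heights keep ⊔ (heights (updatePre 0) ⊔ (heights updateBody ⊔ (heights (outputPre 0) ⊔ (heights outputBody ⊔ heights outputPost)))))

    R : ℕ
    R = suc (V + scratch)

    sample : Cmd
    sample = rand (idx tmp) (idx half) ⨾ program keep

    initialiseC updateC outputC : Cmd
    initialiseC = program (initPre R) ⨾ loop (idx acc) sample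
    updateC     = program (updatePre R) ⨾ loop (idx cnt) (program updateBody)
    outputC     = (program (outputPre R) ⨾ loop (idx cnt) (program outputBody)) ⨾ program outputPost

    nesting≤1 : nesting initialiseC ⊔ nesting updateC ⊔ nesting outputC ≡ 1
    nesting≤1 rewrite nesting-program ((initPre R)) | nesting-program (keep) | nesting-program ((updatePre R))
      | nesting-program (updateBody) | nesting-program ((outputPre R)) | nesting-program (outputBody) | nesting-program (outputPost) = refl

    module Correct (w S s ℓ e : ℕ) (w≡ : w ≡ suc (h + k + (e + ℓ * K))) (S≡ : S ≡ R + s * (K + k)) (S<N : S < 2 ^ w)
                   (1≤s : 1 ≤ s) (1≤K : 1 ≤ K) (1≤e : 1 ≤ e) where

      R≤S : R ≤ S
      R≤S = ℕ.≤-trans (ℕ.m≤m+n R _) (ℕ.≤-reflexive (sym S≡))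

      V<R : V < R
      V<R = s≤s (ℕ.m≤m+n V scratch)

      open RAM w S hiding (⟦_⟧)
      open Simulation h K w S
      open Running R R≤S V<R renaming (step to perform)
      open Expressions h K w S
      open Poly (h + k) ℓ K e using (q; q′; Q; hash<Q; q≢0; q′≢0; Q≢0) renaming (hash to polyHash)

      N : ℕ
      N = 2 ^ w

      N≡2q : N ≡ 2 * q
      N≡2q = trans (cong (2 ^_) w≡) (cong (2 *_) (ℕ.^-distribˡ-+-* 2 (h + k) (e + ℓ * K)))

      q<N : q < N
      q<N = ℕ.≤-trans (ℕ.m<m*n q 2 (s≤s (s≤s z≤n))) (ℕ.≤-reflexive (trans (ℕ.*-comm q 2) (sym N≡2q)))

      q′≤q : q′ ≤ q
      q′≤q = ℕ.m≤n*m q′ Q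

      fits : ∀ ss → heights ss ≤ scratch → ∀ {x ex} → set x ex ∈ ss → V + height ex ≤ R
      fits ss le m = ℕ.≤-trans (ℕ.+-monoʳ-≤ V (ℕ.≤-trans (height≤heights m) le)) (ℕ.n≤1+n _)

      private
        ⊔ˡ = ℕ.m≤m⊔n
        ⊔ʳ = ℕ.m≤n⊔m
        infixr 2 _▹_
        _▹_ : ∀ {a b c} → a ≤ b → b ≤ c → a ≤ c
        _▹_ = ℕ.≤-trans
        f1 = heights (initPre 0)
        f2 = heights keep
        f3 = heights (updatePre 0)
        f4 = heights updateBody
        f5 = heights (outputPre 0)
        f6 = heights outputBody
        f7 = heights outputPost
        g6 = f6 ⊔ f7
        g5 = f5 ⊔ g6
        g4 = f4 ⊔ g5
        g3 = f3 ⊔ g4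
        g2 = f2 ⊔ g3

      fitInit : ∀ {x ex} → set x ex ∈ initPre R → V + height ex ≤ R
      fitInit = fits (initPre R) (⊔ˡ f1 g2)
      fitKeep : ∀ {x ex} → set x ex ∈ keep → V + height ex ≤ R
      fitKeep = fits keep (⊔ˡ f2 g3 ▹ ⊔ʳ f1 g2)
      fitUpdatePre : ∀ {x ex} → set x ex ∈ updatePre R → V + height ex ≤ R
      fitUpdatePre = fits (updatePre R) (⊔ˡ f3 g4 ▹ ⊔ʳ f2 g3 ▹ ⊔ʳ f1 g2)
      fitUpdate : ∀ {x ex} → set x ex ∈ updateBody → V + height ex ≤ R
      fitUpdate = fits updateBody (⊔ˡ f4 g5 ▹ ⊔ʳ f3 g4 ▹ ⊔ʳ f2 g3 ▹ ⊔ʳ f1 g2)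
      fitOutputPre : ∀ {x ex} → set x ex ∈ outputPre R → V + height ex ≤ R
      fitOutputPre = fits (outputPre R) (⊔ˡ f5 g6 ▹ ⊔ʳ f4 g5 ▹ ⊔ʳ f3 g4 ▹ ⊔ʳ f2 g3 ▹ ⊔ʳ f1 g2)
      fitOutput : ∀ {x ex} → set x ex ∈ outputBody → V + height ex ≤ R
      fitOutput = fits outputBody (⊔ˡ f6 f7 ▹ ⊔ʳ f5 g6 ▹ ⊔ʳ f4 g5 ▹ ⊔ʳ f3 g4 ▹ ⊔ʳ f2 g3 ▹ ⊔ʳ f1 g2)
      fitOutputPost : ∀ {x ex} → set x ex ∈ outputPost → V + height ex ≤ R
      fitOutputPost = fits outputPost (⊔ʳ f6 f7 ▹ ⊔ʳ f5 g6 ▹ ⊔ʳ f4 g5 ▹ ⊔ʳ f3 g4 ▹ ⊔ʳ f2 g3 ▹ ⊔ʳ f1 g2)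

      private
        at₀ : ∀ {A : Set} {x : A} {xs} → x ∈ x ∷ xs
        at₀ = here refl
        at₁ : ∀ {A : Set} {a x : A} {xs} → x ∈ a ∷ x ∷ xs
        at₁ = there at₀
        at₂ : ∀ {A : Set} {a b x : A} {xs} → x ∈ a ∷ b ∷ x ∷ xs
        at₂ = there at₁
        at₃ : ∀ {A : Set} {a b c x : A} {xs} → x ∈ a ∷ b ∷ c ∷ x ∷ xs
        at₃ = there at₂

      R<N : R < N
      R<N = ℕ.≤-<-trans R≤S S<N

      reserved<N : ∀ {x} → x ≤ V → x < N
      reserved<N x≤V = ℕ.≤-<-trans x≤V (ℕ.<-trans V<R R<N)

      2≤N : 2 ≤ N
      2≤N = reserved<N (s≤s z≤n)

      K+k<N : K + k < N
      K+k<N = ℕ.≤-<-trans (ℕ.≤-trans (ℕ.m≤n*m (K + k) s {{ℕ.>-nonZero 1≤s}}) (ℕ.≤-trans (ℕ.m≤n+m _ R) (ℕ.≤-reflexive (sym S≡)))) S<N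

      C : ℕ
      C = R + s * K

      S≡C+sk : S ≡ C + s * k
      S≡C+sk = trans S≡ (l R s K k)
        where
        l : ∀ R s K k → R + s * (K + k) ≡ R + s * K + s * k
        l = solve-∀

      seedAddress counterAddress : ℕ → ℕ → ℕ
      seedAddress j b = R + j * K + b
      counterAddress j i = C + j * k + i

      seedAddress<C : ∀ {j b} → j < s → b < K → seedAddress j b < C
      seedAddress<C {j} {b} j<s b<K = ℕ.≤-trans (ℕ.≤-reflexive (sym (ℕ.+-suc (R + j * K) b))) (ℕ.≤-trans (ℕ.+-monoʳ-≤ (R + j * K) b<K)
        (ℕ.≤-trans (ℕ.≤-reflexive (l R j K)) (ℕ.+-monoʳ-≤ R (ℕ.*-monoˡ-≤ K j<s))))
        where
        l : ∀ R j K → R + j * K + K ≡ R + suc j * K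
        l = solve-∀

      C≤S : C ≤ S
      C≤S = ℕ.≤-trans (ℕ.m≤m+n C (s * k)) (ℕ.≤-reflexive (sym S≡C+sk))

      C<N : C < N
      C<N = ℕ.≤-<-trans C≤S S<N

      R≤C : R ≤ C
      R≤C = ℕ.m≤m+n R (s * K)

      counterBase≤ : ∀ {j} → j ≤ s → C + j * k ≤ S
      counterBase≤ j≤s = ℕ.≤-trans (ℕ.+-monoʳ-≤ C (ℕ.*-monoˡ-≤ k j≤s)) (ℕ.≤-reflexive (sym S≡C+sk))

      counterAddress<S : ∀ {j i} → j < s → i < k → counterAddress j i < S
      counterAddress<S {j} {i} j<s i<k = ℕ.≤-trans (ℕ.≤-reflexive (sym (ℕ.+-suc (C + j * k) i))) (ℕ.≤-trans (ℕ.+-monoʳ-≤ (C + j * k) i<k)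
        (ℕ.≤-trans (ℕ.≤-reflexive (l C j k)) (counterBase≤ j<s)))
        where
        l : ∀ R j K → R + j * K + K ≡ R + suc j * K
        l = solve-∀

      counterAddress-injective : ∀ {j j′ i i′} → i < k → i′ < k → counterAddress j i ≡ counterAddress j′ i′ → j ≡ j′ × i ≡ i′
      counterAddress-injective {j} {j′} {i} {i′} i<k i′<k same′ = (begin
        j                    ≡⟨ quotient j i i<k ⟨
        (i + j * k) / k      ≡⟨ cong (λ z → z / k) same ⟩
        (i′ + j′ * k) / k    ≡⟨ quotient j′ i′ i′<k ⟩
        j′                   ∎) , (begin
        i                    ≡⟨ trans ([m+kn]%n≡m%n i j k) (m<n⇒m%n≡m i<k) ⟨
        (i + j * k) % k      ≡⟨ cong (_% k) same ⟩
        (i′ + j′ * k) % k    ≡⟨ trans ([m+kn]%n≡m%n i′ j′ k) (m<n⇒m%n≡m i′<k) ⟩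
        i′                   ∎)
        where
        open ≡-Reasoning
        instance
          k≢0 : NonZero k
          k≢0 = ℕ.>-nonZero (ℕ.≤-<-trans z≤n i<k)
        same : i + j * k ≡ i′ + j′ * k
        same = ℕ.+-cancelˡ-≡ C _ _ (trans (cong (C +_) (ℕ.+-comm i (j * k))) (trans (sym (ℕ.+-assoc C (j * k) i)) (trans same′ (trans (ℕ.+-assoc C (j′ * k) i′) (cong (C +_) (ℕ.+-comm (j′ * k) i′))))))
        quotient : ∀ j i → i < k → (i + j * k) / k ≡ j
        quotient j i i<k = trans (+-distrib-/-∣ʳ i (n∣m*n j)) (cong₂ _+_ (m<n⇒m/n≡0 i<k) (m*n/n≡m j k))

      Ready : State → Set
      Ready σ = glob σ 3F ≡ s × glob σ 4F ≡ q × glob σ 5F ≡ q′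

      record Data (seed : ℕ → Vec ℕ K) (z : ℕ → Fin k → ℤ) (σ : State) : Set where
        constructor stored
        field
          ready    : Ready σ
          seeds    : ∀ {j} → j < s → ∀ b → mem σ (seedAddress j (toℕ b)) ≡ lookup (seed j) b
          counters : ∀ {j} → j < s → ∀ i → mem σ (counterAddress j (toℕ i)) ≋ z j i
      open Data

      Frame : State → State → Set
      Frame σ τ = (∀ g → g ≢ 8F → g ≢ 9F → glob τ g ≡ glob σ g) × vert τ ≡ vert σ × mem τ ≡ mem σ

      loadSeeds : ∀ I {σ j} (seed : Vec ℕ K) → j < s → glob σ 2F ≡ R + j * K → (∀ b → mem σ (seedAddress j (toℕ b)) ≡ lookup seed b) →
        wp I (concatMap loadSeed (allFin K)) (λ τ → Frame σ τ × (∀ b → b ∈ allFin K → blok τ b ≡ lookup seed b)) σ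
      loadSeeds I {σ} {j} seed j<s ptr≡ seeds = wp-family I loadSeed (allFin K) (Frame σ) (λ _ _ → ⊤) (λ b τ → blok τ b ≡ lookup seed b) (Unique.allFin⁺ K)
        each ((λ _ _ _ → refl) , refl , refl) (λ _ _ → tt)
        where
        each : ∀ b {ρ} → Frame σ ρ → ⊤ → wp I (loadSeed b) (λ τ → Frame σ τ × blok τ b ≡ lookup seed b × (∀ y → y ≢ b → (⊤ → ⊤) × (blok ρ y ≡ lookup seed y → blok τ y ≡ lookup seed y))) ρ
        each b {ρ} (globs , verts , mems) _ =
            fitUpdate (∈-++⁺ˡ (∈-concatMap⁺ loadSeed (Any.map (λ { refl → at₀ }) (∈-allFin b))))
          , ℕ.≤-trans (ℕ.≤-trans (ℕ.m≤m+n R (j * K)) (ℕ.m≤m+n _ (toℕ b))) (ℕ.≤-reflexive (sym addr))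
          , ((λ g g≢8 g≢9 → trans (≔-other (glob ρ) _ g≢8) (globs g g≢8 g≢9)) , verts , mems)
          , trans (≔-same (blok ρ) b _) (trans (cong₂ (λ m a → m a) mems addr) (seeds b))
          , λ y y≢b → id , trans (≔-other (blok ρ) _ y≢b)
          where
          addr : eval ρ (exop add (var ptr) (lit (toℕ b))) ≡ seedAddress j (toℕ b)
          addr = add-exact ρ (var ptr) (lit (toℕ b)) (trans (globs 2F (λ ()) (λ ())) ptr≡) (lit-exact ρ (ℕ.<-trans (ℕ.<-≤-trans (Fin.toℕ<n b) (ℕ.m≤m+n K k)) K+k<N))
            (ℕ.<-trans (seedAddress<C j<s (Fin.toℕ<n b)) C<N)

      hash-exact : ∀ σ (seed : Vec ℕ K) p → (∀ b → blok σ b ≡ lookup seed b) → glob σ 4F ≡ q → glob σ 5F ≡ q′ → eval σ (hashE p) ≡ polyHash seed (vert σ p)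
      hash-exact σ seed p bloks half≡ unit≡ = trans
        (quot-exact σ (exop rem (hornerE (tabulate (var ∘ bl)) (var (vt p))) (var half)) (var unit) {y = q′}
          (rem-exact σ (hornerE (tabulate (var ∘ bl)) (var (vt p))) (var half) {y = q} (horner-exact σ (tabulate (var ∘ bl)) (var (vt p))) half≡ (%N< _))
          unit≡ (ℕ.<-trans (m%n<n _ q) q<N))
        (cong (λ z → z / q′) (trans (m∣n⇒o%n%m≡o%m q N _ q∣N) (cong (λ v → evalPoly v (vert σ p) % q) vec≡)))
        where
        open import Data.Nat.Divisibility using (_∣_; divides)
        q∣N : q ∣ N
        q∣N = divides 2 N≡2q
        vec≡ : Vec.map (eval σ) (tabulate (var ∘ bl)) ≡ seed
        vec≡ = trans (sym (Vec.tabulate-∘ (eval σ) (var ∘ bl))) (trans (Vec.tabulate-cong bloks) (Vec.tabulate∘lookup seed))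

      hashVertices : ∀ I {σ} (seed : Vec ℕ K) → (∀ b → blok σ b ≡ lookup seed b) → glob σ 4F ≡ q → glob σ 5F ≡ q′ →
        wp I (concatMap hashVertex (allFin h)) (λ τ → (glob τ ≡ glob σ × vert τ ≡ vert σ × mem τ ≡ mem σ × blok τ ≡ blok σ) × (∀ p → p ∈ allFin h → hash τ p ≡ polyHash seed (vert σ p))) σ
      hashVertices I {σ} seed bloks half≡ unit≡ = wp-family I hashVertex (allFin h) (λ τ → glob τ ≡ glob σ × vert τ ≡ vert σ × mem τ ≡ mem σ × blok τ ≡ blok σ) (λ _ _ → ⊤) (λ p τ → hash τ p ≡ polyHash seed (vert σ p)) (Unique.allFin⁺ h)
        each (refl , refl , refl , refl) (λ _ _ → tt)
        where
        each : ∀ p {ρ} → glob ρ ≡ glob σ × vert ρ ≡ vert σ × mem ρ ≡ mem σ × blok ρ ≡ blok σ → ⊤ →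
          wp I (hashVertex p) (λ τ → (glob τ ≡ glob σ × vert τ ≡ vert σ × mem τ ≡ mem σ × blok τ ≡ blok σ) × hash τ p ≡ polyHash seed (vert σ p) ×
            (∀ y → y ≢ p → (⊤ → ⊤) × (hash ρ y ≡ polyHash seed (vert σ y) → hash τ y ≡ polyHash seed (vert σ y)))) ρ
        each p {ρ} (refl , refl , refl , refl) _ =
            fitUpdate (∈-++⁺ʳ (concatMap loadSeed (allFin K)) (∈-++⁺ˡ (∈-concatMap⁺ hashVertex (Any.map (λ { refl → at₀ }) (∈-allFin p)))))
          , (refl , refl , refl , refl)
          , trans (≔-same (hash ρ) p _) (hash-exact ρ seed p bloks half≡ unit≡)
          , λ y y≢p → id , trans (≔-other (hash ρ) _ y≢p)

      increment : ∀ {n} → ℤ → List (Fin n) → Vec ℕ K → Fin k → ℤ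
      increment sg ws seed i = sg *ᶻ (ℤΣ.⟦ length ws ℕ.≟ ∣ D i ∣ ⟧ *ᶻ weight i ws (λ v → code (polyHash seed (toℕ v))))

      ∑-positions : ∀ {n} d (ws : List (Fin n)) (g : ℕ → ℤ) (v : Fin d → ℕ) → d ≡ length ws → (∀ x → v x ≡ fromMaybe 0 (head (drop (toℕ x) (map toℕ ws)))) →
        ℤΣ.∑ (allFin d) (g ∘ v) ≡ ℤΣ.∑ ws (g ∘ toℕ)
      ∑-positions d ws g v refl v≡ = trans (ℤΣ.S.fold-cong (allFin (length ws)) (λ x → cong g (trans (v≡ x) (nthHead ws x)))) (ℤΣ.S.fold-lookup ws)
        where
        nthHead : ∀ {n} (ws : List (Fin n)) x → fromMaybe 0 (head (drop (toℕ x) (map toℕ ws))) ≡ toℕ (List.lookup ws x)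
        nthHead (w ∷ ws) zero    = refl
        nthHead (w ∷ ws) (suc x) = nthHead ws x

      Q≤N : Q ≤ N
      Q≤N = ℕ.≤-trans (ℕ.m≤m*n Q q′) (ℕ.<⇒≤ q<N)

      table-≋ : ∀ σ u i p → hash σ p < Q → eval σ (tableE u i p) ≋ factor u i (code (hash σ p))
      table-≋ σ u i p y<Q = subst (eval σ (tableE u i p) ≋_) (∑-upTo-δ Q (hash σ p) (factor u i ∘ code) y<Q)
        (sum-≋ σ (upTo Q) (λ c → exop mul (exop eq (var (hs p)) (lit c)) (intE (factor u i (code c)))) (λ c → ℤΣ.⟦ hash σ p ℕ.≟ c ⟧ *ᶻ factor u i (code c))
          (λ {c} c∈ → mul-≋ σ (exop eq (var (hs p)) (lit c)) (intE (factor u i (code c))) (eq-≋ σ (var (hs p)) (lit c) refl (lit-exact σ (ℕ.<-≤-trans (∈-upTo⁻ c∈) Q≤N))) (int-≋ σ (factor u i (code c)))))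

      increment-≋ : ∀ {n} σ sg (ws : List (Fin n)) seed i → glob σ 6F ≋ sg → glob σ 7F ≡ length ws → (∀ p → vert σ p ≡ fromMaybe 0 (head (drop (toℕ p) (map toℕ ws)))) →
        (∀ p → hash σ p ≡ polyHash seed (vert σ p)) → eval σ (incrementE i) ≋ increment sg ws seed i
      increment-≋ σ sg ws seed i sgn≋ card≡ verts hashes = mul-≋ σ (var sgn) (exop mul (exop eq (var card) (lit ∣ D i ∣)) (weightE i)) sgn≋ (inner (length ws ℕ.≟ ∣ D i ∣) refl)
        where
        E : Expr h K
        E = exop mul (exop eq (var card) (lit ∣ D i ∣)) (weightE i)
        W = weight i ws (λ v → code (polyHash seed (toℕ v)))
        test : eval σ (exop eq (var card) (lit ∣ D i ∣)) ≋ ℤΣ.⟦ length ws ℕ.≟ ∣ D i ∣ ⟧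
        test = eq-≋ σ (var card) (lit ∣ D i ∣) card≡ (lit-exact σ (reserved<N (ℕ.≤-trans (∣p∣≤n (D i)) (ℕ.≤-trans (ℕ.m≤m+n h _) (ℕ.m≤n+m _ 11)))))
        inner : (d : Dec (length ws ≡ ∣ D i ∣)) → ℤΣ.⟦ length ws ℕ.≟ ∣ D i ∣ ⟧ ≡ ℤΣ.⟦ d ⟧ → eval σ E ≋ ℤΣ.⟦ length ws ℕ.≟ ∣ D i ∣ ⟧ *ᶻ W
        inner (no _) e = subst (eval σ E ≋_) (trans (cong (_*ᶻ (ℤ.+ eval σ (weightE i))) e) (trans (ℤ.*-zeroˡ (ℤ.+ eval σ (weightE i))) (sym (trans (cong (_*ᶻ W) e) (ℤ.*-zeroˡ W)))))
          (mul-≋ σ (exop eq (var card) (lit ∣ D i ∣)) (weightE i) test (≋-pos (eval σ (weightE i))))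
        inner (yes len≡) _ = mul-≋ σ (exop eq (var card) (lit ∣ D i ∣)) (weightE i) test
          (prod-≋ σ (members (D i)) (λ u → sumE (positions i) (tableE u i)) (λ u → ℤΣ.∑ ws (λ v → factor u i (code (polyHash seed (toℕ v))))) (λ u →
            subst (eval σ (sumE (positions i) (tableE u i)) ≋_) (atPositions u)
              (sum-≋ σ (positions i) (tableE u i) (λ p → factor u i (code (hash σ p))) (λ {p} _ → table-≋ σ u i p (ℕ.≤-<-trans (ℕ.≤-reflexive (hashes p)) (hash<Q seed (vert σ p)))))))
          where
          atPositions : ∀ u → ℤΣ.∑ (positions i) (λ p → factor u i (code (hash σ p))) ≡ ℤΣ.∑ ws (λ v → factor u i (code (polyHash seed (toℕ v))))
          atPositions u = trans (ℤΣ.S.fold-map (λ x → inject≤ x (∣p∣≤n (D i))) (allFin ∣ D i ∣))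
            (trans (ℤΣ.S.fold-cong (allFin ∣ D i ∣) (λ x → cong (factor u i ∘ code) (hashes (inject≤ x (∣p∣≤n (D i))))))
              (∑-positions ∣ D i ∣ ws (λ v → factor u i (code (polyHash seed v))) (λ x → vert σ (inject≤ x (∣p∣≤n (D i)))) (sym len≡)
                (λ x → trans (verts (inject≤ x (∣p∣≤n (D i)))) (cong (λ z → fromMaybe 0 (head (drop z (map toℕ ws)))) (Fin.toℕ-inject≤ x (∣p∣≤n (D i)))))))

      counter-address : ∀ ρ {j} i → j < s → glob ρ (suc 9F) ≡ C + j * k → eval ρ (exop add (var pct) (lit (toℕ i))) ≡ counterAddress j (toℕ {k} i)
      counter-address ρ i j<s pct≡ = add-exact ρ (var pct) (lit (toℕ i)) pct≡ (lit-exact ρ (ℕ.<-trans (ℕ.<-≤-trans (Fin.toℕ<n i) (ℕ.m≤n+m k K)) K+k<N)) (ℕ.<-trans (counterAddress<S j<s (Fin.toℕ<n i)) S<N)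

      R≤counter : ∀ j i → R ≤ counterAddress j i
      R≤counter j i = ℕ.≤-trans R≤C (ℕ.≤-trans (ℕ.m≤m+n C (j * k)) (ℕ.m≤m+n _ i))

      BumpFrame : ℕ → State → State → Set
      BumpFrame j σ τ = (∀ g → g ≢ 8F → g ≢ 9F → glob τ g ≡ glob σ g) × vert τ ≡ vert σ × hash τ ≡ hash σ × (∀ a → (∀ i → a ≢ counterAddress j (toℕ {k} i)) → mem τ a ≡ mem σ a)

      bumps : ∀ {n} I {σ j} sg (ws : List (Fin n)) seed (z : Fin k → ℤ) → j < s → glob σ (suc 9F) ≡ C + j * k → glob σ 6F ≋ sg → glob σ 7F ≡ length ws →
        (∀ p → vert σ p ≡ fromMaybe 0 (head (drop (toℕ p) (map toℕ ws)))) → (∀ p → hash σ p ≡ polyHash seed (vert σ p)) →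
        (∀ i → mem σ (counterAddress j (toℕ i)) ≋ z i) →
        wp I (concatMap bump (allFin k)) (λ τ → BumpFrame j σ τ × (∀ i → i ∈ allFin k → mem τ (counterAddress j (toℕ i)) ≋ z i +ᶻ increment sg ws seed i)) σ
      bumps I {σ} {j} sg ws seed z j<s pct≡ sgn≋ card≡ verts hashes old =
        wp-family I bump (allFin k) (BumpFrame j σ) (λ i τ → mem τ (counterAddress j (toℕ i)) ≋ z i) (λ i τ → mem τ (counterAddress j (toℕ i)) ≋ z i +ᶻ increment sg ws seed i) (Unique.allFin⁺ k)
          each ((λ _ _ _ → refl) , refl , refl , λ _ _ → refl) (λ i _ → old i)
        where
        member : ∀ {x ex} i → set x ex ∈ bump i → set x ex ∈ updateBody
        member i m = ∈-++⁺ʳ (concatMap loadSeed (allFin K)) (∈-++⁺ʳ (concatMap hashVertex (allFin h)) (∈-++⁺ˡ (∈-concatMap⁺ bump (Any.map (λ { refl → m }) (∈-allFin i)))))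
        each : ∀ i {ρ} → BumpFrame j σ ρ → mem ρ (counterAddress j (toℕ i)) ≋ z i →
          wp I (bump i) (λ τ → BumpFrame j σ τ × mem τ (counterAddress j (toℕ i)) ≋ z i +ᶻ increment sg ws seed i ×
            (∀ y → y ≢ i → (mem ρ (counterAddress j (toℕ y)) ≋ z y → mem τ (counterAddress j (toℕ y)) ≋ z y) ×
              (mem ρ (counterAddress j (toℕ y)) ≋ z y +ᶻ increment sg ws seed y → mem τ (counterAddress j (toℕ y)) ≋ z y +ᶻ increment sg ws seed y))) ρ
        each i {ρ} (globs , vert≡ , hash≡ , mems) zᵢ =
            fitUpdate (member i at₀)
          , ℕ.≤-trans (R≤counter j (toℕ i)) (ℕ.≤-reflexive (sym addr))
          , fitUpdate (member i at₂)
          , (ℕ.≤-trans (R≤counter j (toℕ i)) (ℕ.≤-reflexive (sym addr)) , ℕ.≤-<-trans (ℕ.≤-reflexive addr) (counterAddress<S j<s (Fin.toℕ<n i)))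
          , ( (λ g g≢8 g≢9 → trans (≔-other (glob ρ₁ [ 9F ≔ mem ρ a ]) _ g≢9) (trans (≔-other (glob ρ₁) _ g≢9) (trans (≔-other (glob ρ) _ g≢8) (globs g g≢8 g≢9))))
            , vert≡ , hash≡
            , λ b b≢ → trans (cong (λ c → if c then v else mem ρ b) (dec-false (b ℕ.≟ a) (λ e → b≢ i (trans e addr)))) (mems b b≢))
          , subst (_≋ (z i +ᶻ increment sg ws seed i)) (sym (cong (λ c → if c then v else mem ρ (counterAddress j (toℕ i))) (dec-true (counterAddress j (toℕ i) ℕ.≟ a) (sym addr))))
              (add-≋ ρ₂ (var acc) (incrementE i) (subst (_≋ z i) (cong (mem ρ) (sym addr)) zᵢ)
                (increment-≋ ρ₂ sg ws seed i (subst (_≋ sg) (sym (globs 6F (λ ()) (λ ()))) sgn≋) (trans (globs 7F (λ ()) (λ ())) card≡)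
                  (λ p → trans (cong (λ f → f p) vert≡) (verts p)) (λ p → trans (cong (λ f → f p) hash≡) (trans (hashes p) (cong (λ f → polyHash seed (f p)) (sym vert≡))))))
          , λ y y≢i → unaffected y y≢i , unaffected y y≢i
          where
          a = eval ρ (exop add (var pct) (lit (toℕ i)))
          addr : a ≡ counterAddress j (toℕ i)
          addr = counter-address ρ i j<s (trans (globs (suc 9F) (λ ()) (λ ())) pct≡)
          ρ₁ = assign tmp a ρ
          ρ₂ = assign acc (mem ρ a) ρ₁
          v = eval ρ₂ (exop add (var acc) (incrementE i))
          unaffected : ∀ y → y ≢ i → ∀ {x} → mem ρ (counterAddress j (toℕ y)) ≋ x → (if does (counterAddress j (toℕ y) ℕ.≟ a) then v else mem ρ (counterAddress j (toℕ y))) ≋ x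
          unaffected y y≢i {x} p = subst (_≋ x) (sym (cong (λ c → if c then v else mem ρ (counterAddress j (toℕ y)))
            (dec-false (counterAddress j (toℕ y) ℕ.≟ a) (λ e → y≢i (Fin.toℕ-injective (proj₂ (counterAddress-injective {j} {j} (Fin.toℕ<n y) (Fin.toℕ<n i) (trans e addr)))))))) p

      K<N : K < N
      K<N = ℕ.≤-<-trans (ℕ.m≤m+n K k) K+k<N

      k<N : k < N
      k<N = ℕ.≤-<-trans (ℕ.m≤n+m k K) K+k<N

      afterFirst : ℕ → (ℕ → Fin k → ℤ) → (ℕ → Fin k → ℤ) → ℕ → Fin k → ℤ
      afterFirst j z Δ j′ i = if does (j′ ℕ.<? j) then z j′ i +ᶻ Δ j′ i else z j′ i

      afterFirst-last : ∀ j z Δ i → afterFirst (suc j) z Δ j i ≡ afterFirst j z Δ j i +ᶻ Δ j i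
      afterFirst-last j z Δ i rewrite dec-true (j ℕ.<? suc j) (ℕ.n<1+n j) | dec-false (j ℕ.<? j) (ℕ.<-irrefl refl) = refl

      afterFirst-other : ∀ j z Δ {j′} i → j′ ≢ j → afterFirst (suc j) z Δ j′ i ≡ afterFirst j z Δ j′ i
      afterFirst-other j z Δ {j′} i j′≢j = go (j′ ℕ.<? j)
        where
        go : Dec (j′ < j) → afterFirst (suc j) z Δ j′ i ≡ afterFirst j z Δ j′ i
        go (yes j′<j) rewrite dec-true (j′ ℕ.<? j) j′<j | dec-true (j′ ℕ.<? suc j) (ℕ.m<n⇒m<1+n j′<j) = refl
        go (no ge)  rewrite dec-false (j′ ℕ.<? j) ge | dec-false (j′ ℕ.<? suc j) (λ { (s≤s le) → ge (ℕ.≤∧≢⇒< le j′≢j) }) = refl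

      record Updating {n} (sg : ℤ) (ws : List (Fin n)) (seed : ℕ → Vec ℕ K) (z : ℕ → Fin k → ℤ) (j : ℕ) (σ : State) : Set where
        field
          data′ : Data seed (afterFirst j z (λ j′ → increment sg ws (seed j′))) σ
          ptr≡  : glob σ 2F ≡ R + j * K
          pct≡  : glob σ (suc 9F) ≡ C + j * k
          sgn≋  : glob σ 6F ≋ sg
          card≡ : glob σ 7F ≡ length ws
          vert≡ : ∀ p → vert σ p ≡ fromMaybe 0 (head (drop (toℕ p) (map toℕ ws)))

      update-copy : ∀ {n} I {σ j} sg (ws : List (Fin n)) seed z → j < s → Updating sg ws seed z j σ → wp I updateBody (Updating sg ws seed z (suc j)) σ
      update-copy I {σ} {j} sg ws seed z j<s u =
        wp-++ I (concatMap loadSeed (allFin K)) _ (wp-mono I (concatMap loadSeed (allFin K)) (λ {τ₁} (fr , bloks) →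
        wp-++ I (concatMap hashVertex (allFin h)) _ (wp-mono I (concatMap hashVertex (allFin h)) (λ {τ₂} (same , hashes) →
        wp-++ I (concatMap bump (allFin k)) _ (wp-mono I (concatMap bump (allFin k)) (λ {τ₃} (bf , bumped) → finish {τ₁} {τ₂} {τ₃} fr same hashes bf bumped)
          (bumps I sg ws (seed j) (afterFirst j z Δ j) j<s (globs₂ {τ₁} {τ₂} fr same (suc 9F) (λ ()) (λ ()) (pct≡)) (subst (_≋ sg) (sym (globs₂ {τ₁} {τ₂} fr same 6F (λ ()) (λ ()) refl)) sgn≋)
            (globs₂ {τ₁} {τ₂} fr same 7F (λ ()) (λ ()) card≡) (λ p → trans (cong (λ f → f p) (trans (proj₁ (proj₂ same)) (proj₁ (proj₂ fr)))) (vert≡ p))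
            (λ p → trans (hashes p (∈-allFin p)) (cong (λ f → polyHash (seed j) (f p)) (sym (proj₁ (proj₂ same)))))
            (λ i → subst (_≋ afterFirst j z Δ j i) (cong (λ f → f (counterAddress j (toℕ i))) (sym (trans (proj₁ (proj₂ (proj₂ same))) (proj₂ (proj₂ fr))))) (counters data′ j<s i)))))
          (hashVertices I (seed j) (λ b → bloks b (∈-allFin b)) (trans (proj₁ fr 4F (λ ()) (λ ())) (proj₁ (proj₂ (ready data′)))) (trans (proj₁ fr 5F (λ ()) (λ ())) (proj₂ (proj₂ (ready data′)))))))
          (loadSeeds I (seed j) j<s ptr≡ (seeds data′ j<s)))
        where
        open Updating u
        Δ : ℕ → Fin k → ℤ
        Δ j′ = increment sg ws (seed j′)
        Same : State → State → Set
        Same τ₁ τ₂ = glob τ₂ ≡ glob τ₁ × vert τ₂ ≡ vert τ₁ × mem τ₂ ≡ mem τ₁ × blok τ₂ ≡ blok τ₁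
        globs₂ : ∀ {τ₁ τ₂} → Frame σ τ₁ → Same τ₁ τ₂ → ∀ g → g ≢ 8F → g ≢ 9F → ∀ {x} → glob σ g ≡ x → glob τ₂ g ≡ x
        globs₂ fr same g g≢8 g≢9 e = trans (cong (λ f → f g) (proj₁ same)) (trans (proj₁ fr g g≢8 g≢9) e)
        member : ∀ {x ex} → set x ex ∈ advance → set x ex ∈ updateBody
        member m = ∈-++⁺ʳ (concatMap loadSeed (allFin K)) (∈-++⁺ʳ (concatMap hashVertex (allFin h)) (∈-++⁺ʳ (concatMap bump (allFin k)) m))
        finish : ∀ {τ₁ τ₂ τ₃} → Frame σ τ₁ → Same τ₁ τ₂ → (∀ p → p ∈ allFin h → hash τ₂ p ≡ polyHash (seed j) (vert τ₁ p)) → BumpFrame j τ₂ τ₃ →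
          (∀ i → i ∈ allFin k → mem τ₃ (counterAddress j (toℕ i)) ≋ afterFirst j z Δ j i +ᶻ increment sg ws (seed j) i) →
          wp I advance (Updating sg ws seed z (suc j)) τ₃
        finish {τ₁} {τ₂} {τ₃} fr same hashes (globs , verts , _ , mems) bumped = fitUpdate (member at₀) , fitUpdate (member at₁) , record
          { data′ = stored (g₃ 3F (λ ()) (λ ()) (proj₁ (ready data′)) , g₃ 4F (λ ()) (λ ()) (proj₁ (proj₂ (ready data′))) , g₃ 5F (λ ()) (λ ()) (proj₂ (proj₂ (ready data′))))
              (λ {j′} j′<s b → trans (mems (seedAddress j′ (toℕ b)) (λ i e → ℕ.<-irrefl e (ℕ.<-≤-trans (seedAddress<C j′<s (Fin.toℕ<n b)) (ℕ.≤-trans (ℕ.m≤m+n C (j * k)) (ℕ.m≤m+n _ (toℕ i))))))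
                (trans (mem₂ (seedAddress j′ (toℕ b))) (seeds data′ j′<s b)))
              counters′
          ; ptr≡ = trans (add-exact τ₃ (var ptr) (lit K) (g₃ 2F (λ ()) (λ ()) ptr≡) (lit-exact τ₃ K<N) (ℕ.≤-<-trans (ℕ.≤-trans (ℕ.≤-reflexive (l R j K)) (ℕ.+-monoʳ-≤ R (ℕ.*-monoˡ-≤ K j<s))) C<N)) (l R j K)
          ; pct≡ = trans (add-exact τ₄ (var pct) (lit k) (g₃ (suc 9F) (λ ()) (λ ()) pct≡) (lit-exact τ₄ k<N) (ℕ.≤-<-trans (ℕ.≤-trans (ℕ.≤-reflexive (l C j k)) (counterBase≤ j<s)) S<N)) (l C j k)
          ; sgn≋ = subst (_≋ sg) (sym (g₃ 6F (λ ()) (λ ()) refl)) sgn≋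
          ; card≡ = g₃ 7F (λ ()) (λ ()) card≡
          ; vert≡ = λ p → trans (cong (λ f → f p) (trans verts (trans (proj₁ (proj₂ same)) (proj₁ (proj₂ fr))))) (vert≡ p)
          }
          where
          τ₄ = assign ptr (eval τ₃ (exop add (var ptr) (lit K))) τ₃
          l : ∀ R j K → R + j * K + K ≡ R + suc j * K
          l = solve-∀
          g₃ : ∀ g → g ≢ 8F → g ≢ 9F → ∀ {x} → glob σ g ≡ x → glob τ₃ g ≡ x
          g₃ g g≢8 g≢9 e = trans (globs g g≢8 g≢9) (globs₂ {τ₁} {τ₂} fr same g g≢8 g≢9 e)
          mem₂ : ∀ a → mem τ₂ a ≡ mem σ a
          mem₂ a = cong (λ f → f a) (trans (proj₁ (proj₂ (proj₂ same))) (proj₂ (proj₂ fr)))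
          counters′ : ∀ {j′} → j′ < s → ∀ i → mem τ₃ (counterAddress j′ (toℕ i)) ≋ afterFirst (suc j) z Δ j′ i
          counters′ {j′} j′<s i with j′ ℕ.≟ j
          ... | yes refl = subst (mem τ₃ (counterAddress j (toℕ i)) ≋_) (sym (afterFirst-last j z Δ i)) (bumped i (∈-allFin i))
          ... | no j′≢j  = subst₂ _≋_ (sym (trans (mems (counterAddress j′ (toℕ i)) (λ i′ e → j′≢j (proj₁ (counterAddress-injective {j′} {j} (Fin.toℕ<n i) (Fin.toℕ<n i′) e)))) (mem₂ _)))
              (sym (afterFirst-other j z Δ i j′≢j)) (counters data′ j′<s i)

      updateTime : ℕ
      updateTime = suc (duration (updatePre R)) + suc (s * (2 + duration updateBody))

      update-enter : ∀ {n} b sg (ws : List (Fin n)) seed z → n ≤ N → b < N → length ws < N → ℤ.+ b +ᶻ ℤ.+ b +ᶻ - 1ℤ ≡ sg →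
        ∀ {σ} → Data seed z σ → wp (b ∷ length ws ∷ map toℕ ws) (updatePre R) (Updating sg ws seed z 0) σ
      update-enter {n} b sg ws seed z n≤N b<N len<N sg≡ {σ} d = fitUpdatePre at₀ , fitUpdatePre at₁ , reserved<N z≤n , fitUpdatePre at₃ , 2≤N ,
        wp-mono (b ∷ length ws ∷ map toℕ ws) (concatMap (λ j → inp (vt j) (2 + toℕ j) ∷ []) (allFin h)) finish
          (wp-family (b ∷ length ws ∷ map toℕ ws) (λ j → inp (vt j) (2 + toℕ j) ∷ []) (allFin h) (λ τ → glob τ ≡ glob σ₅ × mem τ ≡ mem σ) (λ _ _ → ⊤) (λ p τ → vert τ p ≡ fromMaybe 0 (head (drop (toℕ p) (map toℕ ws)))) (Unique.allFin⁺ h)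
            each (refl , refl) (λ _ _ → tt))
        where
        I = b ∷ length ws ∷ map toℕ ws
        σ₂ = perform I (set pct (exop add (lit R) (exop mul (var cnt) (lit K)))) (perform I (set ptr (lit R)) σ)
        σ₃ = perform I (inp sgn 0) σ₂
        σ₅ = perform I (inp card 1) (perform I (set sgn (exop sub (exop add (var sgn) (var sgn)) (lit 1))) σ₃)
        entry< : ∀ (ws : List (Fin n)) x → fromMaybe 0 (head (drop x (map toℕ ws))) < N
        entry< []       zero    = ℕ.≤-<-trans z≤n b<N
        entry< []       (suc x) = ℕ.≤-<-trans z≤n b<N
        entry< (w ∷ ws) zero    = ℕ.<-≤-trans (Fin.toℕ<n w) n≤N
        entry< (w ∷ ws) (suc x) = entry< ws x
        each : ∀ p {ρ} → glob ρ ≡ glob σ₅ × mem ρ ≡ mem σ → ⊤ → wp I (inp (vt p) (2 + toℕ p) ∷ []) (λ τ → (glob τ ≡ glob σ₅ × mem τ ≡ mem σ) × vert τ p ≡ fromMaybe 0 (head (drop (toℕ p) (map toℕ ws))) ×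
          (∀ y → y ≢ p → (⊤ → ⊤) × (vert ρ y ≡ fromMaybe 0 (head (drop (toℕ y) (map toℕ ws))) → vert τ y ≡ fromMaybe 0 (head (drop (toℕ y) (map toℕ ws)))))) ρ
        each p {ρ} (e₁ , e₂) _ = reserved<N (s≤s (s≤s (ℕ.≤-trans (ℕ.<⇒≤ (Fin.toℕ<n p)) (ℕ.≤-trans (ℕ.m≤m+n h _) (ℕ.m≤n+m _ 9))))) , (e₁ , e₂)
          , trans (≔-same (vert ρ) p _) (m<n⇒m%n≡m (entry< ws (toℕ p)))
          , λ y y≢p → id , trans (≔-other (vert ρ) _ y≢p)
        finish : ∀ {τ} → (glob τ ≡ glob σ₅ × mem τ ≡ mem σ) × (∀ p → p ∈ allFin h → vert τ p ≡ fromMaybe 0 (head (drop (toℕ p) (map toℕ ws)))) → Updating sg ws seed z 0 τ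
        finish {τ} ((e₁ , e₂) , verts) = record
          { data′ = stored (g 3F (proj₁ (ready d)) , g 4F (proj₁ (proj₂ (ready d))) , g 5F (proj₂ (proj₂ (ready d))))
              (λ j<s b → trans (cong (λ f → f _) e₂) (seeds d j<s b)) (λ j<s i → subst (_≋ z _ i) (cong (λ f → f _) (sym e₂)) (counters d j<s i))
          ; ptr≡ = g 2F (trans (m<n⇒m%n≡m R<N) (sym (ℕ.+-identityʳ R)))
          ; pct≡ = g (suc 9F) (trans (add-exact (perform I (set ptr (lit R)) σ) (lit R) (exop mul (var cnt) (lit K)) (m<n⇒m%n≡m R<N)
              (mul-exact (perform I (set ptr (lit R)) σ) (var cnt) (lit K) (proj₁ (ready d)) (m<n⇒m%n≡m K<N) (ℕ.≤-<-trans (ℕ.m≤n+m (s * K) R) C<N)) C<N) (sym (ℕ.+-identityʳ C)))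
          ; sgn≋ = subst₂ _≋_ (sym (g 6F refl)) sg≡ (sub-≋ σ₃ (exop add (var sgn) (var sgn)) (lit 1) (ℕ.<⇒≤ (%N< 1)) (add-≋ σ₃ (var sgn) (var sgn) b≋ b≋) (lit-≋ σ₃ 1))
          ; card≡ = g 7F (m<n⇒m%n≡m len<N)
          ; vert≡ = λ p → verts p (∈-allFin p)
          }
          where
          g : ∀ x {v} → glob σ₅ x ≡ v → glob τ x ≡ v
          g x e = trans (cong (λ f → f x) e₁) e
          b≋ : eval σ₃ (var sgn) ≋ ℤ.+ b
          b≋ = subst (_≋ (ℤ.+ b)) (sym (m<n⇒m%n≡m b<N)) (≋-pos b)

      update-correct : ∀ {n M} b sg (ws : List (Fin n)) seed z → n ≤ N → b < N → length ws < N → ℤ.+ b +ᶻ ℤ.+ b +ᶻ - 1ℤ ≡ sg → Holds (Data seed z) M →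
        ∃[ M′ ] exec (b ∷ length ws ∷ map toℕ ws) updateC M ≡ return (M′ , updateTime) × Holds (Data seed (λ j i → z j i +ᶻ increment sg ws (seed j) i)) M′
      update-correct {n} {M} b sg ws seed z n≤N b<N len<N sg≡ holds =
        proj₁ looped , exec-seq I (program (updatePre R)) (loop (idx cnt) (program updateBody)) (proj₁ (proj₂ entered)) (proj₁ (proj₂ looped)) , finished (proj₂ (proj₂ looped))
        where
        I = b ∷ length ws ∷ map toℕ ws
        entered = exec-stmts I (updatePre R) {Q = Updating sg ws seed z 0} (update-enter b sg ws seed z n≤N b<N len<N sg≡) holds
        looped = exec-loop I cnt updateBody (Updating sg ws seed z) s {proj₁ entered} (update-copy I sg ws seed z) (λ u → proj₁ (ready (Updating.data′ u))) (proj₂ (proj₂ entered))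
        done′ : ∀ j i → j < s → afterFirst s z (λ j → increment sg ws (seed j)) j i ≡ z j i +ᶻ increment sg ws (seed j) i
        done′ j i j<s = cong (λ c → if c then z j i +ᶻ increment sg ws (seed j) i else z j i) (dec-true (j ℕ.<? s) j<s)
        finished : ∀ {M} → Holds (Updating sg ws seed z s) M → Holds (Data seed (λ j i → z j i +ᶻ increment sg ws (seed j) i)) M
        finished (σ , sim , u) = σ , sim , stored (ready d) (seeds d) (λ {j} j<s i → subst (mem σ (counterAddress j (toℕ i)) ≋_) (done′ j i j<s) (counters d j<s i))
          where d = Updating.data′ u

module Phases where

  open Big
  open Hash
  open Codes
  open Ratio
  open Machine
  open Modular
  open Program
  open import Defs
  open import Data.Bool.Base using (if_then_else_)
  open import Data.Fin.Base as Fin using (Fin; zero; suc; toℕ)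
  import Data.Fin.Properties as Fin
  open import Data.Fin.Patterns
  open import Data.Fin.Subset using (Subset)
  open import Data.Integer.Base as ℤ using (ℤ; 1ℤ) renaming (_*_ to _*ᶻ_)
  import Data.Integer.Properties as ℤ
  open import Data.List.Base using ([]; _∷_; upTo; allFin; concatMap)
  open import Data.List.Membership.Propositional using (_∈_)
  open import Data.List.Membership.Propositional.Properties
  open import Data.List.Relation.Unary.Any as Any using (here; there)
  open import Data.Nat.Base as ℕ using (ℕ; zero; suc; _+_; _*_; _∸_; _^_; _≤_; _<_; z≤n; s≤s; NonZero)
  open import Data.Nat.DivMod
  open import Data.Nat.Divisibility using (n∣m*n)
  import Data.Nat.Properties as ℕ
  open import Data.Nat.Tactic.RingSolver using (solve-∀)
  open import Data.Product.Base using (∃-syntax; _×_; _,_; proj₁; proj₂)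
  open import Data.Sum.Base using (_⊎_)
  open import Data.Vec.Base as Vec using (Vec; []; _∷_; tabulate)
  import Data.Vec.Properties as Vec
  open import Relation.Binary.PropositionalEquality
  open import Relation.Nullary.Decidable using (yes; no; does)

  entry : ∀ {m} → Vec ℕ m → ℕ → ℕ
  entry []       x       = 0
  entry (v ∷ vs) zero    = v
  entry (v ∷ vs) (suc x) = entry vs x

  chunk : ∀ {m} K → Vec ℕ m → ℕ → Vec ℕ K
  chunk K v j = tabulate (λ b → entry v (j * K + toℕ b))

  [cd∸1]/c+1≡d : ∀ c d .{{_ : NonZero c}} .{{_ : NonZero d}} → (c * d ∸ 1) / c + 1 ≡ d
  [cd∸1]/c+1≡d (suc c) (suc d) = trans (cong (_+ 1) (trans (cong (λ z → z / suc c) (trans (cong (λ z → d + z) (ℕ.*-suc c d)) (l d c))) (trans (+-distrib-/-∣ʳ c (n∣m*n d)) (cong₂ _+_ (m<n⇒m/n≡0 (ℕ.n<1+n c)) (m*n/n≡m d (suc c)))))) (ℕ.+-comm d 1)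
    where
    l : ∀ d c → d + (c + c * d) ≡ c + d * suc c
    l = solve-∀

  module Phased {h k : ℕ} (D : Fin k → Subset h) (K c₁ c₂ : ℕ) (w S s ℓ e : ℕ) (w≡ : w ≡ suc (h + k + (e + ℓ * K))) (S≡ : S ≡ Sketch.R D K c₁ c₂ + s * (K + k)) (S<N : S < 2 ^ w)
                   (1≤s : 1 ≤ s) (1≤K : 1 ≤ K) (1≤e : 1 ≤ e) where
    open Sketch D K c₁ c₂
    open Correct w S s ℓ e w≡ S≡ S<N 1≤s 1≤K 1≤e
    open Registers h K
    open RAM w S hiding (⟦_⟧)
    open Simulation h K w S
    open Running R R≤S V<R renaming (step to perform)
    open Expressions h K w S
    open Poly (h + k) ℓ K e using (q; q′; q≢0; q′≢0)
    open ℤΣ using (∑; ∏)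
    open Data

    record Accumulating (seed : ℕ → Vec ℕ K) (z : ℕ → Fin k → ℤ) (j : ℕ) (σ : State) : Set where
      field
        data′ : Data seed z σ
        pct≡  : glob σ (suc 9F) ≡ C + j * k
        acc<  : glob σ 9F < N
        acc≋  : glob σ 9F ≋ ∑ (upTo j) (λ j′ → ∏ (allFin k) (z j′))

    multiplies : ∀ I is {σ j y} (z : Fin k → ℤ) → j < s → glob σ (suc 9F) ≡ C + j * k → (∀ i → mem σ (counterAddress j (toℕ i)) ≋ z i) → glob σ 6F ≋ y →
      (∀ {x ex i} → set x ex ∈ multiply i → V + height ex ≤ R) →
      wp I (concatMap multiply is) (λ τ → glob τ 6F ≋ y *ᶻ ∏ is z × (∀ g → g ≢ 6F → g ≢ 7F → g ≢ 8F → glob τ g ≡ glob σ g) × mem τ ≡ mem σ) σ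
    multiplies I []       {σ} {j} {y} z j<s pct≡ cs sgn≋ fit = subst (glob σ 6F ≋_) (sym (ℤ.*-identityʳ y)) sgn≋ , (λ _ _ _ _ → refl) , refl
    multiplies I (i ∷ is) {σ} {j} {y} z j<s pct≡ cs sgn≋ fit =
        fit {i = i} (here refl)
      , ℕ.≤-trans (R≤counter j (toℕ i)) (ℕ.≤-reflexive (sym addr))
      , fit {i = i} (there (there (here refl)))
      , wp-mono I (concatMap multiply is) (λ {τ} (p , globs , mems) → subst (glob τ 6F ≋_) (ℤ.*-assoc y (z i) (∏ is z)) p
          , (λ g g≢6 g≢7 g≢8 → trans (globs g g≢6 g≢7 g≢8) (trans (≔-other (glob σ [ 8F ≔ a ] [ 7F ≔ mem σ a ]) _ g≢6) (trans (≔-other (glob σ [ 8F ≔ a ]) _ g≢7) (≔-other (glob σ) _ g≢8))))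
          , mems)
        (multiplies I is z j<s pct≡ cs (mul-≋ (assign card (mem σ a) (assign tmp a σ)) (var sgn) (var card) sgn≋ (subst (_≋ z i) (cong (mem σ) (sym addr)) (cs i))) fit)
      where
      a = eval σ (exop add (var pct) (lit (toℕ i)))
      addr : a ≡ counterAddress j (toℕ i)
      addr = counter-address σ i j<s pct≡

    output-copy : ∀ I {σ j} seed z → j < s → Accumulating seed z j σ → wp I outputBody (Accumulating seed z (suc j)) σ
    output-copy I {σ} {j} seed z j<s ac = fitOutput (here refl) , wp-++ I (concatMap multiply (allFin k)) accumulate
      (wp-mono I (concatMap multiply (allFin k)) finish
        (multiplies I (allFin k) {y = 1ℤ} (z j) j<s pct≡ (counters data′ j<s) (lit-≋ σ 1) (λ {x} {ex} {i} m → fitOutput (there (∈-++⁺ˡ (∈-concatMap⁺ multiply (Any.map (λ { refl → m }) (∈-allFin i))))))))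
      where
      open Accumulating ac
      l : ∀ R j K → R + j * K + K ≡ R + suc j * K
      l = solve-∀
      σ₁ = assign sgn (eval σ (lit 1)) σ
      finish : ∀ {τ} → glob τ 6F ≋ 1ℤ *ᶻ ∏ (allFin k) (z j) × (∀ g → g ≢ 6F → g ≢ 7F → g ≢ 8F → glob τ g ≡ glob σ₁ g) × mem τ ≡ mem σ₁ → wp I accumulate (Accumulating seed z (suc j)) τ
      finish {τ} (p , globs , mems) = fitOutput (there (∈-++⁺ʳ (concatMap multiply (allFin k)) (here refl))) , fitOutput (there (∈-++⁺ʳ (concatMap multiply (allFin k)) (there (here refl)))) , record
        { data′ = stored (trans (g 3F (λ ()) (λ ()) (λ ())) (proj₁ (ready data′)) , trans (g 4F (λ ()) (λ ()) (λ ())) (proj₁ (proj₂ (ready data′))) , trans (g 5F (λ ()) (λ ()) (λ ())) (proj₂ (proj₂ (ready data′))))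
            (λ j<s b → trans (cong (λ f → f _) mems) (seeds data′ j<s b)) (λ {j′} j<s i → subst (_≋ z j′ i) (cong (λ f → f _) (sym mems)) (counters data′ j<s i))
        ; pct≡ = trans (add-exact τ₁ (var pct) (lit k) (trans (g (suc 9F) (λ ()) (λ ()) (λ ())) pct≡) (lit-exact τ₁ k<N) (ℕ.≤-<-trans (ℕ.≤-trans (ℕ.≤-reflexive (l C j k)) (counterBase≤ j<s)) S<N)) (l C j k)
        ; acc< = %N< _
        ; acc≋ = subst (eval τ (exop add (var acc) (var sgn)) ≋_) (sym (∑-upTo-last j (λ j′ → ∏ (allFin k) (z j′))))
            (add-≋ τ (var acc) (var sgn) (subst (_≋ ∑ (upTo j) (λ j′ → ∏ (allFin k) (z j′))) (sym (g 9F (λ ()) (λ ()) (λ ()))) acc≋) (subst (glob τ 6F ≋_) (ℤ.*-identityˡ _) p))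
        }
        where
        τ₁ = assign acc (eval τ (exop add (var acc) (var sgn))) τ
        g : ∀ x → x ≢ 6F → x ≢ 7F → x ≢ 8F → glob τ x ≡ glob σ x
        g x x≢6 x≢7 x≢8 = trans (globs x x≢6 x≢7 x≢8) (≔-other (glob σ) _ x≢6)

    Answered : (ℕ → Fin k → ℤ) → State → Set
    Answered z σ = (∀ A .{{_ : NonZero (s * c₂ + s * c₂)}} → ∑ (upTo s) (λ j → ∏ (allFin k) (z j)) ≡ ℤ.+ A → 1 ≤ c₁ → c₁ * A + s * c₂ < N → s * c₂ + s * c₂ < N → c₂ < N → c₁ < N →
      glob σ 0F ≡ (c₁ * A + s * c₂) / (s * c₂ + s * c₂)) × glob σ 1F ≡ 1

    output-answer : ∀ I {σ} seed z → Accumulating seed z s σ → wp I outputPost (Answered z) σ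
    output-answer I {σ} seed z ac = fitOutputPost (here refl) , fitOutputPost (there (here refl)) , value , lit-exact σ 2≤N
      where
      open Accumulating ac
      value : ∀ A .{{_ : NonZero (s * c₂ + s * c₂)}} → ∑ (upTo s) (λ j → ∏ (allFin k) (z j)) ≡ ℤ.+ A → 1 ≤ c₁ → c₁ * A + s * c₂ < N → s * c₂ + s * c₂ < N → c₂ < N → c₁ < N →
        eval σ (exop quot (exop add (exop mul (lit c₁) (var acc)) (exop mul (var cnt) (lit c₂))) (exop add (exop mul (var cnt) (lit c₂)) (exop mul (var cnt) (lit c₂)))) ≡ (c₁ * A + s * c₂) / (s * c₂ + s * c₂)
      value A total≡ 1≤c₁ num<N den<N c₂<N c₁<N =
        quot-exact σ (exop add (exop mul (lit c₁) (var acc)) (exop mul (var cnt) (lit c₂))) (exop add (exop mul (var cnt) (lit c₂)) (exop mul (var cnt) (lit c₂)))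
          (add-exact σ (exop mul (lit c₁) (var acc)) (exop mul (var cnt) (lit c₂)) (mul-exact σ (lit c₁) (var acc) (lit-exact σ c₁<N) acc≡ (ℕ.≤-<-trans (ℕ.m≤m+n (c₁ * A) (s * c₂)) num<N)) sc₂ num<N)
          (add-exact σ (exop mul (var cnt) (lit c₂)) (exop mul (var cnt) (lit c₂)) sc₂ sc₂ den<N) num<N
        where
        sc₂ : eval σ (exop mul (var cnt) (lit c₂)) ≡ s * c₂
        sc₂ = mul-exact σ (var cnt) (lit c₂) (proj₁ (ready data′)) (lit-exact σ c₂<N) (ℕ.≤-<-trans (ℕ.m≤m+n (s * c₂) (s * c₂)) den<N)
        A<N : A < N
        A<N = ℕ.≤-<-trans (ℕ.≤-trans (ℕ.m≤n*m A c₁ {{ℕ.>-nonZero 1≤c₁}}) (ℕ.m≤m+n (c₁ * A) (s * c₂))) num<N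
        acc≡ : glob σ 9F ≡ A
        acc≡ = ≋-exact acc< A<N (subst (glob σ 9F ≋_) total≡ acc≋)

    outputTime : ℕ
    outputTime = (suc (duration (outputPre R)) + suc (s * (2 + duration outputBody))) + suc (duration outputPost)

    output-enter : ∀ I seed z {σ} → Data seed z σ → wp I (outputPre R) (Accumulating seed z 0) σ
    output-enter I seed z {σ} d = fitOutputPre (here refl) , fitOutputPre (there (here refl)) , record
      { data′ = stored (ready d) (seeds d) (counters d)
      ; pct≡ = trans (add-exact σ (lit R) (exop mul (var cnt) (lit K)) (m<n⇒m%n≡m R<N) (mul-exact σ (var cnt) (lit K) (proj₁ (ready d)) (m<n⇒m%n≡m K<N) (ℕ.≤-<-trans (ℕ.m≤n+m (s * K) R) C<N)) C<N) (sym (ℕ.+-identityʳ C))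
      ; acc< = %N< 0
      ; acc≋ = lit-≋ σ 0
      }

    output-correct : ∀ {M} I seed z → Holds (Data seed z) M →
      ∃[ M′ ] exec I outputC M ≡ return (M′ , outputTime) × Holds (Answered z) M′
    output-correct {M} I seed z holds = proj₁ answered
      , exec-seq I (program (outputPre R) ⨾ loop (idx cnt) (program outputBody)) (program outputPost)
          (exec-seq I (program (outputPre R)) (loop (idx cnt) (program outputBody)) (proj₁ (proj₂ entered)) (proj₁ (proj₂ looped))) (proj₁ (proj₂ answered))
      , proj₂ (proj₂ answered)
      where
      entered = exec-stmts I (outputPre R) {Q = Accumulating seed z 0} (output-enter I seed z) holds
      looped = exec-loop I cnt outputBody (Accumulating seed z) s {proj₁ entered} (output-copy I seed z) (λ a → proj₁ (ready (Accumulating.data′ a))) (proj₂ (proj₂ entered))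
      answered = exec-stmts I outputPost {Q = Answered z} (output-answer I seed z) (proj₂ (proj₂ looped))

    read-answer : ∀ {M z} → Holds (Answered z) M → (∀ A .{{_ : NonZero (s * c₂ + s * c₂)}} → ∑ (upTo s) (λ j → ∏ (allFin k) (z j)) ≡ ℤ.+ A → 1 ≤ c₁ → c₁ * A + s * c₂ < N → s * c₂ + s * c₂ < N → c₂ < N → c₁ < N →
      read M 0 ≡ (c₁ * A + s * c₂) / (s * c₂ + s * c₂)) × read M 1 ≡ 1
    read-answer (σ , (regs , _) , value , one) = (λ A e p₁ p₂ p₃ p₄ p₅ → trans (regs num) (value A e p₁ p₂ p₃ p₄ p₅)) , trans (regs den) one

    zeros : State
    zeros = state (λ _ → 0) (λ _ → 0) (λ _ → 0) (λ _ → 0) (λ _ → 0)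

    read-blank : ∀ x → read blank x ≡ 0
    read-blank x with x ℕ.<? S
    ... | no _    = refl
    ... | yes x<S = trans (cong toℕ (Vec.lookup-replicate (Fin.fromℕ< x<S) (0 mod N))) (trans (Fin.toℕ-fromℕ< (m%n<n 0 N)) (m<n⇒m%n≡m (ℕ.m^n>0 2 w)))

    blank∼zeros : blank ∼ zeros
    blank∼zeros = (λ { (gl i) → read-blank (idx (gl i)) ; (vt i) → read-blank (idx (vt i)) ; (hs i) → read-blank (idx (hs i)) ; (bl i) → read-blank (idx (bl i)) }) , λ a _ → read-blank a

    record Sampling (σ₀ : ℕ → ℕ) (j : ℕ) (σ : State) : Set where
      field
        ready′ : Ready σ
        ptr≡   : glob σ 2F ≡ R + j
        mem≡   : ∀ a → mem σ a ≡ σ₀ a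

    Prepared : State → Set
    Prepared σ = Sampling (λ _ → 0) 0 σ × glob σ 9F ≡ s * K

    prepare : ∀ n σ → mem σ ≡ (λ _ → 0) → wp (n ∷ S ∷ []) (initPre R) Prepared σ
    prepare n σ mem₀ = 2≤N , fitInit (there (here refl)) , fitInit (there (there (here refl))) , fitInit (there (there (there (here refl)))) , fitInit (there (there (there (there (here refl)))))
      , fitInit (there (there (there (there (there (here refl)))))) , record
        { ready′ = count , halved , units
        ; ptr≡ = trans (m<n⇒m%n≡m R<N) (sym (ℕ.+-identityʳ R))
        ; mem≡ = λ a → cong (λ f → f a) mem₀ }
      , mul-exact σ₅ (var cnt) (lit K) count (m<n⇒m%n≡m K<N) (ℕ.≤-<-trans (ℕ.m≤n+m (s * K) R) C<N)
      where
      I = n ∷ S ∷ []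
      σ₁ = perform I (inp cnt 1) σ
      cntE halfE unitE minus1 : Expr h K
      minus1 = exop sub (lit 0) (lit 1)
      cntE = exop quot (exop sub (var cnt) (lit R)) (lit (K + k))
      halfE = exop add (exop quot minus1 (lit 2)) (lit 1)
      unitE = exop add (exop quot minus1 (lit (2 * 2 ^ (h + k)))) (lit 1)
      σ₂ = perform I (set cnt cntE) σ₁
      σ₃ = perform I (set half halfE) σ₂
      σ₄ = perform I (set unit unitE) σ₃
      σ₅ = perform I (set ptr (lit R)) σ₄
      instance
        K+k≢0 : NonZero (K + k)
        K+k≢0 = ℕ.>-nonZero (ℕ.≤-trans 1≤K (ℕ.m≤m+n K k))
      S∸R : S ∸ R ≡ s * (K + k)
      S∸R = trans (cong (_∸ R) S≡) (ℕ.m+n∸m≡n R (s * (K + k)))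
      count : eval σ₁ cntE ≡ s
      count = trans (quot-exact σ₁ (exop sub (var cnt) (lit R)) (lit (K + k)) (sub-exact σ₁ (var cnt) (lit R) (m<n⇒m%n≡m S<N) (m<n⇒m%n≡m R<N) R≤S S<N) (m<n⇒m%n≡m K+k<N) (ℕ.≤-<-trans (ℕ.m∸n≤m S R) S<N))
        (trans (cong (_/ (K + k)) S∸R) (m*n/n≡m s (K + k)))
      eval-minus1 : ∀ ρ → eval ρ minus1 ≡ N ∸ 1
      eval-minus1 ρ = trans (cong₂ (λ a b → ((N + a) ∸ b) % N) (m<n⇒m%n≡m {n = N} (ℕ.<-trans (s≤s z≤n) 2≤N)) (1<N 2≤N)) (trans (cong (λ z → (z ∸ 1) % N) (ℕ.+-identityʳ N)) (m<n⇒m%n≡m N∸1<N))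
        where
        N∸1<N : N ∸ 1 < N
        N∸1<N = ℕ.≤-reflexive (ℕ.suc-pred N)
      recip : ∀ ρ c d .{{_ : NonZero c}} .{{_ : NonZero d}} → N ≡ c * d → c < N → d < N → eval ρ (exop add (exop quot minus1 (lit c)) (lit 1)) ≡ d
      recip ρ c d N≡cd c<N d<N = trans (add-exact ρ (exop quot minus1 (lit c)) (lit 1)
          (quot-exact ρ minus1 (lit c) (eval-minus1 ρ) (m<n⇒m%n≡m c<N) (ℕ.≤-reflexive (ℕ.suc-pred N))) (1<N 2≤N) (ℕ.≤-<-trans (ℕ.≤-reflexive whole) d<N)) whole
        where
        whole : (N ∸ 1) / c + 1 ≡ d
        whole = trans (cong (λ z → (z ∸ 1) / c + 1) N≡cd) ([cd∸1]/c+1≡d c d)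
      halved : eval σ₂ halfE ≡ q
      halved = recip σ₂ 2 q N≡2q (reserved<N (s≤s (s≤s z≤n))) q<N
      2≤q′ : 2 ≤ q′
      2≤q′ = ℕ.≤-trans (ℕ.^-monoʳ-≤ 2 1≤e) (ℕ.^-monoʳ-≤ 2 (ℕ.m≤m+n e (ℓ * K)))
      N≡ : N ≡ (2 * 2 ^ (h + k)) * q′
      N≡ = trans N≡2q (sym (ℕ.*-assoc 2 (2 ^ (h + k)) q′))
      units : eval σ₃ unitE ≡ q′
      units = recip σ₃ (2 * 2 ^ (h + k)) q′ {{ℕ.m*n≢0 2 (2 ^ (h + k)) {{_}} {{ℕ.m^n≢0 2 (h + k)}}}} N≡
        (ℕ.≤-trans (ℕ.m<m*n (2 * 2 ^ (h + k)) q′ {{ℕ.m*n≢0 2 (2 ^ (h + k)) {{_}} {{ℕ.m^n≢0 2 (h + k)}}}} 2≤q′) (ℕ.≤-reflexive (sym N≡))) (ℕ.≤-<-trans q′≤q q<N)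

    Kept : ∀ {m} (μ : ℕ → ℕ) → ℕ → Vec ℕ m → State → Set
    Kept {m} μ j v σ = Ready σ × (∀ x → x < m → mem σ (R + (j + x)) ≡ entry v x) × (∀ a → a < R + j ⊎ R + (j + m) ≤ a → mem σ a ≡ μ a)

    sample-correct : ∀ I μ j {M} → j < s * K → Holds (Sampling μ j) M →
      Samples q 1 (λ v r → Holds (Sampling (λ a → if does (a ℕ.≟ R + j) then entry v 0 else μ a) (suc j)) (proj₁ r)) (exec I sample M)
    sample-correct I μ j {M} j< (σ , sim , sa) = subst (Samples q 1 _) (sym unfolded) (step (ℕ.suc-pred q) (λ i → keepIt (toℕ i) (ℕ.<-≤-trans (Fin.toℕ<n i) (ℕ.≤-reflexive (ℕ.suc-pred q)))))
      where
      open Sampling sa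
      Post : Vec ℕ 1 → Memory × ℕ → Set
      Post v r = Holds (Sampling (λ a → if does (a ℕ.≟ R + j) then entry v 0 else μ a) (suc j)) (proj₁ r)
      next : ℕ → Rnd (Memory × ℕ)
      next v = exec I (program keep) (write M (idx tmp) v) >>= λ (M′ , t′) → return (M′ , 1 + t′)
      unfolded : exec I sample M ≡ draw (ℕ.pred q) (λ i → next (toℕ i))
      unfolded = exec-rand-seq I (idx tmp) (idx half) (program keep) (trans (proj₁ sim half) (trans (proj₁ (proj₂ ready′)) (sym (ℕ.suc-pred q))))
      kept : ∀ v {σ₁} → Sampling μ j σ₁ × glob σ₁ 8F ≡ v → wp I keep (Sampling (λ a → if does (a ℕ.≟ R + j) then v else μ a) (suc j)) σ₁
      kept v {σ₁} (sa₁ , tmp≡) = (ℕ.≤-trans (ℕ.m≤m+n R j) (ℕ.≤-reflexive (sym ptr₁)) , ℕ.≤-<-trans (ℕ.≤-reflexive ptr₁) (ℕ.<-≤-trans (ℕ.+-monoʳ-< R j<) C≤S)) , fitKeep (there (here refl)) , record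
        { ready′ = Sampling.ready′ sa₁
        ; ptr≡ = trans (add-exact (poke (glob σ₁ 2F) (glob σ₁ 8F) σ₁) (var ptr) (lit 1) ptr₁ (1<N 2≤N) (ℕ.≤-<-trans (ℕ.≤-trans (ℕ.≤-reflexive (trans (ℕ.+-comm (R + j) 1) (sym (ℕ.+-suc R j)))) (ℕ.+-monoʳ-≤ R j<)) C<N)) (trans (ℕ.+-comm (R + j) 1) (sym (ℕ.+-suc R j)))
        ; mem≡ = λ a → cong₂ (λ p (x : ℕ × ℕ) → if does (a ℕ.≟ p) then proj₁ x else proj₂ x) ptr₁ (cong₂ _,_ tmp≡ (Sampling.mem≡ sa₁ a))
        }
        where
        ptr₁ = Sampling.ptr≡ sa₁
      keepIt : ∀ v → v < q → Samples q 0 (λ vs → Post (v ∷ vs)) (next v)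
      keepIt v v<q = subst (Samples q 0 (λ vs → Post (v ∷ vs))) (sym (cong (_>>= λ (M′ , t′) → return (M′ , 1 + t′)) (proj₁ (proj₂ stepped)))) (done (proj₂ (proj₂ stepped)))
        where
        drawn : write M (idx tmp) v ∼ assign tmp v σ
        drawn = assigned tmp v sim (trans (read-write-same M v (reg<S tmp)) (m<n⇒m%n≡m (ℕ.<-trans v<q q<N))) (λ y ne _ → read-write-other M v ne)
        stepped = exec-stmts I keep {Q = Sampling (λ a → if does (a ℕ.≟ R + j) then v else μ a) (suc j)} (kept v) (assign tmp v σ , drawn , record { ready′ = ready′ ; ptr≡ = ptr≡ ; mem≡ = mem≡ } , ≔-same (glob σ) 8F v)

module Init where

  open Big
  open Hash
  open Codes
  open Enum
  open Graph using (length-filter-∑)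
  open Second using (length-members)
  open Ratio
  open Machine
  open Modular
  open Program
  open Phases
  open import Defs
  open import Data.Bool.Base using (if_then_else_)
  open import Data.Fin.Base as Fin using (Fin; zero; suc; toℕ)
  import Data.Fin.Properties as Fin
  open import Data.Fin.Subset using (Subset; ∣_∣)
  open import Data.Fin.Subset.Properties using (∣p∣≤n)
  open import Data.Integer.Base as ℤ using (ℤ; 0ℤ; 1ℤ; -1ℤ; -_) renaming (_+_ to _+ᶻ_; _*_ to _*ᶻ_)
  import Data.Integer.Properties as ℤ
  import Data.Integer.Tactic.RingSolver as ℤSolver
  open import Data.List.Base using ([]; _∷_; map)
  open import Data.Nat.Base as ℕ using (ℕ; zero; suc; _+_; _*_; _^_; _≤_; _<_; z≤n; s≤s)
  open import Data.Nat.DivMod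
  import Data.Nat.Properties as ℕ
  open import Data.Nat.Tactic.RingSolver using (solve-∀)
  open import Data.Product.Base using (∃-syntax; _×_; _,_; proj₁; proj₂)
  open import Data.Product.Properties using () renaming (≡-dec to ×-≡-dec)
  open import Data.Sign.Base as Sign using (Sign)
  import Data.Sign.Properties as Sign
  open import Data.Sum.Base using (_⊎_; inj₁; inj₂)
  open import Data.Vec.Base as Vec using (Vec; []; _∷_)
  import Data.Vec.Properties as Vec
  open import Relation.Binary.PropositionalEquality
  open import Relation.Nullary.Decidable using (Dec; yes; no; does; dec-true; dec-false)

  signed : Sign → ℤ
  signed Sign.+ = 1ℤ
  signed Sign.- = -1ℤ

  bit : Sign → ℕ
  bit Sign.+ = 1
  bit Sign.- = 0

  module Initialised {h k : ℕ} (D : Fin k → Subset h) (K c₁ c₂ : ℕ) (w S s ℓ e : ℕ) (w≡ : w ≡ suc (h + k + (e + ℓ * K))) (S≡ : S ≡ Sketch.R D K c₁ c₂ + s * (K + k)) (S<N : S < 2 ^ w)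
                     (1≤s : 1 ≤ s) (1≤K : 1 ≤ K) (1≤e : 1 ≤ e) where
    open Sketch D K c₁ c₂
    open Correct w S s ℓ e w≡ S≡ S<N 1≤s 1≤K 1≤e
    open Phased D K c₁ c₂ w S s ℓ e w≡ S≡ S<N 1≤s 1≤K 1≤e
    open Registers h K
    open RAM w S hiding (⟦_⟧)
    open Simulation h K w S
    open Running R R≤S V<R renaming (step to perform)
    open Expressions h K w S
    open Poly (h + k) ℓ K e using (q; q′; q≢0; q′≢0)

    samples-correct : ∀ I μ m j {M} → j + m ≤ s * K → Holds (Sampling μ j) M →
      Samples q m (λ v r → Holds (Kept μ j v) (proj₁ r)) (iterate m (exec I sample) M)
    samples-correct I μ zero    j le (σ , sim , sa) = done (σ , sim , Sampling.ready′ sa , (λ _ ()) , λ a _ → Sampling.mem≡ sa a)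
    samples-correct I μ (suc m) j {M} le holds = bind
      (bind-return {R = λ v r → Holds (Sampling (λ a → if does (a ℕ.≟ R + j) then entry v 0 else μ a) (suc j)) (proj₁ r)}
        (sample-correct I μ j (ℕ.≤-trans (ℕ.≤-trans (ℕ.m≤m+n (suc j) m) (ℕ.≤-reflexive (sym (ℕ.+-suc j m)))) le) holds) (λ {v} {(M , t)} p → _ , refl , p))
      (λ { {x ∷ []} {(M₁ , t)} p → bind-return {R = λ v r → Holds (Kept μ j (x ∷ v)) (proj₁ r)}
        (samples-correct I (λ a → if does (a ℕ.≟ R + j) then x else μ a) m (suc j) (ℕ.≤-trans (ℕ.≤-reflexive (sym (ℕ.+-suc j m))) le) p)
        (λ {v} {(M₂ , t)} (σ , sim , kept) → _ , refl , σ , sim , extend v {σ} kept) })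
      where
      extend : ∀ {x} (v : Vec ℕ m) {σ} → Kept (λ a → if does (a ℕ.≟ R + j) then x else μ a) (suc j) v σ → Kept μ j (x ∷ v) σ
      extend {x} v {σ} (rdy , within , outside) = rdy , within′ , outside′
        where
        within′ : ∀ y → y < suc m → mem σ (R + (j + y)) ≡ entry (x ∷ v) y
        within′ zero    _         = trans (outside (R + (j + 0)) (inj₁ (ℕ.≤-trans (ℕ.≤-reflexive (trans (sym (ℕ.+-suc R (j + 0))) (cong (λ z → R + suc z) (ℕ.+-identityʳ j)))) ℕ.≤-refl)))
          (cong (λ b → if b then x else μ (R + (j + 0))) (dec-true (R + (j + 0) ℕ.≟ R + j) (cong (R +_) (ℕ.+-identityʳ j))))
        within′ (suc y) (s≤s y<m) = trans (cong (λ z → mem σ (R + z)) (ℕ.+-suc j y)) (within y y<m)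
        outside′ : ∀ a → a < R + j ⊎ R + (j + suc m) ≤ a → mem σ a ≡ μ a
        outside′ a (inj₁ a<) = trans (outside a (inj₁ (ℕ.<-trans a< (ℕ.+-monoʳ-< R (ℕ.n<1+n j))))) (cong (λ b → if b then x else μ a) (dec-false (a ℕ.≟ R + j) (λ { refl → ℕ.<-irrefl refl a< })))
        outside′ a (inj₂ ≤a) = trans (outside a (inj₂ (ℕ.≤-trans (ℕ.≤-reflexive (cong (R +_) (sym (ℕ.+-suc j m)))) ≤a))) (cong (λ b → if b then x else μ a) (dec-false (a ℕ.≟ R + j)
          (λ { refl → ℕ.<-irrefl refl (ℕ.<-≤-trans (ℕ.+-monoʳ-< R (ℕ.m<m+n j (s≤s z≤n))) ≤a) })))

    initialise-correct : ∀ n → Samples q (s * K) (λ v r → Holds (Data (chunk K v) (λ _ _ → 0ℤ)) (proj₁ r)) (exec (n ∷ S ∷ []) initialiseC blank)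
    initialise-correct n = subst (Samples q (s * K) _) (sym unfolded)
      (bind-return {R = λ v r → Holds (Data (chunk K v) (λ _ _ → 0ℤ)) (proj₁ r)}
        (bind-return {R = λ v r → Holds (Kept (λ _ → 0) 0 v) (proj₁ r)} (samples-correct (n ∷ S ∷ []) (λ _ → 0) (s * K) 0 ℕ.≤-refl (σ₁ , sim₁ , proj₁ prepared)) (λ {v} {(M , t)} p → _ , refl , p))
        (λ {v} {(M , t)} (σ , sim , rdy , within , outside) → _ , refl , σ , sim , stored rdy
          (λ {j} j<s b → trans (cong (mem σ) (ℕ.+-assoc R (j * K) (toℕ b))) (trans (within (j * K + toℕ b) (inside j<s (Fin.toℕ<n b))) (sym (Vec.lookup∘tabulate _ b))))
          (λ {j} j<s i → subst (_≋ 0ℤ) (sym (outside (counterAddress j (toℕ i)) (inj₂ (ℕ.≤-trans (ℕ.m≤m+n C (j * k)) (ℕ.m≤m+n _ (toℕ i)))))) (≋-pos 0))))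
      where
      entered = exec-stmts (n ∷ S ∷ []) (initPre R) {P = λ σ → mem σ ≡ (λ _ → 0)} {Q = Prepared} (λ {σ} → prepare n σ) (zeros , blank∼zeros , refl)
      M₁ = proj₁ entered
      σ₁ = proj₁ (proj₂ (proj₂ entered))
      sim₁ = proj₁ (proj₂ (proj₂ (proj₂ entered)))
      prepared = proj₂ (proj₂ (proj₂ (proj₂ entered)))
      inside : ∀ {j b} → j < s → b < K → j * K + b < s * K
      inside {j} {b} j<s b<K = ℕ.≤-trans (ℕ.+-monoʳ-< (j * K) b<K) (ℕ.≤-trans (ℕ.≤-reflexive (ℕ.+-comm (j * K) K)) (ℕ.*-monoˡ-≤ K j<s))
      unfolded : exec (n ∷ S ∷ []) initialiseC blank ≡
        (tick (iterate (s * K) (exec (n ∷ S ∷ []) sample) M₁) >>= λ (M′ , t′) → return (M′ , suc (duration (initPre R)) + t′))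
      unfolded = exec-seq-loop (n ∷ S ∷ []) (program (initPre R)) (idx acc) sample (proj₁ (proj₂ entered)) (trans (proj₁ sim₁ acc) (proj₂ prepared))

    module Streaming {n} (n≤N : n ≤ N) where

      contribution : Vec ℕ K → Fin k → Item n → ℤ
      contribution seed i (sg , U) = increment (signed sg) (members U) seed i

      item-correct : ∀ (it : Item n) {M} seed z → n < N → Holds (Data seed z) M →
        ∃[ M′ ] exec (bit (proj₁ it) ∷ ∣ proj₂ it ∣ ∷ map toℕ (members (proj₂ it))) updateC M ≡ return (M′ , updateTime) × Holds (Data seed (λ j i → z j i +ᶻ contribution (seed j) i it)) M′
      item-correct (Sign.+ , U) {M} seed z n<N holds = subst (λ c → ∃[ M′ ] exec (1 ∷ c ∷ map toℕ (members U)) updateC M ≡ return (M′ , updateTime) × Holds (Data seed (λ j i → z j i +ᶻ contribution (seed j) i (Sign.+ , U))) M′) (length-members U)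
        (update-correct 1 1ℤ (members U) seed z n≤N 2≤N (ℕ.≤-<-trans (ℕ.≤-trans (ℕ.≤-reflexive (length-members U)) (∣p∣≤n U)) n<N) refl holds)
      item-correct (Sign.- , U) {M} seed z n<N holds = subst (λ c → ∃[ M′ ] exec (0 ∷ c ∷ map toℕ (members U)) updateC M ≡ return (M′ , updateTime) × Holds (Data seed (λ j i → z j i +ᶻ contribution (seed j) i (Sign.- , U))) M′) (length-members U)
        (update-correct 0 -1ℤ (members U) seed z n≤N (ℕ.≤-<-trans z≤n n<N) (ℕ.≤-<-trans (ℕ.≤-trans (ℕ.≤-reflexive (length-members U)) (∣p∣≤n U)) n<N) refl holds)

  -- The net multiplicities of the stream are all that a linear sketch sees.
  stream-sum : ∀ {n} (σ : Stream n) (g : Subset n → ℤ) →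
    ℤΣ.∑ σ (λ (sg , U) → signed sg *ᶻ g U) ≡ ℤΣ.∑ (allSubsets n) (λ U → (ℤ.+ occurs (Sign.+ , U) σ +ᶻ - (ℤ.+ occurs (Sign.- , U) σ)) *ᶻ g U)
  stream-sum {n} σ g = sym (begin
    ∑ (allSubsets n) (λ U → (ℤ.+ occurs (Sign.+ , U) σ +ᶻ - (ℤ.+ occurs (Sign.- , U) σ)) *ᶻ g U)
      ≡⟨ S.fold-cong (allSubsets n) expand ⟩
    ∑ (allSubsets n) (λ U → ∑ σ (λ x → net U x *ᶻ g U))
      ≡⟨ S.fold-swap (allSubsets n) σ _ ⟩
    ∑ σ (λ x → ∑ (allSubsets n) (λ U → net U x *ᶻ g U))
      ≡⟨ S.fold-cong σ collapse ⟩
    ∑ σ (λ (sg , U) → signed sg *ᶻ g U) ∎)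
    where
    open ≡-Reasoning
    open ℤΣ
    _≟ᴵ_ : (x y : Item n) → Dec (x ≡ y)
    _≟ᴵ_ = ×-≡-dec Sign._≟_ _≟ₛ_
    net : Subset n → Item n → ℤ
    net U x = ⟦ (Sign.+ , U) ≟ᴵ x ⟧ +ᶻ -1ℤ *ᶻ ⟦ (Sign.- , U) ≟ᴵ x ⟧
    expand : ∀ U → (ℤ.+ occurs (Sign.+ , U) σ +ᶻ - (ℤ.+ occurs (Sign.- , U) σ)) *ᶻ g U ≡ ∑ σ (λ x → net U x *ᶻ g U)
    expand U = sym (trans (∑-*ʳ σ (g U) (net U)) (cong (_*ᶻ g U) (trans (S.fold-∙ σ _ _) (cong₂ _+ᶻ_ (sym (length-filter-∑ ((Sign.+ , U) ≟ᴵ_) σ))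
      (trans (∑-*ˡ σ -1ℤ _) (trans (ℤ.-1*i≡-i _) (cong -_ (sym (length-filter-∑ ((Sign.- , U) ≟ᴵ_) σ)))))))))
    same : ∀ sg U e → ⟦ (sg , U) ≟ᴵ (sg , e) ⟧ ≡ ⟦ U ≟ₛ e ⟧
    same sg U e = ⟦⇔⟧ ((sg , U) ≟ᴵ (sg , e)) (U ≟ₛ e) (cong proj₂) (cong (sg ,_))
    l₊ : ∀ a x → (a +ᶻ -1ℤ *ᶻ 0ℤ) *ᶻ x ≡ a *ᶻ (1ℤ *ᶻ x)
    l₊ = ℤSolver.solve-∀
    l₋ : ∀ a x → (0ℤ +ᶻ -1ℤ *ᶻ a) *ᶻ x ≡ a *ᶻ (-1ℤ *ᶻ x)
    l₋ = ℤSolver.solve-∀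
    collapse : ∀ x → ∑ (allSubsets n) (λ U → net U x *ᶻ g U) ≡ signed (proj₁ x) *ᶻ g (proj₂ x)
    collapse (Sign.+ , e) = trans (S.fold-cong (allSubsets n) (λ U → trans (cong₂ (λ a b → (a +ᶻ -1ℤ *ᶻ b) *ᶻ g U) (same Sign.+ U e) (⟦no⟧ ((Sign.- , U) ≟ᴵ (Sign.+ , e)) (λ ()))) (l₊ ⟦ U ≟ₛ e ⟧ (g U))))
      (enumerates-allSubsets n e (λ U → 1ℤ *ᶻ g U))
    collapse (Sign.- , e) = trans (S.fold-cong (allSubsets n) (λ U → trans (cong₂ (λ a b → (a +ᶻ -1ℤ *ᶻ b) *ᶻ g U) (⟦no⟧ ((Sign.+ , U) ≟ᴵ (Sign.- , e)) (λ ())) (same Sign.- U e)) (l₋ ⟦ U ≟ₛ e ⟧ (g U))))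
      (enumerates-allSubsets n e (λ U → -1ℤ *ᶻ g U))

  yields-sum : ∀ {n} {σ : Stream n} {G : Hypergraph n} → σ Yields G → ∀ (g : Subset n → ℤ) →
    ℤΣ.∑ σ (λ (sg , U) → signed sg *ᶻ g U) ≡ ℤΣ.∑ (allSubsets n) (λ U → ℤΣ.⟦ U ∈ᴱ? edges G ⟧ *ᶻ g U)
  yields-sum {n} {σ} {G} yields g = trans (stream-sum σ g) (ℤΣ.S.fold-cong (allSubsets n) (λ U → cong (_*ᶻ g U) (net U (U ∈ᴱ? edges G))))
    where
    l : ∀ a → 1ℤ +ᶻ a +ᶻ - a ≡ 1ℤ
    l = ℤSolver.solve-∀
    net : ∀ U (d : Dec (U ∈ᴱ edges G)) → ℤ.+ occurs (Sign.+ , U) σ +ᶻ - (ℤ.+ occurs (Sign.- , U) σ) ≡ ℤΣ.⟦ d ⟧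
    net U (yes U∈) = trans (cong (λ z → ℤ.+ z +ᶻ - (ℤ.+ occurs (Sign.- , U) σ)) (proj₁ (yields U) U∈)) (trans (cong (_+ᶻ - (ℤ.+ occurs (Sign.- , U) σ)) (ℤ.pos-+ 1 (occurs (Sign.- , U) σ))) (l (ℤ.+ occurs (Sign.- , U) σ)))
    net U (no U∉)  = trans (cong (λ z → ℤ.+ z +ᶻ - (ℤ.+ occurs (Sign.- , U) σ)) (proj₂ (yields U) U∉)) (ℤ.+-inverseʳ (ℤ.+ occurs (Sign.- , U) σ))

module Execution where

  open Big
  open Hash
  open Codes
  open Moments
  open Second
  open Graph
  open Ratio
  open Machine
  open Modular
  open Program
  open Phases
  open Init
  open import Defs
  open import Data.Fin.Base using (suc; toℕ)
  open import Data.Fin.Subset using (∣_∣)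
  open import Data.Integer.Base as ℤ using (ℤ; 0ℤ; -_) renaming (_+_ to _+ᶻ_; _*_ to _*ᶻ_)
  import Data.Integer.Properties as ℤ
  open import Data.List.Base using ([]; _∷_; length; upTo; allFin)
  open import Data.Nat.Base as ℕ using (ℕ; suc; _+_; _*_; _^_; _⊔_; _≤_; _<_; z≤n; NonZero)
  open import Data.Nat.DivMod using (_/_)
  open import Data.Nat.Logarithm using (⌊log₂_⌋)
  import Data.Nat.Properties as ℕ
  open import Data.Product.Base using (∃-syntax; _×_; _,_; proj₁; proj₂)
  open import Data.Rational.Base using (ℚ)
  open import Data.Sign.Base as Sign using (Sign)
  open import Data.Vec.Base using (Vec)
  open import Relation.Binary.PropositionalEquality

  algorithm : ∀ {t} (H : Hypergraph t) (K c₁ c₂ wf : ℕ) → Algorithm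
  algorithm H K c₁ c₂ wf = record
    { wordFactor = wf
    ; initialise = Sketch.initialiseC (edgeOf H) K c₁ c₂
    ; update     = Sketch.updateC (edgeOf H) K c₁ c₂
    ; output     = Sketch.outputC (edgeOf H) K c₁ c₂
    }

  module Executed {t} (H : Hypergraph t) (K c₁ c₂ wf : ℕ) {n : ℕ} (S s ℓ e : ℕ)
    (w≡ : wf * ⌊log₂ n ⌋ ≡ suc (t + size H + (e + ℓ * K))) (S≡ : S ≡ Sketch.R (edgeOf H) K c₁ c₂ + s * (K + size H)) (S<N : S < 2 ^ (wf * ⌊log₂ n ⌋))
    (1≤s : 1 ≤ s) (1≤K : 1 ≤ K) (1≤e : 1 ≤ e) (n<N : n < 2 ^ (wf * ⌊log₂ n ⌋)) (n≤2^ℓ : n ≤ 2 ^ ℓ) where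

    private
      k = size H
      D = edgeOf H
      w = wf * ⌊log₂ n ⌋
    A = algorithm H K c₁ c₂ wf
    open Sketch D K c₁ c₂
    open Correct w S s ℓ e w≡ S≡ S<N 1≤s 1≤K 1≤e
    open Phased D K c₁ c₂ w S s ℓ e w≡ S≡ S<N 1≤s 1≤K 1≤e
    open Initialised D K c₁ c₂ w S s ℓ e w≡ S≡ S<N 1≤s 1≤K 1≤e
    open Streaming {n} (ℕ.<⇒≤ n<N)
    open Registers t K
    open RAM w S hiding (⟦_⟧)
    open Simulation t K w S
    open Running R R≤S V<R renaming (step to perform)
    open Expressions t K w S
    open Poly (t + k) ℓ K e using (q; q′; q≢0; q′≢0; Q; seeds)
    open ℤΣ

    Holds-cong : ∀ {M seed z z′} → (∀ j i → z j i ≡ z′ j i) → Holds (Data seed z) M → Holds (Data seed z′) M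
    Holds-cong z≡ (σ , sim , d) = σ , sim , stored (ready d) (seeds′ d) (λ {j} j<s i → subst (mem σ (counterAddress j (toℕ i)) ≋_) (z≡ j i) (counters d j<s i))
      where open Data renaming (seeds to seeds′)

    step-item : ∀ (it : Item n) {M} seed z → Holds (Data seed z) M →
      ∃[ M′ ] exec (encode A n S it) updateC M ≡ return (M′ , updateTime) × Holds (Data seed (λ j i → z j i +ᶻ contribution (seed j) i it)) M′
    step-item it@(Sign.+ , U) seed z holds = item-correct it seed z n<N holds
    step-item it@(Sign.- , U) seed z holds = item-correct it seed z n<N holds

    process-item : ∀ it σ {M M′ T t} → exec (encode A n S it) updateC M ≡ return (M′ , t) → process A n S (it ∷ σ) M T ≡ process A n S σ M′ (T ⊔ t)
    process-item it σ e rewrite e = refl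

    process-correct : ∀ (σ : Stream n) {M} T seed z → T ≤ updateTime → Holds (Data seed z) M →
      ∃[ M′ ] ∃[ T′ ] process A n S σ M T ≡ return (M′ , T′) × T′ ≤ updateTime × Holds (Data seed (λ j i → z j i +ᶻ ∑ σ (contribution (seed j) i))) M′
    process-correct []       {M} T seed z T≤ holds = M , T , refl , T≤ , Holds-cong (λ j i → sym (ℤ.+-identityʳ (z j i))) holds
    process-correct (it ∷ σ) {M} T seed z T≤ holds =
      proj₁ rest , proj₁ (proj₂ rest) , trans (process-item it σ (proj₁ (proj₂ one))) (proj₁ (proj₂ (proj₂ rest))) , proj₁ (proj₂ (proj₂ (proj₂ rest)))
      , Holds-cong (λ j i → ℤ.+-assoc (z j i) (contribution (seed j) i it) _) (proj₂ (proj₂ (proj₂ (proj₂ rest))))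
      where
      one = step-item it seed z holds
      rest = process-correct σ (T ⊔ updateTime) seed (λ j i → z j i +ᶻ contribution (seed j) i it) (ℕ.⊔-lub T≤ ℕ.≤-refl) (proj₂ (proj₂ one))

    answer-at : ∀ M {x} → read M 0 ≡ x → read M 1 ≡ 1 → answer A n S M ≡ fromℕ x
    answer-at M refl e rewrite e = refl

    estimate : Stream n → Vec ℕ K → ℤ
    estimate σ seed = ∏ (allFin k) (λ i → ∑ σ (contribution seed i))

    Rounds : Stream n → Vec ℕ (s * K) → ℚ × ℕ → Set
    Rounds σ v (Z , T) = T ≤ updateTime × (∀ B .{{_ : NonZero (s * c₂ + s * c₂)}} → ∑ (upTo s) (λ j → estimate σ (chunk K v j)) ≡ ℤ.+ B →
      1 ≤ c₁ → c₁ * B + s * c₂ < N → s * c₂ + s * c₂ < N → c₂ < N → c₁ < N → Z ≡ fromℕ ((c₁ * B + s * c₂) / (s * c₂ + s * c₂)))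

    run-correct : ∀ (σ : Stream n) → Samples q (s * K) (Rounds σ) (run A n S σ)
    run-correct σ = bind-return {R = Rounds σ} (initialise-correct n) (λ {v} {r} holds → finish v r holds)
      where
      rest : Memory × ℕ → Rnd (ℚ × ℕ)
      rest (M₀ , _) = process A n S σ M₀ 0 >>= λ (M₁ , T) → exec [] outputC M₁ >>= λ (M₂ , _) → return (answer A n S M₂ , T)
      rest-return : ∀ {M₀ M₁ M₂ t₀ t₁ T} → process A n S σ M₀ 0 ≡ return (M₁ , T) → exec [] outputC M₁ ≡ return (M₂ , t₁) → rest (M₀ , t₀) ≡ return (answer A n S M₂ , T)
      rest-return e₁ e₂ rewrite e₁ | e₂ = refl
      finish : ∀ v r → Holds (Data (chunk K v) (λ _ _ → 0ℤ)) (proj₁ r) → ∃[ b ] rest r ≡ return b × Rounds σ v b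
      finish v (M₀ , t₀) holds = (answer A n S M₂ , T) , rest-return {t₀ = t₀} (proj₁ (proj₂ (proj₂ pr))) (proj₁ (proj₂ out)) , proj₁ (proj₂ (proj₂ (proj₂ pr))) ,
        λ B total≡ p₁ p₂ p₃ p₄ p₅ → answer-at M₂ (proj₁ answers B (trans (ℤΣ.S.fold-cong (upTo s) (λ j → ℤΣ.P.fold-cong (allFin k) (λ i → ℤ.+-identityˡ (∑ σ (contribution (chunk K v j) i))))) total≡) p₁ p₂ p₃ p₄ p₅) (proj₂ answers)
        where
        pr = process-correct σ 0 (chunk K v) (λ _ _ → 0ℤ) z≤n holds
        T = proj₁ (proj₂ pr)
        out = output-correct [] (chunk K v) (λ j i → 0ℤ +ᶻ ∑ σ (contribution (chunk K v j) i)) (proj₂ (proj₂ (proj₂ (proj₂ pr))))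
        M₂ = proj₁ out
        answers = read-answer {M₂} {λ j i → 0ℤ +ᶻ ∑ σ (contribution (chunk K v j) i)} (proj₂ (proj₂ out))

    module _ (G : Hypergraph n) {σ : Stream n} (yields : σ Yields G) where
      open SecondMoment D ℓ K e n≤2^ℓ (present H G) using (counter; Z)
      open Hashed D ℓ K e n≤2^ℓ using (colours)
      open Table D using (weight)

      estimate-counters : ∀ seed → estimate σ seed ≡ Z (colours seed)
      estimate-counters seed = ℤΣ.P.fold-cong (allFin k) (λ i → trans (yields-sum {σ = σ} {G} yields (λ U → ⟦ length (members U) ℕ.≟ ∣ D i ∣ ⟧ *ᶻ weight i (members U) (colours seed)))
        (ℤΣ.S.fold-cong (allSubsets n) (λ U → trans (sym (ℤ.*-assoc ⟦ U ∈ᴱ? edges G ⟧ ⟦ length (members U) ℕ.≟ ∣ D i ∣ ⟧ _)) (cong (_*ᶻ weight i (members U) (colours seed))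
          (trans (cong (λ c → ⟦ U ∈ᴱ? edges G ⟧ *ᶻ ⟦ c ℕ.≟ ∣ D i ∣ ⟧) (length-members U)) (sym (pos-present H G i U)))))))

module Analysis where

  open Big
  open Hash
  open Codes
  open Moments
  open Second
  open Graph
  open Cheby
  open Phases using (entry; chunk)
  open import Defs using (Hypergraph; size; #)
  open import Data.Fin.Base using (zero; suc; toℕ)
  open import Data.Fin.Subset using () renaming (_∈_ to _∈ₛ_)
  open import Data.Integer.Base as ℤ using (ℤ; 0ℤ; 1ℤ; -_) renaming (_+_ to _+ᶻ_; _*_ to _*ᶻ_; _≤_ to _≤ᶻ_)
  import Data.Integer.Properties as ℤ
  import Data.Integer.Tactic.RingSolver as ℤSolver
  open import Data.List.Base as List using (List; []; _∷_; length; upTo)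
  import Data.List.Properties as List
  open import Data.Nat.Base as ℕ using (ℕ; zero; suc; _+_; _*_; _^_; _≤_; _<_; z≤n; s≤s; NonZero)
  open import Data.Nat.DivMod
  import Data.Nat.Properties as ℕ
  open import Data.Nat.Tactic.RingSolver using (solve-∀)
  open import Data.Product.Base using (∃-syntax; _,_)
  open import Data.Sum.Base using (_⊎_; inj₁; inj₂; [_,_]′)
  open import Data.Vec.Base as Vec using (Vec; []; _∷_; lookup) renaming (_++_ to _++ᵛ_; concat to concatᵛ)
  import Data.Vec.Properties as Vec
  open import Function.Base using (_∘_; id)
  open import Relation.Binary.PropositionalEquality
  open import Relation.Nullary.Decidable using (Dec; _⊎-dec_)
  open import Relation.Nullary.Negation using (¬_; contradiction)

  private variable
    A : Set

  ∑-vecs-+ : ∀ (xs : List A) a b (F : Vec A (a + b) → ℕ) → ℕΣ.∑ (vecs xs (a + b)) F ≡ ℕΣ.∑ (vecs xs a) (λ u → ℕΣ.∑ (vecs xs b) (λ v → F (u ++ᵛ v)))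
  ∑-vecs-+ xs zero    b F = sym (ℕ.+-identityʳ _)
  ∑-vecs-+ xs (suc a) b F = trans (ℕΣ.S.fold-vecs xs (a + b)) (trans (ℕΣ.S.fold-cong xs (λ x → ∑-vecs-+ xs a b (λ v → F (x ∷ v)))) (sym (ℕΣ.S.fold-vecs xs a)))

  ∑-concat : ∀ (xs : List A) s K (F : Vec A (s * K) → ℕ) → ℕΣ.∑ (vecs xs (s * K)) F ≡ ℕΣ.∑ (vecs (vecs xs K) s) (F ∘ concatᵛ)
  ∑-concat xs zero    K F = refl
  ∑-concat xs (suc s) K F = trans (∑-vecs-+ xs K (s * K) F) (trans (ℕΣ.S.fold-cong (vecs xs K) (λ u → ∑-concat xs s K (λ v → F (u ++ᵛ v)))) (sym (ℕΣ.S.fold-vecs (vecs xs K) s)))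

  entry-++ˡ : ∀ {a b} (u : Vec ℕ a) (v : Vec ℕ b) i → entry (u ++ᵛ v) (toℕ {a} i) ≡ lookup u i
  entry-++ˡ (x ∷ u) v zero    = refl
  entry-++ˡ (x ∷ u) v (suc i) = entry-++ˡ u v i

  entry-++ʳ : ∀ {a b} (u : Vec ℕ a) (v : Vec ℕ b) x → entry (u ++ᵛ v) (a + x) ≡ entry v x
  entry-++ʳ []      v x = refl
  entry-++ʳ (_ ∷ u) v x = entry-++ʳ u v x

  chunk-first : ∀ {K m} (u : Vec ℕ K) (v : Vec ℕ m) → chunk K (u ++ᵛ v) 0 ≡ u
  chunk-first u v = trans (Vec.tabulate-cong (entry-++ˡ u v)) (Vec.tabulate∘lookup u)

  chunk-rest : ∀ {K m} (u : Vec ℕ K) (v : Vec ℕ m) j → chunk K (u ++ᵛ v) (suc j) ≡ chunk K v j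
  chunk-rest {K} u v j = Vec.tabulate-cong (λ b → trans (cong (entry (u ++ᵛ v)) (ℕ.+-assoc K (j * K) (toℕ b))) (entry-++ʳ u v (j * K + toℕ b)))

  ∑-chunks : ∀ {K s} (X : Vec ℕ K → ℤ) (vs : Vec (Vec ℕ K) s) → ℤΣ.∑ (upTo s) (λ j → X (chunk K (concatᵛ vs) j)) ≡ total X vs
  ∑-chunks X []       = refl
  ∑-chunks {K} {suc s} X (u ∷ vs) = trans (∑-upTo-suc s (λ j → X (chunk K (concatᵛ (u ∷ vs)) j))) (cong₂ _+ᶻ_ (cong X (chunk-first u (concatᵛ vs)))
    (trans (ℤΣ.S.fold-cong (upTo s) (λ j → cong X (chunk-rest u (concatᵛ vs) j))) (∑-chunks X vs)))

  total-affine : ∀ {s} (X : A → ℤ) q c (vs : Vec A s) → total (λ x → q *ᶻ X x +ᶻ - c) vs ≡ q *ᶻ total X vs +ᶻ - (ℤ.+ s *ᶻ c)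
  total-affine X q c [] = sym (trans (cong₂ (λ a b → a +ᶻ - b) (ℤ.*-zeroʳ q) (ℤ.*-zeroˡ c)) refl)
  total-affine {s = suc s} X q c (x ∷ vs) = trans (cong ((q *ᶻ X x +ᶻ - c) +ᶻ_) (total-affine X q c vs)) (trans (l q (X x) (total X vs) c (ℤ.+ s)) (cong (λ z → q *ᶻ (X x +ᶻ total X vs) +ᶻ - (z *ᶻ c)) (sym (ℤ.pos-+ 1 s))))
    where
    l : ∀ q x y c s → (q *ᶻ x +ᶻ - c) +ᶻ (q *ᶻ y +ᶻ - (s *ᶻ c)) ≡ q *ᶻ (x +ᶻ y) +ᶻ - ((1ℤ +ᶻ s) *ᶻ c)
    l = ℤSolver.solve-∀

  module Variance {t} (H : Hypergraph t) (2≤deg : Table.EveryDegree≥2 (edgeOf H)) (1≤deg : ∀ u → ∃[ i ] u ∈ₛ edgeOf H i)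
    {n : ℕ} (G : Hypergraph n) (ℓ K e : ℕ) (n≤2^ℓ : n ≤ 2 ^ ℓ)
    (short : (size H + size H) * t < K) (N<K : t * size H < K) (t<K : t < K) where

    private
      k = size H
      D = edgeOf H
      a = automorphisms H
    open Hashed D ℓ K e n≤2^ℓ
    open SecondMoment D ℓ K e n≤2^ℓ (present H G) using (Z; second-moment; r)
    open ℤΣ

    X : Vec ℕ K → ℤ
    X seed = Z (colours seed)

    c : ℕ
    c = κⁿ D 1≤deg * a * # H G

    slots<K : N < K
    slots<K = ℕ.≤-<-trans (ℕ.≤-trans (List.length-filter _ (List.cartesianProduct (List.allFin t) (List.allFin k)))
      (ℕ.≤-reflexive (trans (length-× (List.allFin t) (List.allFin k)) (cong₂ _*_ (List.length-tabulate {n = t} id) (List.length-tabulate {n = k} id))))) N<K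

    mean : ℤ.+ (Q ^ t) *ᶻ ∑ (seeds K) X ≡ ℤ.+ length (seeds K) *ᶻ ℤ.+ c
    mean = trans (FirstMoment.first-moment 1≤deg slots<K t<K (λ i U → ℤ.+ present H G i U)) (begin
      E (λ _ → 1ℤ) *ᶻ Table.κ D *ᶻ ∑ (vecs (List.allFin n) t) (λ φ → ⟦ injective? φ ⟧ *ᶻ embedded H G φ)
        ≡⟨ cong₂ _*ᶻ_ (cong₂ _*ᶻ_ (trans (∑-const (seeds K) 1ℤ) (ℤ.*-identityʳ (ℤ.+ length (seeds K)))) (κ≡κⁿ D 1≤deg)) (∑-embeddings H G) ⟩
      ℤ.+ length (seeds K) *ᶻ ℤ.+ κⁿ D 1≤deg *ᶻ ℤ.+ (a * # H G)
        ≡⟨ ℤ.*-assoc (ℤ.+ length (seeds K)) (ℤ.+ κⁿ D 1≤deg) (ℤ.+ (a * # H G)) ⟩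
      ℤ.+ length (seeds K) *ᶻ (ℤ.+ κⁿ D 1≤deg *ᶻ ℤ.+ (a * # H G))
        ≡⟨ cong (ℤ.+ length (seeds K) *ᶻ_) (trans (sym (ℤ.pos-* (κⁿ D 1≤deg) (a * # H G))) (cong ℤ.+_ (sym (ℕ.*-assoc (κⁿ D 1≤deg) a (# H G))))) ⟩
      ℤ.+ length (seeds K) *ᶻ ℤ.+ c ∎)
      where open ≡-Reasoning

    module _ (μ : ℕ) (sum≤ : ∀ i → ℕΣ.∑ (Defs.allSubsets n) (present H G i) ≤ μ) where

      V W : ℕ
      V = (suc t ^ t) ^ r * ((3 * 2 ^ (k + k)) ^ t * μ) ^ k
      W = Q ^ t * Q ^ t * V

      private
        T = length (seeds K)
        Y = centred (seeds K) X (ℤ.+ (Q ^ t)) (ℤ.+ c) mean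
        Y² = ∑ (seeds K) (λ x → Y x *ᶻ Y x)

      ∑-squares : ∑ (seeds K) (λ x → X x *ᶻ X x) ≤ᶻ ℤ.+ (T * V)
      ∑-squares = ℤ.≤-trans (i≤∣i∣ _) (ℤ.+≤+ (second-moment 2≤deg (present-01 H G) short μ sum≤))
        where
        i≤∣i∣ : ∀ i → i ≤ᶻ ℤ.+ ℤ.∣ i ∣
        i≤∣i∣ (ℤ.+ n)      = ℤ.≤-refl
        i≤∣i∣ (ℤ.-[1+ n ]) = ℤ.-≤+

      private
        scaled : Y² +ᶻ ℤ.+ (T * (c * c)) ≤ᶻ ℤ.+ (T * W)
        scaled = begin
          Y² +ᶻ ℤ.+ (T * (c * c))                                             ≡⟨ cong (Y² +ᶻ_) (trans (ℤ.pos-* T (c * c)) (cong (ℤ.+ T *ᶻ_) (ℤ.pos-* c c))) ⟩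
          Y² +ᶻ ℤ.+ T *ᶻ (ℤ.+ c *ᶻ ℤ.+ c)                                     ≡⟨ ∑-centred² (seeds K) X (ℤ.+ (Q ^ t)) (ℤ.+ c) mean ⟩
          ℤ.+ (Q ^ t) *ᶻ ℤ.+ (Q ^ t) *ᶻ ∑ (seeds K) (λ x → X x *ᶻ X x)        ≡⟨ cong (_*ᶻ ∑ (seeds K) (λ x → X x *ᶻ X x)) (ℤ.pos-* (Q ^ t) (Q ^ t)) ⟨
          ℤ.+ (Q ^ t * Q ^ t) *ᶻ ∑ (seeds K) (λ x → X x *ᶻ X x)               ≤⟨ ℤ.*-monoˡ-≤-nonNeg (ℤ.+ (Q ^ t * Q ^ t)) ∑-squares ⟩
          ℤ.+ (Q ^ t * Q ^ t) *ᶻ ℤ.+ (T * V)                                  ≡⟨ ℤ.pos-* (Q ^ t * Q ^ t) (T * V) ⟨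
          ℤ.+ (Q ^ t * Q ^ t * (T * V))                                       ≡⟨ cong ℤ.+_ (l (Q ^ t * Q ^ t) T V) ⟩
          ℤ.+ (T * W)                                                         ∎
          where
          open ℤ.≤-Reasoning
          l : ∀ q t v → q * (t * v) ≡ t * (q * v)
          l = solve-∀

        squares≥0 : ∀ (xs : List (Vec ℕ K)) → 0ℤ ≤ᶻ ∑ xs (λ x → Y x *ᶻ Y x)
        squares≥0 []       = ℤ.≤-refl
        squares≥0 (x ∷ xs) = ℤ.+-mono-≤ (ℤ.≤-trans (ℤ.+≤+ z≤n) (ℤ.≤-reflexive (∣i∣² (Y x)))) (squares≥0 xs)

      length-seeds : length (seeds K) ≡ q ^ K
      length-seeds = trans (length-vecs (upTo q) K) (cong (_^ K) (List.length-upTo q))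

      instance
        T≢0 : NonZero (length (seeds K))
        T≢0 = subst NonZero (sym length-seeds) (ℕ.m^n≢0 q K)

      variance≤ : Y² ≤ᶻ ℤ.+ (T * W)
      variance≤ = ℤ.≤-trans (ℤ.≤-trans (ℤ.≤-reflexive (sym (ℤ.+-identityʳ Y²))) (ℤ.+-monoʳ-≤ Y² (ℤ.+≤+ z≤n))) scaled

      c²≤W : c * c ≤ W
      c²≤W = ℕ.*-cancelˡ-≤ (length (seeds K)) (ℤ.drop‿+≤+ (ℤ.≤-trans (ℤ.≤-trans (ℤ.≤-reflexive (sym (ℤ.+-identityˡ _))) (ℤ.+-monoˡ-≤ (ℤ.+ (T * (c * c))) (squares≥0 (seeds K)))) scaled))

      deviation : ∀ s → Vec ℕ (s * K) → ℤ
      deviation s v = ℤ.+ (Q ^ t) *ᶻ ∑ (upTo s) (λ j → X (chunk K v j)) +ᶻ - (ℤ.+ s *ᶻ ℤ.+ c)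

      -- Within half a unit, or within ε / 2 in relative terms, of the mean, where
      -- ε = nu / de.
      Close : ℕ → ℕ → ∀ s → Vec ℕ (s * K) → Set
      Close nu de s v = 2 * ℤ.∣ deviation s v ∣ < s * (κⁿ D 1≤deg * a) ⊎ 2 * de * ℤ.∣ deviation s v ∣ ≤ nu * # H G * (s * (κⁿ D 1≤deg * a))

      close? : ∀ nu de s v → Dec (Close nu de s v)
      close? nu de s v = (2 * ℤ.∣ deviation s v ∣ ℕ.<? s * (κⁿ D 1≤deg * a)) ⊎-dec (2 * de * ℤ.∣ deviation s v ∣ ℕ.≤? nu * # H G * (s * (κⁿ D 1≤deg * a)))

      deviation-total : ∀ s (vs : Vec (Vec ℕ K) s) → deviation s (concatᵛ vs) ≡ total Y vs
      deviation-total s vs = trans (cong (λ z → ℤ.+ (Q ^ t) *ᶻ z +ᶻ - (ℤ.+ s *ᶻ ℤ.+ c)) (∑-chunks X vs)) (sym (total-affine X (ℤ.+ (Q ^ t)) (ℤ.+ c) vs))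

      close-likely : ∀ nu de s → 1 ≤ s * (κⁿ D 1≤deg * a) → 1 ≤ nu * # H G →
        12 * W ≤ s ⊎ 12 * W * (de * de) ≤ s * (nu * # H G * (nu * # H G)) →
        2 * q ^ (s * K) ≤ 3 * ℕΣ.∑ (vecs (upTo q) (s * K)) (λ v → ℕΣ.⟦ close? nu de s v ⟧)
      close-likely nu de s 1≤D 1≤ν enough = begin
        2 * q ^ (s * K)                                                                       ≡⟨ cong (2 *_) (trans (cong (q ^_) (ℕ.*-comm s K)) (trans (sym (ℕ.^-*-assoc q K s)) (cong (_^ s) (sym length-seeds)))) ⟩
        2 * length (seeds K) ^ s                                                              ≤⟨ [ caseA , caseB ]′ enough ⟩
        3 * ℕΣ.∑ (vecs (seeds K) s) (λ vs → ℕΣ.⟦ close? nu de s (concatᵛ vs) ⟧)               ≡⟨ cong (3 *_) (∑-concat (upTo q) s K _) ⟨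
        3 * ℕΣ.∑ (vecs (upTo q) (s * K)) (λ v → ℕΣ.⟦ close? nu de s v ⟧)                      ∎
        where
        open ℕ.≤-Reasoning
        δ = κⁿ D 1≤deg * a
        Dn = s * δ
        ν = nu * # H G
        1≤δ : 1 ≤ δ
        1≤δ = positive δ 1≤D
          where
          positive : ∀ δ → 1 ≤ s * δ → 1 ≤ δ
          positive zero    le = contradiction le (λ le → ℕ.<-irrefl refl (ℕ.≤-trans le (ℕ.≤-reflexive (ℕ.*-zeroʳ s))))
          positive (suc δ) le = s≤s z≤n
        nz : ∀ {x} → 1 ≤ x → NonZero x
        nz = ℕ.>-nonZero
        s≤Dn : s ≤ Dn
        s≤Dn = ℕ.m≤m*n s δ {{nz 1≤δ}}
        apart : ∀ {vs : Vec (Vec ℕ K) s} → ℤ.∣ deviation s (concatᵛ vs) ∣ ≡ ℤ.∣ total Y vs ∣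
        apart {vs} = cong ℤ.∣_∣ (deviation-total s vs)
        caseA : 12 * W ≤ s → 2 * length (seeds K) ^ s ≤ 3 * ℕΣ.∑ (vecs (seeds K) s) (λ vs → ℕΣ.⟦ close? nu de s (concatᵛ vs) ⟧)
        caseA le = chebyshev (seeds K) Y (∑-centred (seeds K) X (ℤ.+ (Q ^ t)) (ℤ.+ c) mean) s W 4 (Dn * Dn) {{nz (ℕ.*-mono-≤ 1≤D 1≤D)}} variance≤
          (ℕ.≤-trans (ℕ.≤-reflexive (l₁ s W)) (ℕ.*-mono-≤ s≤Dn (ℕ.≤-trans le s≤Dn))) (λ vs → close? nu de s (concatᵛ vs)) far
          where
          l₁ : ∀ s W → 3 * s * W * 4 ≡ s * (12 * W)
          l₁ = solve-∀
          l₂ : ∀ y → 2 * y * (2 * y) ≡ 4 * (y * y)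
          l₂ = solve-∀
          far : ∀ vs → ¬ Close nu de s (concatᵛ vs) → Dn * Dn ≤ 4 * (ℤ.∣ total Y vs ∣ * ℤ.∣ total Y vs ∣)
          far vs ¬close = ℕ.≤-trans (ℕ.*-mono-≤ le′ le′) (ℕ.≤-reflexive (l₂ ℤ.∣ total Y vs ∣))
            where
            le′ : Dn ≤ 2 * ℤ.∣ total Y vs ∣
            le′ = ℕ.≤-trans (ℕ.≮⇒≥ (¬close ∘ inj₁)) (ℕ.≤-reflexive (cong (2 *_) (apart {vs})))
        caseB : 12 * W * (de * de) ≤ s * (ν * ν) → 2 * length (seeds K) ^ s ≤ 3 * ℕΣ.∑ (vecs (seeds K) s) (λ vs → ℕΣ.⟦ close? nu de s (concatᵛ vs) ⟧)
        caseB le = chebyshev (seeds K) Y (∑-centred (seeds K) X (ℤ.+ (Q ^ t)) (ℤ.+ c) mean) s W (4 * (de * de)) (ν * Dn * (ν * Dn)) {{nz (ℕ.*-mono-≤ (ℕ.*-mono-≤ 1≤ν 1≤D) (ℕ.*-mono-≤ 1≤ν 1≤D))}} variance≤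
          (ℕ.≤-trans (ℕ.≤-reflexive (l₁ s W de)) (ℕ.≤-trans (ℕ.*-mono-≤ s≤Dn le) (ℕ.≤-trans (ℕ.*-monoʳ-≤ Dn (ℕ.*-monoˡ-≤ (ν * ν) s≤Dn)) (ℕ.≤-reflexive (l₃ Dn ν))))) (λ vs → close? nu de s (concatᵛ vs)) far
          where
          l₁ : ∀ s W d → 3 * s * W * (4 * (d * d)) ≡ s * (12 * W * (d * d))
          l₁ = solve-∀
          l₂ : ∀ y d → 2 * d * y * (2 * d * y) ≡ 4 * (d * d) * (y * y)
          l₂ = solve-∀
          l₃ : ∀ D ν → D * (D * (ν * ν)) ≡ ν * D * (ν * D)
          l₃ = solve-∀
          far : ∀ vs → ¬ Close nu de s (concatᵛ vs) → ν * Dn * (ν * Dn) ≤ 4 * (de * de) * (ℤ.∣ total Y vs ∣ * ℤ.∣ total Y vs ∣)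
          far vs ¬close = ℕ.≤-trans (ℕ.*-mono-≤ le′ le′) (ℕ.≤-reflexive (l₂ ℤ.∣ total Y vs ∣ de))
            where
            le′ : ν * Dn ≤ 2 * de * ℤ.∣ total Y vs ∣
            le′ = ℕ.≤-trans (ℕ.<⇒≤ (ℕ.≰⇒> (¬close ∘ inj₂))) (ℕ.≤-reflexive (cong (2 * de *_) (apart {vs})))

module Rounding where

  open Ratio
  open import Defs using (Approximates; fromℕ; Hypergraph; size; #; cost)
  open import Data.Integer.Base as ℤ using (ℤ; -_) renaming (_+_ to _+ᶻ_; _*_ to _*ᶻ_)
  import Data.Integer.Properties as ℤ
  open import Data.Nat.Base as ℕ using (ℕ; suc; _+_; _*_; _∸_; _^_; _≤_; _<_; z≤n; s≤s; NonZero)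
  open import Data.Nat.Coprimality using (Coprime)
  open import Data.Nat.DivMod
  import Data.Nat.Properties as ℕ
  open import Data.Nat.Tactic.RingSolver using (solve-∀)
  open import Data.Product.Base using (∃-syntax; _×_; _,_; proj₁; proj₂)
  open import Data.Rational.Base as ℚ using (ℚ; mkℚ; 1ℚ; fromℚᵘ)
  import Data.Rational.Properties as ℚ
  open import Data.Rational.Unnormalised.Base as ℚᵘ using (ℚᵘ; mkℚᵘ; *≡*; *≤*)
  import Data.Rational.Unnormalised.Properties as ℚᵘ
  open import Data.Sum.Base using (_⊎_; inj₁; inj₂; [_,_]′)
  open import Relation.Binary.PropositionalEquality
  open import Relation.Nullary.Decidable using (Dec; yes; no)
  open import Relation.Nullary.Negation using (contradiction)

  ∣-∣-split : ∀ a b → a ≤ b + ℤ.∣ ℤ.+ a +ᶻ - (ℤ.+ b) ∣ × b ≤ a + ℤ.∣ ℤ.+ a +ᶻ - (ℤ.+ b) ∣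
  ∣-∣-split a b with ℕ.≤-total a b
  ... | inj₁ a≤b = ℕ.≤-trans a≤b (ℕ.m≤m+n b _)
                 , ℕ.≤-reflexive (sym (trans (cong (a +_) (trans (cong ℤ.∣_∣ (trans (ℤ.m-n≡m⊖n a b) (ℤ.⊖-≤ a≤b))) (ℤ.∣-i∣≡∣i∣ (ℤ.+ (b ∸ a))))) (ℕ.m+[n∸m]≡n a≤b)))
  ... | inj₂ b≤a = ℕ.≤-reflexive (sym (trans (cong (b +_) (cong ℤ.∣_∣ (trans (ℤ.m-n≡m⊖n a b) (ℤ.⊖-≥ b≤a)))) (ℕ.m+[n∸m]≡n b≤a)))
                 , ℕ.≤-trans b≤a (ℕ.m≤m+n a _)

  ∣-n-m∣ : ∀ m n → ℤ.∣ - (ℤ.+ m) +ᶻ - (ℤ.+ n) ∣ ≡ m + n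
  ∣-n-m∣ m n = trans (cong ℤ.∣_∣ (sym (ℤ.neg-distrib-+ (ℤ.+ m) (ℤ.+ n)))) (trans (ℤ.∣-i∣≡∣i∣ (ℤ.+ m +ᶻ ℤ.+ n)) (cong ℤ.∣_∣ (sym (ℤ.pos-+ m n))))

  -- Rounding x / D to the nearest integer, given a deviation y of x from D h that
  -- is small either absolutely or relatively to h.  If 2 y < D the rounding
  -- restores h exactly; otherwise it costs at most y.
  module _ (D h nu de : ℕ) (1≤D : 1 ≤ D) (1≤h : 1 ≤ h) (nu≤de : nu ≤ de) (1≤de : 1 ≤ de) (y : ℕ)
           (close : 2 * y < D ⊎ 2 * de * y ≤ nu * h * D) where

    private instance
      D≢0 : NonZero D
      D≢0 = ℕ.>-nonZero 1≤D
      de≢0 : NonZero de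
      de≢0 = ℕ.>-nonZero 1≤de
      2D≢0 : NonZero (D + D)
      2D≢0 = ℕ.>-nonZero (ℕ.≤-trans 1≤D (ℕ.m≤m+n D D))

    2y≤Dh : 2 * y ≤ D * h
    2y≤Dh = [ (λ 2y<D → ℕ.≤-trans (ℕ.<⇒≤ 2y<D) (ℕ.m≤m*n D h {{ℕ.>-nonZero 1≤h}})) , relative ]′ close
      where
      l₁ : ∀ d y → d * (2 * y) ≡ 2 * d * y
      l₁ = solve-∀
      l₂ : ∀ d h D → d * h * D ≡ d * (D * h)
      l₂ = solve-∀
      relative : 2 * de * y ≤ nu * h * D → 2 * y ≤ D * h
      relative le = ℕ.*-cancelˡ-≤ de (ℕ.≤-trans (ℕ.≤-reflexive (l₁ de y)) (ℕ.≤-trans le (ℕ.≤-trans (ℕ.*-monoˡ-≤ D (ℕ.*-monoˡ-≤ h nu≤de)) (ℕ.≤-reflexive (l₂ de h D)))))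

    exactly-or-relatively : 2 * y < D ⊎ D ≤ 2 * y × 2 * de * y ≤ nu * h * D
    exactly-or-relatively = split (2 * y ℕ.<? D) close
      where
      split : Dec (2 * y < D) → 2 * y < D ⊎ 2 * de * y ≤ nu * h * D → 2 * y < D ⊎ D ≤ 2 * y × 2 * de * y ≤ nu * h * D
      split _         (inj₁ 2y<D) = inj₁ 2y<D
      split (yes 2y<D) (inj₂ le)  = inj₁ 2y<D
      split (no 2y≮D) (inj₂ le)   = inj₂ (ℕ.≮⇒≥ 2y≮D , le)

    module _ (x : ℕ) (x≤ : x ≤ D * h + y) (≤x : D * h ≤ x + y) where

      rounded : ℕ
      rounded = (2 * x + D) / (D + D)

      private
        below : rounded * (D + D) ≤ 2 * x + D
        below = m/n*n≤m (2 * x + D) (D + D)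
        above : 2 * x + D < suc rounded * (D + D)
        above = ℕ.≤-trans (ℕ.≤-reflexive (cong suc (m≡m%n+[m/n]*n (2 * x + D) (D + D)))) (ℕ.+-monoˡ-≤ (rounded * (D + D)) (m%n<n (2 * x + D) (D + D)))

        exact : 2 * y < D → rounded ≡ h
        exact 2y<D = ℕ.≤-antisym (ℕ.≤-pred (ℕ.*-cancelʳ-< (D + D) rounded (suc h) (begin-strict
            rounded * (D + D)       ≤⟨ below ⟩
            2 * x + D               ≤⟨ ℕ.+-monoˡ-≤ D (ℕ.*-monoʳ-≤ 2 x≤) ⟩
            2 * (D * h + y) + D     ≡⟨ l₁ D h y ⟩
            2 * y + (D + 2 * (D * h)) <⟨ ℕ.+-monoˡ-< (D + 2 * (D * h)) 2y<D ⟩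
            D + (D + 2 * (D * h))   ≡⟨ l₂ D h ⟩
            suc h * (D + D)         ∎)))
          (ℕ.≤-pred (ℕ.*-cancelʳ-< (D + D) h (suc rounded) (begin-strict
            h * (D + D)             ≡⟨ l₃ D h ⟩
            2 * (D * h)             ≤⟨ ℕ.*-monoʳ-≤ 2 ≤x ⟩
            2 * (x + y)             ≡⟨ ℕ.*-distribˡ-+ 2 x y ⟩
            2 * x + 2 * y           <⟨ ℕ.+-monoʳ-< (2 * x) 2y<D ⟩
            2 * x + D               <⟨ above ⟩
            suc rounded * (D + D)   ∎)))
          where
          open ℕ.≤-Reasoning
          l₁ : ∀ D h y → 2 * (D * h + y) + D ≡ 2 * y + (D + 2 * (D * h))
          l₁ = solve-∀
          l₂ : ∀ D h → D + (D + 2 * (D * h)) ≡ suc h * (D + D)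
          l₂ = solve-∀
          l₃ : ∀ D h → h * (D + D) ≡ 2 * (D * h)
          l₃ = solve-∀

      rounded-upper : de * rounded ≤ de * h + nu * h
      rounded-upper = [ (λ 2y<D → ℕ.≤-trans (ℕ.≤-reflexive (cong (de *_) (exact 2y<D))) (ℕ.m≤m+n (de * h) (nu * h))) , relative ]′ exactly-or-relatively
        where
        open ℕ.≤-Reasoning
        l₁ : ∀ d D h y → d * (2 * (D * h + y) + 2 * y) ≡ d * h * (D + D) + 2 * (2 * d * y)
        l₁ = solve-∀
        l₂ : ∀ d D h n → d * h * (D + D) + 2 * (n * h * D) ≡ (d * h + n * h) * (D + D)
        l₂ = solve-∀
        relative : D ≤ 2 * y × 2 * de * y ≤ nu * h * D → de * rounded ≤ de * h + nu * h
        relative (D≤2y , le) = ℕ.*-cancelʳ-≤ _ _ (D + D) (begin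
          de * rounded * (D + D)               ≡⟨ ℕ.*-assoc de rounded (D + D) ⟩
          de * (rounded * (D + D))             ≤⟨ ℕ.*-monoʳ-≤ de (ℕ.≤-trans below (ℕ.+-mono-≤ (ℕ.*-monoʳ-≤ 2 x≤) D≤2y)) ⟩
          de * (2 * (D * h + y) + 2 * y)       ≡⟨ l₁ de D h y ⟩
          de * h * (D + D) + 2 * (2 * de * y)  ≤⟨ ℕ.+-monoʳ-≤ (de * h * (D + D)) (ℕ.*-monoʳ-≤ 2 le) ⟩
          de * h * (D + D) + 2 * (nu * h * D)  ≡⟨ l₂ de D h nu ⟩
          (de * h + nu * h) * (D + D)          ∎)

      rounded-lower : de * h ≤ de * rounded + nu * h
      rounded-lower = [ (λ 2y<D → ℕ.≤-trans (ℕ.≤-reflexive (cong (de *_) (sym (exact 2y<D)))) (ℕ.m≤m+n (de * rounded) (nu * h))) , relative ]′ exactly-or-relatively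
        where
        open ℕ.≤-Reasoning
        l₁ : ∀ d D h → d * D + d * h * (D + D) ≡ d * (2 * (D * h) + D)
        l₁ = solve-∀
        l₂ : ∀ d x y D → d * (2 * (x + y) + D) ≡ d * (2 * x + D) + 2 * d * y
        l₂ = solve-∀
        l₃ : ∀ d r D n h → d * (suc r * (D + D)) + n * h * D ≡ d * D + (d * r * (D + D) + d * D + n * h * D)
        l₃ = solve-∀
        l₄ : ∀ d y → d * (2 * y) ≡ 2 * d * y
        l₄ = solve-∀
        l₅ : ∀ d r D n h → d * r * (D + D) + n * h * D + n * h * D ≡ (d * r + n * h) * (D + D)
        l₅ = solve-∀
        relative : D ≤ 2 * y × 2 * de * y ≤ nu * h * D → de * h ≤ de * rounded + nu * h
        relative (D≤2y , le) = ℕ.*-cancelʳ-≤ _ _ (D + D) (ℕ.+-cancelˡ-≤ (de * D) _ _ (begin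
          de * D + de * h * (D + D)                       ≡⟨ l₁ de D h ⟩
          de * (2 * (D * h) + D)                          ≤⟨ ℕ.*-monoʳ-≤ de (ℕ.+-monoˡ-≤ D (ℕ.*-monoʳ-≤ 2 ≤x)) ⟩
          de * (2 * (x + y) + D)                          ≡⟨ l₂ de x y D ⟩
          de * (2 * x + D) + 2 * de * y                   ≤⟨ ℕ.+-mono-≤ (ℕ.*-monoʳ-≤ de (ℕ.<⇒≤ above)) le ⟩
          de * (suc rounded * (D + D)) + nu * h * D       ≡⟨ l₃ de rounded D nu h ⟩
          de * D + (de * rounded * (D + D) + de * D + nu * h * D) ≤⟨ ℕ.+-monoʳ-≤ (de * D) (ℕ.+-monoˡ-≤ (nu * h * D) (ℕ.+-monoʳ-≤ (de * rounded * (D + D)) (ℕ.≤-trans (ℕ.*-monoʳ-≤ de D≤2y) (ℕ.≤-trans (ℕ.≤-reflexive (l₄ de y)) le)))) ⟩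
          de * D + (de * rounded * (D + D) + nu * h * D + nu * h * D)  ≡⟨ cong (de * D +_) (l₅ de rounded D nu h) ⟩
          de * D + (de * rounded + nu * h) * (D + D)      ∎))

      numerator≤ : 2 * x + D ≤ 4 * (D * h)
      numerator≤ = begin
        2 * x + D                       ≤⟨ ℕ.+-mono-≤ (ℕ.*-monoʳ-≤ 2 x≤) (ℕ.m≤m*n D h {{ℕ.>-nonZero 1≤h}}) ⟩
        2 * (D * h + y) + D * h         ≡⟨ l₁ (D * h) y ⟩
        3 * (D * h) + 2 * y             ≤⟨ ℕ.+-monoʳ-≤ (3 * (D * h)) 2y≤Dh ⟩
        3 * (D * h) + D * h             ≡⟨ l₂ (D * h) ⟩
        4 * (D * h)                     ∎
        where
        open ℕ.≤-Reasoning
        l₁ : ∀ a y → 2 * (a + y) + a ≡ 3 * a + 2 * y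
        l₁ = solve-∀
        l₂ : ∀ a → 3 * a + a ≡ 4 * a
        l₂ = solve-∀

    nonnegative : ∀ p (z : ℤ) → 1 ≤ p → y ≡ ℤ.∣ ℤ.+ p *ᶻ z +ᶻ - (ℤ.+ (D * h)) ∣ → ∃[ B ] z ≡ ℤ.+ B × p * B ≤ D * h + y × D * h ≤ p * B + y
    nonnegative p (ℤ.+ B) 1≤p refl = B , refl
      , subst (λ i → p * B ≤ D * h + ℤ.∣ i +ᶻ - (ℤ.+ (D * h)) ∣) (ℤ.pos-* p B) (proj₁ (∣-∣-split (p * B) (D * h)))
      , subst (λ i → D * h ≤ p * B + ℤ.∣ i +ᶻ - (ℤ.+ (D * h)) ∣) (ℤ.pos-* p B) (proj₂ (∣-∣-split (p * B) (D * h)))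
    nonnegative p (ℤ.-[1+ m ]) 1≤p y≡ = contradiction 2y≤Dh (ℕ.<⇒≱ (begin-strict
      D * h                         <⟨ ℕ.m<m+n (D * h) (ℕ.*-mono-≤ 1≤p (s≤s z≤n)) ⟩
      D * h + p * suc m             ≡⟨ ℕ.+-comm (D * h) (p * suc m) ⟩
      p * suc m + D * h             ≡⟨ trans y≡ (trans (cong (λ i → ℤ.∣ i +ᶻ - (ℤ.+ (D * h)) ∣) (trans (sym (ℤ.neg-distribʳ-* (ℤ.+ p) (ℤ.+ suc m))) (cong -_ (sym (ℤ.pos-* p (suc m)))))) (∣-n-m∣ (p * suc m) (D * h))) ⟨
      y                             ≤⟨ ℕ.m≤m+n y _ ⟩
      2 * y                         ∎))
      where open ℕ.≤-Reasoning

  fraction : ℕ → (d : ℕ) .{{_ : NonZero d}} → ℚᵘ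
  fraction x d = mkℚᵘ (ℤ.+ x) (ℕ.pred d)

  /-fraction : ∀ x d .{{_ : NonZero d}} → ℤ.+ x ℚ./ d ≡ fromℚᵘ (fraction x d)
  /-fraction x (suc d) = refl

  fraction-≤ : ∀ {x d x′ d′} .{{_ : NonZero d}} .{{_ : NonZero d′}} → x * d′ ≤ x′ * d → fraction x d ℚᵘ.≤ fraction x′ d′
  fraction-≤ {x} {d} {x′} {d′} le = *≤* (subst₂ ℤ._≤_
    (trans (ℤ.pos-* x d′) (cong (λ z → ℤ.+ x *ᶻ ℤ.+ z) (sym (ℕ.suc-pred d′)))) (trans (ℤ.pos-* x′ d) (cong (λ z → ℤ.+ x′ *ᶻ ℤ.+ z) (sym (ℕ.suc-pred d)))) (ℤ.+≤+ le))

  fraction-≤⁻ : ∀ {x d x′ d′} .{{_ : NonZero d}} .{{_ : NonZero d′}} → fraction x d ℚᵘ.≤ fraction x′ d′ → x * d′ ≤ x′ * d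
  fraction-≤⁻ {x} {d} {x′} {d′} (*≤* le) = ℤ.drop‿+≤+ (subst₂ ℤ._≤_
    (trans (cong (λ z → ℤ.+ x *ᶻ ℤ.+ z) (ℕ.suc-pred d′)) (sym (ℤ.pos-* x d′))) (trans (cong (λ z → ℤ.+ x′ *ᶻ ℤ.+ z) (ℕ.suc-pred d)) (sym (ℤ.pos-* x′ d))) le)

  fraction-* : ∀ x d x′ d′ .{{_ : NonZero d}} .{{_ : NonZero d′}} → fraction x d ℚᵘ.* fraction x′ d′ ℚᵘ.≃ fraction (x * x′) (d * d′) {{ℕ.m*n≢0 d d′}}
  fraction-* x (suc d) x′ (suc d′) = *≡* (cong (_*ᶻ ℤ.+ (suc d * suc d′)) (sym (ℤ.pos-* x x′)))

  cost-fraction : ∀ {t n} nu de .(cop : Coprime (suc nu) (suc de)) (H : Hypergraph t) (G : Hypergraph n) .{{_ : NonZero (# H G)}} →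
    cost (mkℚ (ℤ.+ suc nu) de cop) H G ≡ fromℚᵘ (fraction (suc de * suc de * size G ^ size H) (suc nu * suc nu * # H G ^ 2) {{ℕ.m*n≢0 (suc nu * suc nu) (# H G ^ 2) {{_}} {{ℕ.m^n≢0 (# H G) 2}}}})
  cost-fraction nu de cop H G = begin
    1/ε ℚ.* 1/ε ℚ.* (ℤ.+ (size G ^ size H) ℚ./ (# H G ^ 2))                              ≡⟨ cong₂ (λ a b → a ℚ.* a ℚ.* b) (sym (ℚ.fromℚᵘ-toℚᵘ 1/ε)) (/-fraction (size G ^ size H) (# H G ^ 2)) ⟩
    fromℚᵘ u ℚ.* fromℚᵘ u ℚ.* fromℚᵘ v                                                   ≡⟨ cong (ℚ._* fromℚᵘ v) (fromℚᵘ-* u u) ⟨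
    fromℚᵘ (u ℚᵘ.* u) ℚ.* fromℚᵘ v                                                       ≡⟨ fromℚᵘ-* (u ℚᵘ.* u) v ⟨
    fromℚᵘ (u ℚᵘ.* u ℚᵘ.* v)                                                             ≡⟨ ℚ.fromℚᵘ-cong (ℚᵘ.≃-trans (ℚᵘ.*-cong (fraction-* (suc de) (suc nu) (suc de) (suc nu)) (ℚᵘ.≃-refl {v})) (fraction-* (suc de * suc de) (suc nu * suc nu) (size G ^ size H) (# H G ^ 2))) ⟩
    fromℚᵘ (fraction (suc de * suc de * size G ^ size H) (suc nu * suc nu * # H G ^ 2) {{ℕ.m*n≢0 (suc nu * suc nu) (# H G ^ 2)}})   ∎
    where
    open ≡-Reasoning
    instance
      #²≢0 : NonZero (# H G ^ 2)
      #²≢0 = ℕ.m^n≢0 (# H G) 2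
    1/ε = ℚ.1/ (mkℚ (ℤ.+ suc nu) de cop)
    u = fraction (suc de) (suc nu)
    v = fraction (size G ^ size H) (# H G ^ 2)

  scaled-≤ : ∀ {x C P d} .{{_ : NonZero d}} → x * d ≤ C * P → fromℕ x ℚ.≤ fromℕ C ℚ.* fromℚᵘ (fraction P d)
  scaled-≤ {x} {C} {P} {d} le = ℚ.≤-trans (fromℚᵘ-mono {integer x} {fraction (C * P) (1 * d) {{ℕ.m*n≢0 1 d}}} (fraction-≤ {x} {1} {{_}} {{ℕ.m*n≢0 1 d}} (ℕ.≤-trans (ℕ.≤-reflexive (cong (x *_) (ℕ.*-identityˡ d))) (ℕ.≤-trans le (ℕ.≤-reflexive (sym (ℕ.*-identityʳ (C * P))))))))
    (ℚ.≤-reflexive (trans (sym (ℚ.fromℚᵘ-cong (fraction-* C 1 P d))) (fromℚᵘ-* (integer C) (fraction P d))))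

  approximates : ∀ nu de .(cop : Coprime (suc nu) (suc de)) h R → suc de * R ≤ suc de * h + suc nu * h → suc de * h ≤ suc de * R + suc nu * h →
    Approximates (mkℚ (ℤ.+ suc nu) de cop) h (fromℕ R)
  approximates nu de cop h R upper lower = low , high
    where
    ε = mkℚ (ℤ.+ suc nu) de cop
    εh : ε ℚ.* fromℕ h ≡ fromℚᵘ (fraction (suc nu * h) (suc de * 1))
    εh = trans (cong (ℚ._* fromℕ h) (sym (ℚ.fromℚᵘ-toℚᵘ ε))) (trans (sym (fromℚᵘ-* (fraction (suc nu) (suc de)) (integer h))) (ℚ.fromℚᵘ-cong (fraction-* (suc nu) (suc de) h 1)))
    sum : ∀ a → fromℕ a ℚ.+ ε ℚ.* fromℕ h ≡ fromℚᵘ (fraction (suc de * a + suc nu * h) (suc de))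
    sum a = trans (cong (fromℕ a ℚ.+_) εh) (trans (sym (fromℚᵘ-+ (integer a) (fraction (suc nu * h) (suc de * 1)))) (ℚ.fromℚᵘ-cong {integer a ℚᵘ.+ fraction (suc nu * h) (suc de * 1)} {fraction (suc de * a + suc nu * h) (suc de)} (*≡* (begin
      (ℤ.+ a *ᶻ ℤ.+ (suc de * 1) +ᶻ ℤ.+ (suc nu * h) *ᶻ ℤ.+ 1) *ᶻ ℤ.+ suc de      ≡⟨ cong (_*ᶻ ℤ.+ suc de) (trans (cong₂ _+ᶻ_ (sym (ℤ.pos-* a (suc de * 1))) (sym (ℤ.pos-* (suc nu * h) 1))) (sym (ℤ.pos-+ (a * (suc de * 1)) (suc nu * h * 1)))) ⟩
      ℤ.+ (a * (suc de * 1) + suc nu * h * 1) *ᶻ ℤ.+ suc de                       ≡⟨ ℤ.pos-* (a * (suc de * 1) + suc nu * h * 1) (suc de) ⟨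
      ℤ.+ ((a * (suc de * 1) + suc nu * h * 1) * suc de)                          ≡⟨ cong ℤ.+_ (l a (suc de) (suc nu * h)) ⟩
      ℤ.+ ((suc de * a + suc nu * h) * (1 * (suc de * 1)))                        ≡⟨ ℤ.pos-* (suc de * a + suc nu * h) (1 * (suc de * 1)) ⟩
      ℤ.+ (suc de * a + suc nu * h) *ᶻ ℤ.+ (1 * (suc de * 1))                     ∎))))
      where
      open ≡-Reasoning
      l : ∀ a d n → (a * (d * 1) + n * 1) * d ≡ (d * a + n) * (1 * (d * 1))
      l = solve-∀
    high : fromℕ R ℚ.≤ (1ℚ ℚ.+ ε) ℚ.* fromℕ h
    high = begin
      fromℕ R                                                ≤⟨ fromℚᵘ-mono {integer R} {fraction (suc de * h + suc nu * h) (suc de)} (fraction-≤ {R} {1} {suc de * h + suc nu * h} {suc de} (ℕ.≤-trans (ℕ.≤-reflexive (ℕ.*-comm R (suc de))) (ℕ.≤-trans upper (ℕ.≤-reflexive (sym (ℕ.*-identityʳ _)))))) ⟩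
      fromℚᵘ (fraction (suc de * h + suc nu * h) (suc de))   ≡⟨ sum h ⟨
      fromℕ h ℚ.+ ε ℚ.* fromℕ h                              ≡⟨ cong (ℚ._+ ε ℚ.* fromℕ h) (ℚ.*-identityˡ (fromℕ h)) ⟨
      1ℚ ℚ.* fromℕ h ℚ.+ ε ℚ.* fromℕ h                       ≡⟨ ℚ.*-distribʳ-+ (fromℕ h) 1ℚ ε ⟨
      (1ℚ ℚ.+ ε) ℚ.* fromℕ h                                 ∎
      where open ℚ.≤-Reasoning
    h≤ : fromℕ h ℚ.≤ fromℕ R ℚ.+ ε ℚ.* fromℕ h
    h≤ = ℚ.≤-trans (fromℚᵘ-mono {integer h} {fraction (suc de * R + suc nu * h) (suc de)} (fraction-≤ {h} {1} {suc de * R + suc nu * h} {suc de} (ℕ.≤-trans (ℕ.≤-reflexive (ℕ.*-comm h (suc de))) (ℕ.≤-trans lower (ℕ.≤-reflexive (sym (ℕ.*-identityʳ _))))))) (ℚ.≤-reflexive (sym (sum R)))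
    low : (1ℚ ℚ.- ε) ℚ.* fromℕ h ℚ.≤ fromℕ R
    low = begin
      (1ℚ ℚ.- ε) ℚ.* fromℕ h                                 ≡⟨ ℚ.*-distribʳ-+ (fromℕ h) 1ℚ (ℚ.- ε) ⟩
      1ℚ ℚ.* fromℕ h ℚ.+ (ℚ.- ε) ℚ.* fromℕ h                 ≡⟨ cong₂ ℚ._+_ (ℚ.*-identityˡ (fromℕ h)) (sym (ℚ.neg-distribˡ-* ε (fromℕ h))) ⟩
      fromℕ h ℚ.+ ℚ.- (ε ℚ.* fromℕ h)                        ≤⟨ ℚ.+-monoˡ-≤ (ℚ.- (ε ℚ.* fromℕ h)) h≤ ⟩
      (fromℕ R ℚ.+ ε ℚ.* fromℕ h) ℚ.+ ℚ.- (ε ℚ.* fromℕ h)    ≡⟨ ℚ.+-assoc (fromℕ R) (ε ℚ.* fromℕ h) (ℚ.- (ε ℚ.* fromℕ h)) ⟩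
      fromℕ R ℚ.+ (ε ℚ.* fromℕ h ℚ.+ ℚ.- (ε ℚ.* fromℕ h))    ≡⟨ cong (fromℕ R ℚ.+_) (ℚ.+-inverseʳ (ε ℚ.* fromℕ h)) ⟩
      fromℕ R ℚ.+ ℚ.0ℚ                                       ≡⟨ ℚ.+-identityʳ (fromℕ R) ⟩
      fromℕ R                                                ∎
      where open ℚ.≤-Reasoning

module Degrees where

  open Big
  open Codes
  open Graph
  open import Defs
  open import Data.Fin.Base as Fin using (Fin; zero; suc)
  import Data.Fin.Properties as Fin
  open import Data.Fin.Subset using (Subset; _∈_; ⊤; inside)
  open import Data.Fin.Subset.Properties using (_∈?_; ⊆-antisym)
  open import Data.List.Base using (List; []; _∷_; length; filter; allFin)
  import Data.List.Membership.Propositional as L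
  open import Data.List.Membership.Propositional.Properties
  open import Data.List.Relation.Unary.All using ([]; _∷_)
  open import Data.List.Relation.Unary.AllPairs using (_∷_)
  open import Data.List.Relation.Unary.Any using (here; there)
  open import Data.List.Relation.Unary.Unique.Propositional using (Unique)
  import Data.List.Relation.Unary.Unique.Propositional.Properties as Unique
  open import Data.Nat.Base as ℕ using (ℕ; suc; _⊓_; _≤_; z≤n; s≤s; NonZero)
  import Data.Nat.Properties as ℕ
  open import Data.Product.Base using (∃-syntax; _×_; _,_; proj₂)
  open import Data.Vec.Base as Vec using (Vec; []; _∷_; lookup; tabulate; foldr₁)
  import Data.Vec.Properties as Vec
  open import Relation.Binary.PropositionalEquality
  open import Relation.Nullary.Decidable using (yes; no)
  open import Relation.Nullary.Negation using (contradiction)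

  private variable
    A : Set

  foldr₁-⊓≤ : ∀ {n} (xs : Vec ℕ (suc n)) i → foldr₁ _⊓_ xs ≤ lookup xs i
  foldr₁-⊓≤ (x ∷ [])     zero    = ℕ.≤-refl
  foldr₁-⊓≤ (x ∷ y ∷ xs) zero    = ℕ.m⊓n≤m x _
  foldr₁-⊓≤ (x ∷ y ∷ xs) (suc i) = ℕ.≤-trans (ℕ.m⊓n≤n x _) (foldr₁-⊓≤ (y ∷ xs) i)

  minDegree≤degree : ∀ {t} (H : Hypergraph (suc t)) u → minDegree H ≤ degree H u
  minDegree≤degree H u = ℕ.≤-trans (foldr₁-⊓≤ (tabulate (degree H)) u) (ℕ.≤-reflexive (Vec.lookup∘tabulate (degree H) u))

  another : ∀ {n} (x : Subset n) {ys} → Unique ys → 2 ≤ length ys → ∃[ y ] y L.∈ ys × x ≢ y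
  another x {y ∷ z ∷ ys} ((y≢z ∷ _) ∷ _) _ with x ≟ₛ y
  ... | no x≢y   = y , here refl , x≢y
  ... | yes refl = z , there (here refl) , y≢z
  another x {_ ∷ []} _ (s≤s ())

  1≤length : ∀ {x : A} {xs} → x L.∈ xs → 1 ≤ length xs
  1≤length (here _)  = s≤s z≤n
  1≤length (there _) = s≤s z≤n

  member : ∀ (xs : List A) .{{_ : NonZero (length xs)}} → ∃[ x ] x L.∈ xs
  member (x ∷ _) = x , here refl

  module _ {t} (H : Hypergraph (suc t)) (2≤ : 2 ≤ minDegree H) where

    another-edge : ∀ u D → ∃[ j ] u ∈ edgeOf H j × D ≢ edgeOf H j
    another-edge u D with D′ , D′∈ , D≢ ← another D (Unique.filter⁺ (u ∈?_) (unique H)) (ℕ.≤-trans 2≤ (minDegree≤degree H u))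
                     with D′∈E , u∈ ← ∈-filter⁻ (u ∈?_) {xs = edges H} D′∈
                     with j , refl ← ∈-edge H D′∈E = j , u∈ , D≢

    everyDegree≥2 : Table.EveryDegree≥2 (edgeOf H)
    everyDegree≥2 {u} {i} _ = let j , u∈ , D≢ = another-edge u (edgeOf H i) in j , (λ i≡j → D≢ (cong (edgeOf H) i≡j)) , u∈

    everyDegree≥1 : ∀ u → ∃[ i ] u ∈ edgeOf H i
    everyDegree≥1 u = let j , u∈ , _ = another-edge u ⊤ in j , u∈

  several-vertices : ∀ {t} (H : Hypergraph (suc t)) → 2 ≤ minDegree H → 1 ≤ t
  several-vertices {suc t} H 2≤ = s≤s z≤n
  several-vertices {0}     H 2≤ with i , 0∈ , i≢ ← another-edge H 2≤ zero ⊤ = contradiction (full 0∈) i≢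
    where
    full : ∀ {D : Subset 1} → zero ∈ D → ⊤ ≡ D
    full {inside ∷ []} _ = refl

  1≤automorphisms : ∀ {t} (H : Hypergraph t) → 1 ≤ automorphisms H
  1≤automorphisms {t} H = 1≤length (∈-filter⁺ (isIso? H ⊤ (edges H)) (∈-vecs ι) iso)
    where
    ι = Vec.allFin t
    ∈-vecs : ∀ {N} (v : Vec (Fin t) N) → v L.∈ vecs (allFin t) N
    ∈-vecs []      = here refl
    ∈-vecs (x ∷ v) = ∈-cartesianProductWith⁺ _∷_ (∈-allFin x) (∈-vecs v)
    image-ι : ∀ D → image ι D ≡ D
    image-ι D = ⊆-antisym (λ v∈ → let u , u∈ , e = ∈-image⁻ ι v∈ in subst (_∈ D) (trans (sym (Vec.lookup-allFin u)) e) u∈)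
                          (λ {u} u∈ → subst (_∈ image ι D) (Vec.lookup-allFin u) (∈-image⁺ ι u∈))
    iso : IsIso H ⊤ (edges H) ι
    iso = (λ u v e → trans (sym (Vec.lookup-allFin u)) (trans e (Vec.lookup-allFin v))) , image-ι ⊤ ,
          λ D → subst (_∈ᴱ edges H) (sym (image-ι D)) , subst (_∈ᴱ edges H) (image-ι D)

  vertices≤ : ∀ {t n} (H : Hypergraph t) (G : Hypergraph n) .{{_ : NonZero (# H G)}} → t ≤ n
  vertices≤ {n = n} H G with UF , UF∈ ← member (filter (isOccurrence? H) (candidates H G))
                        with _ , φ , inj , _ ← proj₂ (∈-filter⁻ (isOccurrence? H) {xs = candidates H G} UF∈) = Fin.injective⇒≤ {f = lookup φ} (λ {u} {v} → inj u v)

module Sizing where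

  open import Data.Nat.Base as ℕ using (ℕ; zero; suc; _+_; _*_; _∸_; _^_; _⊓_; _≤_; _<_; z≤n; s≤s; NonZero)
  open import Data.Nat.DivMod
  open import Data.Nat.Logarithm using (⌊log₂_⌋; ⌊log₂⌋-mono-≤; ⌊log₂[2^n]⌋≡n)
  import Data.Nat.Properties as ℕ
  open import Data.Nat.Tactic.RingSolver using (solve-∀)
  open import Data.Sum.Base using (_⊎_; inj₁; inj₂)
  open import Relation.Binary.PropositionalEquality
  open import Relation.Nullary.Decidable using (yes; no)
  open import Relation.Nullary.Negation using (contradiction)

  ^-distribʳ-* : ∀ k a b → (a * b) ^ k ≡ a ^ k * b ^ k
  ^-distribʳ-* zero    a b = refl
  ^-distribʳ-* (suc k) a b = trans (cong (a * b *_) (^-distribʳ-* k a b)) (l a b (a ^ k) (b ^ k))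
    where
    l : ∀ a b x y → a * b * (x * y) ≡ a * x * (b * y)
    l = solve-∀

  n<2^n : ∀ n → n < 2 ^ n
  n<2^n zero    = s≤s z≤n
  n<2^n (suc n) = ℕ.≤-trans (ℕ.+-mono-≤ (ℕ.m^n>0 2 n) (n<2^n n)) (ℕ.≤-reflexive (cong (2 ^ n +_) (sym (ℕ.+-identityʳ (2 ^ n)))))

  n<2^[1+log₂n] : ∀ n → n < 2 ^ suc ⌊log₂ n ⌋
  n<2^[1+log₂n] n with n ℕ.<? 2 ^ suc ⌊log₂ n ⌋
  ... | yes lt = lt
  ... | no ≮   = contradiction (ℕ.≤-trans (ℕ.≤-reflexive (sym (⌊log₂[2^n]⌋≡n (suc ⌊log₂ n ⌋)))) (⌊log₂⌋-mono-≤ (ℕ.≮⇒≥ ≮))) (ℕ.<-irrefl refl)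

  m≤m² : ∀ m → m ≤ m * m
  m≤m² zero        = z≤n
  m≤m² m@(suc _) = ℕ.m≤m*n m m

  -- The parameters of the sketch: R registers, K + k words per copy, the mean δ of
  -- a copy per occurrence and its second moment W₀ μ ^ k.
  module Sized (h k R K W₀ δ c₁ : ℕ) (1≤W₀ : 1 ≤ W₀) where

    constants : ℕ
    constants = R + 12 * W₀ * (K + k) + 48 * (W₀ * W₀) + 24 * (W₀ * δ) + c₁ + δ

    wordFactor′ : ℕ
    wordFactor′ = (2 + h + k + 2 * K) + (constants + 4 * (h * k))

    module Words (n : ℕ) (2≤n : 2 ≤ n) where

      private
        λ₂ = ⌊log₂ n ⌋
      ℓ = 2 * λ₂
      w = wordFactor′ * λ₂
      M = (suc n ^ h) ^ k
      cap = 12 * W₀ * M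
      e = w ∸ suc (h + k + ℓ * K)

      1≤λ : 1 ≤ λ₂
      1≤λ = ⌊log₂⌋-mono-≤ 2≤n

      suc-n≤2^ℓ : suc n ≤ 2 ^ ℓ
      suc-n≤2^ℓ = ℕ.≤-trans (n<2^[1+log₂n] n) (ℕ.^-monoʳ-≤ 2 (ℕ.≤-trans (ℕ.+-monoˡ-≤ λ₂ 1≤λ) (ℕ.≤-reflexive (cong (λ₂ +_) (sym (ℕ.+-identityʳ λ₂))))))

      scale : ∀ a → a ≤ a * λ₂
      scale a = ℕ.m≤m*n a λ₂ {{ℕ.>-nonZero 1≤λ}}

      private
        room : suc (suc (h + k + ℓ * K)) ≤ w
        room = begin
          suc (suc (h + k + ℓ * K))                     ≡⟨ l₁ h k λ₂ K ⟩
          (2 + h + k) + 2 * K * λ₂                      ≤⟨ ℕ.+-monoˡ-≤ (2 * K * λ₂) (scale (2 + h + k)) ⟩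
          (2 + h + k) * λ₂ + 2 * K * λ₂                 ≡⟨ ℕ.*-distribʳ-+ λ₂ (2 + h + k) (2 * K) ⟨
          (2 + h + k + 2 * K) * λ₂                      ≤⟨ ℕ.*-monoˡ-≤ λ₂ (ℕ.m≤m+n (2 + h + k + 2 * K) (constants + 4 * (h * k))) ⟩
          w                                             ∎
          where
          open ℕ.≤-Reasoning
          l₁ : ∀ h k l K → suc (suc (h + k + 2 * l * K)) ≡ (2 + h + k) + 2 * K * l
          l₁ = solve-∀

      w≡ : w ≡ suc (h + k + (e + ℓ * K))
      w≡ = trans (sym (ℕ.m∸n+n≡m (ℕ.<⇒≤ room))) (l e (h + k) (ℓ * K))
        where
        l : ∀ e a b → e + suc (a + b) ≡ suc (a + (e + b))
        l = solve-∀

      1≤e : 1 ≤ e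
      1≤e = ℕ.m<n⇒0<n∸m room

      n<N : n < 2 ^ w
      n<N = ℕ.≤-trans suc-n≤2^ℓ (ℕ.^-monoʳ-≤ 2 (ℕ.*-monoˡ-≤ λ₂ {2} {wordFactor′} (s≤s (s≤s z≤n))))

      M≤ : M ≤ 2 ^ (2 * (h * k) * λ₂)
      M≤ = begin
        (suc n ^ h) ^ k              ≡⟨ ℕ.^-*-assoc (suc n) h k ⟩
        suc n ^ (h * k)              ≤⟨ ℕ.^-monoˡ-≤ (h * k) suc-n≤2^ℓ ⟩
        (2 ^ ℓ) ^ (h * k)            ≡⟨ ℕ.^-*-assoc 2 ℓ (h * k) ⟩
        2 ^ (ℓ * (h * k))            ≡⟨ cong (2 ^_) (l λ₂ (h * k)) ⟩
        2 ^ (2 * (h * k) * λ₂)       ∎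
        where
        open ℕ.≤-Reasoning
        l : ∀ l a → 2 * l * a ≡ 2 * a * l
        l = solve-∀

      1≤M : 1 ≤ M
      1≤M = ℕ.m^n>0 (suc n ^ h) {{ℕ.m^n≢0 (suc n) h}} k

      fits : ∀ {c x} → x ≤ c * (M * M) → c ≤ constants → x < 2 ^ w
      fits {c} {x} x≤ c≤ = begin-strict
        x                                                                     ≤⟨ x≤ ⟩
        c * (M * M)                                                           <⟨ ℕ.*-monoˡ-< (M * M) {{ℕ.>-nonZero (ℕ.*-mono-≤ 1≤M 1≤M)}} (n<2^n c) ⟩
        2 ^ c * (M * M)                                                       ≤⟨ ℕ.*-mono-≤ (ℕ.^-monoʳ-≤ 2 (ℕ.≤-trans c≤ (scale constants))) (ℕ.*-mono-≤ M≤ M≤) ⟩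
        2 ^ (constants * λ₂) * (2 ^ (2 * (h * k) * λ₂) * 2 ^ (2 * (h * k) * λ₂))  ≡⟨ cong (2 ^ (constants * λ₂) *_) (ℕ.^-distribˡ-+-* 2 (2 * (h * k) * λ₂) (2 * (h * k) * λ₂)) ⟨
        2 ^ (constants * λ₂) * 2 ^ (2 * (h * k) * λ₂ + 2 * (h * k) * λ₂)      ≡⟨ ℕ.^-distribˡ-+-* 2 (constants * λ₂) _ ⟨
        2 ^ (constants * λ₂ + (2 * (h * k) * λ₂ + 2 * (h * k) * λ₂))          ≤⟨ ℕ.^-monoʳ-≤ 2 (ℕ.≤-trans (ℕ.≤-reflexive (l constants (h * k) λ₂)) (ℕ.*-monoˡ-≤ λ₂ (ℕ.m≤n+m (constants + 4 * (h * k)) (2 + h + k + 2 * K)))) ⟩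
        2 ^ w                                                                 ∎
        where
        open ℕ.≤-Reasoning
        l : ∀ c a l → c * l + (2 * a * l + 2 * a * l) ≡ (c + 4 * a) * l
        l = solve-∀

      private
        linear : ∀ a → a ≤ a * (M * M)
        linear a = ℕ.m≤m*n a (M * M) {{ℕ.>-nonZero (ℕ.*-mono-≤ 1≤M 1≤M)}}

        a₁ = R + 12 * W₀ * (K + k)
        a₂ = a₁ + 48 * (W₀ * W₀)
        a₃ = a₂ + 24 * (W₀ * δ)
        a₃≤ : a₃ ≤ constants
        a₃≤ = ℕ.≤-trans (ℕ.m≤m+n a₃ c₁) (ℕ.m≤m+n (a₃ + c₁) δ)

      c₁<N : c₁ < 2 ^ w
      c₁<N = fits (linear c₁) (ℕ.≤-trans (ℕ.m≤n+m c₁ a₃) (ℕ.m≤m+n (a₃ + c₁) δ))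

      δ<N : δ < 2 ^ w
      δ<N = fits (linear δ) (ℕ.m≤n+m δ (a₃ + c₁))

      module _ {s} (s≤cap : s ≤ cap) where

        memory<N : R + s * (K + k) < 2 ^ w
        memory<N = fits {a₁} (begin
          R + s * (K + k)                                    ≤⟨ ℕ.+-mono-≤ (linear R) (ℕ.*-monoˡ-≤ (K + k) s≤cap) ⟩
          R * (M * M) + 12 * W₀ * M * (K + k)                ≤⟨ ℕ.+-monoʳ-≤ (R * (M * M)) (ℕ.*-monoˡ-≤ (K + k) (ℕ.*-monoʳ-≤ (12 * W₀) (m≤m² M))) ⟩
          R * (M * M) + 12 * W₀ * (M * M) * (K + k)          ≡⟨ l R W₀ (M * M) (K + k) ⟩
          a₁ * (M * M)                                       ∎) (ℕ.≤-trans (ℕ.m≤m+n a₁ _) (ℕ.≤-trans (ℕ.m≤m+n a₂ _) a₃≤))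
          where
          open ℕ.≤-Reasoning
          l : ∀ R W M b → R * M + 12 * W * M * b ≡ (R + 12 * W * b) * M
          l = solve-∀

        numerator<N : ∀ {c} → c ≤ W₀ * M → 4 * (s * c) < 2 ^ w
        numerator<N {c} c≤ = fits {48 * (W₀ * W₀)} (ℕ.≤-trans (ℕ.*-monoʳ-≤ 4 (ℕ.*-mono-≤ s≤cap c≤)) (ℕ.≤-reflexive (l W₀ M)))
          (ℕ.≤-trans (ℕ.m≤n+m (48 * (W₀ * W₀)) a₁) (ℕ.≤-trans (ℕ.m≤m+n a₂ _) a₃≤))
          where
          l : ∀ W M → 4 * (12 * W * M * (W * M)) ≡ 48 * (W * W) * (M * M)
          l = solve-∀

        denominator<N : s * δ + s * δ < 2 ^ w
        denominator<N = fits {24 * (W₀ * δ)} (begin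
          s * δ + s * δ                     ≤⟨ ℕ.+-mono-≤ (ℕ.*-monoˡ-≤ δ s≤cap) (ℕ.*-monoˡ-≤ δ s≤cap) ⟩
          cap * δ + cap * δ                 ≡⟨ l W₀ M δ ⟩
          24 * (W₀ * δ) * M                 ≤⟨ ℕ.*-monoʳ-≤ (24 * (W₀ * δ)) (m≤m² M) ⟩
          24 * (W₀ * δ) * (M * M)           ∎) (ℕ.≤-trans (ℕ.m≤n+m (24 * (W₀ * δ)) a₂) a₃≤)
          where
          open ℕ.≤-Reasoning
          l : ∀ W M d → 12 * W * M * d + 12 * W * M * d ≡ 24 * (W * d) * M
          l = solve-∀

      -- The number of copies: proportional to the cost P / d, but never more than
      -- what the trivial bound M on m ^ k calls for.
      module Copies (P d : ℕ) .{{_ : NonZero d}} where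

        s : ℕ
        s = cap ⊓ suc (12 * W₀ * P / d)

        s≤cap : s ≤ cap
        s≤cap = ℕ.m⊓n≤m cap _

        1≤s : 1 ≤ s
        1≤s = ℕ.⊓-glb (ℕ.*-mono-≤ (ℕ.*-mono-≤ {1} {12} (s≤s z≤n) 1≤W₀) 1≤M) (s≤s z≤n)

        enough : cap ≤ s ⊎ 12 * W₀ * P ≤ s * d
        enough with ℕ.⊓-sel cap (suc (12 * W₀ * P / d))
        ... | inj₁ s≡ = inj₁ (ℕ.≤-reflexive (sym s≡))
        ... | inj₂ s≡ = inj₂ (begin
          12 * W₀ * P                                               ≡⟨ m≡m%n+[m/n]*n (12 * W₀ * P) d ⟩
          12 * W₀ * P % d + 12 * W₀ * P / d * d                     ≤⟨ ℕ.+-monoˡ-≤ _ (ℕ.<⇒≤ (m%n<n (12 * W₀ * P) d)) ⟩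
          suc (12 * W₀ * P / d) * d                                 ≡⟨ cong (_* d) s≡ ⟨
          s * d                                                     ∎)
          where open ℕ.≤-Reasoning

        module _ (d≤ : d ≤ W₀ * P) where

          s-cost : s * d ≤ 13 * (W₀ * P)
          s-cost = begin
            s * d                                                   ≤⟨ ℕ.*-monoˡ-≤ d (ℕ.m⊓n≤n cap _) ⟩
            d + 12 * W₀ * P / d * d                                 ≤⟨ ℕ.+-mono-≤ d≤ (m/n*n≤m (12 * W₀ * P) d) ⟩
            W₀ * P + 12 * W₀ * P                                    ≡⟨ l W₀ P ⟩
            13 * (W₀ * P)                                           ∎
            where
            open ℕ.≤-Reasoning
            l : ∀ W P → W * P + 12 * W * P ≡ 13 * (W * P)
            l = solve-∀

          affine-cost : ∀ a b → (a + s * b) * d ≤ W₀ * (a + 13 * b) * P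
          affine-cost a b = begin
            (a + s * b) * d                       ≡⟨ l₁ a s b d ⟩
            a * d + b * (s * d)                   ≤⟨ ℕ.+-mono-≤ (ℕ.*-monoʳ-≤ a d≤) (ℕ.*-monoʳ-≤ b s-cost) ⟩
            a * (W₀ * P) + b * (13 * (W₀ * P))    ≡⟨ l₂ a b W₀ P ⟩
            W₀ * (a + 13 * b) * P                 ∎
            where
            open ℕ.≤-Reasoning
            l₁ : ∀ a s b d → (a + s * b) * d ≡ a * d + b * (s * d)
            l₁ = solve-∀
            l₂ : ∀ a b W P → a * (W * P) + b * (13 * (W * P)) ≡ W * (a + 13 * b) * P
            l₂ = solve-∀

        enough-for : ∀ {P′ d′} → P′ * d ≤ P * d′ → 12 * W₀ * P ≤ s * d → 12 * W₀ * P′ ≤ s * d′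
        enough-for {P′} {d′} cheaper le = ℕ.*-cancelʳ-≤ (12 * W₀ * P′) (s * d′) d (begin
          12 * W₀ * P′ * d              ≡⟨ ℕ.*-assoc (12 * W₀) P′ d ⟩
          12 * W₀ * (P′ * d)            ≤⟨ ℕ.*-monoʳ-≤ (12 * W₀) cheaper ⟩
          12 * W₀ * (P * d′)            ≡⟨ ℕ.*-assoc (12 * W₀) P d′ ⟨
          12 * W₀ * P * d′              ≤⟨ ℕ.*-monoˡ-≤ d′ le ⟩
          s * d * d′                    ≡⟨ l s d d′ ⟩
          s * d′ * d                    ∎)
          where
          open ℕ.≤-Reasoning
          l : ∀ s d d′ → s * d * d′ ≡ s * d′ * d
          l = solve-∀

module Guarantee where

  open Big
  open Hash
  open Second
  open Graph
  open Ratio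
  open Machine
  open Program
  open Phases
  open Execution
  open Analysis
  open Rounding
  open Degrees
  open Sizing
  open import Defs
  open import Data.Integer.Base as ℤ using (ℤ; -_) renaming (_+_ to _+ᶻ_; _*_ to _*ᶻ_)
  import Data.Integer.Properties as ℤ
  open import Data.List.Base using (length; upTo; allFin) renaming (_++_ to _++ˡ_)
  open import Data.Nat.Base as ℕ using (ℕ; suc; _+_; _*_; _^_; _≤_; _<_; z≤n; s≤s; NonZero)
  open import Data.Nat.Coprimality using (Coprime)
  open import Data.Nat.DivMod using (_/_)
  open import Data.Nat.Logarithm using (⌊log₂_⌋)
  import Data.Nat.Properties as ℕ
  open import Data.Nat.Tactic.RingSolver using (solve-∀)
  open import Data.Product.Base using (_,_; proj₁; proj₂)
  open import Data.Rational.Base as ℚ using (ℚ; mkℚ; fromℚᵘ)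
  import Data.Rational.Properties as ℚ
  open import Data.Sum.Base using (inj₁; inj₂; [_,_]′)
  open import Relation.Binary.PropositionalEquality

  module Guaranteed {t} (H : Hypergraph (suc t)) (2≤ : 2 ≤ minDegree H) where

    private
      h = suc t
      k = size H
      D = edgeOf H
      a = automorphisms H
      1≤deg = everyDegree≥1 H 2≤
      2≤deg = everyDegree≥2 H 2≤
      Q = 2 ^ (h + k)

    δ c₁ K R W₀ : ℕ
    δ = κⁿ D 1≤deg * a
    c₁ = 2 * Q ^ h
    K = suc ((k + k) * h + h * k + h)
    R = Sketch.R D K c₁ δ
    W₀ = Q ^ h * Q ^ h * ((suc h ^ h) ^ length (allFin k ++ˡ allFin k) * ((3 * 2 ^ (k + k)) ^ h) ^ k)

    1≤δ : 1 ≤ δ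
    1≤δ = ℕ.*-mono-≤ (1≤κⁿ D 1≤deg) (1≤automorphisms H)

    private
      1≤2^ : ∀ i → 1 ≤ 2 ^ i
      1≤2^ = ℕ.m^n>0 2
      1≤^ : ∀ {x} i → 1 ≤ x → 1 ≤ x ^ i
      1≤^ {x} i 1≤x = ℕ.m^n>0 x {{ℕ.>-nonZero 1≤x}} i

    1≤Q^h : 1 ≤ Q ^ h
    1≤Q^h = 1≤^ h (1≤2^ (h + k))

    1≤W₀ : 1 ≤ W₀
    1≤W₀ = ℕ.*-mono-≤ (ℕ.*-mono-≤ 1≤Q^h 1≤Q^h)
      (ℕ.*-mono-≤ (1≤^ (length (allFin k ++ˡ allFin k)) (1≤^ {suc h} h (s≤s z≤n))) (1≤^ k (1≤^ h (ℕ.*-mono-≤ {1} {3} (s≤s z≤n) (1≤2^ (k + k))))))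

    open Sized h k R K W₀ δ c₁ 1≤W₀

    A : Algorithm
    A = algorithm H K c₁ δ wordFactor′

    C₁ C₂ : ℕ
    C₁ = W₀ * (suc R + 13 * (K + k)) * wordFactor′
    C₂ = W₀ * (suc (duration h K (Sketch.updatePre D K c₁ δ R)) + 1 + 13 * (2 + duration h K (Sketch.updateBody D K c₁ δ)))
      where open Registers

    module Bounded {n} (2≤n : 2 ≤ n) where
      open Words n 2≤n

      n≤2^ℓ : n ≤ 2 ^ ℓ
      n≤2^ℓ = ℕ.<⇒≤ suc-n≤2^ℓ

      short : (k + k) * h < K
      short = s≤s (ℕ.≤-trans (ℕ.m≤m+n _ (h * k)) (ℕ.m≤m+n _ h))
      slots<K : h * k < K
      slots<K = s≤s (ℕ.≤-trans (ℕ.m≤n+m _ ((k + k) * h)) (ℕ.m≤m+n _ h))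
      h<K : h < K
      h<K = s≤s (ℕ.m≤n+m h _)

      module V (G : Hypergraph n) = Variance H 2≤deg 1≤deg G ℓ K e n≤2^ℓ short slots<K h<K

      W≡ : ∀ G μ sum≤ → V.W G μ sum≤ ≡ W₀ * μ ^ k
      W≡ G μ sum≤ = trans (cong (λ z → Q ^ h * Q ^ h * ((suc h ^ h) ^ length (allFin k ++ˡ allFin k) * z)) (^-distribʳ-* k ((3 * 2 ^ (k + k)) ^ h) μ))
        (l (Q ^ h * Q ^ h) ((suc h ^ h) ^ length (allFin k ++ˡ allFin k)) (((3 * 2 ^ (k + k)) ^ h) ^ k) (μ ^ k))
        where
        l : ∀ q a b m → q * (a * (b * m)) ≡ q * (a * b) * m
        l = solve-∀

      c²≤ : ∀ G → δ * # H G * (δ * # H G) ≤ W₀ * size G ^ k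
      c²≤ G = ℕ.≤-trans (V.c²≤W G (size G) (∑-present≤size H G)) (ℕ.≤-reflexive (W≡ G (size G) (∑-present≤size H G)))

      c≤ : ∀ G → δ * # H G ≤ W₀ * M
      c≤ G = ℕ.≤-trans (m≤m² (δ * # H G)) (ℕ.≤-trans (V.c²≤W G (suc n ^ h) (∑-present≤[1+n]^t H G)) (ℕ.≤-reflexive (W≡ G (suc n ^ h) (∑-present≤[1+n]^t H G))))

      module Sketched (nu de : ℕ) (nu≤de : nu ≤ de) .(cop : Coprime (suc nu) (suc de)) where

        ε : ℚ
        ε = mkℚ (ℤ.+ suc nu) de cop

        P d : Hypergraph n → ℕ
        P G = suc de * suc de * size G ^ k
        d G = suc nu * suc nu * # H G ^ 2

        d≢0 : ∀ G .{{_ : NonZero (# H G)}} → NonZero (d G)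
        d≢0 G = ℕ.m*n≢0 (suc nu * suc nu) (# H G ^ 2) {{_}} {{ℕ.m^n≢0 (# H G) 2}}

        cost≡ : ∀ G .{{_ : NonZero (# H G)}} → cost ε H G ≡ fromℚᵘ (fraction (P G) (d G) {{d≢0 G}})
        cost≡ = cost-fraction nu de cop H

        d≤ : ∀ G → d G ≤ W₀ * P G
        d≤ G = begin
          suc nu * suc nu * # H G ^ 2                             ≤⟨ ℕ.*-mono-≤ (ℕ.*-mono-≤ (s≤s nu≤de) (s≤s nu≤de)) #²≤ ⟩
          suc de * suc de * (W₀ * size G ^ k)                     ≡⟨ l (suc de * suc de) W₀ (size G ^ k) ⟩
          W₀ * (suc de * suc de * size G ^ k)                     ∎
          where
          open ℕ.≤-Reasoning
          l : ∀ e W m → e * (W * m) ≡ W * (e * m)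
          l = solve-∀
          #≤c : # H G ≤ δ * # H G
          #≤c = ℕ.m≤n*m (# H G) δ {{ℕ.>-nonZero 1≤δ}}
          #²≤ : # H G ^ 2 ≤ W₀ * size G ^ k
          #²≤ = ℕ.≤-trans (ℕ.≤-reflexive (cong (# H G *_) (ℕ.*-identityʳ (# H G)))) (ℕ.≤-trans (ℕ.*-mono-≤ #≤c #≤c) (c²≤ G))

        module _ (G : Hypergraph n) .{{#≢0 : NonZero (# H G)}} where
          open Copies (P G) (d G) {{d≢0 G}}

          S : ℕ
          S = R + s * (K + k)

          within : ∀ C x → x * d G ≤ C * P G → C ≤ C₁ + C₂ → fromℕ x ℚ.≤ fromℕ (C₁ + C₂) ℚ.* cost ε H G
          within C x le C≤ = ℚ.≤-trans (scaled-≤ {x} {C₁ + C₂} {P G} {d G} {{d≢0 G}} (ℕ.≤-trans le (ℕ.*-monoˡ-≤ (P G) C≤))) (ℚ.≤-reflexive (cong (fromℕ (C₁ + C₂) ℚ.*_) (sym (cost≡ G))))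

          space : fromℕ (spaceBits A n S) ℚ.≤ fromℕ (C₁ + C₂) ℚ.* cost ε H G ℚ.* fromℕ ⌊log₂ n ⌋
          space = ℚ.≤-trans (ℚ.≤-reflexive (trans (cong fromℕ bits) (fromℕ-* ((suc R + s * (K + k)) * wordFactor′) ⌊log₂ n ⌋)))
            (ℚ.*-monoʳ-≤-nonNeg (fromℕ ⌊log₂ n ⌋) {{ℚ.pos⇒nonNeg (fromℕ ⌊log₂ n ⌋) {{fromℕ-pos ⌊log₂ n ⌋ {{ℕ.>-nonZero 1≤λ}}}}}} (within C₁ ((suc R + s * (K + k)) * wordFactor′) le (ℕ.m≤m+n C₁ C₂)))
            where
            bits : spaceBits A n S ≡ (suc R + s * (K + k)) * wordFactor′ * ⌊log₂ n ⌋
            bits = trans (cong (λ z → (S + z) * w) (Sketch.nesting≤1 D K c₁ δ)) (trans (cong (_* w) (ℕ.+-comm S 1)) (sym (ℕ.*-assoc (suc R + s * (K + k)) wordFactor′ ⌊log₂ n ⌋)))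
            le : (suc R + s * (K + k)) * wordFactor′ * d G ≤ C₁ * P G
            le = begin
              (suc R + s * (K + k)) * wordFactor′ * d G                    ≡⟨ l (suc R + s * (K + k)) wordFactor′ (d G) ⟩
              (suc R + s * (K + k)) * d G * wordFactor′                    ≤⟨ ℕ.*-monoˡ-≤ wordFactor′ (affine-cost (d≤ G) (suc R) (K + k)) ⟩
              W₀ * (suc R + 13 * (K + k)) * P G * wordFactor′              ≡⟨ l (W₀ * (suc R + 13 * (K + k))) (P G) wordFactor′ ⟩
              W₀ * (suc R + 13 * (K + k)) * wordFactor′ * P G              ∎
              where
              open ℕ.≤-Reasoning
              l : ∀ x y z → x * y * z ≡ x * z * y
              l = solve-∀

          memory : R + s * (K + k) < 2 ^ w
          memory = memory<N s≤cap

          open Executed H K c₁ δ wordFactor′ S s ℓ e w≡ refl memory 1≤s (s≤s z≤n) 1≤e n<N n≤2^ℓ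
            using (Rounds; run-correct; estimate; estimate-counters)

          updateTime : ℕ
          updateTime = suc (duration h K (Sketch.updatePre D K c₁ δ R)) + suc (s * (2 + duration h K (Sketch.updateBody D K c₁ δ)))
            where open Registers

          time : ∀ {T} → T ≤ updateTime → fromℕ T ℚ.≤ fromℕ (C₁ + C₂) ℚ.* cost ε H G
          time {T} T≤ = within C₂ T (ℕ.≤-trans (ℕ.*-monoˡ-≤ (d G) (ℕ.≤-trans T≤ (ℕ.≤-reflexive (l p₁ (s * p₂))))) (affine-cost (d≤ G) (p₁ + 1) p₂)) (ℕ.m≤n+m C₂ C₁)
            where
            open Registers
            p₁ = suc (duration h K (Sketch.updatePre D K c₁ δ R))
            p₂ = 2 + duration h K (Sketch.updateBody D K c₁ δ)
            l : ∀ p x → p + suc x ≡ p + 1 + x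
            l = solve-∀

          updates : ∀ σ → Always (λ r → fromℕ (proj₂ r) ℚ.≤ fromℕ (C₁ + C₂) ℚ.* cost ε H G) (run A n S σ)
          updates σ = always (run-correct σ) (λ (T≤ , _) → time T≤)

          module _ (G′ : Hypergraph n) .{{_ : NonZero (# H G′)}} (cheaper : cost ε H G′ ℚ.≤ cost ε H G) where
            open V G′ using (X; deviation; Close; close?; close-likely)

            private
              m′ = size G′
              sum≤ = ∑-present≤size H G′
              #′ = # H G′
              1≤#′ : 1 ≤ #′
              1≤#′ = ℕ.>-nonZero⁻¹ #′
              1≤D : 1 ≤ s * δ
              1≤D = ℕ.*-mono-≤ 1≤s 1≤δ

              ratios : P G′ * d G ≤ P G * d G′
              ratios = fraction-≤⁻ {P G′} {d G′} {P G} {d G} {{d≢0 G′}} {{d≢0 G}} (fromℚᵘ-cancel {fraction (P G′) (d G′) {{d≢0 G′}}} {fraction (P G) (d G) {{d≢0 G}}}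
                (subst₂ ℚ._≤_ (cost≡ G′) (cost≡ G) cheaper))

            open Poly (h + k) ℓ K e using (q; q≢0)

            good : ℕ
            good = ℕΣ.∑ (vecs (upTo q) (s * K)) (λ v → ℕΣ.⟦ close? m′ sum≤ (suc nu) (suc de) s v ⟧)

            likely : 2 * q ^ (s * K) ≤ 3 * good
            likely = [ capped , sized ]′ enough
              where
              1≤ν : 1 ≤ suc nu * #′
              1≤ν = ℕ.*-mono-≤ {1} {suc nu} (s≤s z≤n) 1≤#′
              capped : cap ≤ s → 2 * q ^ (s * K) ≤ 3 * good
              capped le = close-likely (suc n ^ h) (∑-present≤[1+n]^t H G′) (suc nu) (suc de) s 1≤D 1≤ν
                (inj₁ (ℕ.≤-trans (ℕ.≤-reflexive (trans (cong (12 *_) (W≡ G′ (suc n ^ h) (∑-present≤[1+n]^t H G′))) (sym (ℕ.*-assoc 12 W₀ M)))) le))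
              sized : 12 * W₀ * P G ≤ s * d G → 2 * q ^ (s * K) ≤ 3 * good
              sized le = close-likely m′ sum≤ (suc nu) (suc de) s 1≤D 1≤ν (inj₂ (begin
                12 * V.W G′ m′ sum≤ * (suc de * suc de)          ≡⟨ cong (λ z → 12 * z * (suc de * suc de)) (W≡ G′ m′ sum≤) ⟩
                12 * (W₀ * m′ ^ k) * (suc de * suc de)           ≡⟨ l₁ W₀ (m′ ^ k) (suc de * suc de) ⟩
                12 * W₀ * P G′                                   ≤⟨ enough-for {P G′} {d G′} ratios le ⟩
                s * d G′                                         ≡⟨ cong (s *_) (l₂ (suc nu) #′) ⟩
                s * (suc nu * #′ * (suc nu * #′))                ∎))
                where
                open ℕ.≤-Reasoning
                l₁ : ∀ W m e → 12 * (W * m) * e ≡ 12 * W * (e * m)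
                l₁ = solve-∀
                l₂ : ∀ n x → n * n * (x * (x * 1)) ≡ n * x * (n * x)
                l₂ = solve-∀

            accurate : ∀ {σ v r} → σ Yields G′ → Rounds σ v r → Close m′ sum≤ (suc nu) (suc de) s v → Approximates ε #′ (proj₁ r)
            accurate {σ} {v} {r} yields (_ , rounds) close = subst (Approximates ε #′) (sym answer≡)
              (approximates nu de cop #′ rounded′ (rounded-upper (s * δ) #′ (suc nu) (suc de) 1≤D 1≤#′ (s≤s nu≤de) (s≤s z≤n) y close x x≤ ≤x)
                (rounded-lower (s * δ) #′ (suc nu) (suc de) 1≤D 1≤#′ (s≤s nu≤de) (s≤s z≤n) y close x x≤ ≤x))
              where
              z = ℤΣ.∑ (upTo s) (λ j → X (chunk K v j))
              y = ℤ.∣ deviation m′ sum≤ s v ∣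
              centre : ℤ.+ s *ᶻ ℤ.+ (δ * #′) ≡ ℤ.+ (s * δ * #′)
              centre = trans (sym (ℤ.pos-* s (δ * #′))) (cong ℤ.+_ (sym (ℕ.*-assoc s δ #′)))
              natural = nonnegative (s * δ) #′ (suc nu) (suc de) 1≤D 1≤#′ (s≤s nu≤de) (s≤s z≤n) y close (Q ^ h) z 1≤Q^h
                (cong (λ c → ℤ.∣ ℤ.+ (Q ^ h) *ᶻ z +ᶻ - c ∣) centre)
              B = proj₁ natural
              x = Q ^ h * B
              x≤ : x ≤ s * δ * #′ + y
              x≤ = proj₁ (proj₂ (proj₂ natural))
              ≤x : s * δ * #′ ≤ x + y
              ≤x = proj₂ (proj₂ (proj₂ natural))
              rounded′ = rounded (s * δ) #′ (suc nu) (suc de) 1≤D 1≤#′ (s≤s nu≤de) (s≤s z≤n) y close x x≤ ≤x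
              instance
                2D≢0 : NonZero (s * δ + s * δ)
                2D≢0 = ℕ.>-nonZero (ℕ.≤-trans 1≤D (ℕ.m≤m+n (s * δ) (s * δ)))
              numerator : c₁ * B + s * δ < 2 ^ w
              numerator = ℕ.≤-<-trans (ℕ.≤-trans (ℕ.≤-reflexive (cong (_+ s * δ) (ℕ.*-assoc 2 (Q ^ h) B)))
                (numerator≤ (s * δ) #′ (suc nu) (suc de) 1≤D 1≤#′ (s≤s nu≤de) (s≤s z≤n) y close x x≤ ≤x))
                (ℕ.≤-<-trans (ℕ.≤-reflexive (cong (4 *_) (ℕ.*-assoc s δ #′))) (numerator<N s≤cap (c≤ G′)))
              answer≡ : proj₁ r ≡ fromℕ rounded′
              answer≡ = trans (rounds B (trans (ℤΣ.S.fold-cong (upTo s) (λ j → estimate-counters G′ {σ} yields (chunk K v j))) (proj₁ (proj₂ natural)))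
                (ℕ.*-mono-≤ {1} {2} (s≤s z≤n) 1≤Q^h) numerator (denominator<N s≤cap) δ<N c₁<N)
                (cong (λ a → fromℕ ((a + s * δ) / (s * δ + s * δ))) (ℕ.*-assoc 2 (Q ^ h) B))

            correct : ∀ σ → σ Yields G′ → ℤ.+ 2 ℚ./ 3 ℚ.≤ Pr (λ r → approximates? ε #′ (proj₁ r)) (run A n S σ)
            correct σ yields = two-thirds good (q ^ (s * K)) (Pr (λ r → approximates? ε #′ (proj₁ r)) (run A n S σ)) {{ℕ.m^n≢0 q (s * K) {{q≢0}}}} likely
              (good≤Pr (λ r → approximates? ε #′ (proj₁ r)) (close? m′ sum≤ (suc nu) (suc de) s) (weaken (λ {v} {r} → accurate {σ} {v} {r} yields) (run-correct σ)))

open import Defs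
open import Data.Empty using (⊥-elim-irr)
open import Data.Integer.Base as ℤ using (+_)
import Data.Integer.Properties as ℤ
open import Data.Nat.Base as ℕ using (ℕ; suc)
open import Data.Nat.Coprimality using (Coprime)
open import Data.Nat.Logarithm using (⌊log₂_⌋)
import Data.Nat.Properties as ℕ
open import Data.Product.Base using (Σ-syntax; _×_; _,_; proj₁; proj₂)
open import Data.Rational.Base using (ℚ; 1ℚ; _<_; _≤_; _*_; _/_; Positive; mkℚ; *<*)
open import Relation.Binary.PropositionalEquality using (subst₂)
open Degrees
open Guarantee

positive-fraction : ∀ {F : (ε : ℚ) .{{_ : Positive ε}} → Set} →
  (∀ nu de .(cop : Coprime (suc nu) (suc de)) → F (mkℚ (+ suc nu) de cop)) → ∀ ε .{{_ : Positive ε}} → F ε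
positive-fraction f (mkℚ (+ suc nu) de cop)      = f nu de cop
positive-fraction f (mkℚ (+ 0) de cop)       {{p}} = ⊥-elim-irr (ℤ.Positive.pos p)
positive-fraction f (mkℚ ℤ.-[1+ m ] de cop) {{p}} = ⊥-elim-irr (ℤ.Positive.pos p)

fraction<1 : ∀ {nu de} .(cop : Coprime (suc nu) (suc de)) → mkℚ (+ suc nu) de cop < 1ℚ → nu ℕ.≤ de
fraction<1 {nu} {de} _ (*<* less) = ℕ.≤-pred (ℕ.<⇒≤ (ℤ.drop‿+<+ (subst₂ ℤ._<_ (ℤ.*-identityʳ (+ suc nu)) (ℤ.*-identityˡ (+ suc de)) less)))

theorem1 :
  ∀ {t} (H : Hypergraph (suc t)) → 2 ℕ.≤ minDegree H →
  Σ[ C ∈ ℕ ] Σ[ A ∈ Algorithm ]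
  (∀ (ε : ℚ) .{{_ : Positive ε}} → ε < 1ℚ →
   ∀ {n} (G : Hypergraph n) .{{_ : ℕ.NonZero (# H G)}} →
   Σ[ S ∈ ℕ ]
     fromℕ (spaceBits A n S) ≤ fromℕ C * cost ε H G * fromℕ ⌊log₂ n ⌋
   × (∀ (G′ : Hypergraph n) .{{_ : ℕ.NonZero (# H G′)}} → cost ε H G′ ≤ cost ε H G →
      ∀ (σ : Stream n) → σ Yields G′ →
        Always (λ r → fromℕ (proj₂ r) ≤ fromℕ C * cost ε H G) (run A n S σ)
      × + 2 / 3 ≤ Pr (λ r → approximates? ε (# H G′) (proj₁ r)) (run A n S σ)))
theorem1 {t} H 2≤ = C₁ ℕ.+ C₂ , A , positive-fraction λ nu de cop ε<1 {n} G →
  let open Bounded (ℕ.≤-trans (ℕ.s≤s (several-vertices H 2≤)) (vertices≤ H G))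
      open Sketched nu de (fraction<1 cop ε<1) cop
  in S G , space G , λ G′ cheaper σ yields → updates G σ , correct G G′ cheaper σ yields
  where open Guaranteed H 2≤
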